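{- For all integers $t\ge k\ge 2$ and every $\gamma>0$, there exist $n_0$ and $C$ such that the following holds for every $n\ge n_0$. Every $n$-vertex $k$-graph $H$ with \[ \delta(H)\ge \left(1-\frac{1}{\binom{t-1}{k-1}+\binom{t-2}{k-2}}+\gamma\right)n \] contains at least $\exp(n\log n-Cn)$ distinct copies of the $(t-k+1)$th power of a Hamilton tight cycle.
   Context: A $k$-graph is a hypergraph all of whose edges have exactly $k$ vertices. The minimum codegree $\delta(H)$ of a $k$-graph $H$ is the minimum, over all $(k-1)$-sets $S\subseteq V(H)$, of the number of edges containing $S$. For $t\ge k\ge 2$, a $k$-graph $C$ is the $(t-k+1)$th power of a tight cycle if there is a cyclic ordering $v_1,\dots,v_s$ of $V(C)$ such that, for every $i\in[s]$ (indices modulo $s$), the set $\{v_i,\dots,v_{i+t-1}\}$ spans a $k$-uniform clique (all its $k$-subsets are edges). A copy of the $(t-k+1)$th power of a Hamilton tight cycle in $H$ is such a subgraph $C\subseteq H$ with $V(C)=V(H)$. $\log$ is the natural logarithm. -}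

module Defs where

open import Data.Nat using (ℕ; zero; suc; _+_; _∸_; _<_)
open import Data.Nat.DivMod using (_%_)
open import Data.Nat.Combinatorics using (_C_)
open import Data.Fin using (Fin; toℕ)
open import Data.Fin.Subset using (Subset; _∈_; ∣_∣; ⁅_⁆; _∪_)
open import Data.Fin.Permutation using (Permutation′; _⟨$⟩ˡ_)
open import Data.Bool using (Bool; true; not; _∧_)
open import Data.Vec using (tabulate; lookup)
open import Data.Integer using (+_)
open import Data.Rational using (ℚ; _/_; 0ℚ; 1ℚ; _-_; _*_; _≤_) renaming (_+_ to _+ℚ_)
open import Data.Product using (Σ; ∃; _×_)
open import Relation.Binary.PropositionalEquality using (_≡_)

record KGraph (k n : ℕ) : Set where
  field
    edge    : Subset n → Bool
    uniform : ∀ e → edge e ≡ true → ∣ e ∣ ≡ k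
open KGraph public

codeg : ∀ {k n} → KGraph k n → Subset n → ℕ
codeg H S = ∣ tabulate (λ v → not (lookup S v) ∧ edge H (⁅ v ⁆ ∪ S)) ∣

MinCodegreeAtLeast : ∀ {k n} → KGraph k n → ℚ → Set
MinCodegreeAtLeast {k} {n} H x =
  ∀ (S : Subset n) → ∣ S ∣ ≡ k ∸ 1 → x ≤ (+ codeg H S / 1)

ℕtoℚ : ℕ → ℚ
ℕtoℚ m = + m / 1

-- 1 / d as a rational (d = 0 never occurs in use)
invℕ : ℕ → ℚ
invℕ zero    = 0ℚ
invℕ (suc d) = + 1 / suc d

threshold : ℕ → ℕ → ℚ → ℚ
threshold t k γ = (1ℚ - invℕ (((t ∸ 1) C (k ∸ 1)) + ((t ∸ 2) C (k ∸ 2)))) +ℚ γ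

-- x mod n (indices modulo n); the case n = 0 never occurs in use
modN : ℕ → ℕ → ℕ
modN zero    x = x
modN (suc m) x = x % suc m

-- Cyclic ordering v_0,…,v_{n-1} given by a permutation σ, v_i = σ(i).
-- v lies in the window {v_i,…,v_{i+t-1}} (indices mod n)
InWindow : ∀ {n} → ℕ → Permutation′ n → Fin n → Fin n → Set
InWindow {n} t σ i v = ∃ λ j → j < t × toℕ (σ ⟨$⟩ˡ v) ≡ modN n (toℕ i + j)

-- Edges of the (t-k+1)th power of the tight cycle with ordering σ:
-- exactly the k-sets contained in some window of t consecutive vertices.
PowEdge : ∀ {n} → ℕ → ℕ → Permutation′ n → Subset n → Set
PowEdge {n} k t σ e = ∣ e ∣ ≡ k × ∃ λ (i : Fin n) → ∀ v → v ∈ e → InWindow t σ i v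

PowerIn : ∀ {k n} → ℕ → KGraph k n → Permutation′ n → Set
PowerIn {k} t H σ = ∀ e → PowEdge k t σ e → edge H e ≡ true

SamePower : ∀ {n} → ℕ → ℕ → Permutation′ n → Permutation′ n → Set
SamePower k t σ τ = ∀ e → (PowEdge k t σ e → PowEdge k t τ e) × (PowEdge k t τ e → PowEdge k t σ e)

{-# OPTIONS --safe #-}
-- With D = C(t-1,k-1) + C(t-2,k-2), the hypothesis says that every (k-1)-set has at most (1/D - γ)n
-- vertices that do not complete it to an edge.  A vertex extending one (t-1)-clique, and at the same time
-- extending a second (t-1)-clique that shares t-2 vertices with it, has to avoid at most D such bad sets, so it
-- can be chosen in linearly many ways.  This gives:
--  * Connection: any two ordered (t-1)-cliques are joined by a power path of bounded length.  One counts
--    homomorphic images, which may revisit vertices, and follows a popular one greedily with fresh clones.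
--  * Absorption: every vertex v has Ω(n^(2t-2)) paths of 2t-2 vertices into whose middle v can be inserted;
--    a multiplicative-weights choice of linearly many of them serves all vertices at once.
--  * Covering: given weights on the (k-1)-sets, some t-clique meets the weighted bad sets more often than
--    average.  Walking around it and updating the weights multiplicatively lowers all bad degrees in
--    proportion to the number of vertices used, so the hypothesis survives until almost nothing is left.
--  Together these yield one spanning power path between prescribed ends.  To count, split the vertex set into
--  two random halves (almost all splits inherit the codegree condition), join the two recursive families
--  through a fixed clique, and iterate down to sets of constant size: this gives w!/K^w paths.  Finally, a power
--  of a Hamilton cycle determines its cyclic order up to at most n·(t²)^(n-1) choices, because consecutive
--  vertices of one order share a window of the other.
module Submission where

open import Defs
open import Data.Bool using (Bool; true; false; _∧_; _∨_; not; if_then_else_)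
import Data.Bool.Properties as BoolP
open import Data.Empty using (⊥; ⊥-elim)
open import Data.Fin using (Fin; zero; suc; #_; toℕ; fromℕ<; cast)
open import Data.Fin.Permutation using (Permutation′; permutation)
open import Data.Fin.Properties using (toℕ-injective; toℕ-cast; toℕ-fromℕ<; toℕ<n) renaming (_≟_ to _≟F_)
open import Data.Fin.Subset using (Subset; ⁅_⁆; _∪_; ∣_∣) renaming (_∈_ to _∈s_; ⊥ to ⊥s)
open import Data.Fin.Subset.Properties using (∪-comm; ∪-assoc; x∈⁅x⁆; x∈⁅y⁆⇒x≡y)
import Data.Integer as ℤ
import Data.Integer.Properties as ℤP
open import Data.Integer.Tactic.RingSolver using () renaming (solve-∀ to solveℤ)
open import Data.List hiding (lookup; and; or; all; any; sum; product; fromMaybe; insertAt; removeAt; updateAt)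
import Data.List as List
open import Data.List.Membership.Propositional using (_∈_; _∉_)
open import Data.List.Membership.Propositional.Properties
open import Data.List.Properties
open import Data.List.Relation.Binary.Permutation.Propositional using (_↭_; refl; prep; swap; trans; ↭-sym; ↭-trans; ↭-reflexive)
open import Data.List.Relation.Binary.Permutation.Propositional.Properties using (∈-resp-↭; All-resp-↭; ↭-length; shift; ++-comm; ++⁺; ++⁺ˡ; ++⁺ʳ; shifts)
open import Data.List.Relation.Binary.Pointwise as PW using (Pointwise; []; _∷_)
open import Data.List.Relation.Unary.All using (All; []; _∷_)
import Data.List.Relation.Unary.All as All
open import Data.List.Relation.Unary.AllPairs using (AllPairs; []; _∷_)
import Data.List.Relation.Unary.AllPairs as AllPairs
open import Data.List.Relation.Unary.Any using (here; there; index)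
open import Data.List.Relation.Unary.Any.Properties using (lookup-index)
open import Data.List.Relation.Unary.Linked using (Linked; []; [-]; _∷_)
open import Data.List.Relation.Unary.Unique.Propositional using (Unique)
import Data.List.Relation.Unary.Unique.Propositional.Properties as UniqueP
open import Data.Nat
open import Data.Nat.Combinatorics using (nCk+nC[k+1]≡[n+1]C[k+1]; k>n⇒nCk≡0) renaming (_C_ to _choose_)
open import Data.Nat.DivMod using (m≡m%n+[m/n]*n; m%n<n; m/n*n≤m; %-distribˡ-+; m%n%n≡m%n; [m+n]%n≡m%n; m<n⇒m%n≡m)
open import Data.Nat.Properties
open import Data.Nat.Tactic.RingSolver using (solve-∀)
open import Data.Product using (Σ; ∃; _×_; _,_; proj₁; proj₂)
import Data.Product as Product
open import Data.Rational using (ℚ; 0ℚ) renaming (_<_ to _<ℚ_; _*_ to _*ℚ_)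
import Data.Rational as ℚ
import Data.Rational.Properties as ℚP
import Data.Rational.Unnormalised as ℚᵘ
import Data.Rational.Unnormalised.Properties as ℚᵘP
open import Data.Sum using (_⊎_; inj₁; inj₂; [_,_]′)
open import Data.Unit using (⊤; tt)
open import Data.Vec using (Vec; []; _∷_; lookup; _[_]≔_; toList)
import Data.Vec as Vec
open import Data.Vec.Properties using (lookup∘update; lookup∘update′; lookup-zipWith; []=⇒lookup; lookup⇒[]=)
import Data.Vec.Properties as VecP
open import Relation.Binary.Definitions using (DecidableEquality)
open import Relation.Binary.PropositionalEquality using (_≡_; refl; _≢_; cong; cong₂; subst; subst₂)
import Relation.Binary.PropositionalEquality as Eq
open import Relation.Nullary using (¬_; Dec; yes; no; does)
open Eq using () renaming (sym to symm; trans to infixr 2 _⟫_)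

-- The bound exp(n log n - Cn) is stated as `n ^ n ≤ N * K ^ n`, with K in the role of e^C; all
-- estimates are inequalities between natural numbers. D consists of the C(t-1,k-1) sets inside a
-- (t-1)-clique and the C(t-2,k-2) further sets through the one vertex in which the second clique
-- differs. Greedy choices could ruin the codegree condition on the remaining vertices, and a walk
-- that revisits vertices could degenerate. Against the first, a potential over all (k-1)-sets (or
-- all vertices) replaces a random choice; against the second, each step is open to linearly many
-- vertices, so that e^m configurations of m vertices outnumber the O(w^(m-1)) that have to be
-- discarded. In the count, each halving costs t-1 linking vertices and half of the splits. The
-- induction therefore carries a surplus factor 2·w^t beside w!, which pays for both and keeps the
-- base K constant at all depths. The relative slack shrinks with the recursion level by summable
-- amounts of order 1/i^2, and the deviation of a balanced split fits into them because sets at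
-- level i that are split have size exponential in i.

private variable
  Elt Elt′ : Set

-- Sums and counts over lists

-- The ring solver proves equations only, so a linear inequality is reduced to one: `s` is the
-- explicit slack, and `L ≤ R` is the sum of all inequalities used.
lin : ∀ s {a b L R} → L ≤ R → a + R + s ≡ b + L → a ≤ b
lin s {a} {b} {L} {R} h e = +-cancelʳ-≤ L a b
  (≤-trans (+-monoʳ-≤ a h) (≤-trans (m≤m+n (a + R) s) (≤-reflexive e)))

b2n : Bool → ℕ
b2n true  = 1
b2n false = 0

b2n≤1 : ∀ b → b2n b ≤ 1
b2n≤1 true  = ≤-refl
b2n≤1 false = z≤n

sumL : (Elt → ℕ) → List Elt → ℕ
sumL f []       = 0
sumL f (x ∷ xs) = f x + sumL f xs

cnt : (Elt → Bool) → List Elt → ℕ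
cnt p = sumL (λ x → b2n (p x))

sumL-mono : ∀ {f g : Elt → ℕ} xs → (∀ {x} → x ∈ xs → f x ≤ g x) → sumL f xs ≤ sumL g xs
sumL-mono []       h = z≤n
sumL-mono (x ∷ xs) h = +-mono-≤ (h (here refl)) (sumL-mono xs (λ m → h (there m)))

sumL-cong : ∀ {f g : Elt → ℕ} xs → (∀ {x} → x ∈ xs → f x ≡ g x) → sumL f xs ≡ sumL g xs
sumL-cong []       h = refl
sumL-cong (x ∷ xs) h = cong₂ _+_ (h (here refl)) (sumL-cong xs (λ m → h (there m)))

+-interchange : ∀ a b c d → (a + b) + (c + d) ≡ (a + c) + (b + d)
+-interchange = solve-∀

sumL-+ : ∀ (f g : Elt → ℕ) xs → sumL (λ x → f x + g x) xs ≡ sumL f xs + sumL g xs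
sumL-+ f g []       = refl
sumL-+ f g (x ∷ xs) = cong (f x + g x +_) (sumL-+ f g xs)
  ⟫ +-interchange (f x) (g x) (sumL f xs) (sumL g xs)

sumL-* : ∀ c (f : Elt → ℕ) xs → sumL (λ x → c * f x) xs ≡ c * sumL f xs
sumL-* c f []       = symm (*-zeroʳ c)
sumL-* c f (x ∷ xs) = cong (c * f x +_) (sumL-* c f xs) ⟫ symm (*-distribˡ-+ c (f x) _)

sumL-const : ∀ c (xs : List Elt) → sumL (λ _ → c) xs ≡ length xs * c
sumL-const c []       = refl
sumL-const c (x ∷ xs) = cong (c +_) (sumL-const c xs)

sumL-swap : ∀ (f : Elt → Elt′ → ℕ) xs ys →
  sumL (λ x → sumL (f x) ys) xs ≡ sumL (λ y → sumL (λ x → f x y) xs) ys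
sumL-swap f []       ys = symm (sumL-const 0 ys ⟫ *-zeroʳ (length ys))
sumL-swap f (x ∷ xs) ys = cong (sumL (f x) ys +_) (sumL-swap f xs ys)
  ⟫ symm (sumL-+ (f x) (λ y → sumL (λ x → f x y) xs) ys)

sumL-++ : ∀ (f : Elt → ℕ) xs ys → sumL f (xs ++ ys) ≡ sumL f xs + sumL f ys
sumL-++ f []       ys = refl
sumL-++ f (x ∷ xs) ys = cong (f x +_) (sumL-++ f xs ys) ⟫ symm (+-assoc (f x) _ _)

sumL-map : ∀ (f : Elt′ → ℕ) (g : Elt → Elt′) xs → sumL f (map g xs) ≡ sumL (λ x → f (g x)) xs
sumL-map f g []       = refl
sumL-map f g (x ∷ xs) = cong (f (g x) +_) (sumL-map f g xs)

sumL-↭ : ∀ (f : Elt → ℕ) {xs ys} → xs ↭ ys → sumL f xs ≡ sumL f ys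
sumL-↭ f refl          = refl
sumL-↭ f (prep x p)    = cong (f x +_) (sumL-↭ f p)
sumL-↭ f (swap x y p)  = cong (λ s → f x + (f y + s)) (sumL-↭ f p) ⟫ h (f x) (f y) _
  where h : ∀ a b c → a + (b + c) ≡ b + (a + c)
        h = solve-∀
sumL-↭ f (trans p q)   = sumL-↭ f p ⟫ sumL-↭ f q

sumL-bound : ∀ {f : Elt → ℕ} c xs → (∀ {x} → x ∈ xs → f x ≤ c) → sumL f xs ≤ length xs * c
sumL-bound c xs h = ≤-trans (sumL-mono xs h) (≤-reflexive (sumL-const c xs))

sumL-∈ : ∀ (f : Elt → ℕ) {x xs} → x ∈ xs → f x ≤ sumL f xs
sumL-∈ f (here refl) = m≤m+n _ _
sumL-∈ f (there m)   = ≤-trans (sumL-∈ f m) (m≤n+m _ _)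

-- The first-moment method: the probabilistic existence arguments go through this or through its
-- version for vectors, `ΣV-∃`.
sumL-∃ : ∀ {f g : Elt → ℕ} xs → sumL f xs < sumL g xs → ∃ λ x → x ∈ xs × f x < g x
sumL-∃ {f = f} {g} (x ∷ xs) h with f x <? g x
... | yes q = x , here refl , q
... | no ¬q with sumL-∃ {f = f} {g} xs (+-cancelˡ-< (g x) _ _ (<-≤-trans (s≤s (+-monoˡ-≤ (sumL f xs) (≮⇒≥ ¬q))) h))
...   | y , m , r = y , there m , r

cnt≤length : ∀ (p : Elt → Bool) xs → cnt p xs ≤ length xs
cnt≤length p xs = ≤-trans (sumL-bound 1 xs (λ {x} _ → b2n≤1 (p x))) (≤-reflexive (*-identityʳ _))

cnt-true : ∀ (xs : List Elt) → cnt (λ _ → true) xs ≡ length xs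
cnt-true xs = sumL-const 1 xs ⟫ *-identityʳ _

b2n-mono : ∀ {a b} → (a ≡ true → b ≡ true) → b2n a ≤ b2n b
b2n-mono {false} h = z≤n
b2n-mono {true}  h rewrite h refl = ≤-refl

cnt-mono : ∀ {p q : Elt → Bool} xs → (∀ {x} → x ∈ xs → p x ≡ true → q x ≡ true) → cnt p xs ≤ cnt q xs
cnt-mono xs h = sumL-mono xs (λ m → b2n-mono (h m))

cnt-∃ : ∀ (p : Elt → Bool) xs → 0 < cnt p xs → ∃ λ x → x ∈ xs × p x ≡ true
cnt-∃ p (x ∷ xs) h with p x in eq
... | true = x , here refl , eq
... | false with cnt-∃ p xs h
...   | y , m , r = y , there m , r

cnt-∈ : ∀ (p : Elt → Bool) {x xs} → x ∈ xs → p x ≡ true → 0 < cnt p xs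
cnt-∈ p {x} {xs} m e = ≤-trans (≤-reflexive (cong b2n (symm e))) (sumL-∈ (λ x → b2n (p x)) m)

cnt-split : ∀ (p q : Elt → Bool) xs → cnt p xs ≤ cnt (λ x → p x ∧ not (q x)) xs + cnt q xs
cnt-split p q xs = ≤-trans (sumL-mono xs (λ {x} _ → h (p x) (q x)))
                           (≤-reflexive (sumL-+ _ _ xs))
  where h : ∀ a b → b2n a ≤ b2n (a ∧ not b) + b2n b
        h true true   = ≤-refl
        h true false  = ≤-refl
        h false b     = z≤n

allB : (Elt → Bool) → List Elt → Bool
allB p []       = true
allB p (x ∷ xs) = p x ∧ allB p xs

∧-elim : ∀ {a b} → a ∧ b ≡ true → a ≡ true × b ≡ true
∧-elim {true} e = refl , e

∧-intro : ∀ {a b} → a ≡ true → b ≡ true → a ∧ b ≡ true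
∧-intro refl refl = refl

not-true : ∀ {b} → not b ≡ true → b ≡ false
not-true {false} _ = refl

allB-∈ : ∀ (p : Elt → Bool) {x xs} → allB p xs ≡ true → x ∈ xs → p x ≡ true
allB-∈ p e (here refl) = proj₁ (∧-elim e)
allB-∈ p {xs = y ∷ xs} e (there m) = allB-∈ p (proj₂ (∧-elim {p y} e)) m

-- Union bound: each test in `ss` spoils at most `b` of the elements.
cnt-tests : ∀ (bd : Elt′ → Elt → Bool) (p : Elt → Bool) ss xs b → (∀ {s} → s ∈ ss → cnt (bd s) xs ≤ b) →
  cnt p xs ≤ cnt (λ x → p x ∧ allB (λ s → not (bd s x)) ss) xs + length ss * b
cnt-tests bd p [] xs b h = ≤-trans (cnt-mono xs (λ _ e → ∧-intro e refl)) (m≤m+n _ _)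
cnt-tests bd p (s ∷ ss) xs b h = begin
  cnt p xs
    ≤⟨ cnt-split p (bd s) xs ⟩
  cnt p' xs + cnt (bd s) xs
    ≤⟨ +-mono-≤ (cnt-tests bd p' ss xs b (λ m → h (there m))) (h (here refl)) ⟩
  cnt (λ x → p' x ∧ allB (λ s → not (bd s x)) ss) xs + length ss * b + b
    ≤⟨ +-monoˡ-≤ b (+-monoˡ-≤ _ (cnt-mono xs (λ {x} _ → as (p x)))) ⟩
  cnt (λ x → p x ∧ (not (bd s x) ∧ allB (λ s → not (bd s x)) ss)) xs + length ss * b + b
    ≡⟨ l3 (cnt (λ x → p x ∧ (not (bd s x) ∧ allB (λ s → not (bd s x)) ss)) xs) (length ss * b) b ⟩
  cnt (λ x → p x ∧ (not (bd s x) ∧ allB (λ s → not (bd s x)) ss)) xs + (b + length ss * b) ∎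
  where
    open ≤-Reasoning
    p' : _ → Bool
    p' x = p x ∧ not (bd s x)
    as : ∀ a {b c} → (a ∧ b) ∧ c ≡ true → a ∧ (b ∧ c) ≡ true
    as true e = e
    l3 : ∀ a b c → a + b + c ≡ a + (c + b)
    l3 = solve-∀

data Snoc {Elt : Set} : List Elt → Set where
  nil  : Snoc []
  snoc : ∀ xs x → Snoc (xs ++ x ∷ [])

snocView : (xs : List Elt) → Snoc xs
snocView [] = nil
snocView (x ∷ xs) with snocView xs
... | nil       = snoc [] x
... | snoc ys y = snoc (x ∷ ys) y

_⊆l_ : List Elt → List Elt → Set
xs ⊆l ys = ∀ {x} → x ∈ xs → x ∈ ys

Unique-↭ : ∀ {xs ys : List Elt} → xs ↭ ys → Unique xs → Unique ys
Unique-↭ refl u = u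
Unique-↭ (prep x p) (a ∷ u) = All-resp-↭ p a ∷ Unique-↭ p u
Unique-↭ (swap x y p) ((x≢y ∷ a) ∷ (b ∷ u)) =
  ((λ e → x≢y (symm e)) ∷ All-resp-↭ p b) ∷ (All-resp-↭ p a ∷ Unique-↭ p u)
Unique-↭ (trans p q) u = Unique-↭ q (Unique-↭ p u)

∉⇒All≢ : ∀ {x : Elt} {xs} → x ∉ xs → All (x ≢_) xs
∉⇒All≢ {xs = []} n = []
∉⇒All≢ {xs = y ∷ xs} n = (λ e → n (here e)) ∷ ∉⇒All≢ (λ m → n (there m))

All≢⇒∉ : ∀ {x : Elt} {xs} → All (x ≢_) xs → x ∉ xs
All≢⇒∉ (a ∷ as) (here e)  = a e
All≢⇒∉ (a ∷ as) (there m) = All≢⇒∉ as m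

Unique-++ˡ : ∀ (xs : List Elt) {ys} → Unique (xs ++ ys) → Unique xs
Unique-++ˡ [] u = []
Unique-++ˡ (x ∷ xs) (a ∷ u) = ∉⇒All≢ (λ m → All≢⇒∉ a (∈-++⁺ˡ m)) ∷ Unique-++ˡ xs u

Unique-++ʳ : ∀ (xs : List Elt) {ys} → Unique (xs ++ ys) → Unique ys
Unique-++ʳ [] u = u
Unique-++ʳ (x ∷ xs) (a ∷ u) = Unique-++ʳ xs u

Unique-++-disj : ∀ (xs : List Elt) {ys} → Unique (xs ++ ys) → ∀ {x} → x ∈ xs → x ∉ ys
Unique-++-disj (x ∷ xs) (a ∷ u) (here refl) m = All≢⇒∉ a (∈-++⁺ʳ xs m)
Unique-++-disj (x ∷ xs) (a ∷ u) (there n) m = Unique-++-disj xs u n m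

Unique-++ : ∀ {xs ys : List Elt} → Unique xs → Unique ys → (∀ {x} → x ∈ xs → x ∉ ys) → Unique (xs ++ ys)
Unique-++ u v d = UniqueP.++⁺ u v (λ (m , n) → d m n)

take-++ : ∀ n (xs ys : List Elt) → n ≤ length xs → take n (xs ++ ys) ≡ take n xs
take-++ zero xs ys h = refl
take-++ (suc n) (x ∷ xs) ys (s≤s h) = cong (x ∷_) (take-++ n xs ys h)

take-exact : ∀ (xs ys : List Elt) n → length xs ≡ n → take n (xs ++ ys) ≡ xs
take-exact [] ys zero e = refl
take-exact (x ∷ xs) ys (suc n) e = cong (x ∷_) (take-exact xs ys n (suc-injective e))

∈-take : ∀ n (xs : List Elt) → take n xs ⊆l xs
∈-take (suc n) (x ∷ xs) (here e)  = here e
∈-take (suc n) (x ∷ xs) (there m) = there (∈-take n xs m)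

module _ {V : Set} (_≟v_ : DecidableEquality V) where
  open import Data.List.Membership.DecPropositional _≟v_ using (_∈?_)

  abstract
    mem : V → List V → Bool
    mem x ys = does (x ∈? ys)

    mem-true : ∀ {x ys} → mem x ys ≡ true → x ∈ ys
    mem-true {x} {ys} e with x ∈? ys
    ... | yes m = m

    mem-∈ : ∀ {x ys} → x ∈ ys → mem x ys ≡ true
    mem-∈ {x} {ys} m with x ∈? ys
    ... | yes _ = refl
    ... | no n = ⊥-elim (n m)

    mem-false : ∀ {x ys} → mem x ys ≡ false → x ∉ ys
    mem-false e m with () ← symm e ⟫ mem-∈ m

    mem-∉ : ∀ {x ys} → x ∉ ys → mem x ys ≡ false
    mem-∉ {x} {ys} m with x ∈? ys
    ... | yes a = ⊥-elim (m a)
    ... | no n = refl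

  cnt-eq≤1 : ∀ y xs → Unique xs → cnt (λ x → does (x ≟v y)) xs ≤ 1
  cnt-eq≤1 y [] u = z≤n
  cnt-eq≤1 y (x ∷ xs) (a ∷ u) with x ≟v y
  ... | no _ = cnt-eq≤1 y xs u
  ... | yes refl = s≤s (≤-reflexive (z xs a))
    where z : ∀ xs → All (x ≢_) xs → cnt (λ z → does (z ≟v x)) xs ≡ 0
          z [] [] = refl
          z (w ∷ ws) (n ∷ ns) with w ≟v x
          ... | yes refl = ⊥-elim (n refl)
          ... | no _ = z ws ns

  cnt-mem : ∀ xs ys → Unique xs → cnt (λ x → mem x ys) xs ≤ length ys
  cnt-mem xs ys u = begin
    cnt (λ x → mem x ys) xs                                ≤⟨ sumL-mono xs (λ {x} _ → h x ys) ⟩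
    sumL (λ x → cnt (λ y → does (x ≟v y)) ys) xs           ≡⟨ sumL-swap _ xs ys ⟩
    sumL (λ y → cnt (λ x → does (x ≟v y)) xs) ys           ≤⟨ sumL-bound 1 ys (λ {y} _ → cnt-eq≤1 y xs u) ⟩
    length ys * 1                                          ≡⟨ *-identityʳ _ ⟩
    length ys ∎
    where
      open ≤-Reasoning
      h : ∀ x ys → b2n (mem x ys) ≤ cnt (λ y → does (x ≟v y)) ys
      h x ys with mem x ys in e
      ... | false = z≤n
      ... | true = cnt-∈ (λ y → does (x ≟v y)) (mem-true e) (d x)
        where d : ∀ x → does (x ≟v x) ≡ true
              d x with x ≟v x
              ... | yes _ = refl
              ... | no n = ⊥-elim (n refl)

  cnt-fresh : ∀ (p : V → Bool) xs ys → Unique xs → cnt p xs ≤ cnt (λ x → p x ∧ not (mem x ys)) xs + length ys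
  cnt-fresh p xs ys u = ≤-trans (cnt-split p (λ x → mem x ys) xs) (+-monoʳ-≤ _ (cnt-mem xs ys u))

  ∃-fresh : ∀ (p : V → Bool) xs ys → Unique xs → length ys < cnt p xs →
    ∃ λ x → x ∈ xs × p x ≡ true × x ∉ ys
  ∃-fresh p xs ys u h with cnt-∃ (λ x → p x ∧ not (mem x ys)) xs
      (+-cancelʳ-< (length ys) 0 _ (<-≤-trans h (cnt-fresh p xs ys u)))
  ... | x , m , e = x , m , proj₁ (∧-elim e) , mem-false (not-true (proj₂ (∧-elim {p x} e)))

  -- Used vertices are split off as a prefix up to permutation; uniqueness of the whole list then
  -- yields that the rest is disjoint from them.
  remove : ∀ vs xs → Unique xs → Unique vs → vs ⊆l xs → ∃ λ ys → xs ↭ vs ++ ys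
  remove [] xs u w s = xs , refl
  remove (v ∷ vs) xs u (a ∷ w) s with ∈-∃++ (s (here refl))
  ... | ps , qs , refl with remove vs (ps ++ qs) (Unique-tail (Unique-↭ (shift v ps qs) u)) w s'
    where
      Unique-tail : ∀ {x : V} {xs} → Unique (x ∷ xs) → Unique xs
      Unique-tail (_ ∷ u) = u
      s' : vs ⊆l (ps ++ qs)
      s' m with ∈-resp-↭ (shift v ps qs) (s (there m))
      ... | here refl = ⊥-elim (All≢⇒∉ a m)
      ... | there r = r
  ...   | ys , p = ys , ↭-trans (shift v ps qs) (prep v p)

-- Binomial coefficients and sublists of given length.

bin : ℕ → ℕ → ℕ
bin n       zero    = 1
bin zero    (suc k) = 0
bin (suc n) (suc k) = bin n k + bin n (suc k)

bin-suc : ∀ n k → bin n k ≤ bin (suc n) k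
bin-suc n zero = ≤-refl
bin-suc n (suc k) = m≤n+m _ _

bin-mono : ∀ {m n} k → m ≤ n → bin m k ≤ bin n k
bin-mono {m} k h = go (≤⇒≤′ h)
  where go : ∀ {n} → m ≤′ n → bin m k ≤ bin n k
        go ≤′-refl = ≤-refl
        go (≤′-step {n} p) = ≤-trans (go p) (bin-suc n k)

bin-absorb : ∀ n k → suc k * bin (suc n) (suc k) ≡ suc n * bin n k
bin-absorb zero zero = refl
bin-absorb zero (suc k) = *-zeroʳ (suc (suc k))
bin-absorb (suc n) zero = *-identityˡ _ ⟫ cong suc h
  where h : bin n 0 + bin n 1 ≡ suc n * 1
        h = symm (*-identityˡ _) ⟫ bin-absorb n zero
bin-absorb (suc n) (suc k) = begin
  suc (suc k) * (P + Q)                     ≡⟨ l1 k P Q ⟩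
  suc k * P + P + suc (suc k) * Q           ≡⟨ cong₂ (λ a b → a + P + b) (bin-absorb n k) (bin-absorb n (suc k)) ⟩
  suc n * bin n k + P + suc n * bin n (suc k) ≡⟨ l2 n (bin n k) (bin n (suc k)) ⟩
  suc (suc n) * P ∎
  where
    open Eq.≡-Reasoning
    P = bin (suc n) (suc k)
    Q = bin (suc n) (suc (suc k))
    l1 : ∀ k P Q → suc (suc k) * (P + Q) ≡ suc k * P + P + suc (suc k) * Q
    l1 = solve-∀
    l2 : ∀ n a b → suc n * a + (a + b) + suc n * b ≡ suc (suc n) * (a + b)
    l2 = solve-∀

-- The codegree threshold makes every vertex of a clique available at a rank at most proportional to its index.
bin-rank : ∀ t2 k2 i → i ≤ suc t2 →
  bin i (suc k2) * suc (suc t2) ≤ i * (bin (suc t2) (suc k2) + bin t2 k2)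
bin-rank t2 k2 zero h = z≤n
bin-rank t2 k2 (suc i) (s≤s h) = *-cancelˡ-≤ (suc k2) (begin
  suc k2 * (bin (suc i) (suc k2) * suc (suc t2))  ≡⟨ symm (*-assoc (suc k2) (bin (suc i) (suc k2)) (suc (suc t2))) ⟩
  suc k2 * bin (suc i) (suc k2) * suc (suc t2)    ≡⟨ cong (_* suc (suc t2)) (bin-absorb i k2) ⟩
  suc i * bin i k2 * suc (suc t2)                 ≤⟨ *-monoˡ-≤ (suc (suc t2)) (*-monoʳ-≤ (suc i) (bin-mono k2 h)) ⟩
  suc i * b * suc (suc t2)                        ≤⟨ m≤m+n _ (suc i * (k2 * b)) ⟩
  suc i * b * suc (suc t2) + suc i * (k2 * b)     ≡⟨ l1 i b t2 k2 ⟩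
  suc i * (suc t2 * b + suc k2 * b)               ≡⟨ cong (λ z → suc i * (z + suc k2 * b)) (symm (bin-absorb t2 k2)) ⟩
  suc i * (suc k2 * B' + suc k2 * b)              ≡⟨ l2 i k2 B' b ⟩
  suc k2 * (suc i * (B' + b)) ∎)
  where
    open ≤-Reasoning
    b = bin t2 k2
    B' = bin (suc t2) (suc k2)
    l1 : ∀ i b t2 k2 → suc i * b * suc (suc t2) + suc i * (k2 * b) ≡ suc i * (suc t2 * b + suc k2 * b)
    l1 = solve-∀
    l2 : ∀ i k2 Elt′ b → suc i * (suc k2 * Elt′ + suc k2 * b) ≡ suc k2 * (suc i * (Elt′ + b))
    l2 = solve-∀

subs : ℕ → List Elt → List (List Elt)
subs zero    xs       = [] ∷ []
subs (suc j) []       = []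
subs (suc j) (x ∷ xs) = map (x ∷_) (subs j xs) ++ subs (suc j) xs

length-subs : ∀ j (xs : List Elt) → length (subs j xs) ≡ bin (length xs) j
length-subs zero xs = refl
length-subs (suc j) [] = refl
length-subs (suc j) (x ∷ xs) = length-++ (map (x ∷_) (subs j xs))
  ⟫ cong₂ _+_ (length-map (x ∷_) (subs j xs) ⟫ length-subs j xs) (length-subs (suc j) xs)

subs-length : ∀ j (xs : List Elt) {s} → s ∈ subs j xs → length s ≡ j
subs-length zero xs (here refl) = refl
subs-length (suc j) (x ∷ xs) m with ∈-++⁻ (map (x ∷_) (subs j xs)) m
... | inj₂ n = subs-length (suc j) xs n
... | inj₁ n with ∈-map⁻ (x ∷_) n
...   | s , p , refl = cong suc (subs-length j xs p)

subs-⊆ : ∀ j (xs : List Elt) {s} → s ∈ subs j xs → s ⊆l xs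
subs-⊆ zero xs (here refl) ()
subs-⊆ (suc j) (x ∷ xs) m with ∈-++⁻ (map (x ∷_) (subs j xs)) m
... | inj₂ n = λ q → there (subs-⊆ (suc j) xs n q)
... | inj₁ n with ∈-map⁻ (x ∷_) n
...   | s , p , refl = λ { (here e) → here e ; (there q) → there (subs-⊆ j xs p q) }

subs-Unique : ∀ j (xs : List Elt) {s} → Unique xs → s ∈ subs j xs → Unique s
subs-Unique zero xs u (here refl) = []
subs-Unique (suc j) (x ∷ xs) (a ∷ u) m with ∈-++⁻ (map (x ∷_) (subs j xs)) m
... | inj₂ n = subs-Unique (suc j) xs u n
... | inj₁ n with ∈-map⁻ (x ∷_) n
...   | s , p , refl = ∉⇒All≢ (λ q → All≢⇒∉ a (subs-⊆ j xs p q)) ∷ subs-Unique j xs u p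

-- t = t2 + 2 and k = k2 + 2.  MC and NC bound the number of distinct positions and the length of a connecting
-- walk, connW q the size from which two ends can be connected when a 1/q fraction is spare, mA is the size of an absorber.
module Params (t2 k2 : ℕ) where
  k1 t1 T : ℕ
  k1 = suc k2
  t1 = suc t2
  T  = suc t1

  ell : ℕ → ℕ
  ell h = suc h * T

  abstract
    D MC NC mA : ℕ
    D = bin t1 k1 + bin t2 k2
    MC = T + T + t1 + t1 * T
    NC = T + 0 + t1 + T * (T + T)
    mA = t1 + t1

    D-def : D ≡ bin t1 k1 + bin t2 k2
    D-def = refl

    MC-def : MC ≡ T + T + t1 + t1 * T
    MC-def = refl

    NC-def : NC ≡ T + 0 + t1 + T * (T + T)
    NC-def = refl

    mA≡ : mA ≡ t1 + t1
    mA≡ = refl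

    connW : ℕ → ℕ
    connW q = suc (NC * NC * suc (q + q) ^ MC + q * (MC + MC))

    connW-def : ∀ q → connW q ≡ suc (NC * NC * suc (q + q) ^ MC + q * (MC + MC))
    connW-def q = refl

  NC>0 : 0 < NC
  NC>0 = ≤-trans (s≤s z≤n) (≤-reflexive (symm NC-def))

does-true : ∀ {P : Set} (d : Dec P) → does d ≡ true → P
does-true (yes p) e = p

does-intro : ∀ {P : Set} (d : Dec P) → P → does d ≡ true
does-intro (yes p) q = refl
does-intro (no n)  q = ⊥-elim (n q)

does-false : ∀ {P : Set} (d : Dec P) → does d ≡ false → ¬ P
does-false (no n) e = n

-- Sums over configurations, the vectors with entries in a list.

ΣV : List Elt → (m : ℕ) → (Vec Elt m → ℕ) → ℕ
ΣV W zero    f = f []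
ΣV W (suc m) f = ΣV W m (λ c → sumL (λ x → f (x ∷ c)) W)

module _ {W : List Elt} where

  ΣV-mono : ∀ m {f g : Vec Elt m → ℕ} → (∀ c → f c ≤ g c) → ΣV W m f ≤ ΣV W m g
  ΣV-mono zero    h = h []
  ΣV-mono (suc m) h = ΣV-mono m (λ c → sumL-mono W (λ {x} _ → h (x ∷ c)))

  ΣV-cong : ∀ m {f g : Vec Elt m → ℕ} → (∀ c → f c ≡ g c) → ΣV W m f ≡ ΣV W m g
  ΣV-cong zero    h = h []
  ΣV-cong (suc m) h = ΣV-cong m (λ c → sumL-cong W (λ {x} _ → h (x ∷ c)))

  ΣV-+ : ∀ m (f g : Vec Elt m → ℕ) → ΣV W m (λ c → f c + g c) ≡ ΣV W m f + ΣV W m g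
  ΣV-+ zero    f g = refl
  ΣV-+ (suc m) f g = ΣV-cong m (λ c → sumL-+ (λ x → f (x ∷ c)) (λ x → g (x ∷ c)) W) ⟫ ΣV-+ m _ _

  ΣV-* : ∀ m k (f : Vec Elt m → ℕ) → ΣV W m (λ c → k * f c) ≡ k * ΣV W m f
  ΣV-* zero    k f = refl
  ΣV-* (suc m) k f = ΣV-cong m (λ c → sumL-* k (λ x → f (x ∷ c)) W) ⟫ ΣV-* m k _

  ΣV-const : ∀ m k → ΣV W m (λ _ → k) ≡ k * length W ^ m
  ΣV-const zero    k = symm (*-identityʳ k)
  ΣV-const (suc m) k = ΣV-cong m (λ c → sumL-const k W ⟫ *-comm (length W) k)
    ⟫ ΣV-const m (k * length W) ⟫ *-assoc k (length W) _

  ΣV-sumL : ∀ m {Elt′ : Set} (f : Elt′ → Vec Elt m → ℕ) ys →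
    ΣV W m (λ c → sumL (λ y → f y c) ys) ≡ sumL (λ y → ΣV W m (f y)) ys
  ΣV-sumL m f []       = ΣV-const m 0
  ΣV-sumL m f (y ∷ ys) = ΣV-+ m (f y) (λ c → sumL (λ y → f y c) ys) ⟫ cong (ΣV W m (f y) +_) (ΣV-sumL m f ys)

  ΣV-∃ : ∀ m {f g : Vec Elt m → ℕ} → ΣV W m f < ΣV W m g →
    ∃ λ c → (∀ i → lookup c i ∈ W) × f c < g c
  ΣV-∃ zero h = [] , (λ ()) , h
  ΣV-∃ (suc m) h with ΣV-∃ m h
  ... | c , a , q with sumL-∃ W q
  ...   | x , x∈ , r = x ∷ c , (λ { zero → x∈ ; (suc i) → a i }) , r

  ΣV-pos : ∀ m (p : Vec Elt m → Bool) → 0 < ΣV W m (λ c → b2n (p c)) →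
    ∃ λ c → (∀ i → lookup c i ∈ W) × p c ≡ true
  ΣV-pos m p h with ΣV-∃ m {λ _ → 0} {λ c → b2n (p c)} (≤-<-trans (≤-reflexive (ΣV-const m 0)) h)
  ... | c , a , r = c , a , b2n-pos (p c) r
    where b2n-pos : ∀ b → 0 < b2n b → b ≡ true
          b2n-pos true _ = refl

  ΣV-∈ : ∀ m (f : Vec Elt m → ℕ) c → (∀ i → lookup c i ∈ W) → f c ≤ ΣV W m f
  ΣV-∈ zero f [] h = ≤-refl
  ΣV-∈ (suc m) f (x ∷ c) h = ≤-trans (sumL-∈ (λ y → f (y ∷ c)) (h zero))
    (ΣV-∈ m (λ c → sumL (λ y → f (y ∷ c)) W) c (λ i → h (suc i)))

  -- The configurations are fibred into the |W|^m lines parallel to coordinate `p`. This bounds what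
  -- one step of a walk discards.
  ΣV-coord : ∀ m (p : Fin (suc m)) (g : Vec Elt (suc m) → ℕ) d →
    (∀ c → sumL (λ y → g (c [ p ]≔ y)) W ≤ d) → ΣV W (suc m) g ≤ d * length W ^ m
  ΣV-coord m zero g d h = ≤-trans (ΣV-mono m (λ c → hz c)) (≤-reflexive (ΣV-const m d))
    where
      hz : ∀ c → sumL (λ y → g (y ∷ c)) W ≤ d
      -- A line is addressed through one of its points, which takes an element of `W`; if there is
      -- none, the sum is empty.
      hz c = go W refl
        where go : ∀ Z → Z ≡ W → sumL (λ y → g (y ∷ c)) W ≤ d
              go [] e = subst (λ Z → sumL (λ y → g (y ∷ c)) Z ≤ d) e z≤n
              go (w ∷ _) e = h (w ∷ c)
  ΣV-coord (suc m) (suc p) g d h = ≤-trans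
    (ΣV-coord m p (λ c → sumL (λ x → g (x ∷ c)) W) (length W * d) (λ c →
      ≤-trans (≤-reflexive (sumL-swap (λ y x → g (x ∷ (c [ p ]≔ y))) W W))
              (sumL-bound d W (λ {x} _ → h (x ∷ c)))))
    (≤-reflexive (cong (_* length W ^ m) (*-comm (length W) d) ⟫ *-assoc d (length W) _))

take-cong-++ : ∀ n (xs ys Z : List Elt) → length xs ≡ length ys → take n xs ≡ take n ys →
  take n (xs ++ Z) ≡ take n (ys ++ Z)
take-cong-++ n       []       []       Z l e = refl
take-cong-++ zero    (x ∷ xs) (y ∷ ys) Z l e = refl
take-cong-++ (suc n) (x ∷ xs) (y ∷ ys) Z l e =
  cong₂ _∷_ (∷-injectiveˡ e) (take-cong-++ n xs ys Z (suc-injective l) (∷-injectiveʳ e))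

take-pred : ∀ n (xs ys : List Elt) → take (suc n) xs ≡ take (suc n) ys → take n xs ≡ take n ys
take-pred zero    xs       ys       e = refl
take-pred (suc n) []       []       e = refl
take-pred (suc n) (x ∷ xs) (y ∷ ys) e = cong₂ _∷_ (∷-injectiveˡ e) (take-pred n xs ys (∷-injectiveʳ e))

lookup∈toList : ∀ {m} (c : Vec Elt m) i → lookup c i ∈ toList c
lookup∈toList (x ∷ c) zero    = here refl
lookup∈toList (x ∷ c) (suc i) = there (lookup∈toList c i)

length-toList : ∀ {m} (c : Vec Elt m) → length (toList c) ≡ m
length-toList []      = refl
length-toList (x ∷ c) = cong suc (length-toList c)

take-++-cong : ∀ n (xs : List Elt) {ys zs} → take n ys ≡ take n zs → take n (xs ++ ys) ≡ take n (xs ++ zs)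
take-++-cong n       []       e = e
take-++-cong zero    (x ∷ xs) e = refl
take-++-cong (suc n) (x ∷ xs) {ys} {zs} e = cong (x ∷_) (take-++-cong n xs (take-pred n ys zs e))

end-identity₁ : ∀ e a c m M d w → e + ((w + (a + c + m)) + (M + d)) + 0 ≡ a + ((d + e + M + w) + (m + c))
end-identity₁ = solve-∀

-- Rearranging concatenated blocks.

cat : ∀ {n} → Vec (List Elt) n → List (Fin n) → List Elt
cat bs []           = []
-- No trailing `[]` is appended, so for concrete blocks `cat` computes to the very lists that occur
-- in the walks.
cat bs (i ∷ [])     = lookup bs i
cat bs (i ∷ j ∷ is) = lookup bs i ++ cat bs (j ∷ is)

module _ {n} (bs : Vec (List Elt) n) where

  cat-∈⁻ : ∀ is {x} → x ∈ cat bs is → ∃ λ i → i ∈ is × x ∈ lookup bs i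
  cat-∈⁻ (i ∷ []) m = i , here refl , m
  cat-∈⁻ (i ∷ j ∷ is) m = [ (λ a → i , here refl , a)
    , (λ a → let k , k∈ , b = cat-∈⁻ (j ∷ is) a in k , there k∈ , b) ]′ (∈-++⁻ (lookup bs i) m)

  cat-∈⁺ : ∀ is {i x} → i ∈ is → x ∈ lookup bs i → x ∈ cat bs is
  cat-∈⁺ (i ∷ []) (here refl) m = m
  cat-∈⁺ (i ∷ j ∷ is) (here refl) m = ∈-++⁺ˡ m
  cat-∈⁺ (i ∷ j ∷ is) (there a) m = ∈-++⁺ʳ (lookup bs i) (cat-∈⁺ (j ∷ is) a m)

  cat-uniq : ∀ is {i} → Unique (cat bs is) → i ∈ is → Unique (lookup bs i)
  cat-uniq (i ∷ []) u (here refl) = u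
  cat-uniq (i ∷ j ∷ is) u (here refl) = Unique-++ˡ (lookup bs i) u
  cat-uniq (i ∷ j ∷ is) u (there m) = cat-uniq (j ∷ is) (Unique-++ʳ (lookup bs i) u) m

  cat-disj : ∀ is {i j x} → Unique (cat bs is) → i ∈ is → j ∈ is → i ≢ j → x ∈ lookup bs i → x ∉ lookup bs j
  cat-disj (_ ∷ []) u (here refl) (here refl) ne a b = ne refl
  cat-disj (_ ∷ _ ∷ is) u (here refl) (here refl) ne a b = ne refl
  cat-disj (i ∷ j ∷ is) u (here refl) (there n) ne a b = Unique-++-disj (lookup bs i) u a (cat-∈⁺ (j ∷ is) n b)
  cat-disj (i ∷ j ∷ is) u (there m) (here refl) ne a b = Unique-++-disj (lookup bs i) u b (cat-∈⁺ (j ∷ is) m a)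
  cat-disj (i ∷ j ∷ is) u (there m) (there n) ne a b = cat-disj (j ∷ is) (Unique-++ʳ (lookup bs i) u) m n ne a b

memF : ∀ {n} → Fin n → List (Fin n) → Bool
memF i []       = false
memF i (j ∷ js) = does (i ≟F j) ∨ memF i js

memF-true : ∀ {n} (i : Fin n) js → memF i js ≡ true → i ∈ js
memF-true i (j ∷ js) e with i ≟F j
... | yes p = here p
... | no _ = there (memF-true i js e)

subF : ∀ {n} → List (Fin n) → List (Fin n) → Bool
subF js is = allB (λ j → memF j is) js

uniqF : ∀ {n} → List (Fin n) → Bool
uniqF []       = true
uniqF (j ∷ js) = not (memF j js) ∧ uniqF js

memF-false : ∀ {n} (i : Fin n) js → memF i js ≡ false → i ∉ js
memF-false i (j ∷ js) e (here p) with i ≟F j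
... | no n = n p
memF-false i (j ∷ js) e (there m) with i ≟F j
... | no _ = memF-false i js e m

cat-⊆ : ∀ {n} (bs : Vec (List Elt) n) js is → subF js is ≡ true → cat bs js ⊆l cat bs is
cat-⊆ bs js is e m with cat-∈⁻ bs js m
... | i , i∈ , a = cat-∈⁺ bs is (memF-true i is (allB-∈ (λ j → memF j is) e i∈)) a

-- Proof by reflection: whether blocks may be dropped and permuted is a Boolean computation on their
-- indices, which `refl` settles at every use.
cat-Unique : ∀ {n} (bs : Vec (List Elt) n) is js → Unique (cat bs is) → subF js is ≡ true → uniqF js ≡ true → Unique (cat bs js)
cat-Unique bs is [] u e f = []
cat-Unique bs is (j ∷ []) u e f = cat-uniq bs is u (memF-true j is (proj₁ (∧-elim e)))
cat-Unique bs is (j ∷ j' ∷ js) u e f =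
  Unique-++ (cat-uniq bs is u (memF-true j is e1)) (cat-Unique bs is (j' ∷ js) u e2 (proj₂ (∧-elim {not (memF j (j' ∷ js))} f))) dis
  where
    e1 = proj₁ (∧-elim {memF j is} e)
    e2 = proj₂ (∧-elim {memF j is} e)
    dis : ∀ {x} → x ∈ lookup bs j → x ∉ cat bs (j' ∷ js)
    dis a b with cat-∈⁻ bs (j' ∷ js) b
    ... | i , i∈ , c = cat-disj bs is u (memF-true j is e1) (memF-true i is (allB-∈ (λ j → memF j is) e2 i∈))
          (λ { refl → memF-false j (j' ∷ js) (not-true (proj₁ (∧-elim f))) i∈ }) a c

connect-identity₁ : ∀ d r T → suc (d + suc (d + r)) + (T + T) + T ≡ T + r + 1 * (T + T) + (suc d + suc d)
connect-identity₁ = solve-∀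

connect-identity₂ : ∀ d s → suc (suc d + s) ≡ suc s + suc d
connect-identity₂ = solve-∀

connect-identity₃ : ∀ d s → suc (suc (d + s)) ≡ suc s + suc d
connect-identity₃ = solve-∀

connect-identity₄ : ∀ m s n T d → suc m + s + n * T + T + suc d ≡ m + suc n * T + (suc s + suc d)
connect-identity₄ = solve-∀

connect-identity₅ : ∀ T d r s n → T + suc (suc (d + r)) + s + suc n * (T + T) + T + T ≡ T + r + suc (suc n) * (T + T) + (suc s + suc d)
connect-identity₅ = solve-∀

connect-identity₆ : ∀ x d j → suc x + suc (d + j) ≡ x + suc (d + suc j)
connect-identity₆ = solve-∀

connect-identity₇ : ∀ T r j z → T + suc r + j + z ≡ T + r + suc j + z
connect-identity₇ = solve-∀

Unique-zero : ∀ {m} {xs : List (Fin m)} → Unique xs → Unique (Fin.zero ∷ map suc xs)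
Unique-zero {xs = xs} u = ∉⇒All≢ z∉ ∷ UniqueP.map⁺ (λ { refl → refl }) u
  where
    z∉ : Fin.zero ∉ map Fin.suc xs
    z∉ m with ∈-map⁻ Fin.suc m
    ... | _ , _ , ()

^-mul : ∀ a b n → (a * b) ^ n ≡ a ^ n * b ^ n
^-mul a b zero = refl
^-mul a b (suc n) = cong (a * b *_) (^-mul a b n) ⟫ l a b (a ^ n) (b ^ n)
  where l : ∀ a b c d → a * b * (c * d) ≡ a * c * (b * d)
        l = solve-∀

^-pos : ∀ a n → 0 < a → 0 < a ^ n
^-pos a zero h = s≤s z≤n
^-pos a (suc n) h = *-mono-≤ h (^-pos a n h)

*-mono-<ˡ : ∀ {a b} c → 0 < c → a < b → a * c < b * c
*-mono-<ˡ (suc c) _ h = *-monoˡ-< (suc c) h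

*-canc-< : ∀ c {a b} → c * a < c * b → a < b
*-canc-< c {a} {b} h = *-cancelˡ-< c a b h

*-canc-≤ : ∀ c {a b} → 0 < c → c * a ≤ c * b → a ≤ b
*-canc-≤ (suc c) _ h = *-cancelˡ-≤ (suc c) h

-- As e ≥ w/Q, the power e^(m+1) is at least w^m · w/Q^(m+1). So e^(m+1) configurations outnumber
-- B·w^m discarded ones once w exceeds a constant.
power-room : ∀ Q e w m B → w ≤ Q * e → B * Q ^ suc m < w → B * w ^ m < e ^ suc m
power-room Q e w m B h g = *-canc-< (Q ^ suc m) (begin-strict
  Q ^ suc m * (B * w ^ m)   ≡⟨ l (Q ^ suc m) B (w ^ m) ⟩
  B * Q ^ suc m * w ^ m     <⟨ *-mono-<ˡ (w ^ m) (^-pos w m (≤-<-trans z≤n g)) g ⟩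
  w * w ^ m                 ≤⟨ ^-monoˡ-≤ (suc m) h ⟩
  (Q * e) ^ suc m           ≡⟨ ^-mul Q e (suc m) ⟩
  Q ^ suc m * e ^ suc m ∎)
  where
    open ≤-Reasoning
    l : ∀ a b c → a * (b * c) ≡ b * a * c
    l = solve-∀

-- Multiplicative weights

weight-identity₁ : ∀ ℓ' μ → suc ((ℓ' * μ + suc ℓ') * suc (suc ℓ' * μ)) + 0 + (ℓ' + μ) ≡ (suc ℓ' * μ + suc ℓ') * suc (ℓ' * μ + 1) + 0
weight-identity₁ = solve-∀

weight-identity₂ : ∀ a b d → a * b * d ≡ a * d * b
weight-identity₂ = solve-∀

weight-identity₃ : ∀ a b d → a * (b * d) ≡ b * (a * d)
weight-identity₃ = solve-∀

weight-identity₄ : ∀ a b d e → a * (b * d) * e ≡ a * (b * (d * e))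
weight-identity₄ = solve-∀

weight-identity₅ : ∀ g m → suc (g + suc m) * suc g + 0 + m ≡ suc (suc g) * (g + suc m) + 0
weight-identity₅ = solve-∀

weight-identity₆ : ∀ ℓ' μ → suc ℓ' * μ + suc ℓ' ≡ ℓ' * μ + suc ℓ' + μ
weight-identity₆ = solve-∀

weight-identity₇ : ∀ a b d e → a * b * (d * e) ≡ b * d * (a * e)
weight-identity₇ = solve-∀

weight-identity₈ : ∀ a b d e → a * b * (d * e) ≡ a * e * (b * d)
weight-identity₈ = solve-∀

weight-identity₉ : ∀ ℓ' μ' → ℓ' * suc μ' + 1 + μ' ≡ suc ℓ' * suc μ'
weight-identity₉ = solve-∀

weight-identity₁₀ : ∀ a b c → a * (b * c) ≡ b * (a * c)
weight-identity₁₀ = solve-∀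

weight-identity₁₁ : ∀ a e → suc (a + e * suc a + suc e) ≡ suc e * suc (suc a)
weight-identity₁₁ = solve-∀

weight-identity₁₂ : ∀ a b c → a * (b * c) ≡ b * (c * a)
weight-identity₁₂ = solve-∀

weight-identity₁₃ : ∀ a b c → a * (b * c) ≡ b * a * c
weight-identity₁₃ = solve-∀

weight-identity₁₄ : ∀ a b c → a * (b * c) ≡ c * (a * b)
weight-identity₁₄ = solve-∀

weight-identity₁₅ : ∀ c d → c * suc (c + d) + 0 + d ≡ (c + d) * suc c + 0
weight-identity₁₅ = solve-∀

weight-identity₁₆ : ∀ a b d → a * b * d ≡ b * (a * d)
weight-identity₁₆ = solve-∀

weight-identity₁₇ : ∀ a b d → a * (b * d) ≡ a * b * d
weight-identity₁₇ = solve-∀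

weight-identity₁₈ : ∀ a b d → a * b * d ≡ d * a * b
weight-identity₁₈ = solve-∀

weight-identity₁₉ : ∀ n A z → (suc n + A) * (A * z) + 0 + n * z ≡ suc A * ((n + A) * z) + 0
weight-identity₁₉ = solve-∀

weight-identity₂₀ : ∀ a b c d → a * (b * c * d) ≡ b * (a * c * d)
weight-identity₂₀ = solve-∀

weight-identity₂₁ : ∀ a b → a + a * b ≡ a * suc b
weight-identity₂₁ = solve-∀

-- Bernoulli's inequality (1 - x)^m ≥ 1 - mx at x = 1/(c+1), cleared of denominators.
bernoulli : ∀ m g → let c = g + m in (suc c) ^ m * suc g ≤ c ^ m * suc c
bernoulli zero g = ≤-reflexive (cong (λ z → 1 * suc z) (symm (+-identityʳ g)))
bernoulli (suc m) g = begin
  suc c ^ suc m * suc g          ≡⟨ weight-identity₁₆ (suc c) (suc c ^ m) (suc g) ⟩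
  suc c ^ m * (suc c * suc g)    ≤⟨ *-monoʳ-≤ (suc c ^ m) (lin m {L = 0} z≤n (l2 g m c refl)) ⟩
  suc c ^ m * (suc (suc g) * c)  ≡⟨ weight-identity₁₇ (suc c ^ m) (suc (suc g)) c ⟩
  suc c ^ m * suc (suc g) * c    ≤⟨ *-monoˡ-≤ c (subst (λ z → suc z ^ m * suc (suc g) ≤ z ^ m * suc z) (symm (+-suc g m)) (bernoulli m (suc g))) ⟩
  c ^ m * suc c * c              ≡⟨ weight-identity₁₈ (c ^ m) (suc c) c ⟩
  c ^ suc m * suc c ∎
  where
    open ≤-Reasoning
    c = g + suc m
    l2 : ∀ g m c → c ≡ g + suc m → suc c * suc g + 0 + m ≡ suc (suc g) * c + 0
    l2 g m .(g + suc m) refl = weight-identity₅ g m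

-- Bernoulli's inequality 1 + n/A ≤ (1 + 1/A)^n, cleared of denominators.
lin-exp : ∀ A n → (n + A) * A ^ n ≤ A * suc A ^ n
lin-exp A zero = ≤-refl
lin-exp A (suc n) = begin
  (suc n + A) * (A * A ^ n)      ≤⟨ lin (n * A ^ n) {L = 0} z≤n (weight-identity₁₉ n A (A ^ n)) ⟩
  suc A * ((n + A) * A ^ n)      ≤⟨ *-monoʳ-≤ (suc A) (lin-exp A n) ⟩
  suc A * (A * suc A ^ n)        ≡⟨ weight-identity₁₀ (suc A) A (suc A ^ n) ⟩
  A * (suc A * suc A ^ n) ∎
  where
    open ≤-Reasoning

^-swap : ∀ a n m → (a ^ n) ^ m ≡ (a ^ m) ^ n
^-swap a n m = ^-*-assoc a n m ⟫ cong (a ^_) (*-comm n m) ⟫ symm (^-*-assoc a m n)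

-- Apply lin-exp with base A' = e(A+1)-1, for which (1+1/A')^e ≤ 1+1/A.
poly-exp′ : ∀ A e → 0 < A → ∃ λ C → ∀ n → suc n ^ e * A ^ n ≤ C * suc A ^ n
poly-exp′ A zero h = 1 , λ n → ≤-trans (≤-reflexive (*-identityˡ _)) (≤-trans (^-monoˡ-≤ n (n≤1+n A)) (≤-reflexive (symm (*-identityˡ _))))
poly-exp′ (suc A₀) (suc e₀) h = A' ^ e , prf
  where
    A = suc A₀
    e = suc e₀
    g = A₀ + e₀ * A
    A' = g + e
    s1 : suc A' ^ e * A ≤ suc A * A' ^ e
    s1 = *-cancelˡ-≤ e (begin
      e * (suc A' ^ e * A)       ≡⟨ weight-identity₁₀ e (suc A' ^ e) A ⟩
      suc A' ^ e * (e * A)       ≤⟨ bernoulli e g ⟩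
      A' ^ e * suc A'            ≡⟨ cong (A' ^ e *_) (weight-identity₁₁ A₀ e₀) ⟩
      A' ^ e * (e * suc A)       ≡⟨ weight-identity₁₂ (A' ^ e) e (suc A) ⟩
      e * (suc A * A' ^ e) ∎)
      where
        open ≤-Reasoning
    A'>0 : 0 < A'
    A'>0 = ≤-trans (s≤s z≤n) (m≤n+m e g)
    prf : ∀ n → suc n ^ e * A ^ n ≤ A' ^ e * suc A ^ n
    prf n = *-canc-≤ ((A' ^ e) ^ n) (^-pos (A' ^ e) n (^-pos A' e A'>0)) (begin
      (A' ^ e) ^ n * (suc n ^ e * A ^ n)        ≡⟨ weight-identity₁₃ ((A' ^ e) ^ n) (suc n ^ e) (A ^ n) ⟩
      suc n ^ e * (A' ^ e) ^ n * A ^ n          ≡⟨ cong (λ z → suc n ^ e * z * A ^ n) (^-swap A' e n) ⟩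
      suc n ^ e * (A' ^ n) ^ e * A ^ n          ≡⟨ cong (_* A ^ n) (symm (^-mul (suc n) (A' ^ n) e)) ⟩
      (suc n * A' ^ n) ^ e * A ^ n              ≤⟨ *-monoˡ-≤ (A ^ n) (^-monoˡ-≤ e (≤-trans (*-monoˡ-≤ (A' ^ n) (≤-trans (≤-reflexive (+-comm 1 n)) (+-monoʳ-≤ n A'>0))) (lin-exp A' n))) ⟩
      (A' * suc A' ^ n) ^ e * A ^ n             ≡⟨ cong (_* A ^ n) (^-mul A' (suc A' ^ n) e) ⟩
      A' ^ e * (suc A' ^ n) ^ e * A ^ n         ≡⟨ cong (λ z → A' ^ e * z * A ^ n) (^-swap (suc A') n e) ⟩
      A' ^ e * (suc A' ^ e) ^ n * A ^ n         ≡⟨ *-assoc (A' ^ e) ((suc A' ^ e) ^ n) (A ^ n) ⟩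
      A' ^ e * ((suc A' ^ e) ^ n * A ^ n)       ≡⟨ cong (A' ^ e *_) (symm (^-mul (suc A' ^ e) A n)) ⟩
      A' ^ e * (suc A' ^ e * A) ^ n             ≤⟨ *-monoʳ-≤ (A' ^ e) (^-monoˡ-≤ n s1) ⟩
      A' ^ e * (suc A * A' ^ e) ^ n             ≡⟨ cong (A' ^ e *_) (^-mul (suc A) (A' ^ e) n) ⟩
      A' ^ e * (suc A ^ n * (A' ^ e) ^ n)       ≡⟨ weight-identity₁₄ (A' ^ e) (suc A ^ n) ((A' ^ e) ^ n) ⟩
      (A' ^ e) ^ n * (A' ^ e * suc A ^ n) ∎)
      where
        open ≤-Reasoning

-- The polynomial bound is applied with exponent e + 1; the spare factor N + 1 outgrows the
-- constants.
exp-beats′ : ∀ A e c → 0 < A → ∃ λ N₀ → ∀ N → N₀ ≤ N → (c * N) ^ e * A ^ N < suc A ^ N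
exp-beats′ A e c h with poly-exp′ A (suc e) h
... | C , p = c ^ e * C , λ N le → *-canc-< (suc N) (begin-strict
    suc N * ((c * N) ^ e * A ^ N)         ≡⟨ cong (λ z → suc N * (z * A ^ N)) (^-mul c N e) ⟩
    suc N * (c ^ e * N ^ e * A ^ N)       ≤⟨ *-monoʳ-≤ (suc N) (*-monoˡ-≤ (A ^ N) (*-monoʳ-≤ (c ^ e) (^-monoˡ-≤ e (n≤1+n N)))) ⟩
    suc N * (c ^ e * suc N ^ e * A ^ N)   ≡⟨ weight-identity₂₀ (suc N) (c ^ e) (suc N ^ e) (A ^ N) ⟩
    c ^ e * (suc N ^ suc e * A ^ N)       ≤⟨ *-monoʳ-≤ (c ^ e) (p N) ⟩
    c ^ e * (C * suc A ^ N)               ≡⟨ symm (*-assoc (c ^ e) C _) ⟩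
    c ^ e * C * suc A ^ N                 <⟨ *-mono-<ˡ (suc A ^ N) (^-pos (suc A) N (s≤s z≤n)) (s≤s le) ⟩
    suc N * suc A ^ N ∎)
  where
    open ≤-Reasoning

abstract
  poly-exp : ∀ A e → 0 < A → ∃ λ C → ∀ n → suc n ^ e * A ^ n ≤ C * suc A ^ n
  poly-exp = poly-exp′

  exp-beats : ∀ A e c → 0 < A → ∃ λ N₀ → ∀ N → N₀ ≤ N → (c * N) ^ e * A ^ N < suc A ^ N
  exp-beats = exp-beats′

-- 1 + 1/A decreases in A, so a number of rounds that suffices for the largest parameter serves all
-- smaller ones.
exp-mono : ∀ {A A'} J N → 0 < A → A ≤ A' → J * A' ^ N < suc A' ^ N → J * A ^ N < suc A ^ N
exp-mono {A} {A'} J N h le p = *-canc-< (A' ^ N) (begin-strict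
  A' ^ N * (J * A ^ N)        ≡⟨ weight-identity₁₃ (A' ^ N) J (A ^ N) ⟩
  J * A' ^ N * A ^ N          <⟨ *-mono-<ˡ (A ^ N) (^-pos A N h) p ⟩
  suc A' ^ N * A ^ N          ≡⟨ symm (^-mul (suc A') A N) ⟩
  (suc A' * A) ^ N            ≤⟨ ^-monoˡ-≤ N (+-monoˡ-≤ (A' * A) le) ⟩
  (A' + A' * A) ^ N           ≡⟨ cong (_^ N) (weight-identity₂₁ A' A) ⟩
  (A' * suc A) ^ N            ≡⟨ ^-mul A' (suc A) N ⟩
  A' ^ N * suc A ^ N ∎)
  where
    open ≤-Reasoning

-- The A for which N rounds suffice when (1 + 1/A)^N exceeds the number of tests. Here ℓ = ℓ' + 1
-- bounds the gain of a test in one round, μ = μ' + 1 is the guaranteed weighted average gain, and A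
-- is the product (c - μ)(c' + 1) that arises in the potential argument with c' = ℓμ and c = c' + ℓ.
mwA : ℕ → ℕ → ℕ
mwA ℓ' μ' = (ℓ' * suc μ' + suc ℓ') * suc (suc ℓ' * suc μ')

-- Multiplicative weights: test j carries the weight ∏ (c - xᵢ(j)) over the rounds played so far.
module MW {J : Set} (js : List J) (ℓ' μ' N : ℕ) (I : ℕ → (J → ℕ) → Set)
  (step : ∀ i X → i < N → I i X → (φ : J → ℕ) → (∀ j → 0 < φ j) →
    ∃ λ (x : J → ℕ) → (∀ j → x j ≤ suc ℓ') × suc μ' * sumL φ js ≤ sumL (λ j → φ j * x j) js × I (suc i) (λ j → X j + x j))
  (start : I 0 (λ _ → 0))
  (big : length js * mwA ℓ' μ' ^ N < suc (mwA ℓ' μ') ^ N) where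

  private
    ℓ = suc ℓ'
    μ = suc μ'
    c' = ℓ * μ
    c = c' + ℓ
    cμ = ℓ' * μ + ℓ

    cμ-eq : c ≡ cμ + μ
    cμ-eq = weight-identity₆ ℓ' μ

    -- Each unit of gain costs at most a factor c'/(c'+1), since c - x ≥ c' + 1 holds before each of
    -- the first ℓ units.
    weight : ∀ x → x ≤ ℓ → c * c' ^ x ≤ (c ∸ x) * suc c' ^ x
    weight zero h = ≤-refl
    weight (suc x) h = begin
      c * (c' * c' ^ x)              ≡⟨ weight-identity₃ c c' (c' ^ x) ⟩
      c' * (c * c' ^ x)              ≤⟨ *-monoʳ-≤ c' (weight x (≤-trans (n≤1+n x) h)) ⟩
      c' * ((c ∸ x) * suc c' ^ x)    ≡⟨ symm (*-assoc c' (c ∸ x) _) ⟩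
      c' * (c ∸ x) * suc c' ^ x      ≤⟨ *-monoˡ-≤ (suc c' ^ x) ineq ⟩
      (c ∸ suc x) * suc c' * suc c' ^ x ≡⟨ *-assoc (c ∸ suc x) (suc c') _ ⟩
      (c ∸ suc x) * (suc c' * suc c' ^ x) ∎
      where
        open ≤-Reasoning
        d = ℓ ∸ suc x
        ed : c ∸ suc x ≡ c' + d
        ed = +-∸-assoc c' h
        ed' : c ∸ x ≡ suc (c' + d)
        ed' = +-∸-assoc 1 {c} {suc x} (≤-trans h (m≤n+m ℓ c')) ⟫ cong suc ed
        ineq : c' * (c ∸ x) ≤ (c ∸ suc x) * suc c'
        ineq = subst₂ (λ a b → c' * a ≤ b * suc c') (symm ed') (symm ed) (lin d {L = 0} z≤n (weight-identity₁₅ c' d))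

    record State (i : ℕ) : Set where
      field
        X φ  : J → ℕ
        inv  : I i X
        tot  : sumL φ js ≤ length js * cμ ^ i
        low  : ∀ j → c ^ i * c' ^ X j ≤ suc c' ^ X j * φ j
        pos  : ∀ j → 0 < φ j
    open State

    run : ∀ i → i ≤ N → State i
    run zero h = record { X = λ _ → 0 ; φ = λ _ → 1 ; inv = start ; tot = ≤-reflexive (sumL-const 1 js)
                        ; low = λ _ → ≤-refl ; pos = λ _ → s≤s z≤n }
    run (suc i) h with run i (≤-trans (n≤1+n i) h)
    ... | s with step i (X s) h (inv s) (φ s) (pos s)
    ...   | x , x≤ , gain , inv' = record
      { X = λ j → X s j + x j ; φ = λ j → φ s j * (c ∸ x j) ; inv = inv'
      ; tot = tot'
      ; low = low'
      ; pos = λ j → *-mono-≤ (pos s j) (m<n⇒0<n∸m (≤-<-trans (x≤ j) (m<n+m ℓ (s≤s z≤n)))) }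
      where
        S = sumL (λ j → φ s j * (c ∸ x j)) js
        split : ∀ j → φ s j * (c ∸ x j) + φ s j * x j ≡ c * φ s j
        split j = symm (*-distribˡ-+ (φ s j) (c ∸ x j) (x j)) ⟫ cong (φ s j *_) (m∸n+n≡m (≤-trans (x≤ j) (m≤n+m ℓ c'))) ⟫ *-comm (φ s j) c
        Seq : S + sumL (λ j → φ s j * x j) js ≡ c * sumL (φ s) js
        Seq = symm (sumL-+ (λ j → φ s j * (c ∸ x j)) (λ j → φ s j * x j) js) ⟫ sumL-cong js (λ {j} _ → split j) ⟫ sumL-* c (φ s) js
        -- The average gain μ replaces the factor c of the total weight by c - μ.
        tot' : S ≤ length js * cμ ^ suc i
        tot' = ≤-trans (+-cancelʳ-≤ (μ * sumL (φ s) js) S (cμ * sumL (φ s) js) (begin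
            S + μ * sumL (φ s) js                       ≤⟨ +-monoʳ-≤ S gain ⟩
            S + sumL (λ j → φ s j * x j) js             ≡⟨ Seq ⟩
            c * sumL (φ s) js                           ≡⟨ cong (_* sumL (φ s) js) cμ-eq ⟩
            (cμ + μ) * sumL (φ s) js                    ≡⟨ *-distribʳ-+ (sumL (φ s) js) cμ μ ⟩
            cμ * sumL (φ s) js + μ * sumL (φ s) js ∎))
          (≤-trans (*-monoʳ-≤ cμ (tot s)) (≤-reflexive (weight-identity₃ cμ (length js) (cμ ^ i))))
          where
            open ≤-Reasoning
        low' : ∀ j → c ^ suc i * c' ^ (X s j + x j) ≤ suc c' ^ (X s j + x j) * (φ s j * (c ∸ x j))
        low' j = begin
          c * c ^ i * c' ^ (X s j + x j)                       ≡⟨ cong (c * c ^ i *_) (^-distribˡ-+-* c' (X s j) (x j)) ⟩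
          c * c ^ i * (c' ^ X s j * c' ^ x j)                  ≡⟨ weight-identity₇ c (c ^ i) (c' ^ X s j) (c' ^ x j) ⟩
          (c ^ i * c' ^ X s j) * (c * c' ^ x j)                ≤⟨ *-mono-≤ (low s j) (weight (x j) (x≤ j)) ⟩
          (suc c' ^ X s j * φ s j) * ((c ∸ x j) * suc c' ^ x j) ≡⟨ weight-identity₈ (suc c' ^ X s j) (φ s j) (c ∸ x j) (suc c' ^ x j) ⟩
          (suc c' ^ X s j * suc c' ^ x j) * (φ s j * (c ∸ x j)) ≡⟨ cong (_* (φ s j * (c ∸ x j))) (symm (^-distribˡ-+-* (suc c') (X s j) (x j))) ⟩
          suc c' ^ (X s j + x j) * (φ s j * (c ∸ x j)) ∎
          where
            open ≤-Reasoning

    g = ℓ' * μ + 1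
    gc : g + μ' ≡ c'
    gc = weight-identity₉ ℓ' μ'

    -- A test with gain at most μ'N keeps weight at least c^N (c'/(c'+1))^(μ'N), while the total
    -- weight is at most |J|(c - μ)^N. Bernoulli gives (c'/(c'+1))^μ' ≥ (g+1)/(c'+1), and c(g+1) ≥ A
    -- + 1 then contradicts `big`.
    fail : ∀ x f → x ≤ μ' * N → c ^ N * c' ^ x ≤ suc c' ^ x * f → f ≤ length js * cμ ^ N → ⊥
    fail x f h lw tt' = <-irrefl refl (<-≤-trans big (begin
        suc A ^ N                          ≤⟨ ^-monoˡ-≤ N AB ⟩
        (c * suc g) ^ N                    ≤⟨ *-canc-≤ (P ^ N) (^-pos P N (^-pos (suc c') μ' (s≤s z≤n))) key ⟩
        length js * A ^ N ∎))
      where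
        open ≤-Reasoning
        A = mwA ℓ' μ'
        P = suc c' ^ μ'
        p = c' ^ μ'
        AB : suc A ≤ c * suc g
        AB = lin (ℓ' + μ) {L = 0} z≤n (weight-identity₁ ℓ' μ)
        bern : P * suc g ≤ p * suc c'
        bern = subst (λ z → suc z ^ μ' * suc g ≤ z ^ μ' * suc z) gc (bernoulli μ' g)
        y = μ' * N ∸ x
        xy : x + y ≡ μ' * N
        xy = m+[n∸m]≡n h
        step1 : c ^ N * c' ^ (μ' * N) ≤ suc c' ^ (μ' * N) * (length js * cμ ^ N)
        step1 = begin
          c ^ N * c' ^ (μ' * N)                        ≡⟨ cong (λ z → c ^ N * c' ^ z) (symm xy) ⟩
          c ^ N * c' ^ (x + y)                         ≡⟨ cong (c ^ N *_) (^-distribˡ-+-* c' x y) ⟩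
          c ^ N * (c' ^ x * c' ^ y)                    ≡⟨ symm (*-assoc (c ^ N) (c' ^ x) (c' ^ y)) ⟩
          c ^ N * c' ^ x * c' ^ y                      ≤⟨ *-mono-≤ (≤-trans lw (*-monoʳ-≤ (suc c' ^ x) tt')) (^-monoˡ-≤ y (n≤1+n c')) ⟩
          suc c' ^ x * (length js * cμ ^ N) * suc c' ^ y ≡⟨ weight-identity₂ (suc c' ^ x) (length js * cμ ^ N) (suc c' ^ y) ⟩
          suc c' ^ x * suc c' ^ y * (length js * cμ ^ N) ≡⟨ cong (_* (length js * cμ ^ N)) (symm (^-distribˡ-+-* (suc c') x y) ⟫ cong (suc c' ^_) xy) ⟩
          suc c' ^ (μ' * N) * (length js * cμ ^ N) ∎
        key : P ^ N * (c * suc g) ^ N ≤ P ^ N * (length js * A ^ N)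
        key = begin
          P ^ N * (c * suc g) ^ N                ≡⟨ symm (^-mul P (c * suc g) N) ⟩
          (P * (c * suc g)) ^ N                  ≡⟨ cong (_^ N) (weight-identity₃ P c (suc g)) ⟩
          (c * (P * suc g)) ^ N                  ≤⟨ ^-monoˡ-≤ N (*-monoʳ-≤ c bern) ⟩
          (c * (p * suc c')) ^ N                 ≡⟨ ^-mul c (p * suc c') N ⟫ cong (c ^ N *_) (^-mul p (suc c') N) ⟫ symm (*-assoc (c ^ N) (p ^ N) (suc c' ^ N)) ⟩
          c ^ N * p ^ N * suc c' ^ N             ≡⟨ cong (λ z → c ^ N * z * suc c' ^ N) (^-*-assoc c' μ' N) ⟩
          c ^ N * c' ^ (μ' * N) * suc c' ^ N     ≤⟨ *-monoˡ-≤ (suc c' ^ N) step1 ⟩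
          suc c' ^ (μ' * N) * (length js * cμ ^ N) * suc c' ^ N ≡⟨ cong (λ z → z * (length js * cμ ^ N) * suc c' ^ N) (symm (^-*-assoc (suc c') μ' N)) ⟩
          P ^ N * (length js * cμ ^ N) * suc c' ^ N ≡⟨ weight-identity₄ (P ^ N) (length js) (cμ ^ N) (suc c' ^ N) ⟩
          P ^ N * (length js * (cμ ^ N * suc c' ^ N)) ≡⟨ cong (λ z → P ^ N * (length js * z)) (symm (^-mul cμ (suc c') N)) ⟩
          P ^ N * (length js * A ^ N) ∎

  result : ∃ λ (X : J → ℕ) → I N X × (∀ {j} → j ∈ js → μ' * N ≤ X j)
  result = X s , inv s , λ {j} m → ≮⇒≥ (λ lt → fail (X s j) (φ s j) (<⇒≤ lt) (low s j) (≤-trans (sumL-∈ (φ s) m) (tot s)))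
    where s = run N ≤-refl

heavy-identity₁ : ∀ a b c → a * (b * c) ≡ b * a * c
heavy-identity₁ = solve-∀

heavy-identity₂ : ∀ e v a i B T f → e + (v + (a + i + B)) + (f + T) + 0 ≡ a + (B + f) + (v + T + e + i)
heavy-identity₂ = solve-∀

heavy-identity₃ : ∀ a r s T x → a * (r * s + T * x) ≡ r * (a * s) + a * T * x
heavy-identity₃ = solve-∀

heavy-identity₄ : ∀ a b c → a * (b * c) ≡ b * (a * c)
heavy-identity₄ = solve-∀

-- Layer sums and weight thresholds.

sumTo : ℕ → (ℕ → ℕ) → ℕ
sumTo zero    f = 0
sumTo (suc n) f = f (suc n) + sumTo n f

sumTo-mono : ∀ n {f g : ℕ → ℕ} → (∀ θ → f θ ≤ g θ) → sumTo n f ≤ sumTo n g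
sumTo-mono zero    h = z≤n
sumTo-mono (suc n) h = +-mono-≤ (h (suc n)) (sumTo-mono n h)

sumTo-+ : ∀ n (f g : ℕ → ℕ) → sumTo n (λ θ → f θ + g θ) ≡ sumTo n f + sumTo n g
sumTo-+ zero    f g = refl
sumTo-+ (suc n) f g = cong (f (suc n) + g (suc n) +_) (sumTo-+ n f g) ⟫ +-interchange (f (suc n)) (g (suc n)) _ _

sumTo-* : ∀ n c (f : ℕ → ℕ) → sumTo n (λ θ → c * f θ) ≡ c * sumTo n f
sumTo-* zero    c f = symm (*-zeroʳ c)
sumTo-* (suc n) c f = cong (c * f (suc n) +_) (sumTo-* n c f) ⟫ symm (*-distribˡ-+ c (f (suc n)) _)

sumTo-const : ∀ n c → sumTo n (λ _ → c) ≡ n * c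
sumTo-const zero    c = refl
sumTo-const (suc n) c = cong (c +_) (sumTo-const n c)

sumTo-sumL : ∀ {A : Set} n (f : ℕ → A → ℕ) xs →
  sumTo n (λ θ → sumL (f θ) xs) ≡ sumL (λ x → sumTo n (λ θ → f θ x)) xs
sumTo-sumL zero    f xs = symm (sumL-const 0 xs ⟫ *-zeroʳ (length xs))
sumTo-sumL (suc n) f xs = cong (sumL (f (suc n)) xs +_) (sumTo-sumL n f xs) ⟫ symm (sumL-+ (f (suc n)) _ xs)

leq : ℕ → ℕ → Bool
leq a b = does (a ≤? b)

le-true : ∀ {a b} → leq a b ≡ true → a ≤ b
le-true {a} {b} e = does-true (a ≤? b) e

le-intro : ∀ {a b} → a ≤ b → leq a b ≡ true
le-intro {a} {b} h = does-intro (a ≤? b) h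

-- The layer-cake formula: the thresholds 1, ..., w are those that w reaches.
layers : ∀ n w → w ≤ n → w ≤ sumTo n (λ θ → b2n (leq θ w))
layers n w h = go n h
  where
    full : ∀ n → n ≤ w → n ≤ sumTo n (λ θ → b2n (leq θ w))
    full zero h = z≤n
    full (suc n) h rewrite le-intro h = s≤s (full n (≤-trans (n≤1+n n) h))
    go : ∀ n → w ≤ n → w ≤ sumTo n (λ θ → b2n (leq θ w))
    go n h with m≤n⇒m<n∨m≡n h
    go n h | inj₂ refl = full n ≤-refl
    go (suc n) h | inj₁ lt = ≤-trans (go n (≤-pred lt)) (m≤n+m _ _)

module Thresholds (cn : ℕ → ℕ) where
  -- If `cn θ` counts the vertices of weight at least θ, this is the ρ-th largest weight, capped at
  -- n.
  mx : ℕ → ℕ → ℕ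
  mx ρ zero    = 0
  mx ρ (suc n) = if leq ρ (cn (suc n)) then suc n else mx ρ n

  mx-ok : ∀ ρ n → ρ ≤ cn 0 → ρ ≤ cn (mx ρ n)
  mx-ok ρ zero h = h
  mx-ok ρ (suc n) h with leq ρ (cn (suc n)) in eq
  ... | true = le-true eq
  ... | false = mx-ok ρ n h

  -- All θ counted on the left lie between 1 and the largest of them, which is `mx ρ n`.
  mx-sum : ∀ ρ n → sumTo n (λ θ → b2n (leq ρ (cn θ))) ≤ mx ρ n
  mx-sum ρ zero = z≤n
  mx-sum ρ (suc n) with leq ρ (cn (suc n))
  ... | true = s≤s (≤-trans (sumTo-mono n {g = λ _ → 1} (λ θ → b2n≤1 _)) (≤-reflexive (sumTo-const n 1 ⟫ *-identityʳ n)))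
  ... | false = mx-sum ρ n

fins : ∀ n → List (Fin n)
fins zero    = []
fins (suc n) = zero ∷ map suc (fins n)

length-fins : ∀ n → length (fins n) ≡ n
length-fins zero    = refl
length-fins (suc n) = cong suc (length-map suc (fins n) ⟫ length-fins n)

Unique-fins : ∀ n → Unique (fins n)
Unique-fins zero    = []
Unique-fins (suc n) = Unique-zero (Unique-fins n)

sumL-fins : ∀ {n} (v : Vec ℕ n) → sumL (lookup v) (fins n) ≡ sumL (λ x → x) (toList v)
sumL-fins []      = refl
sumL-fins (x ∷ v) = cong (x +_) (sumL-map (lookup (x ∷ v)) suc (fins _) ⟫ sumL-fins v)

repeat : ∀ {A : Set} → ℕ → List A → List A
repeat zero    xs = xs
repeat (suc h) xs = xs ++ repeat h xs

sumL-repeat : ∀ {A : Set} (f : A → ℕ) h xs → sumL f (repeat h xs) ≡ suc h * sumL f xs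
sumL-repeat f zero    xs = symm (+-identityʳ _)
sumL-repeat f (suc h) xs = sumL-++ f xs (repeat h xs) ⟫ cong (sumL f xs +_) (sumL-repeat f h xs)

length-repeat : ∀ {A : Set} h (xs : List A) → length (repeat h xs) ≡ suc h * length xs
length-repeat zero    xs = symm (+-identityʳ _)
length-repeat (suc h) xs = length-++ xs ⟫ cong (length xs +_) (length-repeat h xs)

repeat-++ : ∀ {A : Set} h (xs : List A) → ∃ λ ys → repeat h xs ≡ xs ++ ys
repeat-++ zero    xs = [] , symm (++-identityʳ xs)
repeat-++ (suc h) xs = repeat h xs , refl

Pointwise-sum : ∀ {A B : Set} {f : A → ℕ} {g : B → ℕ} {xs ys} → Pointwise (λ a b → f a ≤ g b) xs ys → sumL f xs ≤ sumL g ys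
Pointwise-sum []      = z≤n
Pointwise-sum (h ∷ p) = +-mono-≤ h (Pointwise-sum p)

block-identity₁ : ∀ e a d f m w → e + (w + (a + d + f) + m) + 0 ≡ a + (d + e + m + w + f)
block-identity₁ = solve-∀

∈-take-insert : ∀ {A : Set} n (xs : List A) {v ys z} → length xs ≤ n →
  z ∈ take (suc n) (xs ++ v ∷ ys) → z ∈ v ∷ take n (xs ++ ys)
∈-take-insert n [] h m = m
∈-take-insert (suc n) (x ∷ xs) (s≤s h) (here e) = there (here e)
∈-take-insert (suc n) (x ∷ xs) (s≤s h) (there m) with ∈-take-insert n xs h m
... | here e = here e
... | there q = there (there q)

split-len : ∀ {A : Set} n (xs : List A) → n ≤ length xs → length (take n xs) ≡ n × length (drop n xs) ≡ length xs ∸ n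
split-len n xs h = (length-take n xs ⟫ m≤n⇒m⊓n≡m h) , length-drop n xs

absorb-identity₁ : ∀ a b c d → a + (b + (c + d)) ≡ (a + b + c) + d
absorb-identity₁ = solve-∀

absorb-identity₂ : ∀ a b → 2 * (a * b) ≡ (a + a) * b
absorb-identity₂ = solve-∀

absorb-identity₃ : ∀ a b c → a * (b * c) ≡ b * (a * c)
absorb-identity₃ = solve-∀

absorb-identity₄ : ∀ d e f w v r → d + f + (w + e + (v + r)) + 0 ≡ r + (d + e + f + v + w)
absorb-identity₄ = solve-∀

absorb-identity₅ : ∀ a b c → a * (b * c) ≡ b * (c * a)
absorb-identity₅ = solve-∀

tile-identity₁ : ∀ d e2 t e1 v ℓ r r' → d + e2 + t + (r + e1 + (v + r' + ℓ)) + 0 ≡ r' + (d + e1 + e2 + (v + ℓ) + (r + t))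
tile-identity₁ = solve-∀

tile-identity₂ : ∀ r m Φ ℓ f → r * (m * Φ) + ℓ * (Φ * f) ≡ (m * r + ℓ * f) * Φ
tile-identity₂ = solve-∀

lists : ∀ {A : Set} → ℕ → List A → List (List A)
lists zero    U = [] ∷ []
lists (suc n) U = concatMap (λ x → map (x ∷_) (lists n U)) U

length-concatMap : ∀ {A B : Set} (f : A → List B) c xs → (∀ x → length (f x) ≡ c) → length (concatMap f xs) ≡ length xs * c
length-concatMap f c []       h = refl
length-concatMap f c (x ∷ xs) h = length-++ (f x) ⟫ cong₂ _+_ (h x) (length-concatMap f c xs h)

length-lists : ∀ {A : Set} n (U : List A) → length (lists n U) ≡ length U ^ n
length-lists zero    U = refl
length-lists (suc n) U = length-concatMap _ (length U ^ n) U (λ x → length-map (x ∷_) (lists n U) ⟫ length-lists n U)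

∈-lists : ∀ {A : Set} (S U : List A) → S ⊆l U → S ∈ lists (length S) U
∈-lists [] U h = here refl
∈-lists (x ∷ S) U h = ∈-concat⁺′ (∈-map⁺ (x ∷_) (∈-lists S U (λ m → h (there m)))) (∈-map⁺ (λ y → map (y ∷_) (lists (length S) U)) (h (here refl)))

module _ {V : Set} (_≟v_ : DecidableEquality V) where

  cnt-add : ∀ (p : V → Bool) x xs → Unique xs → x ∈ xs → p x ≡ false →
    cnt (λ y → p y ∨ does (y ≟v x)) xs ≡ suc (cnt p xs)
  cnt-add p x (z ∷ xs) (a ∷ u) m e with z ≟v x
  ... | yes refl rewrite e = cong suc (sumL-cong xs (λ {y} y∈ → cong b2n (ne y (λ { refl → All≢⇒∉ a y∈ }))))
    where ne : ∀ y → y ≢ z → p y ∨ does (y ≟v z) ≡ p y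
          ne y h with y ≟v z
          ... | yes q = ⊥-elim (h q)
          ... | no _ with p y
          ...   | true = refl
          ...   | false = refl
  cnt-add p x (z ∷ xs) (a ∷ u) (here refl) e | no n = ⊥-elim (n refl)
  cnt-add p x (z ∷ xs) (a ∷ u) (there m) e | no n =
    cong₂ _+_ (cong b2n (orf (p z))) (cnt-add p x xs u m e) ⟫ +-suc (b2n (p z)) (cnt p xs)
    where orf : ∀ b → b ∨ false ≡ b
          orf true = refl
          orf false = refl

  -- Used to pad all bad sets to one common size: the total weight of the vertices is then known
  -- exactly, and every bad degree starts from the same value.
  pad-ex : ∀ d (p : V → Bool) xs → Unique xs → cnt p xs + d ≤ length xs →
    ∃ λ (p' : V → Bool) → (∀ x → p x ≡ true → p' x ≡ true) × cnt p' xs ≡ cnt p xs + d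
  pad-ex zero p xs u h = p , (λ _ e → e) , symm (+-identityʳ _)
  pad-ex (suc d) p xs u h with cnt-∃ (λ x → not (p x)) xs some
    where
      eqn : ∀ ys → cnt p ys + cnt (λ x → not (p x)) ys ≡ length ys
      eqn [] = refl
      eqn (y ∷ ys) with p y
      ... | true = cong suc (eqn ys)
      ... | false = +-suc (cnt p ys) _ ⟫ cong suc (eqn ys)
      some : 0 < cnt (λ x → not (p x)) xs
      some = +-cancelˡ-≤ (cnt p xs) 1 _ (≤-trans (+-monoʳ-≤ (cnt p xs) (s≤s z≤n)) (≤-trans h (≤-reflexive (symm (eqn xs)))))
  ... | x , x∈ , e with pad-ex d (λ y → p y ∨ does (y ≟v x)) xs u
           (≤-trans (≤-reflexive (cong (_+ d) (cnt-add p x xs u x∈ (not-true e)) ⟫ symm (+-suc (cnt p xs) d))) h)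
  ...   | p' , sup , eq = p' , (λ y q → sup y (ort (p y) q))
            , (eq ⟫ cong (_+ d) (cnt-add p x xs u x∈ (not-true e)) ⟫ symm (+-suc (cnt p xs) d))
    where ort : ∀ b {c} → b ≡ true → b ∨ c ≡ true
          ort true _ = refl

-- Numbers governing one covering phase

phase-identity₁ : ∀ Q N C → 4 * (Q * (N * C)) ≡ N * (4 * Q * C)
phase-identity₁ = solve-∀

phase-identity₂ : ∀ D Q N → 8 * (D * Q * N) ≡ N * (8 * D * Q)
phase-identity₂ = solve-∀

phase-identity₃ : ∀ M → M + 4 * M ≡ 5 * M
phase-identity₃ = solve-∀

phase-identity₄ : ∀ M D Q → 4 * (M * (D * Q * (5 * M))) ≡ 20 * D * Q * (M * M)
phase-identity₄ = solve-∀

phase-identity₅ : ∀ a s → a + s + (a + s) ≡ a + a + (s + s)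
phase-identity₅ = solve-∀

phase-identity₆ : ∀ t n l → t * (n * l) ≡ n * (t * l)
phase-identity₆ = solve-∀

phase-identity₇ : ∀ m → m + m + m + m ≡ 4 * m
phase-identity₇ = solve-∀

phase-identity₈ : ∀ q M → 4 * q * (4 * M) ≡ 16 * q * M
phase-identity₈ = solve-∀

phase-identity₉ : ∀ m → m + m ≡ 2 * m
phase-identity₉ = solve-∀

phase-identity₁₀ : ∀ e q → (e + e) * (8 * q) ≡ 16 * q * e
phase-identity₁₀ = solve-∀

phase-identity₁₁ : ∀ D f → 2 * (4 * D * (1 + f)) ≡ 8 * D + 8 * D * f
phase-identity₁₁ = solve-∀

phase-identity₁₂ : ∀ r → r + r ≡ 2 * r
phase-identity₁₂ = solve-∀

phase-identity₁₃ : ∀ r M a d x → 4 * (r * M + r * a + 2 * (r * d) + x) ≡ r * (4 * M) + r * (4 * a) + r * (8 * d) + 4 * x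
phase-identity₁₃ = solve-∀

phase-identity₁₄ : ∀ r → r * r + r * r + r * r + r * r ≡ 4 * (r * r)
phase-identity₁₄ = solve-∀

phase-identity₁₅ : ∀ a r x → a * r + (r + x) ≡ suc a * r + x
phase-identity₁₅ = solve-∀

phase-identity₁₆ : ∀ a v r x → a * (v + r) + x ≡ a * r + (x + a * v)
phase-identity₁₆ = solve-∀

phase-identity₁₇ : ∀ M → 2 * M + 2 * M ≡ 4 * M
phase-identity₁₇ = solve-∀

phase-identity₁₈ : ∀ q' Θ → 2 * Θ + 2 * Θ + 0 + (4 * q' * Θ + 4 * suc q' * Θ) ≡ 8 * suc q' * Θ + 0
phase-identity₁₈ = solve-∀

phase-identity₁₉ : ∀ q' Θ → 8 * suc q' * Θ + (2 * Θ + 2 * Θ + (2 * Θ + 2 * Θ)) + 0 + 8 * q' * Θ ≡ 8 * suc q' * Θ + 8 * suc q' * Θ + 0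
phase-identity₁₉ = solve-∀

phase-identity₂₀ : ∀ D' q z' M → suc z' * (16 * q * M) + 0 + q * suc z' * (144 + 160 * D' + 160 * z' + 160 * D' * z') * M ≡ 160 * suc D' * q * (suc z' * suc z') * M + 0
phase-identity₂₀ = solve-∀

phase-identity₂₁ : ∀ D q z' M → suc z' * (32 * D * q * M) + 0 + D * q * suc z' * (128 + 160 * z') * M ≡ 160 * D * q * (suc z' * suc z') * M + 0
phase-identity₂₁ = solve-∀

phase-identity₂₂ : ∀ D' q → 8 * q * 1 + 0 + 8 * D' * q ≡ 8 * suc D' * q + 0
phase-identity₂₂ = solve-∀

phase-identity₂₃ : ∀ D q' → 8 * D + 0 + 8 * D * q' ≡ 8 * D * suc q' + 0
phase-identity₂₃ = solve-∀

phase-identity₂₄ : ∀ D q' M → 8 * D * (4 * M) + 0 + 32 * D * q' * M ≡ 32 * D * suc q' * M + 0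
phase-identity₂₄ = solve-∀

phase-identity₂₅ : ∀ q Θ → 8 * q * Θ ≡ 4 * q * (2 * Θ)
phase-identity₂₅ = solve-∀

phase-identity₂₆ : ∀ q' M → 4 * M + 0 + (12 * M + 16 * q' * M) ≡ 16 * suc q' * M + 0
phase-identity₂₆ = solve-∀

phase-identity₂₇ : ∀ s q D b r → s * (4 * q * (D * b) + r) ≡ b * (D * (4 * q * s)) + s * r
phase-identity₂₇ = solve-∀

phase-identity₂₈ : ∀ q s r → 4 * q * s * r ≡ s * (4 * q * r)
phase-identity₂₈ = solve-∀

phase-identity₂₉ : ∀ q a b → 2 * (4 * q * (a + b)) ≡ 8 * q * a + b * (8 * q)
phase-identity₂₉ = solve-∀

phase-identity₃₀ : ∀ q M → 8 * q * (2 * M) ≡ 16 * q * M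
phase-identity₃₀ = solve-∀

phase-identity₃₁ : ∀ a r → (a + a) * r + (a + a) * r ≡ 4 * (a * r)
phase-identity₃₁ = solve-∀

phase-identity₃₂ : ∀ f g D Q → 4 * (suc (f + g) * (D * Q)) ≡ Q * (4 * D * g) + Q * (4 * D * (1 + f))
phase-identity₃₂ = solve-∀

phase-identity₃₃ : ∀ D q z M Θ → z * z * (20 * D * (8 * q * Θ) * (M * M)) ≡ (160 * D * q * (z * z)) * Θ * (M * M)
phase-identity₃₃ = solve-∀

phase-identity₃₄ : ∀ Θ M → Θ * Θ * (M * M) ≡ (Θ * M) * (Θ * M)
phase-identity₃₄ = solve-∀

phase-identity₃₅ : ∀ z r → (z * r) * (z * r) ≡ z * z * (r * r)
phase-identity₃₅ = solve-∀

phase-identity₃₆ : ∀ r A N ℓ C DQ f → r * (suc A * (N * (ℓ + C))) + (2 * (r * (DQ * N)) + N * ℓ * (DQ * (1 + f))) ≡ N * ℓ * (A * r) + (r * (N * ℓ) + r * (suc A * (N * C)) + 2 * (r * (DQ * N)) + N * ℓ * (DQ * (1 + f)))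
phase-identity₃₆ = solve-∀

phase-identity₃₇ : ∀ N ℓ g f DQ r → N * ℓ * (suc (g + f) * DQ) + r * r ≡ N * DQ * (ℓ * g) + N * ℓ * (DQ * (1 + f)) + r * r
phase-identity₃₇ = solve-∀

phase-identity₃₈ : ∀ N DQ m r ℓ f → N * DQ * (suc (suc m) * r) + N * ℓ * (DQ * (1 + f)) + r * r ≡ r * (r + DQ * (m * N)) + (2 * (r * (DQ * N)) + N * ℓ * (DQ * (1 + f)))
phase-identity₃₈ = solve-∀

phase-identity₃₉ : ∀ a s r → suc a * r + s * r ≡ (a + suc s) * r
phase-identity₃₉ = solve-∀

div-lower : ∀ m n .{{_ : NonZero n}} → m < suc (m / n) * n
div-lower m n = ≤-trans (≤-reflexive (cong suc (m≡m%n+[m/n]*n m n))) (+-monoˡ-≤ ((m / n) * n) (m%n<n m n))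

mwA-mono : ∀ ℓ' {μ μ₂} → μ ≤ μ₂ → mwA ℓ' μ ≤ mwA ℓ' μ₂
mwA-mono ℓ' h = *-mono-≤ (+-monoˡ-≤ (suc ℓ') (*-monoʳ-≤ ℓ' (s≤s h))) (s≤s (*-monoʳ-≤ (suc ℓ') (s≤s h)))

private
  slk : ∀ s {a b} → a + 0 + s ≡ b + 0 → a ≤ b
  slk s e = lin s {L = 0} z≤n e

  n1 : ∀ q Θ → 0 < q → 2 * Θ + 2 * Θ ≤ 8 * q * Θ
  n1 (suc q') Θ _ = slk (4 * q' * Θ + 4 * suc q' * Θ) (phase-identity₁₈ q' Θ)

  n2 : ∀ q Θ → 0 < q → 8 * q * Θ + (2 * Θ + 2 * Θ + (2 * Θ + 2 * Θ)) ≤ 8 * q * Θ + 8 * q * Θ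
  n2 (suc q') Θ _ = slk (8 * q' * Θ) (phase-identity₁₉ q' Θ)

  n3 : ∀ D q z M → 0 < D → 0 < z → z * (16 * q * M) ≤ 160 * D * q * (z * z) * M
  n3 (suc D') q (suc z') M _ _ = slk (q * suc z' * (144 + 160 * D' + 160 * z' + 160 * D' * z') * M) (phase-identity₂₀ D' q z' M)

  n4 : ∀ D q z M → 0 < z → z * (32 * D * q * M) ≤ 160 * D * q * (z * z) * M
  n4 D q (suc z') M _ = slk (D * q * suc z' * (128 + 160 * z') * M) (phase-identity₂₁ D q z' M)

  n5 : ∀ D q → 0 < D → 8 * q * 1 ≤ 8 * D * q
  n5 (suc D') q _ = slk (8 * D' * q) (phase-identity₂₂ D' q)

  n6 : ∀ D q → 0 < q → 8 * D ≤ 8 * D * q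
  n6 D (suc q') _ = slk (8 * D * q') (phase-identity₂₃ D q')

  n7 : ∀ D q M → 0 < q → 8 * D * (4 * M) ≤ 32 * D * q * M
  n7 D (suc q') M _ = slk (32 * D * q' * M) (phase-identity₂₄ D q' M)

  n9 : ∀ D b → 0 < D → b ≤ D * b
  n9 (suc D') b _ = m≤m+n b (D' * b)

n8 : ∀ q M → 0 < q → 4 * M ≤ 16 * q * M
n8 (suc q') M _ = lin (12 * M + 16 * q' * M) {L = 0} z≤n (phase-identity₂₆ q' M)

-- `b₊` is the padded size of the bad sets, `e₁` the number of vertices a phase may use, `e₂` the
-- room left for connections, `f` the error in the rank of a weight, and `μ'` the guaranteed number
-- of hits per tile. `next` restores the hypothesis with slack s' for the remaining r' vertices.
record PhaseNumbers (D Q q ℓ NC T N r s' b : ℕ) : Set where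
  field
    b₊ f e₁ e₂ μ' : ℕ
    b≤b₊   : b ≤ b₊
    b₊≤r   : b₊ ≤ r
    mar    : D * b₊ + e₁ + e₂ ≤ r
    hq     : r ≤ 16 * q * e₂
    e₂-big : ∀ x → 8 * q * x ≤ r → x ≤ e₂
    hN     : N * (ℓ + NC) ≤ e₁
    hf     : N * (ℓ + NC) + T + N * ℓ ≤ f
    hD     : D * b₊ + f ≤ r
    hμ     : suc μ' * r + ℓ * f ≤ ℓ * b₊
    μ'≤ℓ   : μ' ≤ ℓ
    r>0    : 0 < r
    half   : N * (ℓ + NC) + N * (ℓ + NC) ≤ r
    next   : ∀ v r' → r ≡ v + r' → v ≤ N * (ℓ + NC) → D * Q * (b₊ ∸ μ' * N) + s' * r' ≤ Q * r'

-- One phase turns the slack s/Q of the bad-set bound b into (s-1)/Q.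
module PhaseNum (D q z : ℕ) (D>0 : 0 < D) (q>0 : 0 < q) (z>0 : 0 < z) where

  abstract
    Θ Q s₁ : ℕ
    Θ = 160 * D * q * (z * z)
    Q = 8 * q * Θ
    -- The slack falls from 2s₁/Q = 1/(2q) to s₁/Q = 1/(4q), one unit per phase. A phase uses about
    -- a 1/Θ fraction of the initial vertices, so s₁ = 2Θ phases suffice in spite of rounding.
    s₁ = 2 * Θ

    Θ-def : Θ ≡ 160 * D * q * (z * z)
    Θ-def = refl

    Q-def : Q ≡ 8 * q * Θ
    Q-def = refl

    s₁-def : s₁ ≡ 2 * Θ
    s₁-def = refl

  Q-s₁ : Q ≡ 4 * q * s₁
  Q-s₁ = Q-def ⟫ phase-identity₂₅ q Θ ⟫ cong (4 * q *_) (symm s₁-def)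

  Θ>0 : 0 < Θ
  Θ>0 = ≤-trans (*-mono-≤ (*-mono-≤ (*-mono-≤ {1} {160} (s≤s z≤n) D>0) q>0) (*-mono-≤ z>0 z>0)) (≤-reflexive (symm Θ-def))

  Q>0 : 0 < Q
  Q>0 = ≤-trans (*-mono-≤ (*-mono-≤ {1} {8} (s≤s z≤n) q>0) Θ>0) (≤-reflexive (symm Q-def))

  s₁>0 : 0 < s₁
  s₁>0 = ≤-trans (*-mono-≤ {1} {2} (s≤s z≤n) Θ>0) (≤-reflexive (symm s₁-def))

  module At (ℓ NC T N r w s' b : ℕ) (hs : s₁ ≤ suc s') (hs2 : suc s' ≤ s₁ + s₁) (hN : N * (Θ * ℓ) ≤ w) (hw : w < r * z)
    (hℓ1 : 4 * Q * NC ≤ ℓ) (hℓ2 : 8 * D * Q ≤ ℓ) (hℓ3 : NC ≤ ℓ) (hT : T ≤ ℓ) (N>0 : 0 < N)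
    (hr : 8 * D * q ≤ r) (hb : D * Q * b + suc s' * r ≤ Q * r) where

    M s : ℕ
    M = N * ℓ
    s = suc s'

    r>0 : 0 < r
    r>0 = ≤-trans (*-mono-≤ (*-mono-≤ {1} {8} (s≤s z≤n) D>0) q>0) hr

    instance
      nzr : NonZero r
      nzr = >-nonZero r>0
      nz8q : NonZero (8 * q)
      nz8q = >-nonZero (*-mono-≤ {1} {8} (s≤s z≤n) q>0)
      nz4q : NonZero (4 * q)
      nz4q = >-nonZero (*-mono-≤ {1} {4} (s≤s z≤n) q>0)
      nzDQ : NonZero (D * Q)
      nzDQ = >-nonZero (*-mono-≤ D>0 Q>0)

    s≤Q : s ≤ Q
    s≤Q = ≤-trans hs2 (≤-trans (≤-reflexive (cong₂ _+_ s₁-def s₁-def)) (≤-trans (n1 q Θ q>0) (≤-reflexive (symm Q-def))))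

    A0 : ℕ
    A0 = Q ∸ s
    QA : A0 + s ≡ Q
    QA = m∸n+n≡m s≤Q

    halfA : Q ≤ A0 + A0
    halfA = +-cancelʳ-≤ (s + s) Q (A0 + A0) (≤-trans (+-monoʳ-≤ Q (+-mono-≤ hs2 hs2)) (≤-trans
        (≤-trans (≤-reflexive (cong₂ (λ a b → a + (b + b + (b + b))) Q-def s₁-def)) (≤-trans (n2 q Θ q>0) (≤-reflexive (symm (cong₂ _+_ Q-def Q-def))))) (≤-reflexive (cong₂ _+_ (symm QA) (symm QA) ⟫ phase-identity₅ A0 s))))

    -- The largest size of bad sets that the slack s/Q permits.
    b₊ : ℕ
    b₊ = (A0 * r) / (D * Q)

    up : b₊ * (D * Q) ≤ A0 * r
    up = m/n*n≤m (A0 * r) (D * Q)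

    lo : A0 * r < suc b₊ * (D * Q)
    lo = div-lower (A0 * r) (D * Q)

    A0r : A0 * r + s * r ≡ Q * r
    A0r = symm (*-distribʳ-+ r A0 s) ⟫ cong (_* r) QA

    b≤b₊ : b ≤ b₊
    b≤b₊ = ≤-pred (*-cancelʳ-< (D * Q) b (suc b₊) (≤-<-trans (+-cancelʳ-≤ (s * r) _ _
             (≤-trans (≤-reflexive (cong (_+ s * r) (*-comm b (D * Q)))) (≤-trans hb (≤-reflexive (symm A0r))))) lo))

    ΘM : Θ * M ≤ z * r
    ΘM = ≤-trans (≤-reflexive (phase-identity₆ Θ N ℓ)) (≤-trans hN (≤-trans (<⇒≤ hw) (≤-reflexive (*-comm r z))))

    16qM : 16 * q * M ≤ r
    16qM = *-canc-≤ z z>0 (≤-trans (n3 D q z M D>0 z>0) (≤-trans (≤-reflexive (cong (_* M) (symm Θ-def))) ΘM))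

    32DqM : 32 * D * q * M ≤ r
    32DqM = *-canc-≤ z z>0 (≤-trans (n4 D q z M z>0) (≤-trans (≤-reflexive (cong (_* M) (symm Θ-def))) ΘM))

    ℓ≤M : ℓ ≤ M
    ℓ≤M = ≤-trans (≤-reflexive (symm (*-identityˡ ℓ))) (*-monoˡ-≤ ℓ N>0)

    f : ℕ
    f = N * (ℓ + NC) + T + M

    f≤ : f ≤ 4 * M
    f≤ = ≤-trans (+-monoˡ-≤ M (+-mono-≤ (≤-trans (≤-reflexive (*-distribˡ-+ N ℓ NC)) (+-monoʳ-≤ M (*-monoʳ-≤ N hℓ3))) (≤-trans hT ℓ≤M)))
           (≤-reflexive (phase-identity₇ M))

    4qDb : 4 * q * (D * b₊) + r ≤ 4 * q * r
    4qDb = *-canc-≤ s₁ s₁>0 (begin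
      s₁ * (4 * q * (D * b₊) + r)        ≡⟨ phase-identity₂₇ s₁ q D b₊ r ⟩
      b₊ * (D * (4 * q * s₁)) + s₁ * r   ≡⟨ cong (λ y → b₊ * (D * y) + s₁ * r) (symm Q-s₁) ⟩
      b₊ * (D * Q) + s₁ * r              ≤⟨ +-mono-≤ up (*-monoˡ-≤ r hs) ⟩
      A0 * r + s * r                     ≡⟨ A0r ⟩
      Q * r                              ≡⟨ cong (_* r) Q-s₁ ⟩
      4 * q * s₁ * r                     ≡⟨ phase-identity₂₈ q s₁ r ⟩
      s₁ * (4 * q * r) ∎)
      where
        open ≤-Reasoning

    room : ∀ x → 4 * q * x ≤ r → D * b₊ + x ≤ r
    room x h = *-cancelˡ-≤ (4 * q) (≤-trans (≤-reflexive (*-distribˡ-+ (4 * q) (D * b₊) x)) (≤-trans (+-monoʳ-≤ _ h) 4qDb))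

    hD : D * b₊ + f ≤ r
    hD = room f (≤-trans (*-monoʳ-≤ (4 * q) f≤) (≤-trans (≤-reflexive (phase-identity₈ q M)) 16qM))

    b₊≤r : b₊ ≤ r
    b₊≤r = ≤-trans (n9 D b₊ D>0) (≤-trans (m≤m+n (D * b₊) f) hD)

    e₁ e₂ : ℕ
    e₁ = N * (ℓ + NC)
    e₂ = r / (8 * q)

    e₁≤ : e₁ ≤ 2 * M
    e₁≤ = ≤-trans (≤-reflexive (*-distribˡ-+ N ℓ NC)) (≤-trans (+-monoʳ-≤ M (*-monoʳ-≤ N hℓ3)) (≤-reflexive (phase-identity₉ M)))

    mar : D * b₊ + e₁ + e₂ ≤ r
    mar = ≤-trans (≤-reflexive (+-assoc (D * b₊) e₁ e₂)) (room (e₁ + e₂) (*-cancelˡ-≤ 2 (begin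
      2 * (4 * q * (e₁ + e₂))            ≡⟨ phase-identity₂₉ q e₁ e₂ ⟩
      8 * q * e₁ + e₂ * (8 * q)          ≤⟨ +-mono-≤ (≤-trans (*-monoʳ-≤ (8 * q) e₁≤) (≤-trans (≤-reflexive (phase-identity₃₀ q M)) 16qM)) (m/n*n≤m r (8 * q)) ⟩
      r + r                              ≡⟨ phase-identity₁₂ r ⟩
      2 * r ∎)))
      where
        open ≤-Reasoning

    e₂-big : ∀ x → 8 * q * x ≤ r → x ≤ e₂
    e₂-big x h = ≤-pred (*-cancelˡ-< (8 * q) x (suc e₂) (≤-<-trans h (<-≤-trans (div-lower r (8 * q)) (≤-reflexive (*-comm (suc e₂) (8 * q))))))

    hq : r ≤ 16 * q * e₂
    hq = ≤-trans (<⇒≤ (div-lower r (8 * q))) (≤-trans (*-monoˡ-≤ (8 * q) (+-monoˡ-≤ e₂ (e₂-big 1 (≤-trans (n5 D q D>0) hr)))) (≤-reflexive (phase-identity₁₀ e₂ q)))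

    -- b₊ ≥ r/(4D) + f, hence at least one of the ℓ tile vertices is gained.
    b₊-big : r ≤ 4 * D * (b₊ ∸ f)
    b₊-big = *-canc-≤ Q Q>0 (+-cancelʳ-≤ (Q * (4 * D * (1 + f))) _ _ (begin
      Q * r + Q * (4 * D * (1 + f))                   ≤⟨ +-monoʳ-≤ (Q * r) (*-monoʳ-≤ Q fr) ⟩
      Q * r + Q * r                                   ≤⟨ +-mono-≤ (*-monoˡ-≤ r halfA) (*-monoˡ-≤ r halfA) ⟩
      (A0 + A0) * r + (A0 + A0) * r                   ≡⟨ phase-identity₃₁ A0 r ⟩
      4 * (A0 * r)                                    ≤⟨ *-monoʳ-≤ 4 (<⇒≤ lo) ⟩
      4 * (suc b₊ * (D * Q))                          ≤⟨ *-monoʳ-≤ 4 (*-monoˡ-≤ (D * Q) (s≤s (m≤n+m∸n b₊ f))) ⟩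
      4 * (suc (f + (b₊ ∸ f)) * (D * Q))              ≡⟨ phase-identity₃₂ f (b₊ ∸ f) D Q ⟩
      Q * (4 * D * (b₊ ∸ f)) + Q * (4 * D * (1 + f)) ∎))
      where
        open ≤-Reasoning
        fr : 4 * D * (1 + f) ≤ r
        fr = *-cancelˡ-≤ 2 (begin
          2 * (4 * D * (1 + f))             ≡⟨ phase-identity₁₁ D f ⟩
          8 * D + 8 * D * f                 ≤⟨ +-mono-≤ {8 * D} {r} {8 * D * f} (≤-trans (n6 D q q>0) hr) (*-monoʳ-≤ (8 * D) f≤) ⟩
          r + 8 * D * (4 * M)               ≤⟨ +-monoʳ-≤ r (≤-trans (n7 D q M q>0) 32DqM) ⟩
          r + r                             ≡⟨ phase-identity₁₂ r ⟩
          2 * r ∎)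

    -- On weighted average a tile of ℓ vertices hits a bad set at least ℓ(b₊ - f)/r times. One hit
    -- is given up in `μ'`, because the weights guarantee only μ - 1 per round out of an average of
    -- μ.
    μ₀ : ℕ
    μ₀ = (ℓ * (b₊ ∸ f)) / r

    μ₀>0 : 0 < μ₀
    μ₀>0 = ≤-pred (*-cancelʳ-< r 1 (suc μ₀) (≤-<-trans (≤-trans (≤-reflexive (*-identityˡ r)) (≤-trans b₊-big (*-monoˡ-≤ (b₊ ∸ f)
             (≤-trans (≤-trans (*-monoˡ-≤ D {4} {8} (s≤s (s≤s (s≤s (s≤s z≤n))))) (≤-trans (≤-reflexive (symm (*-identityʳ (8 * D)))) (*-monoʳ-≤ (8 * D) Q>0))) hℓ2))))
             (div-lower (ℓ * (b₊ ∸ f)) r)))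

    μ' : ℕ
    μ' = pred μ₀

    μ≡ : suc μ' ≡ μ₀
    μ≡ = suc-pred μ₀ {{>-nonZero μ₀>0}}

    f≤b₊ : f ≤ b₊
    f≤b₊ with ≤-total f b₊
    ... | inj₁ h = h
    ... | inj₂ h = ⊥-elim (<-irrefl refl (<-≤-trans r>0 (≤-trans b₊-big (≤-reflexive (cong (4 * D *_) (m≤n⇒m∸n≡0 h) ⟫ *-zeroʳ (4 * D))))))

    hμ : suc μ' * r + ℓ * f ≤ ℓ * b₊
    hμ = ≤-trans (+-monoˡ-≤ (ℓ * f) (≤-trans (≤-reflexive (cong (_* r) μ≡)) (m/n*n≤m (ℓ * (b₊ ∸ f)) r)))
           (≤-reflexive (symm (*-distribˡ-+ ℓ (b₊ ∸ f) f) ⟫ cong (ℓ *_) (m∸n+n≡m f≤b₊)))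

    μ'≤ℓ : μ' ≤ ℓ
    μ'≤ℓ = *-cancelʳ-≤ μ' ℓ r (≤-trans (*-monoˡ-≤ r (n≤1+n μ')) (≤-trans (m≤m+n (suc μ' * r) (ℓ * f)) (≤-trans hμ (*-monoʳ-≤ ℓ b₊≤r))))

    -- Θ² = 20·D·Q·z² bounds the second-order term (Nℓ)² against r².
    square : 20 * D * Q * (M * M) ≤ r * r
    square = *-canc-≤ (z * z) (*-mono-≤ z>0 z>0) (begin
      z * z * (20 * D * Q * (M * M))     ≡⟨ cong (λ y → z * z * (20 * D * y * (M * M))) Q-def ⟫ phase-identity₃₃ D q z M Θ ⟫ cong (λ y → y * Θ * (M * M)) (symm Θ-def) ⟫ phase-identity₃₄ Θ M ⟩
      (Θ * M) * (Θ * M)                  ≤⟨ *-mono-≤ ΘM ΘM ⟩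
      (z * r) * (z * r)                  ≡⟨ phase-identity₃₅ z r ⟩
      z * z * (r * r) ∎)
      where
        open ≤-Reasoning

    -- The left side is the cost of removing up to N(ℓ + NC) vertices at the new rate Q - s + 1. It
    -- is paid by the unit of slack given up, worth r, and by the drop μ'N of every bad degree.
    key : suc A0 * (N * (ℓ + NC)) ≤ r + D * Q * (μ' * N)
    key = *-cancelˡ-≤ r (+-cancelʳ-≤ (2 * (r * (D * Q * N)) + N * ℓ * (D * Q * (1 + f))) _ _ (begin
      r * (suc A0 * (N * (ℓ + NC))) + (2 * (r * (D * Q * N)) + N * ℓ * (D * Q * (1 + f)))
        ≡⟨ phase-identity₃₆ r A0 N ℓ NC (D * Q) f ⟩
      M * (A0 * r) + (r * M + r * (suc A0 * (N * NC)) + 2 * (r * (D * Q * N)) + M * (D * Q * (1 + f)))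
        ≤⟨ +-monoʳ-≤ (M * (A0 * r)) four ⟩
      M * (A0 * r) + r * r
        ≤⟨ +-monoˡ-≤ (r * r) (*-monoʳ-≤ M (<⇒≤ lo)) ⟩
      M * (suc b₊ * (D * Q)) + r * r
        ≤⟨ +-monoˡ-≤ (r * r) (*-monoʳ-≤ M (*-monoˡ-≤ (D * Q) (s≤s (≤-reflexive (symm (m∸n+n≡m f≤b₊)))))) ⟩
      M * (suc ((b₊ ∸ f) + f) * (D * Q)) + r * r
        ≡⟨ phase-identity₃₇ N ℓ (b₊ ∸ f) f (D * Q) r ⟩
      N * (D * Q) * (ℓ * (b₊ ∸ f)) + M * (D * Q * (1 + f)) + r * r
        ≤⟨ +-monoˡ-≤ (r * r) (+-monoˡ-≤ _ (*-monoʳ-≤ (N * (D * Q)) (≤-trans (<⇒≤ (div-lower (ℓ * (b₊ ∸ f)) r)) (≤-reflexive (cong (λ y → suc y * r) (symm μ≡)))))) ⟩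
      N * (D * Q) * (suc (suc μ') * r) + M * (D * Q * (1 + f)) + r * r
        ≡⟨ phase-identity₃₈ N (D * Q) μ' r ℓ f ⟩
      r * (r + D * Q * (μ' * N)) + (2 * (r * (D * Q * N)) + N * ℓ * (D * Q * (1 + f))) ∎))
      where
        open ≤-Reasoning
        4M≤r : 4 * M ≤ r
        4M≤r = ≤-trans (n8 q M q>0) 16qM
        M≤r : M ≤ r
        M≤r = ≤-trans (m≤m+n M (3 * M)) 4M≤r
        A<Q : suc A0 ≤ Q
        A<Q = ≤-trans (≤-trans (≤-reflexive (+-comm 1 A0)) (+-monoʳ-≤ A0 (s≤s z≤n))) (≤-reflexive QA)
        t2' : 4 * (suc A0 * (N * NC)) ≤ r
        t2' = ≤-trans (*-monoʳ-≤ 4 (*-monoˡ-≤ (N * NC) A<Q)) (≤-trans (≤-reflexive (phase-identity₁ Q N NC)) (≤-trans (*-monoʳ-≤ N hℓ1) M≤r))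
        t3 : 8 * (D * Q * N) ≤ r
        t3 = ≤-trans (≤-reflexive (phase-identity₂ D Q N)) (≤-trans (*-monoʳ-≤ N hℓ2) M≤r)
        1+f : 1 + f ≤ 5 * M
        1+f = ≤-trans (+-mono-≤ (≤-trans (≤-trans (≤-trans (*-mono-≤ (*-mono-≤ {1} {8} (s≤s z≤n) D>0) Q>0) hℓ2) ℓ≤M) (≤-refl {M})) f≤) (≤-reflexive (phase-identity₃ M))
        t4 : 4 * (M * (D * Q * (1 + f))) ≤ r * r
        t4 = ≤-trans (*-monoʳ-≤ 4 (*-monoʳ-≤ M (*-monoʳ-≤ (D * Q) 1+f))) (≤-trans (≤-reflexive (phase-identity₄ M D Q)) square)
        four : r * M + r * (suc A0 * (N * NC)) + 2 * (r * (D * Q * N)) + M * (D * Q * (1 + f)) ≤ r * r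
        four = *-cancelˡ-≤ 4 (begin
          4 * (r * M + r * (suc A0 * (N * NC)) + 2 * (r * (D * Q * N)) + M * (D * Q * (1 + f)))
            ≡⟨ phase-identity₁₃ r M (suc A0 * (N * NC)) (D * Q * N) (M * (D * Q * (1 + f))) ⟩
          r * (4 * M) + r * (4 * (suc A0 * (N * NC))) + r * (8 * (D * Q * N)) + 4 * (M * (D * Q * (1 + f)))
            ≤⟨ +-mono-≤ (+-mono-≤ (+-mono-≤ (*-monoʳ-≤ r 4M≤r) (*-monoʳ-≤ r t2')) (*-monoʳ-≤ r t3)) t4 ⟩
          r * r + r * r + r * r + r * r ≡⟨ phase-identity₁₄ r ⟩
          4 * (r * r) ∎)

    next : ∀ v r' → r ≡ v + r' → v ≤ N * (ℓ + NC) → D * Q * (b₊ ∸ μ' * N) + s' * r' ≤ Q * r'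
    next v r' er hv with ≤-total b₊ (μ' * N)
    ... | inj₁ h = ≤-trans (≤-reflexive (cong (_+ s' * r') (cong (D * Q *_) (m≤n⇒m∸n≡0 h) ⟫ *-zeroʳ (D * Q))))
                     (*-monoˡ-≤ r' (≤-trans (n≤1+n s') s≤Q))
    ... | inj₂ h = ≤-trans (+-monoˡ-≤ (s' * r') main) (≤-reflexive (phase-identity₃₉ A0 s' r' ⟫ cong (_* r') (QA)))
      where
        open ≤-Reasoning
        main : D * Q * (b₊ ∸ μ' * N) ≤ suc A0 * r'
        main = +-cancelʳ-≤ (D * Q * (μ' * N) + suc A0 * v) _ _ (begin
          D * Q * (b₊ ∸ μ' * N) + (D * Q * (μ' * N) + suc A0 * v) ≡⟨ symm (+-assoc (D * Q * (b₊ ∸ μ' * N)) _ _) ⟫ cong (_+ suc A0 * v) (symm (*-distribˡ-+ (D * Q) (b₊ ∸ μ' * N) (μ' * N)) ⟫ cong (D * Q *_) (m∸n+n≡m h) ⟫ *-comm (D * Q) b₊) ⟩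
          b₊ * (D * Q) + suc A0 * v                     ≤⟨ +-mono-≤ up (≤-trans (*-monoʳ-≤ (suc A0) hv) key) ⟩
          A0 * r + (r + D * Q * (μ' * N))               ≡⟨ phase-identity₁₅ A0 r (D * Q * (μ' * N)) ⟫ cong (λ y → suc A0 * y + D * Q * (μ' * N)) er ⟩
          suc A0 * (v + r') + D * Q * (μ' * N)          ≡⟨ phase-identity₁₆ (suc A0) v r' (D * Q * (μ' * N)) ⟩
          suc A0 * r' + (D * Q * (μ' * N) + suc A0 * v) ∎)

    numbers : PhaseNumbers D Q q ℓ NC T N r s' b
    numbers = record { b₊ = b₊ ; f = f ; e₁ = e₁ ; e₂ = e₂ ; μ' = μ' ; b≤b₊ = b≤b₊ ; b₊≤r = b₊≤r ; mar = mar ; hq = hq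
      ; e₂-big = e₂-big ; hN = ≤-refl ; hf = ≤-refl ; hD = hD ; hμ = hμ ; μ'≤ℓ = μ'≤ℓ ; r>0 = r>0
      ; half = ≤-trans (+-mono-≤ e₁≤ e₁≤) (≤-trans (≤-reflexive (phase-identity₁₇ M)) (≤-trans (n8 q M q>0) 16qM))
      ; next = next }

  abstract
    phaseNumbers : ∀ ℓ NC T N r w s' b → s₁ ≤ suc s' → suc s' ≤ s₁ + s₁ → N * (Θ * ℓ) ≤ w → w < r * z →
      4 * Q * NC ≤ ℓ → 8 * D * Q ≤ ℓ → NC ≤ ℓ → T ≤ ℓ → 0 < N → 8 * D * q ≤ r → D * Q * b + suc s' * r ≤ Q * r →
      PhaseNumbers D Q q ℓ NC T N r s' b
    phaseNumbers = At.numbers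

-- Size thresholds for covering and for existence.

cover-identity₁ : ∀ r z → (r + r) * z ≡ 2 * z * r
cover-identity₁ = solve-∀

cover-identity₂ : ∀ N c → (N + N) * c ≡ 2 * c * N
cover-identity₂ = solve-∀

cover-identity₃ : ∀ c N → 3 * (2 * c * N) ≡ 6 * c * N
cover-identity₃ = solve-∀

cover-identity₄ : ∀ D q s b r → D * (4 * q * s) * b + (s + s) * r ≡ 2 * s * (2 * q * (D * b) + r)
cover-identity₄ = solve-∀

cover-identity₅ : ∀ s q r → 2 * s * (2 * q * r) ≡ 4 * q * s * r
cover-identity₅ = solve-∀

cover-identity₆ : ∀ s q D b r → s * (4 * q * (D * b) + r) ≡ D * (4 * q * s) * b + s * r
cover-identity₆ = solve-∀

cover-identity₇ : ∀ q s r → 4 * q * s * r ≡ s * (4 * q * r)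
cover-identity₇ = solve-∀

cover-identity₈ : ∀ Θ ℓ N → 2 * (Θ * ℓ) * N ≡ 2 * Θ * (N * ℓ)
cover-identity₈ = solve-∀

mwA-pos : ∀ ℓ' μ → 0 < mwA ℓ' μ
mwA-pos ℓ' μ = *-mono-≤ {1} (≤-trans (s≤s z≤n) (m≤n+m (suc ℓ') (ℓ' * suc μ))) (s≤s z≤n)

module CoverSize (t2 k2 q z : ℕ) (D>0 : 0 < Params.D t2 k2) (q>0 : 0 < q) (z>0 : 0 < z) where
  open Params t2 k2
  open PhaseNum D q z D>0 q>0 z>0 using (Θ; Q)

  w₀ : ℕ
  w₀ = connW (16 * q)

  abstract
    h : ℕ
    h = 4 * Q * NC + 8 * D * Q + NC

    h-def : h ≡ 4 * Q * NC + 8 * D * Q + NC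
    h-def = refl

  ℓ c Amax N₀ w₁ X₀ : ℕ
  ℓ = ell h
  c = Θ * ℓ
  Amax = mwA (pred ℓ) ℓ
  N₀ = proj₁ (exp-beats Amax k1 (6 * c) (mwA-pos (pred ℓ) ℓ))
  -- The remaining set must exceed the three summands for the estimates of a phase, for connecting,
  -- and for realising a tile by distinct vertices.
  X₀ = 8 * D * q + 8 * q * w₀ + ℓ * ℓ * (2 * Θ) ^ T
  -- The first summand gives N > N₀ rounds; the second makes every r with w < rz exceed X₀.
  w₁ = c * suc N₀ + z * X₀

abstract
  coverW : ∀ t2 k2 q z → 0 < Params.D t2 k2 → 0 < q → 0 < z → ℕ
  coverW t2 k2 q z D>0 q>0 z>0 = CoverSize.w₁ t2 k2 q z D>0 q>0 z>0

  coverW-def : ∀ t2 k2 q z D>0 q>0 z>0 → coverW t2 k2 q z D>0 q>0 z>0 ≡ CoverSize.w₁ t2 k2 q z D>0 q>0 z>0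
  coverW-def t2 k2 q z D>0 q>0 z>0 = refl

exist-identity₁ : ∀ q' v → v + v + 0 + (2 * v + 4 * q' * v) ≡ 4 * suc q' * v + 0
exist-identity₁ = solve-∀

exist-identity₂ : ∀ q e → 2 * (4 * q) * e ≡ 8 * q * e
exist-identity₂ = solve-∀

exist-identity₃ : ∀ e a m → e + (e + (a + m + (a + m))) + 0 ≡ 2 * a + (2 * m + (e + e))
exist-identity₃ = solve-∀

exist-identity₄ : ∀ q a → 8 * q * (2 * a) ≡ 16 * q * a
exist-identity₄ = solve-∀

exist-identity₅ : ∀ q B N → 8 * q * (2 * B * N) ≡ 16 * q * B * N
exist-identity₅ = solve-∀

exist-identity₆ : ∀ q d r w → 2 * q * d + r + 2 * w ≡ 2 * (q * d + w) + r
exist-identity₆ = solve-∀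

exist-identity₇ : ∀ q v r → 2 * (q * (v + r)) + r ≡ 2 * q * r + (2 * q * v + r)
exist-identity₇ = solve-∀

exist-identity₈ : ∀ q v → 2 * q * v + 0 + 2 * q * v ≡ 4 * q * v + 0
exist-identity₈ = solve-∀

exist-identity₉ : ∀ w → w + w ≡ 2 * w
exist-identity₉ = solve-∀

exist-identity₁₀ : ∀ r → r + r ≡ 2 * 1 * r
exist-identity₁₀ = solve-∀

exist-identity₁₁ : ∀ a b c → a * (b * c) ≡ c * (a * b)
exist-identity₁₁ = solve-∀

exist-identity₁₂ : ∀ q d e w → q * (d + e + e) + w + 0 + q * (e + e) ≡ q * d + w + e * (4 * q) + 0
exist-identity₁₂ = solve-∀

exist-identity₁₃ : ∀ a n → (a + a) * n ≡ 2 * n * a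
exist-identity₁₃ = solve-∀

div-big : ∀ m n x .{{_ : NonZero n}} → n * x ≤ m → x ≤ m / n
div-big m n x h = ≤-pred (*-cancelˡ-< n x (suc (m / n)) (≤-<-trans h (<-≤-trans (div-lower m n) (≤-reflexive (*-comm (suc (m / n)) n)))))

div-half : ∀ m n .{{_ : NonZero n}} → n ≤ m → m ≤ 2 * n * (m / n)
div-half m n h = ≤-trans (<⇒≤ (div-lower m n)) (≤-trans (*-monoˡ-≤ n (+-monoˡ-≤ (m / n) (div-big m n 1 (≤-trans (≤-reflexive (*-identityʳ n)) h)))) (≤-reflexive (exist-identity₁₃ (m / n) n)))

module ExistSize (t2 k2 q : ℕ) (D>0 : 0 < Params.D t2 k2) (q>0 : 0 < q) where
  open Params t2 k2

  qc qa B cA ℓa z : ℕ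
  qc = 8 * q
  qa = 16 * q
  B = mA + NC
  cA = 16 * q * B
  -- Every vertex is served by at least N/ℓa of the N absorbers, and N ≥ w/cA. With z = cA·ℓa, a
  -- remainder of at most w/z vertices is therefore within that capacity.
  ℓa = suc (qa ^ mA + qa ^ mA)
  z = cA * ℓa

  B>0 : 0 < B
  B>0 = ≤-trans NC>0 (m≤n+m NC mA)

  cA>0 : 0 < cA
  cA>0 = *-mono-≤ (*-mono-≤ {1} {16} (s≤s z≤n) q>0) B>0

  z>0 : 0 < z
  z>0 = *-mono-≤ {1} {cA} {1} {ℓa} cA>0 (s≤s z≤n)

  Aa N₀ w₀ w₁ w₊ : ℕ
  w₀ = connW qc
  w₁ = coverW t2 k2 q z D>0 q>0 z>0
  Aa = mwA (qa ^ mA + qa ^ mA) 1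
  N₀ = proj₁ (exp-beats Aa 1 cA (mwA-pos (qa ^ mA + qa ^ mA) 1))
  w₊ = w₁ + (4 * q * (B * suc N₀) + 4 * q * (2 * suc mA) + 4 * q * w₀ + 2 * z * (w₀ + 4 * q))

abstract
  existW : ∀ t2 k2 q → 0 < Params.D t2 k2 → 0 < q → ℕ
  existW t2 k2 q D>0 q>0 = ExistSize.w₊ t2 k2 q D>0 q>0

  existW-def : ∀ t2 k2 q D>0 q>0 → existW t2 k2 q D>0 q>0 ≡ ExistSize.w₊ t2 k2 q D>0 q>0
  existW-def t2 k2 q D>0 q>0 = refl

-- Random splits

split-identity₁ : ∀ s → (3 + s) * ((3 + s) * (3 + s) * suc ((3 + s) * (3 + s))) + 0 + (2 + 4 * s + s * s) * ((3 + s) * (3 + s)) ≡ (2 + s) * (suc (3 + s) * suc (3 + s) * ((3 + s) * (3 + s))) + 0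
split-identity₁ = solve-∀

split-identity₂ : ∀ s → 5 + 5 * s + s * s + (3 + s) ≡ (2 + s) * suc (3 + s)
split-identity₂ = solve-∀

split-identity₃ : ∀ s → suc ((2 + s) * suc (3 + s)) ≡ (3 + s) * (3 + s)
split-identity₃ = solve-∀

split-identity₄ : ∀ D Y I B → D * (Y * D * I * Y * (Y * D * I * Y) * B) ≡ Y * Y * (Y * Y) * (I * I) * (D * (D * D * B))
split-identity₄ = solve-∀

split-identity₅ : ∀ a b c d → a * b * (c * d) ≡ a * c * (b * d)
split-identity₅ = solve-∀

split-identity₆ : ∀ M P A I D Z → M * P * (M * P) * A * (I * I * (D * D * Z)) ≡ A * (P * D * I * M * (P * D * I * M) * Z)
split-identity₆ = solve-∀

split-identity₇ : ∀ x B e → x * x * (B * B * e) ≡ B * B * (x * x * e)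
split-identity₇ = solve-∀

split-identity₈ : ∀ B w e → B * B * (w * w * e) ≡ B * w * (B * w) * e
split-identity₈ = solve-∀

split-identity₉ : ∀ t x e → t * x * (t * x) * e ≡ x * x * (t * t * e)
split-identity₉ = solve-∀

split-identity₁₀ : ∀ n b → 2 * (2 * (n * b)) ≡ b * (4 * n)
split-identity₁₀ = solve-∀

split-identity₁₁ : ∀ a b c → a * (b * c) ≡ b * (a * c)
split-identity₁₁ = solve-∀

split-identity₁₂ : ∀ s → (3 + s) * (2 + s) ≡ suc (5 + 5 * s + s * s)
split-identity₁₂ = solve-∀

split-identity₁₃ : ∀ b a → b * (a * a) ≡ a * (b * a)
split-identity₁₃ = solve-∀

split-identity₁₄ : ∀ a b c → a * (b * c) ≡ b * a * c
split-identity₁₄ = solve-∀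

split-identity₁₅ : ∀ a b c → a * b * c ≡ b * (a * c)
split-identity₁₅ = solve-∀

split-identity₁₆ : ∀ n B → 4 * n * (B + B) ≡ 8 * n * B
split-identity₁₆ = solve-∀

split-identity₁₇ : ∀ e n B → e * (n * B * (n * B)) ≡ B * B * (n * n * e)
split-identity₁₇ = solve-∀

split-identity₁₈ : ∀ a p q → (2 + a) * p * q ≡ (2 + a) * (p * q)
split-identity₁₈ = solve-∀

split-identity₁₉ : ∀ a p q → p * (a * q) ≡ a * (p * q)
split-identity₁₉ = solve-∀

split-identity₂₀ : ∀ a x y → (2 + a) * (x * y) + a * (x * y) ≡ (x + (x + 0)) * (suc a * y)
split-identity₂₀ = solve-∀

split-identity₂₁ : ∀ x y → x * y + x * y ≡ (x + (x + 0)) * y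
split-identity₂₁ = solve-∀

split-identity₂₂ : ∀ x → x + x ≡ 2 * x
split-identity₂₂ = solve-∀

Split : Set → Set
Split A = List A × List A

splits : ∀ {A : Set} → List A → List (Split A)
splits []      = ([] , []) ∷ []
splits (x ∷ W) = map (λ s → x ∷ proj₁ s , proj₂ s) (splits W) ++ map (λ s → proj₁ s , x ∷ proj₂ s) (splits W)

module _ {A : Set} where

  splits-elim : ∀ {P : Split A → Set} x W → (∀ {a b} → (a , b) ∈ splits W → P (x ∷ a , b)) →
    (∀ {a b} → (a , b) ∈ splits W → P (a , x ∷ b)) → ∀ {s} → s ∈ splits (x ∷ W) → P s
  splits-elim {P} x W l r m with ∈-++⁻ (map (λ s → x ∷ proj₁ s , proj₂ s) (splits W)) m
  ... | inj₁ q = let (a , b) , ab∈ , eq = ∈-map⁻ (λ s → x ∷ proj₁ s , proj₂ s) q in subst P (symm eq) (l ab∈)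
  ... | inj₂ q = let (a , b) , ab∈ , eq = ∈-map⁻ (λ s → proj₁ s , x ∷ proj₂ s) q in subst P (symm eq) (r ab∈)

  splits-↭ : ∀ W {s : Split A} → s ∈ splits W → proj₁ s ++ proj₂ s ↭ W
  splits-↭ [] (here refl) = refl
  splits-↭ (x ∷ W) = splits-elim {λ s → proj₁ s ++ proj₂ s ↭ x ∷ W} x W (λ m → prep x (splits-↭ W m))
    (λ {a} {b} m → ↭-trans (shift x a b) (prep x (splits-↭ W m)))

  splits-len : ∀ (W : List A) → length (splits W) ≡ 2 ^ length W
  splits-len [] = refl
  splits-len (x ∷ W) = length-++ (map _ (splits W)) ⟫ cong₂ _+_ (length-map _ (splits W) ⟫ splits-len W)
    (length-map _ (splits W) ⟫ splits-len W ⟫ symm (+-identityʳ _))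

  splits-count : ∀ (W : List A) α → cnt (λ s → does (length (proj₁ s) ≟ α)) (splits W) ≡ bin (length W) α
  splits-count [] zero = refl
  splits-count [] (suc α) = refl
  splits-count (x ∷ W) zero = sumL-++ _ (map _ (splits W)) (map _ (splits W)) ⟫ cong₂ _+_
    (sumL-map _ _ (splits W) ⟫ sumL-const 0 (splits W) ⟫ *-zeroʳ (length (splits W))) (sumL-map _ _ (splits W) ⟫ splits-count W zero)
  splits-count (x ∷ W) (suc α) = sumL-++ _ (map _ (splits W)) (map _ (splits W)) ⟫ cong₂ _+_
    (sumL-map _ _ (splits W) ⟫ sumL-cong (splits W) (λ {s} _ → cong b2n (sucd (length (proj₁ s)) α)) ⟫ splits-count W α)
    (sumL-map _ _ (splits W) ⟫ splits-count W (suc α))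
    where
      sucd : ∀ a b → does (suc a ≟ suc b) ≡ does (a ≟ b)
      sucd a b = refl

  splits-⊆ : ∀ W {s : Split A} → s ∈ splits W → ∀ {x} → x ∈ proj₁ s → x ∈ W
  splits-⊆ W m x∈ = ∈-resp-↭ (splits-↭ W m) (∈-++⁺ˡ x∈)

  splits-⊆ʳ : ∀ W {s : Split A} → s ∈ splits W → ∀ {x} → x ∈ proj₂ s → x ∈ W
  splits-⊆ʳ W {s} m x∈ = ∈-resp-↭ (splits-↭ W m) (∈-++⁺ʳ (proj₁ s) x∈)

  -- The underlying set of the first part determines the split; this separates the paths obtained
  -- from different splits.
  splits-inj : ∀ W → Unique W → {s s' : Split A} → s ∈ splits W → s' ∈ splits W → proj₁ s ⊆l proj₁ s' → proj₁ s' ⊆l proj₁ s → s ≡ s'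
  splits-inj [] u (here refl) (here refl) _ _ = refl
  splits-inj (x ∷ W) (a ∷ u) {s} {s'} m = splits-elim {λ s → s' ∈ splits (x ∷ W) → proj₁ s ⊆l proj₁ s' → proj₁ s' ⊆l proj₁ s → s ≡ s'} x W
      (λ {p} {q} m₁ → splits-elim {λ s' → (x ∷ p) ⊆l proj₁ s' → proj₁ s' ⊆l (x ∷ p) → (x ∷ p , q) ≡ s'} x W
        (λ m₂ h k → cong (λ z → x ∷ proj₁ z , proj₂ z) (splits-inj W u m₁ m₂ (strip m₁ h) (strip m₂ k)))
        (λ m₂ h k → ⊥-elim (x∉ (splits-⊆ W m₂ (h (here refl))))))
      (λ {p} {q} m₁ → splits-elim {λ s' → p ⊆l proj₁ s' → proj₁ s' ⊆l p → (p , x ∷ q) ≡ s'} x W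
        (λ m₂ h k → ⊥-elim (x∉ (splits-⊆ W m₁ (k (here refl)))))
        (λ m₂ h k → cong (λ z → proj₁ z , x ∷ proj₂ z) (splits-inj W u m₁ m₂ h k))) m
    where
      x∉ : x ∉ W
      x∉ = All≢⇒∉ a
      strip : ∀ {p q c} → (p , c) ∈ splits W → (x ∷ p) ⊆l (x ∷ q) → p ⊆l q
      strip m h y∈ with h (there y∈)
      ... | here refl = ⊥-elim (x∉ (splits-⊆ W m y∈))
      ... | there r = r

  splits-Unique : ∀ W → Unique W → Unique (splits W)
  splits-Unique [] u = [] ∷ []
  splits-Unique (x ∷ W) (a ∷ u) = Unique-++ (UniqueP.map⁺ (λ { refl → refl }) (splits-Unique W u)) (UniqueP.map⁺ (λ { refl → refl }) (splits-Unique W u)) dis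
    where
      dis : ∀ {s} → s ∈ map (λ s → x ∷ proj₁ s , proj₂ s) (splits W) → s ∉ map (λ s → proj₁ s , x ∷ proj₂ s) (splits W)
      dis m n with ∈-map⁻ (λ s → x ∷ proj₁ s , proj₂ s) m | ∈-map⁻ (λ s → proj₁ s , x ∷ proj₂ s) n
      ... | (p , q) , _ , refl | (p' , q') , n' , refl = All≢⇒∉ a (splits-⊆ W n' (here refl))

-- The weight (1+1/a)^|A∩Q| (1-1/a)^|B∩Q| has mean 1 over all splits (A,B).
chernoff-sum : ∀ {A : Set} (Q : A → Bool) a' W →
  sumL (λ s → (2 + a') ^ cnt Q (proj₁ s) * a' ^ cnt Q (proj₂ s)) (splits W) ≡ 2 ^ length W * suc a' ^ cnt Q W
chernoff-sum Q a' [] = refl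
chernoff-sum Q a' (x ∷ W) = sumL-++ _ (map _ (splits W)) (map _ (splits W))
  ⟫ cong₂ _+_ (sumL-map _ _ (splits W)) (sumL-map _ _ (splits W)) ⟫ go (Q x)
  where
    S : ℕ
    S = sumL (λ s → (2 + a') ^ cnt Q (proj₁ s) * a' ^ cnt Q (proj₂ s)) (splits W)
    go : ∀ b → sumL (λ s → (2 + a') ^ (b2n b + cnt Q (proj₁ s)) * a' ^ cnt Q (proj₂ s)) (splits W)
             + sumL (λ s → (2 + a') ^ cnt Q (proj₁ s) * a' ^ (b2n b + cnt Q (proj₂ s))) (splits W)
             ≡ 2 ^ suc (length W) * suc a' ^ (b2n b + cnt Q W)
    go false = cong₂ _+_ (chernoff-sum Q a' W) (chernoff-sum Q a' W) ⟫ split-identity₂₁ (2 ^ length W) (suc a' ^ cnt Q W)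
    go true = cong₂ _+_
        (sumL-cong (splits W) (λ {s} _ → split-identity₁₈ a' ((2 + a') ^ cnt Q (proj₁ s)) (a' ^ cnt Q (proj₂ s))) ⟫ sumL-* (2 + a') _ (splits W) ⟫ cong ((2 + a') *_) (chernoff-sum Q a' W))
        (sumL-cong (splits W) (λ {s} _ → split-identity₁₉ a' ((2 + a') ^ cnt Q (proj₁ s)) (a' ^ cnt Q (proj₂ s))) ⟫ sumL-* a' _ (splits W) ⟫ cong (a' *_) (chernoff-sum Q a' W))
      ⟫ split-identity₂₀ a' (2 ^ length W) (suc a' ^ cnt Q W)

-- (1-1/a²)^(ad) ≥ (1-1/a)^d and (a-1)(a+1)² ≥ a³+a, squared so that no halves occur.
chernoff-one : ∀ s x y d → let a = 3 + s in y + d ≤ x → x + y ≤ a * d →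
  (a ^ (x + y)) * (a ^ (x + y)) * suc (a * a) ^ d
    ≤ (suc a ^ x * (2 + s) ^ y) * (suc a ^ x * (2 + s) ^ y) * (a * a) ^ d
chernoff-one s x y d hx hw = *-canc-≤ (a ^ d) (^-pos a d (s≤s z≤n)) (begin
  a ^ d * (a ^ (x + y) * a ^ (x + y) * A⁺ ^ d)                ≡⟨ eqL ⟩
  a² ^ (y + y) * (a ^ i * a ^ i) * (a * (a * a * A⁺)) ^ d     ≤⟨ *-mono-≤ (*-monoʳ-≤ (a² ^ (y + y)) (*-mono-≤ (^-monoˡ-≤ i (n≤1+n a)) (^-monoˡ-≤ i (n≤1+n a)))) (^-monoˡ-≤ d cube) ⟩
  a² ^ (y + y) * (p ^ i * p ^ i) * (m * (p * p * (a * a))) ^ d ≡⟨ eqM ⟩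
  (a² ^ (y + y) * m ^ d) * ((p ^ i * p ^ i) * (p * p * (a * a)) ^ d) ≤⟨ *-monoˡ-≤ _ drop-y ⟩
  (mp ^ (y + y) * a ^ d) * ((p ^ i * p ^ i) * (p * p * (a * a)) ^ d) ≡⟨ eqR ⟩
  a ^ d * ((p ^ x * m ^ y) * (p ^ x * m ^ y) * (a * a) ^ d) ∎)
  where
    open ≤-Reasoning
    a = 3 + s
    p = suc a
    m = 2 + s
    a² = a * a
    A⁺ = suc (a * a)
    mp = m * p
    i = x ∸ (y + d)
    xi : (y + d) + i ≡ x
    xi = m+[n∸m]≡n hx
    cube : a * (a * a * A⁺) ≤ m * (p * p * (a * a))
    cube = lin ((2 + 4 * s + s * s) * ((3 + s) * (3 + s))) {L = 0} z≤n (split-identity₁ s)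
    g = 5 + 5 * s + s * s
    c≡ : g + a ≡ mp
    c≡ = split-identity₂ s
    c+1 : suc mp ≡ a²
    c+1 = split-identity₃ s
    one : a² ^ a * m ≤ mp ^ a * a
    one = *-cancelˡ-≤ a (begin
      a * (a² ^ a * m)      ≡⟨ split-identity₁₁ a (a² ^ a) m ⟩
      a² ^ a * (a * m)      ≡⟨ cong₂ (λ u v → u ^ a * v) (symm (cong suc c≡ ⟫ c+1)) (split-identity₁₂ s) ⟩
      suc (g + a) ^ a * suc g ≤⟨ bernoulli a g ⟩
      (g + a) ^ a * suc (g + a) ≡⟨ cong₂ (λ u v → u ^ a * v) c≡ (cong suc c≡ ⟫ c+1) ⟩
      mp ^ a * a²           ≡⟨ split-identity₁₃ (mp ^ a) a ⟩
      a * (mp ^ a * a) ∎)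
    v = a * d ∸ (y + y)
    2y≤ : y + y ≤ a * d
    2y≤ = ≤-trans (+-monoˡ-≤ y (≤-trans (m≤m+n y d) hx)) hw
    uv : (y + y) + v ≡ a * d
    uv = m+[n∸m]≡n 2y≤
    mp≤a² : mp ≤ a²
    mp≤a² = ≤-trans (n≤1+n mp) (≤-reflexive c+1)
    drop-y : a² ^ (y + y) * m ^ d ≤ mp ^ (y + y) * a ^ d
    drop-y = *-canc-≤ (a² ^ v) (^-pos a² v (s≤s z≤n)) (begin
      a² ^ v * (a² ^ (y + y) * m ^ d)     ≡⟨ split-identity₁₄ (a² ^ v) (a² ^ (y + y)) (m ^ d) ⟫ cong (_* m ^ d) (symm (^-distribˡ-+-* a² (y + y) v) ⟫ cong (a² ^_) uv ⟫ symm (^-*-assoc a² a d)) ⟩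
      (a² ^ a) ^ d * m ^ d                ≡⟨ symm (^-mul (a² ^ a) m d) ⟩
      (a² ^ a * m) ^ d                    ≤⟨ ^-monoˡ-≤ d one ⟩
      (mp ^ a * a) ^ d                    ≡⟨ ^-mul (mp ^ a) a d ⟫ cong (_* a ^ d) (^-*-assoc mp a d ⟫ cong (mp ^_) (symm uv) ⟫ ^-distribˡ-+-* mp (y + y) v) ⟩
      mp ^ (y + y) * mp ^ v * a ^ d       ≤⟨ *-monoˡ-≤ (a ^ d) (*-monoʳ-≤ (mp ^ (y + y)) (^-monoˡ-≤ v mp≤a²)) ⟩
      mp ^ (y + y) * a² ^ v * a ^ d       ≡⟨ split-identity₁₅ (mp ^ (y + y)) (a² ^ v) (a ^ d) ⟩
      a² ^ v * (mp ^ (y + y) * a ^ d) ∎)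
    pw : ∀ z → z ^ x ≡ z ^ y * z ^ d * z ^ i
    pw z = cong (z ^_) (symm xi) ⟫ ^-distribˡ-+-* z (y + d) i ⟫ cong (_* z ^ i) (^-distribˡ-+-* z y d)
    eqL : a ^ d * (a ^ (x + y) * a ^ (x + y) * A⁺ ^ d) ≡ a² ^ (y + y) * (a ^ i * a ^ i) * (a * (a * a * A⁺)) ^ d
    eqL = cong (λ z → a ^ d * (z * z * A⁺ ^ d)) (^-distribˡ-+-* a x y ⟫ cong (_* a ^ y) (pw a))
        ⟫ split-identity₄ (a ^ d) (a ^ y) (a ^ i) (A⁺ ^ d)
        ⟫ symm (cong₂ (λ u v → u * (a ^ i * a ^ i) * v) (^-distribˡ-+-* a² y y ⟫ cong₂ _*_ (^-mul a a y) (^-mul a a y))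
            (^-mul a (a * a * A⁺) d ⟫ cong (a ^ d *_) (^-mul (a * a) A⁺ d ⟫ cong (_* A⁺ ^ d) (^-mul a a d))))
    eqM : a² ^ (y + y) * (p ^ i * p ^ i) * (m * (p * p * (a * a))) ^ d ≡ (a² ^ (y + y) * m ^ d) * ((p ^ i * p ^ i) * (p * p * (a * a)) ^ d)
    eqM = cong (a² ^ (y + y) * (p ^ i * p ^ i) *_) (^-mul m (p * p * (a * a)) d) ⟫ split-identity₅ (a² ^ (y + y)) (p ^ i * p ^ i) (m ^ d) ((p * p * (a * a)) ^ d)
    eqR : (mp ^ (y + y) * a ^ d) * ((p ^ i * p ^ i) * (p * p * (a * a)) ^ d) ≡ a ^ d * ((p ^ x * m ^ y) * (p ^ x * m ^ y) * (a * a) ^ d)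
    eqR = cong₂ (λ u v → u * a ^ d * ((p ^ i * p ^ i) * v)) (^-distribˡ-+-* mp y y ⟫ cong₂ _*_ (^-mul m p y) (^-mul m p y))
            (^-mul (p * p) (a * a) d ⟫ cong (_* (a * a) ^ d) (^-mul p p d))
        ⟫ split-identity₆ (m ^ y) (p ^ y) (a ^ d) (p ^ i) (p ^ d) ((a * a) ^ d)
        ⟫ symm (cong (λ z → a ^ d * (z * m ^ y * (z * m ^ y) * (a * a) ^ d)) (pw p))

sq-≤ : ∀ a b → a * a ≤ b * b → a ≤ b
sq-≤ a b h = ≮⇒≥ (λ lt → <-irrefl refl (<-≤-trans (*-mono-< lt lt) h))

unbalanced : ∀ {A : Set} → ℕ → (A → Bool) → Split A → Bool
unbalanced d Q s = leq (cnt Q (proj₂ s) + d) (cnt Q (proj₁ s))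

swapS : ∀ {A : Set} → Split A → Split A
swapS s = proj₂ s , proj₁ s

-- Markov's inequality for the weight of `chernoff-sum`: some unbalanced split has weight at most
-- the total divided by B, while `chernoff-one` bounds the weight of every unbalanced split from
-- below. The squares are inherited from there.
chernoff : ∀ {A : Set} (Q : A → Bool) s d W → let a = 3 + s in length W ≤ a * d →
  let B = cnt (unbalanced d Q) (splits W) in
  B * B * suc (a * a) ^ d ≤ (2 ^ length W * 2 ^ length W) * (a * a) ^ d
chernoff {A} Q s d W hW with cnt (unbalanced d Q) (splits W) in eqB
... | zero = z≤n
... | suc B₀ = fin (sumL-∃ {f = λ sp → B * (b2n (unbalanced d Q sp) * wt sp)} {λ sp → b2n (unbalanced d Q sp) * suc tot} (splits W) strict)
  where
    a = 3 + s
    B = suc B₀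
    q = cnt Q W
    tot = 2 ^ length W * a ^ q
    wt : Split A → ℕ
    wt sp = (4 + s) ^ cnt Q (proj₁ sp) * (2 + s) ^ cnt Q (proj₂ sp)
    strict : sumL (λ sp → B * (b2n (unbalanced d Q sp) * wt sp)) (splits W) < sumL (λ sp → b2n (unbalanced d Q sp) * suc tot) (splits W)
    strict = begin-strict
      sumL (λ sp → B * (b2n (unbalanced d Q sp) * wt sp)) (splits W) ≡⟨ sumL-* B _ (splits W) ⟩
      B * sumL (λ sp → b2n (unbalanced d Q sp) * wt sp) (splits W)   ≤⟨ *-monoʳ-≤ B (≤-trans (sumL-mono (splits W) (λ {sp} _ → ≤-trans (*-monoˡ-≤ (wt sp) (b2n≤1 (unbalanced d Q sp))) (≤-reflexive (*-identityˡ (wt sp))))) (≤-reflexive (chernoff-sum Q (2 + s) W))) ⟩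
      B * tot                                                        <⟨ *-monoʳ-< B (n<1+n tot) ⟩
      B * suc tot                                                    ≡⟨ *-comm B (suc tot) ⟫ cong (suc tot *_) (symm eqB) ⟫ symm (sumL-* (suc tot) _ (splits W)) ⟩
      sumL (λ sp → suc tot * b2n (unbalanced d Q sp)) (splits W)     ≡⟨ sumL-cong (splits W) (λ {sp} _ → *-comm (suc tot) (b2n (unbalanced d Q sp))) ⟩
      sumL (λ sp → b2n (unbalanced d Q sp) * suc tot) (splits W) ∎
      where open ≤-Reasoning
    fin : (∃ λ sp → sp ∈ splits W × B * (b2n (unbalanced d Q sp) * wt sp) < b2n (unbalanced d Q sp) * suc tot) →
      B * B * suc (a * a) ^ d ≤ (2 ^ length W * 2 ^ length W) * (a * a) ^ d
    fin (sp , sp∈ , lt) = go (unbalanced d Q sp) refl lt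
      where
        x = cnt Q (proj₁ sp)
        y = cnt Q (proj₂ sp)
        xy : x + y ≡ q
        xy = symm (sumL-++ _ (proj₁ sp) (proj₂ sp)) ⟫ sumL-↭ _ (splits-↭ W sp∈)
        go : ∀ u → unbalanced d Q sp ≡ u → B * (b2n u * wt sp) < b2n u * suc tot → _
        go false _ h with () ← ≤-<-trans z≤n h
        go true eu h = *-canc-≤ (a ^ q * a ^ q) (*-mono-≤ (^-pos a q (s≤s z≤n)) (^-pos a q (s≤s z≤n))) (begin
          a ^ q * a ^ q * (B * B * suc (a * a) ^ d)       ≡⟨ split-identity₇ (a ^ q) B (suc (a * a) ^ d) ⟩
          B * B * (a ^ q * a ^ q * suc (a * a) ^ d)       ≤⟨ *-monoʳ-≤ (B * B) (subst (λ z → a ^ z * a ^ z * suc (a * a) ^ d ≤ wt sp * wt sp * (a * a) ^ d) xy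
                                                              (chernoff-one s x y d (le-true eu) (≤-trans (≤-reflexive xy) (≤-trans (cnt≤length Q W) hW)))) ⟩
          B * B * (wt sp * wt sp * (a * a) ^ d)           ≡⟨ split-identity₈ B (wt sp) ((a * a) ^ d) ⟩
          (B * wt sp) * (B * wt sp) * (a * a) ^ d         ≤⟨ *-monoˡ-≤ ((a * a) ^ d) (*-mono-≤ h' h') ⟩
          tot * tot * (a * a) ^ d                         ≡⟨ split-identity₉ (2 ^ length W) (a ^ q) ((a * a) ^ d) ⟩
          a ^ q * a ^ q * ((2 ^ length W * 2 ^ length W) * (a * a) ^ d) ∎)
          where
            open ≤-Reasoning
            h' : B * wt sp ≤ tot
            h' = ≤-pred (subst₂ _<_ (cong (B *_) (+-identityʳ (wt sp))) (+-identityʳ (suc tot)) h)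

chernoffʳ : ∀ {A : Set} (Q : A → Bool) d W →
  cnt (λ s → unbalanced d Q (swapS s)) (splits W) ≡ cnt (unbalanced d Q) (splits W)
chernoffʳ {A} Q d W = swap-sum W (λ s → b2n (unbalanced d Q s))
  where
    swap-sum : ∀ W (f : Split A → ℕ) → sumL (λ s → f (swapS s)) (splits W) ≡ sumL f (splits W)
    swap-sum [] f = refl
    swap-sum (x ∷ W) f = sumL-++ _ (map _ (splits W)) (map _ (splits W))
      ⟫ cong₂ _+_ (sumL-map _ _ (splits W) ⟫ swap-sum W (λ s → f (proj₁ s , x ∷ proj₂ s))) (sumL-map _ _ (splits W) ⟫ swap-sum W (λ s → f (x ∷ proj₁ s , proj₂ s)))
      ⟫ +-comm (sumL (λ s → f (proj₁ s , x ∷ proj₂ s)) (splits W)) (sumL (λ s → f (x ∷ proj₁ s , proj₂ s)) (splits W)) ⟫ symm (sumL-++ f (map _ (splits W)) (map _ (splits W)) ⟫ cong₂ _+_ (sumL-map f _ (splits W)) (sumL-map f _ (splits W)))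

balanced : ∀ {A : Set} → ℕ → List (A → Bool) → Split A → Bool
balanced d Qs s = allB (λ Q → not (unbalanced d Q s ∨ unbalanced d Q (swapS s))) Qs

-- With n tests, each is unbalanced in one of the two directions on at most a 1/(4n) fraction of the
-- splits, by `chernoff` and symmetry. The union bound leaves more than half.
many-balanced : ∀ {A : Set} (Qs : List (A → Bool)) s d W → let a = 3 + s in length W ≤ a * d → 0 < length Qs →
  (8 * length Qs) * (8 * length Qs) * (a * a) ^ d ≤ suc (a * a) ^ d →
  2 ^ length W < 2 * cnt (balanced d Qs) (splits W)
many-balanced {A} Qs s d W hW ne big = +-cancelʳ-< (2 * (n * β)) _ _ (begin-strict
    2 ^ w + 2 * (n * β)        <⟨ +-monoʳ-< (2 ^ w) small ⟩
    2 ^ w + 2 ^ w              ≡⟨ split-identity₂₂ (2 ^ w) ⟩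
    2 * 2 ^ w                  ≡⟨ cong (2 *_) (symm (cnt-true (splits W) ⟫ splits-len W)) ⟩
    2 * cnt (λ _ → true) (splits W) ≤⟨ *-monoʳ-≤ 2 (cnt-tests bd (λ _ → true) Qs (splits W) β each) ⟩
    2 * (cnt (balanced d Qs) (splits W) + n * β) ≡⟨ *-distribˡ-+ 2 (cnt (balanced d Qs) (splits W)) (n * β) ⟩
    2 * cnt (balanced d Qs) (splits W) + 2 * (n * β) ∎)
  where
    open ≤-Reasoning
    a = 3 + s
    w = length W
    n = length Qs
    bd : (A → Bool) → Split A → Bool
    bd Q sp = unbalanced d Q sp ∨ unbalanced d Q (swapS sp)
    instance
      nzn : NonZero (4 * n)
      nzn = >-nonZero (*-mono-≤ {1} {4} (s≤s z≤n) ne)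
    β = 2 ^ w / (4 * n)
    small : 2 * (n * β) < 2 ^ w
    small = *-canc-< 2 (≤-<-trans (≤-trans (≤-reflexive (split-identity₁₀ n β)) (m/n*n≤m (2 ^ w) (4 * n)))
              (<-≤-trans (m<m+n (2 ^ w) (^-pos 2 w (s≤s z≤n))) (≤-reflexive (split-identity₂₂ (2 ^ w)))))
    each : ∀ {Q} → Q ∈ Qs → cnt (bd Q) (splits W) ≤ β
    each {Q} _ = div-big (2 ^ w) (4 * n) _ (≤-trans (*-monoʳ-≤ (4 * n) or-bound) (≤-trans (≤-reflexive (split-identity₁₆ n B)) (sq-≤ (8 * n * B) (2 ^ w) (*-canc-≤ ((a * a) ^ d) (^-pos (a * a) d (s≤s z≤n)) (begin
        (a * a) ^ d * (8 * n * B * (8 * n * B))        ≡⟨ split-identity₁₇ ((a * a) ^ d) (8 * n) B ⟩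
        B * B * (8 * n * (8 * n) * (a * a) ^ d)        ≤⟨ *-monoʳ-≤ (B * B) big ⟩
        B * B * suc (a * a) ^ d                        ≤⟨ chernoff Q s d W hW ⟩
        2 ^ w * 2 ^ w * (a * a) ^ d                    ≡⟨ *-comm (2 ^ w * 2 ^ w) ((a * a) ^ d) ⟩
        (a * a) ^ d * (2 ^ w * 2 ^ w) ∎)))))
      where
        B = cnt (unbalanced d Q) (splits W)
        or-bound : cnt (bd Q) (splits W) ≤ B + B
        or-bound = ≤-trans (sumL-mono (splits W) (λ {sp} _ → orb (unbalanced d Q sp) (unbalanced d Q (swapS sp))))
          (≤-reflexive (sumL-+ _ _ (splits W) ⟫ cong (B +_) (chernoffʳ Q d W)))
          where orb : ∀ p q → b2n (p ∨ q) ≤ b2n p + b2n q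
                orb true q = s≤s z≤n
                orb false q = ≤-refl

balanced-bound : ∀ {A : Set} d Qs (s : Split A) {Q} → balanced d Qs s ≡ true → Q ∈ Qs →
  cnt Q (proj₁ s) < cnt Q (proj₂ s) + d × cnt Q (proj₂ s) < cnt Q (proj₁ s) + d
balanced-bound d Qs s {Q} e m = fin (unbalanced d Q s) refl (unbalanced d Q (swapS s)) refl (not-true (allB-∈ (λ Q → not (unbalanced d Q s ∨ unbalanced d Q (swapS s))) e m))
  where
    fin : ∀ p → unbalanced d Q s ≡ p → ∀ q → unbalanced d Q (swapS s) ≡ q → p ∨ q ≡ false →
      cnt Q (proj₁ s) < cnt Q (proj₂ s) + d × cnt Q (proj₂ s) < cnt Q (proj₁ s) + d
    fin false ep false eq _ = ≰⇒> (does-false (cnt Q (proj₂ s) + d ≤? cnt Q (proj₁ s)) ep)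
                            , ≰⇒> (does-false (cnt Q (proj₁ s) + d ≤? cnt Q (proj₂ s)) eq)

-- The binomial coefficients sum to 2^w, so on average over α at least half of the splits of size α
-- survive. A fixed α makes concatenated paths decodable, and the binomial coefficient rebuilds w!
-- from the factorials of the halves.
popular-size : ∀ {A : Set} (W : List A) (p : Split A → Bool) → 2 ^ length W < 2 * cnt p (splits W) →
  ∃ λ α → bin (length W) α < 2 * cnt (λ s → p s ∧ does (length (proj₁ s) ≟ α)) (splits W)
popular-size W p h = let α , _ , lt = sumL-∃ {f = λ α → bin w α} {λ α → 2 * cnt (λ s → p s ∧ does (length (proj₁ s) ≟ α)) (splits W)} sizes strict in α , lt
  where
    w = length W
    sizes = upTo (suc w)
    strict : sumL (λ α → bin w α) sizes < sumL (λ α → 2 * cnt (λ s → p s ∧ does (length (proj₁ s) ≟ α)) (splits W)) sizes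
    strict = begin-strict
      sumL (λ α → bin w α) sizes
        ≡⟨ sumL-cong sizes (λ {α} _ → symm (splits-count W α)) ⟩
      sumL (λ α → cnt (λ s → does (length (proj₁ s) ≟ α)) (splits W)) sizes
        ≡⟨ sumL-swap _ sizes (splits W) ⟩
      sumL (λ s → cnt (λ α → does (length (proj₁ s) ≟ α)) sizes) (splits W)
        ≤⟨ sumL-bound 1 (splits W) (λ {s} _ → ≤-trans (≤-reflexive (sumL-cong sizes (λ {α} _ → cong b2n (flip≟ (length (proj₁ s)) α)))) (cnt-eq≤1 _≟_ (length (proj₁ s)) sizes (UniqueP.upTo⁺ (suc w)))) ⟩
      length (splits W) * 1
        ≡⟨ *-identityʳ _ ⟫ splits-len W ⟩
      2 ^ w
        <⟨ h ⟩
      2 * cnt p (splits W)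
        ≤⟨ *-monoʳ-≤ 2 (≤-trans (sumL-mono (splits W) (λ {s} m → cover (p s) s m)) (≤-reflexive (sumL-swap _ (splits W) sizes))) ⟩
      2 * sumL (λ α → cnt (λ s → p s ∧ does (length (proj₁ s) ≟ α)) (splits W)) sizes
        ≡⟨ symm (sumL-* 2 (λ α → cnt (λ s → p s ∧ does (length (proj₁ s) ≟ α)) (splits W)) sizes) ⟩
      sumL (λ α → 2 * cnt (λ s → p s ∧ does (length (proj₁ s) ≟ α)) (splits W)) sizes ∎
      where
        open ≤-Reasoning
        flip≟ : ∀ x y → does (x ≟ y) ≡ does (y ≟ x)
        flip≟ zero zero = refl
        flip≟ zero (suc y) = refl
        flip≟ (suc x) zero = refl
        flip≟ (suc x) (suc y) = flip≟ x y
        cover : ∀ b s → s ∈ splits W → b2n b ≤ cnt (λ α → b ∧ does (length (proj₁ s) ≟ α)) sizes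
        cover false s m = z≤n
        cover true s m = cnt-∈ (λ α → does (length (proj₁ s) ≟ α)) (∈-upTo⁺ (s≤s (≤-trans (≤-trans (m≤m+n _ _) (≤-reflexive (symm (length-++ (proj₁ s))))) (≤-reflexive (↭-length (splits-↭ W m))))))
          (does-intro (length (proj₁ s) ≟ length (proj₁ s)) refl)

-- Numbers governing the recursive halving

level-identity₁ : ∀ w → 8 * (4 * w) ≡ 32 * w
level-identity₁ = solve-∀

level-identity₂ : ∀ i → suc (suc i) + 0 + i ≡ 2 * suc i + 0
level-identity₂ = solve-∀

level-identity₃ : ∀ i → 2 * i + 1 + 0 + 1 ≡ suc i * 2 + 0
level-identity₃ = solve-∀

level-identity₄ : ∀ a j → 32 * (a * j) ≡ 32 * a * j
level-identity₄ = solve-∀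

level-identity₅ : ∀ a j e → e * (2 * (a * j * (a * j))) ≡ e * (2 * (a * a)) * (j * j)
level-identity₅ = solve-∀

level-identity₆ : ∀ a j x y z u → a * j * (x * y * (z * u)) ≡ a * (x * z) * (j * y * u)
level-identity₆ = solve-∀

level-identity₇ : ∀ b s f → (b + 0) * (s * f * 1) ≡ s * (b * (f * 1))
level-identity₇ = solve-∀

level-identity₈ : ∀ n f p → n * (f * p) ≡ f * (n * p)
level-identity₈ = solve-∀

level-identity₉ : ∀ a e → suc (a + e * suc a + suc e) ≡ suc e * suc (suc a)
level-identity₉ = solve-∀

level-identity₁₀ : ∀ i x w → suc i * suc (suc i) * x + w + suc (suc i) * ((2 * i + 1) * w) ≡ suc i * (suc (suc i) * x + (2 * suc i + 1) * w)
level-identity₁₀ = solve-∀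

level-identity₁₁ : ∀ i q w → suc i * (suc (suc i) * (q * w)) ≡ suc (suc i) * (suc i * q * w)
level-identity₁₁ = solve-∀

level-identity₁₂ : ∀ a g h w → a * ((g + h) * w) ≡ a * (g * w) + a * (h * w)
level-identity₁₂ = solve-∀

level-identity₁₃ : ∀ i q D b d w → suc (suc i) * suc i * (q * D) * (b + d) + w ≡ (suc i * suc (suc i) * (q * (D * b)) + w) + suc (suc i) * (suc i * q * (D * d))
level-identity₁₃ = solve-∀

level-identity₁₄ : ∀ a g α d x → a * (g * (2 * α + 2 * d)) + a * x ≡ 2 * a * g * α + a * (g * (2 * d) + x)
level-identity₁₄ = solve-∀

level-identity₁₅ : ∀ i q D d → 2 * suc i * (suc i * q * (2 * d) + suc i * q * (D * d)) ≡ 2 * (suc i * suc i) * q * (D + 2) * d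
level-identity₁₅ = solve-∀

level-identity₁₆ : ∀ i q D d → 2 * (2 * (suc i * suc i) * q * (D + 2) * d) ≡ 4 * q * (D + 2) * (suc i * suc i) * d
level-identity₁₆ = solve-∀

level-identity₁₇ : ∀ d → 2 * (4 * d) ≡ 8 * d
level-identity₁₇ = solve-∀

level-identity₁₈ : ∀ a j t → a * j * t ≡ a * t * j
level-identity₁₈ = solve-∀

level-identity₁₉ : ∀ a b c → a * (b * c) ≡ b * (c * a)
level-identity₁₉ = solve-∀

level-identity₂₀ : ∀ a b c → a * (b * c) ≡ c * (b * a)
level-identity₂₀ = solve-∀

level-identity₂₁ : ∀ p q s f u g → (p + q) * (s * f * (u * g)) ≡ s * (p * (f * (u * g))) + u * (q * (s * f * g))
level-identity₂₁ = solve-∀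

level-identity₂₂ : ∀ i q D b α → 2 * suc (suc i) * (suc i * (q * (D * b)) + (2 * i + 1) * α) ≡ suc (suc i) * suc i * (q * D) * (2 * b) + 2 * suc (suc i) * (2 * i + 1) * α
level-identity₂₂ = solve-∀

level-identity₂₃ : ∀ i g α → 2 * suc (suc i) * g * α + 2 * suc (suc i) * (2 * i + 1) * α ≡ 2 * suc (suc i) * ((g + (2 * i + 1)) * α)
level-identity₂₃ = solve-∀

level-identity₂₄ : ∀ i x w → suc (suc i) * (suc i * x + (2 * i + 1) * w) + 0 + w ≡ suc i * (suc (suc i) * x + (2 * suc i + 1) * w) + 0
level-identity₂₄ = solve-∀

level-identity₂₅ : ∀ a b c → a * (b * c) ≡ b * (a * c)
level-identity₂₅ = solve-∀

bin-> : ∀ n k → n < k → bin n k ≡ 0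
bin-> zero    (suc k) h = refl
bin-> (suc n) (suc k) (s≤s h) = cong₂ _+_ (bin-> n k h) (bin-> n (suc k) (≤-trans h (n≤1+n k)))

bin-fact : ∀ a b → bin (a + b) a * (a ! * b !) ≡ (a + b) !
bin-fact zero b = *-identityˡ _ ⟫ *-identityˡ _
bin-fact (suc a) zero = cong (λ z → (bin (a + 0) a + z) * (suc a ! * 1)) (bin-> (a + 0) (suc a) (s≤s (≤-reflexive (+-identityʳ a))))
  ⟫ level-identity₇ (bin (a + 0) a) (suc a) (a !) ⟫ cong₂ (λ x y → suc x * y) (symm (+-identityʳ a)) (bin-fact a 0)
bin-fact (suc a) (suc b) = begin
  (p + q) * (suc a * a ! * (suc b * b !))                       ≡⟨ level-identity₂₁ p q (suc a) (a !) (suc b) (b !) ⟩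
  suc a * (p * (a ! * (suc b * b !))) + suc b * (q * (suc a * a ! * b !)) ≡⟨ cong₂ (λ x y → suc a * x + suc b * y) (bin-fact a (suc b)) (cong (λ z → bin z (suc a) * (suc a * a ! * b !)) (+-suc a b) ⟫ bin-fact (suc a) b) ⟩
  suc a * (a + suc b) ! + suc b * (suc a + b) !                 ≡⟨ cong (λ z → suc a * (a + suc b) ! + suc b * z !) (symm (+-suc a b)) ⟩
  suc a * (a + suc b) ! + suc b * (a + suc b) !                 ≡⟨ symm (*-distribʳ-+ ((a + suc b) !) (suc a) (suc b)) ⟩
  (suc a + suc b) ! ∎
  where
    open Eq.≡-Reasoning
    p = bin (a + suc b) a
    q = bin (a + suc b) (suc a)

-- Each of the a factors beyond b! is at most n, unless a + b exceeds n. This measures the loss when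
-- a linking vertices are set aside.
fact-split : ∀ a b n → (a + b) ! ≤ b ! * n ^ a ⊎ n < a + b
fact-split zero b n = inj₁ (≤-reflexive (symm (*-identityʳ (b !))))
fact-split (suc a) b n with fact-split a b n
... | inj₂ h = inj₂ (≤-trans h (n≤1+n _))
... | inj₁ h with suc (a + b) ≤? n
...   | no c = inj₂ (≰⇒> c)
...   | yes c = inj₁ (≤-trans (*-mono-≤ c h) (≤-reflexive (level-identity₈ n (b !) (n ^ a))))

fact≤pow : ∀ w M → w ≤ M → w ! ≤ M ^ w
fact≤pow zero M h = s≤s z≤n
fact≤pow (suc w) M h = *-mono-≤ h (fact≤pow w M (≤-trans (n≤1+n w) h))

-- The threshold is made a closed polynomial by bounding the constant that `poly-exp′` computes: A
-- and c will depend on the recursion level, and the dependence has to be polynomial.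
exp-explicit : ∀ A e c N → 0 < A → c ^ e * (suc e * suc A) ^ suc e ≤ N → (c * N) ^ e * A ^ N < suc A ^ N
exp-explicit (suc A₀) e c N h hN = proj₂ (exp-beats′ (suc A₀) e c h) N
  (≤-trans (*-monoʳ-≤ (c ^ e) (^-monoˡ-≤ (suc e) (≤-trans (n≤1+n _) (≤-reflexive (level-identity₉ A₀ e))))) hN)

-- The relative slack at level i is (2i+1)/((i+1)q) = (2 - 1/(i+1))/q. Descending from level i+1 to
-- i releases 1/((i+1)(i+2)q), and `hd` makes the deviation d of the split small enough to be
-- absorbed by it.
slack-step : ∀ i q D b b₂ w d α → 2 ≤ q →
  suc (suc i) * (q * (D * b)) + (2 * suc i + 1) * w ≤ suc (suc i) * (q * w) →
  2 * b₂ ≤ b + d → w ≤ 2 * α + 2 * d → 2 * (suc i * suc i) * q * (D + 2) * d ≤ w →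
  suc i * (q * (D * b₂)) + (2 * i + 1) * α ≤ suc i * (q * α)
slack-step i q D b b₂ w d α hq H hb hw hd = *-cancelˡ-≤ (2 * suc (suc i)) (begin
  2 * suc (suc i) * (suc i * (q * (D * b₂)) + (2 * i + 1) * α)
    ≡⟨ level-identity₂₂ i q D b₂ α ⟩
  suc (suc i) * suc i * (q * D) * (2 * b₂) + 2 * suc (suc i) * (2 * i + 1) * α
    ≤⟨ +-monoˡ-≤ _ (*-monoʳ-≤ (suc (suc i) * suc i * (q * D)) hb) ⟩
  suc (suc i) * suc i * (q * D) * (b + d) + 2 * suc (suc i) * (2 * i + 1) * α
    ≤⟨ +-monoˡ-≤ _ main ⟩
  2 * suc (suc i) * g * α + 2 * suc (suc i) * (2 * i + 1) * α
    ≡⟨ level-identity₂₃ i g α ⟩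
  2 * suc (suc i) * ((g + (2 * i + 1)) * α)
    ≡⟨ cong (λ z → 2 * suc (suc i) * (z * α)) gq ⟫ cong (2 * suc (suc i) *_) (*-assoc (suc i) q α) ⟩
  2 * suc (suc i) * (suc i * (q * α)) ∎)
  where
    open ≤-Reasoning
    g = suc i * q ∸ (2 * i + 1)
    gq : g + (2 * i + 1) ≡ suc i * q
    gq = m∸n+n≡m {suc i * q} {2 * i + 1} (≤-trans (lin 1 {2 * i + 1} {suc i * 2} {0} {0} z≤n (level-identity₃ i)) (*-monoʳ-≤ (suc i) hq))
    H' : suc i * suc (suc i) * (q * (D * b)) + w ≤ suc (suc i) * (g * w)
    H' = +-cancelʳ-≤ (suc (suc i) * ((2 * i + 1) * w)) _ _ (begin
      suc i * suc (suc i) * (q * (D * b)) + w + suc (suc i) * ((2 * i + 1) * w)  ≡⟨ level-identity₁₀ i (q * (D * b)) w ⟩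
      suc i * (suc (suc i) * (q * (D * b)) + (2 * suc i + 1) * w)                ≤⟨ *-monoʳ-≤ (suc i) H ⟩
      suc i * (suc (suc i) * (q * w))                                            ≡⟨ level-identity₁₁ i q w ⟫ cong (λ z → suc (suc i) * (z * w)) (symm gq) ⟩
      suc (suc i) * ((g + (2 * i + 1)) * w)                                      ≡⟨ level-identity₁₂ (suc (suc i)) g (2 * i + 1) w ⟩
      suc (suc i) * (g * w) + suc (suc i) * ((2 * i + 1) * w) ∎)
    main : suc (suc i) * suc i * (q * D) * (b + d) ≤ 2 * suc (suc i) * g * α
    main = +-cancelʳ-≤ w _ _ (begin
      suc (suc i) * suc i * (q * D) * (b + d) + w
        ≡⟨ level-identity₁₃ i q D b d w ⟩
      (suc i * suc (suc i) * (q * (D * b)) + w) + suc (suc i) * (suc i * q * (D * d))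
        ≤⟨ +-monoˡ-≤ _ (≤-trans H' (*-monoʳ-≤ (suc (suc i)) (*-monoʳ-≤ g hw))) ⟩
      suc (suc i) * (g * (2 * α + 2 * d)) + suc (suc i) * (suc i * q * (D * d))
        ≡⟨ level-identity₁₄ (suc (suc i)) g α d (suc i * q * (D * d)) ⟩
      2 * suc (suc i) * g * α + suc (suc i) * (g * (2 * d) + suc i * q * (D * d))
        ≤⟨ +-monoʳ-≤ (2 * suc (suc i) * g * α) (≤-trans (*-mono-≤ two (+-monoˡ-≤ _ (*-monoˡ-≤ (2 * d) (≤-trans (m≤m+n g (2 * i + 1)) (≤-reflexive gq))))) (≤-trans (≤-reflexive (level-identity₁₅ i q D d)) hd)) ⟩
      2 * suc (suc i) * g * α + w ∎)
      where
        two : suc (suc i) ≤ 2 * suc i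
        two = lin i {L = 0} z≤n (level-identity₂ i)

slack-down : ∀ i x w y → suc (suc i) * x + (2 * suc i + 1) * w ≤ suc (suc i) * y → suc i * x + (2 * i + 1) * w ≤ suc i * y
slack-down i x w y H = *-cancelˡ-≤ (suc (suc i)) (begin
  suc (suc i) * (suc i * x + (2 * i + 1) * w)            ≤⟨ lin w {L = 0} z≤n (level-identity₂₄ i x w) ⟩
  suc i * (suc (suc i) * x + (2 * suc i + 1) * w)        ≤⟨ *-monoʳ-≤ (suc i) H ⟩
  suc i * (suc (suc i) * y)                              ≡⟨ level-identity₂₅ (suc i) (suc (suc i)) y ⟩
  suc (suc i) * (suc i * y) ∎)
  where
    open ≤-Reasoning

-- Everything that is needed of a set size w at level i, once w exceeds a fixed polynomial in i.
record LevelNums (q D k1 t1 m T i w : ℕ) : Set where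
  field
    s d : ℕ
    w≤ad : w ≤ (3 + s) * d
    dsm  : 2 * (suc i * suc i) * q * (D + 2) * d ≤ w
    4d≤w : 4 * d ≤ w
    t1≤d : t1 ≤ d
    beat : ∀ n → n ≤ (4 * w) ^ k1 → 0 < k1 → (8 * n) * (8 * n) * ((3 + s) * (3 + s)) ^ d ≤ suc ((3 + s) * (3 + s)) ^ d
    4m≤w : 4 * m ≤ w
    16≤w : 16 ^ T ≤ w
    4t≤w : 4 * t1 ≤ w
    qT≤w : q * T ≤ w

module Levels (q D k1 t1 m T : ℕ) (q>0 : 0 < q) where
  e a₀ F₀ E₁ Kp : ℕ
  e = k1 + k1
  -- With a = a₀(i+1)^2 and d about w/a, the bound a·d ≤ 2w is twice the inequality `dsm`.
  a₀ = 4 * q * (D + 2)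
  F₀ = (32 * a₀) ^ e * (suc e * (2 * (a₀ * a₀))) ^ suc e
  E₁ = suc e + (suc e + suc e)
  Kp = a₀ * F₀ + a₀ + a₀ * t1 + 4 * m + 16 ^ T + 4 * t1 + q * T

  a₀≥8 : 8 ≤ a₀
  a₀≥8 = *-mono-≤ {4} {4 * q} {2} {D + 2} (≤-trans (≤-reflexive refl) (*-monoʳ-≤ 4 q>0)) (m≤n+m 2 D)

  levelNums : ∀ i w → Kp * suc i ^ (E₁ + E₁) ≤ w → LevelNums q D k1 t1 m T i w
  levelNums i w hw = record
    { s = s ; d = d
    ; w≤ad = subst (λ z → w ≤ z * d) (symm a≡) w≤ad
    ; dsm = *-cancelˡ-≤ 2 (≤-trans (≤-reflexive (level-identity₁₆ i q D d)) ad≤2w)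
    ; 4d≤w = *-cancelˡ-≤ 2 (≤-trans (≤-reflexive (level-identity₁₇ d)) (≤-trans (*-monoˡ-≤ d a≥8) ad≤2w))
    ; t1≤d = *-canc-≤ a a>0 (≤-trans (≤-trans (≤-reflexive (level-identity₁₈ a₀ j t1)) (≤-trans (*-monoʳ-≤ (a₀ * t1) j≤J) (partial (a₀ * t1) h3))) w≤ad)
    ; beat = beat
    ; 4m≤w = ≤-trans (≤-reflexive (symm (*-identityʳ _))) (≤-trans (*-monoʳ-≤ (4 * m) J>0) (partial (4 * m) h4))
    ; 16≤w = ≤-trans (≤-reflexive (symm (*-identityʳ _))) (≤-trans (*-monoʳ-≤ (16 ^ T) J>0) (partial (16 ^ T) h5))
    ; 4t≤w = ≤-trans (≤-reflexive (symm (*-identityʳ _))) (≤-trans (*-monoʳ-≤ (4 * t1) J>0) (partial (4 * t1) h6))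
    ; qT≤w = ≤-trans (≤-reflexive (symm (*-identityʳ _))) (≤-trans (*-monoʳ-≤ (q * T) J>0) (partial (q * T) h7)) }
    where
      j J a s d : ℕ
      j = suc i * suc i
      J = j ^ E₁
      a = a₀ * j
      s = a ∸ 3
      J≡ : suc i ^ (E₁ + E₁) ≡ J
      J≡ = ^-distribˡ-+-* (suc i) E₁ E₁ ⟫ symm (^-mul (suc i) (suc i) E₁)
      J>0 : 0 < J
      J>0 = ^-pos j E₁ (s≤s z≤n)
      j≤J : j ≤ J
      j≤J = ≤-trans (≤-reflexive (symm (*-identityʳ j))) (*-monoʳ-≤ j (^-pos j (e + (suc e + suc e)) (s≤s z≤n)))
      partial : ∀ x → x ≤ Kp → x * J ≤ w
      partial x h = ≤-trans (*-monoˡ-≤ J h) (≤-trans (≤-reflexive (cong (Kp *_) (symm J≡))) hw)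
      c₁ = a₀ * F₀
      h7 : q * T ≤ Kp
      h7 = m≤n+m (q * T) _
      h6 : 4 * t1 ≤ Kp
      h6 = ≤-trans (m≤n+m (4 * t1) (c₁ + a₀ + a₀ * t1 + 4 * m + 16 ^ T)) (m≤m+n _ (q * T))
      h5 : 16 ^ T ≤ Kp
      h5 = ≤-trans (m≤n+m (16 ^ T) (c₁ + a₀ + a₀ * t1 + 4 * m)) (≤-trans (m≤m+n _ (4 * t1)) (m≤m+n _ (q * T)))
      h4 : 4 * m ≤ Kp
      h4 = ≤-trans (m≤n+m (4 * m) (c₁ + a₀ + a₀ * t1)) (≤-trans (m≤m+n _ (16 ^ T)) (≤-trans (m≤m+n _ (4 * t1)) (m≤m+n _ (q * T))))
      h3 : a₀ * t1 ≤ Kp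
      h3 = ≤-trans (m≤n+m (a₀ * t1) (c₁ + a₀)) (≤-trans (m≤m+n _ (4 * m)) (≤-trans (m≤m+n _ (16 ^ T)) (≤-trans (m≤m+n _ (4 * t1)) (m≤m+n _ (q * T)))))
      h2 : a₀ ≤ Kp
      h2 = ≤-trans (m≤n+m a₀ c₁) (≤-trans (m≤m+n _ (a₀ * t1)) (≤-trans (m≤m+n _ (4 * m)) (≤-trans (m≤m+n _ (16 ^ T)) (≤-trans (m≤m+n _ (4 * t1)) (m≤m+n _ (q * T))))))
      h1 : c₁ ≤ Kp
      h1 = ≤-trans (m≤m+n c₁ a₀) (≤-trans (m≤m+n _ (a₀ * t1)) (≤-trans (m≤m+n _ (4 * m)) (≤-trans (m≤m+n _ (16 ^ T)) (≤-trans (m≤m+n _ (4 * t1)) (m≤m+n _ (q * T))))))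
      a≥8 : 8 ≤ a
      a≥8 = ≤-trans a₀≥8 (≤-trans (≤-reflexive (symm (*-identityʳ a₀))) (*-monoʳ-≤ a₀ {1} {j} (s≤s z≤n)))
      a>0 : 0 < a
      a>0 = ≤-trans (s≤s z≤n) a≥8
      instance
        nza : NonZero a
        nza = >-nonZero a>0
      d = suc (w / a)
      a≡ : 3 + s ≡ a
      a≡ = m+[n∸m]≡n (≤-trans (s≤s (s≤s (s≤s z≤n))) a≥8)
      w≤ad : w ≤ a * d
      w≤ad = ≤-trans (<⇒≤ (div-lower w a)) (≤-reflexive (*-comm d a))
      a≤w : a ≤ w
      a≤w = ≤-trans (*-monoʳ-≤ a₀ j≤J) (partial a₀ h2)
      ad≤2w : a * d ≤ 2 * w
      ad≤2w = ≤-trans (≤-reflexive (*-suc a (w / a) ⟫ cong (a +_) (*-comm a (w / a)))) (≤-trans (+-mono-≤ a≤w (m/n*n≤m w a)) (≤-reflexive (cong (w +_) (symm (+-identityʳ w)))))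
      -- The exponential bound needs d ≥ F a, and a * F a is a monomial in j of degree E₁.
      F : ℕ
      F = (32 * a) ^ e * (suc e * (2 * (a * a))) ^ suc e
      aF : a * F ≡ c₁ * J
      aF = begin
        a₀ * j * ((32 * (a₀ * j)) ^ e * (suc e * (2 * (a₀ * j * (a₀ * j)))) ^ suc e)
          ≡⟨ cong₂ (λ x y → a₀ * j * (x ^ e * y ^ suc e)) (level-identity₄ a₀ j) (level-identity₅ a₀ j (suc e)) ⟩
        a₀ * j * ((32 * a₀ * j) ^ e * (suc e * (2 * (a₀ * a₀)) * (j * j)) ^ suc e)
          ≡⟨ cong₂ (λ x y → a₀ * j * (x * y)) (^-mul (32 * a₀) j e) (^-mul (suc e * (2 * (a₀ * a₀))) (j * j) (suc e)) ⟩
        a₀ * j * ((32 * a₀) ^ e * j ^ e * ((suc e * (2 * (a₀ * a₀))) ^ suc e * (j * j) ^ suc e))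
          ≡⟨ level-identity₆ a₀ j ((32 * a₀) ^ e) (j ^ e) ((suc e * (2 * (a₀ * a₀))) ^ suc e) ((j * j) ^ suc e) ⟩
        a₀ * F₀ * (j * j ^ e * (j * j) ^ suc e)
          ≡⟨ cong (λ z → a₀ * F₀ * (j * j ^ e * z)) (^-mul j j (suc e) ⟫ symm (^-distribˡ-+-* j (suc e) (suc e))) ⟩
        a₀ * F₀ * (j ^ suc e * j ^ (suc e + suc e))
          ≡⟨ cong (a₀ * F₀ *_) (symm (^-distribˡ-+-* j (suc e) (suc e + suc e))) ⟩
        a₀ * F₀ * J ∎
        where
          open Eq.≡-Reasoning
      F≤d : F ≤ d
      F≤d = *-canc-≤ a a>0 (≤-trans (≤-reflexive aF) (≤-trans (partial c₁ h1) w≤ad))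
      a²>0 : 0 < a * a
      a²>0 = *-mono-≤ a>0 a>0
      beat : ∀ n → n ≤ (4 * w) ^ k1 → 0 < k1 → (8 * n) * (8 * n) * ((3 + s) * (3 + s)) ^ d ≤ suc ((3 + s) * (3 + s)) ^ d
      beat n hn hk = subst (λ z → (8 * n) * (8 * n) * (z * z) ^ d ≤ suc (z * z) ^ d) (symm a≡) (begin
        (8 * n) * (8 * n) * (a * a) ^ d                ≤⟨ *-monoˡ-≤ ((a * a) ^ d) (*-mono-≤ 8n 8n) ⟩
        (32 * a * d) ^ k1 * (32 * a * d) ^ k1 * (a * a) ^ d ≡⟨ cong (_* (a * a) ^ d) (symm (^-distribˡ-+-* (32 * a * d) k1 k1)) ⟩
        (32 * a * d) ^ e * (a * a) ^ d                 ≤⟨ <⇒≤ (exp-explicit (a * a) e (32 * a) d a²>0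
            (≤-trans (*-monoʳ-≤ ((32 * a) ^ e) (^-monoˡ-≤ (suc e) (*-monoʳ-≤ (suc e) (≤-trans (+-monoˡ-≤ (a * a) a²>0) (≤-reflexive (cong (a * a +_) (symm (+-identityʳ (a * a))))))))) F≤d)) ⟩
        suc (a * a) ^ d ∎)
        where
          open ≤-Reasoning
          8n : 8 * n ≤ (32 * a * d) ^ k1
          8n = ≤-trans (*-mono-≤ (≤-trans (≤-reflexive (symm (^-identityʳ 8))) (^-monoʳ-≤ 8 hk)) hn)
                 (≤-trans (≤-reflexive (symm (^-mul 8 (4 * w) k1) ⟫ cong (_^ k1) (level-identity₁ w))) (^-monoˡ-≤ k1 (≤-trans (*-monoʳ-≤ 32 w≤ad) (≤-reflexive (symm (*-assoc 32 a d))))))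

  M₁ : ℕ
  M₁ = suc (proj₁ (poly-exp 3 (E₁ + E₁) (s≤s z≤n)) * Kp)

  -- Above M₁·(4/3)^i a set exceeds the polynomial required by `levelNums`, by `poly-exp` for the
  -- ratio 4/3.
  large : ∀ i w → ¬ (3 ^ i * w ≤ 4 ^ i * M₁) → LevelNums q D k1 t1 m T i w
  large i w h = levelNums i w (<⇒≤ (*-canc-< (3 ^ i) (begin-strict
    3 ^ i * (Kp * suc i ^ (E₁ + E₁))      ≡⟨ level-identity₁₉ (3 ^ i) Kp (suc i ^ (E₁ + E₁)) ⟩
    Kp * (suc i ^ (E₁ + E₁) * 3 ^ i)      ≤⟨ *-monoʳ-≤ Kp (proj₂ (poly-exp 3 (E₁ + E₁) (s≤s z≤n)) i) ⟩
    Kp * (C * 4 ^ i)                      ≡⟨ level-identity₂₀ Kp C (4 ^ i) ⟩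
    4 ^ i * (C * Kp)                      ≤⟨ *-monoʳ-≤ (4 ^ i) (n≤1+n (C * Kp)) ⟩
    4 ^ i * M₁                            <⟨ ≰⇒> h ⟩
    3 ^ i * w ∎)))
    where
      open ≤-Reasoning
      C : ℕ
      C = proj₁ (poly-exp 3 (E₁ + E₁) (s≤s z≤n))

abstract
  levels : ∀ q D k1 t1 m T → 0 < q → ∃ λ M₀ → 0 < M₀ × (∀ i w → ¬ (3 ^ i * w ≤ 4 ^ i * M₀) → LevelNums q D k1 t1 m T i w)
  levels q D k1 t1 m T q>0 = Levels.M₁ q D k1 t1 m T q>0 , s≤s z≤n , Levels.large q D k1 t1 m T q>0

count-identity₁ : ∀ x d → d + (x + (x + d)) ≡ 2 * x + 2 * d
count-identity₁ = solve-∀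

count-identity₂ : ∀ w x d → w + (2 * x + 2 * d + (2 * x + 2 * d) + w) + 0 ≡ 4 * x + (w + w + 4 * d)
count-identity₂ = solve-∀

count-identity₃ : ∀ x y d t w → 4 * x + ((y + d + (y + d)) + (w + (w + w))) + (2 * d + 2 * t) ≡ 3 * w + ((x + x) + (4 * d + (t + (x + y) + (t + (x + y)))))
count-identity₃ = solve-∀

count-identity₄ : ∀ i x w → suc i * x + (2 * i + 1) * w + 0 + w ≡ suc i * (x + 2 * w) + 0
count-identity₄ = solve-∀

count-identity₅ : ∀ p w → 3 * (p * w) + 0 + 3 * p ≡ (3 * w + 3) * p + 0
count-identity₅ = solve-∀

count-identity₆ : ∀ i → suc (suc i) + 0 + suc i ≡ 2 * suc i + 1 + 0
count-identity₆ = solve-∀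

count-identity₇ : ∀ x y d b → 2 * x + (y + d + b) + 0 ≡ b + d + (x + (x + y))
count-identity₇ = solve-∀

count-identity₈ : ∀ t x → 4 * (t * x) ≡ t * (4 * x)
count-identity₈ = solve-∀

count-identity₉ : ∀ t w → t * (3 * w) ≡ 3 * t * w
count-identity₉ = solve-∀

count-identity₁₀ : ∀ x → x + (x + x) ≡ 3 * x
count-identity₁₀ = solve-∀

count-identity₁₁ : ∀ f b a → f * b * (f * a) ≡ f * f * (b * a)
count-identity₁₁ = solve-∀

count-identity₁₂ : ∀ g a b x y → 2 * (2 * g * (a * b) * (x * y)) ≡ g * (2 * (b * x) * (2 * (a * y)))
count-identity₁₂ = solve-∀

count-identity₁₃ : ∀ a b c d → a * b * (c * d) ≡ a * c * (b * d)
count-identity₁₃ = solve-∀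

app-inj : ∀ {A : Set} (xs xs' : List A) {ys ys'} → length xs ≡ length xs' → xs ++ ys ≡ xs' ++ ys' → xs ≡ xs' × ys ≡ ys'
app-inj []       []         l e = refl , e
app-inj (x ∷ xs) (x' ∷ xs') l e with app-inj xs xs' (suc-injective l) (∷-injectiveʳ e)
... | p , q = cong₂ _∷_ (∷-injectiveˡ e) p , q

Unique-concatMap : ∀ {A B : Set} (f : A → List B) xs → Unique xs → (∀ {x} → x ∈ xs → Unique (f x)) →
  (∀ {x y z} → x ∈ xs → y ∈ xs → z ∈ f x → z ∈ f y → x ≡ y) → Unique (concatMap f xs)
Unique-concatMap f [] u h k = []
Unique-concatMap f (x ∷ xs) (a ∷ u) h k = Unique-++ (h (here refl)) (Unique-concatMap f xs u (λ m → h (there m)) (λ m n → k (there m) (there n))) dis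
  where
    dis : ∀ {z} → z ∈ f x → z ∉ concatMap f xs
    dis m n with ∈-concat⁻′ (map f xs) n
    ... | zs , z∈ , zs∈ with ∈-map⁻ f zs∈
    ...   | y , y∈ , refl = All≢⇒∉ a (subst (_∈ xs) (symm (k (here refl) (there y∈) m z∈)) y∈)

sel : ∀ {A : Set} → (A → Bool) → List A → List A
sel p = filter (λ x → p x BoolP.≟ true)

length-sel : ∀ {A : Set} (p : A → Bool) xs → length (sel p xs) ≡ cnt p xs
length-sel p [] = refl
length-sel p (x ∷ xs) with p x
... | true = cong suc (length-sel p xs)
... | false = length-sel p xs

module CountSize (t2 k2 q : ℕ) (D>0 : 0 < Params.D t2 k2) (q>1 : 2 ≤ q) where
  open Params t2 k2

  q>0 : 0 < q
  q>0 = ≤-trans (s≤s z≤n) q>1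

  abstract
    m : ℕ
    m = suc (existW t2 k2 q D>0 q>0)

    m-def : m ≡ suc (existW t2 k2 q D>0 q>0)
    m-def = refl

  M₀ : ℕ
  M₀ = proj₁ (levels q D k1 t1 m T q>0)

  M₀>0 : 0 < M₀
  M₀>0 = proj₁ (proj₂ (levels q D k1 t1 m T q>0))

  level : ∀ i w → ¬ (3 ^ i * w ≤ 4 ^ i * M₀) → LevelNums q D k1 t1 m T i w
  level = proj₂ (proj₂ (levels q D k1 t1 m T q>0))

  abstract
    K : ℕ
    -- Dictated by the base case w ≤ M₀, where a single path has to account for 2·w!·w^T ≤ K^w.
    K = 2 * (M₀ * M₀ ^ T)

    K-def : K ≡ 2 * (M₀ * M₀ ^ T)
    K-def = refl

  K>0 : 0 < K
  K>0 = ≤-trans (*-mono-≤ {1} {2} (s≤s z≤n) (*-mono-≤ M₀>0 (^-pos M₀ T M₀>0))) (≤-reflexive (symm K-def))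

-- Clearing denominators

bin≡C : ∀ n k → n choose k ≡ bin n k
bin≡C n zero = refl
bin≡C zero (suc k) = k>n⇒nCk≡0 {0} {suc k} (s≤s z≤n)
bin≡C (suc n) (suc k) = symm (nCk+nC[k+1]≡[n+1]C[k+1] n k) ⟫ cong₂ _+_ (bin≡C n k) (bin≡C n (suc k))

-- Here γ = (p+1)/(d+1) and δ + 1 is the sum of the two binomial coefficients. Unnormalised
-- rationals keep both sides as explicit fractions, which are then cross-multiplied.
clear-denominators : ∀ δ p d γ n cd → ℚ.toℚᵘ γ ≡ ℚᵘ.mkℚᵘ (ℤ.+ suc p) d →
  ((ℚ.1ℚ ℚ.- invℕ (suc δ)) ℚ.+ γ) ℚ.* ℕtoℚ n ℚ.≤ ℕtoℚ cd →
  (δ * suc d + suc p * suc δ) * n ≤ cd * (suc δ * suc d)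
clear-denominators δ p d γ n cd eγ h = ℤ.drop‿+≤+ (subst₂ ℤ._≤_ lhs rhs (ℚᵘP.drop-*≤* hᵘ))
  where
    one inv g nn : ℚᵘ.ℚᵘ
    one = ℚᵘ.mkℚᵘ (ℤ.+ 1) 0
    inv = ℚᵘ.mkℚᵘ (ℤ.+ 1) δ
    g   = ℚᵘ.mkℚᵘ (ℤ.+ suc p) d
    nn  = ℚᵘ.mkℚᵘ (ℤ.+ n) 0
    eqL : ℚ.toℚᵘ (((ℚ.1ℚ ℚ.- invℕ (suc δ)) ℚ.+ γ) ℚ.* ℕtoℚ n) ℚᵘ.≃ ((one ℚᵘ.- inv) ℚᵘ.+ g) ℚᵘ.* nn
    eqL = ℚᵘP.≃-trans (ℚP.toℚᵘ-homo-* ((ℚ.1ℚ ℚ.- invℕ (suc δ)) ℚ.+ γ) (ℕtoℚ n))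
      (ℚᵘP.*-cong (ℚᵘP.≃-trans (ℚP.toℚᵘ-homo-+ (ℚ.1ℚ ℚ.- invℕ (suc δ)) γ)
        (ℚᵘP.+-cong (ℚᵘP.≃-trans (ℚP.toℚᵘ-homo-+ ℚ.1ℚ (ℚ.- invℕ (suc δ))) (ℚᵘP.+-congʳ one
          (ℚᵘP.≃-trans (ℚP.toℚᵘ-homo‿- (invℕ (suc δ))) (ℚᵘP.-‿cong (ℚP.toℚᵘ-fromℚᵘ inv))))) (ℚᵘP.≃-reflexive eγ)))
        (ℚP.toℚᵘ-fromℚᵘ nn))
    hᵘ : ((one ℚᵘ.- inv) ℚᵘ.+ g) ℚᵘ.* nn ℚᵘ.≤ ℚᵘ.mkℚᵘ (ℤ.+ cd) 0
    hᵘ = ℚᵘP.≤-respˡ-≃ eqL (ℚᵘP.≤-respʳ-≃ (ℚP.toℚᵘ-fromℚᵘ (ℚᵘ.mkℚᵘ (ℤ.+ cd) 0)) (ℚP.toℚᵘ-mono-≤ h))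
    lhs : ℚᵘ.↥ (((one ℚᵘ.- inv) ℚᵘ.+ g) ℚᵘ.* nn) ℤ.* ℤ.+ 1 ≡ ℤ.+ ((δ * suc d + suc p * suc δ) * n)
    lhs = cong (λ z → (((ℤ.+ 1 ℤ.* (ℤ.+ 1 ℤ.+ ℤ.+ δ) ℤ.+ ℤ.- (ℤ.+ 1) ℤ.* ℤ.+ 1) ℤ.* ℤ.+ suc d ℤ.+ ℤ.+ suc p ℤ.* ℤ.+ suc z) ℤ.* ℤ.+ n) ℤ.* ℤ.+ 1) (+-identityʳ δ)
      ⟫ l (ℤ.+ δ) (ℤ.+ suc d) (ℤ.+ suc p) (ℤ.+ n)
      ⟫ symm (ℤP.pos-* (δ * suc d + suc p * suc δ) n ⟫ cong (ℤ._* ℤ.+ n) (cong₂ ℤ._+_ (ℤP.pos-* δ (suc d)) (ℤP.pos-* (suc p) (suc δ))))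
      where
        l : ∀ a b c e → (((ℤ.+ 1 ℤ.* (ℤ.+ 1 ℤ.+ a) ℤ.+ ℤ.- (ℤ.+ 1) ℤ.* ℤ.+ 1) ℤ.* b ℤ.+ c ℤ.* (ℤ.+ 1 ℤ.+ a)) ℤ.* e) ℤ.* ℤ.+ 1 ≡ (a ℤ.* b ℤ.+ c ℤ.* (ℤ.+ 1 ℤ.+ a)) ℤ.* e
        l = solveℤ
    rhs : ℤ.+ cd ℤ.* ℚᵘ.↧ (((one ℚᵘ.- inv) ℚᵘ.+ g) ℚᵘ.* nn) ≡ ℤ.+ (cd * (suc δ * suc d))
    rhs = symm (ℤP.pos-* cd _) ⟫ cong (λ z → ℤ.+ (cd * z)) (cong suc (*-identityʳ _ ⟫ cong (λ z → d + z * suc d) (+-identityʳ δ)))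

-- The bound kept is D·bd ≤ (1 - 1/(d+1))n, which follows from γ ≥ 1/(d+1) and D ≥ 1.
codegree-bad : ∀ δ p d n cd bd → cd + bd ≡ n → (δ * suc d + suc p * suc δ) * n ≤ cd * (suc δ * suc d) →
  suc d * (suc δ * bd) + n ≤ suc d * n
codegree-bad δ p d .(cd + bd) cd bd refl h = lin (p * suc δ * (cd + bd) + δ * (cd + bd)) h (l δ p d cd bd)
  where l : ∀ δ p d c b → suc d * (suc δ * b) + (c + b) + c * (suc δ * suc d) + (p * suc δ * (c + b) + δ * (c + b))
              ≡ suc d * (c + b) + (δ * suc d + suc p * suc δ) * (c + b)
        l = solve-∀

-- Stirling's bound with 4 in place of e, by (1 + 1/n)^n ≤ 4 at each step.
self-power : ∀ n → n ^ n ≤ 4 ^ n * n !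
self-power zero = ≤-refl
self-power (suc n) = begin
  suc n * suc n ^ n             ≤⟨ *-monoʳ-≤ (suc n) (step n) ⟩
  suc n * (4 * n ^ n)           ≤⟨ *-monoʳ-≤ (suc n) (*-monoʳ-≤ 4 (self-power n)) ⟩
  suc n * (4 * (4 ^ n * n !))   ≡⟨ l (suc n) (4 ^ n) (n !) ⟩
  4 ^ suc n * suc n ! ∎
  where
    open ≤-Reasoning
    l : ∀ a b c → a * (4 * (b * c)) ≡ 4 * b * (a * c)
    l = solve-∀
    -- (1-1/(n+1))^j ≥ 1/2 for j = ⌊(n+1)/2⌋, and n ≤ 2j.
    step : ∀ n → suc n ^ n ≤ 4 * n ^ n
    step n with half n
      where
        half : ∀ n → ∃ λ j → (n ≡ j + j) ⊎ (n ≡ suc (j + j))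
        half zero = 0 , inj₁ refl
        half (suc n) with half n
        ... | j , inj₁ e = j , inj₂ (cong suc e)
        ... | j , inj₂ e = suc j , inj₁ (cong suc (e ⟫ symm (+-suc j j)))
    ... | j , inj₁ refl = ≤-trans (≤-reflexive (^-distribˡ-+-* (suc (j + j)) j j)) (≤-trans (*-mono-≤ h h)
            (≤-trans (≤-reflexive (l2 ((j + j) ^ j))) (≤-reflexive (cong (4 *_) (symm (^-distribˡ-+-* (j + j) j j))))))
      where
        l2 : ∀ a → 2 * a * (2 * a) ≡ 4 * (a * a)
        l2 = solve-∀
        h : suc (j + j) ^ j ≤ 2 * (j + j) ^ j
        h = *-cancelˡ-≤ (suc j) (≤-trans (≤-reflexive (*-comm (suc j) _)) (≤-trans (bern j j) (≤-trans (*-monoʳ-≤ ((j + j) ^ j) (≤-trans (n≤1+n _) (≤-reflexive (l3 j)))) (≤-reflexive (l4 ((j + j) ^ j) (suc j))))))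
          where
            bern : ∀ m g → suc (g + m) ^ m * suc g ≤ (g + m) ^ m * suc (g + m)
            bern m g = bernoulli m g
            l3 : ∀ j → suc (suc (j + j)) ≡ 2 * suc j
            l3 = solve-∀
            l4 : ∀ a j → a * (2 * j) ≡ j * (2 * a)
            l4 = solve-∀
    ... | j , inj₂ refl = ≤-trans (*-canc-≤ m (s≤s z≤n) (≤-trans (*-monoˡ-≤ (suc m ^ m) (n≤1+n m)) (≤-trans (≤-reflexive split) (≤-trans (*-mono-≤ h h) (≤-reflexive join))))) ≤-refl
      where
        m = suc (j + j)
        i = suc j
        split : suc m * suc m ^ m ≡ suc m ^ i * suc m ^ i
        split = cong (λ z → suc m ^ suc z) (symm (+-suc j j)) ⟫ ^-distribˡ-+-* (suc m) i i
        h : suc m ^ i ≤ 2 * m ^ i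
        h = *-cancelˡ-≤ (suc j) (≤-trans (≤-reflexive (*-comm (suc j) _)) (≤-trans (subst (λ z → suc z ^ i * suc j ≤ z ^ i * suc z) (+-suc j j) (bernoulli i j)) (≤-reflexive (l4 (m ^ i) j))))
          where l4 : ∀ a j → a * suc (suc (j + j)) ≡ suc j * (2 * a)
                l4 = solve-∀
        join : 2 * m ^ i * (2 * m ^ i) ≡ m * (4 * m ^ m)
        join = l5 (m ^ i) ⟫ cong (4 *_) (symm (^-distribˡ-+-* m i i) ⟫ cong (λ z → m ^ suc z) (+-suc j j)) ⟫ l6 m (m ^ m)
          where l5 : ∀ a → 2 * a * (2 * a) ≡ 4 * (a * a)
                l5 = solve-∀
                l6 : ∀ a b → 4 * (a * b) ≡ a * (4 * b)
                l6 = solve-∀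

n≤2^n : ∀ n → n ≤ 2 ^ n
n≤2^n zero = z≤n
n≤2^n (suc n) = ≤-trans (+-mono-≤ (^-pos 2 n (s≤s z≤n)) (n≤2^n n)) (≤-reflexive (cong (2 ^ n +_) (symm (+-identityʳ _))))

module Graph {V : Set} (_≟v_ : DecidableEquality V) (E : List V → Bool)
  (E-perm : ∀ {xs ys} → xs ↭ ys → E xs ≡ E ys) (t2 k2 : ℕ) where
  -- Cliques and power paths

  open Params t2 k2 public
  open import Data.List.Membership.DecPropositional _≟v_ using (_∈?_)

  subs-complete : ∀ xs (ys : List V) → Unique ys → ys ⊆l xs → ∃ λ s → s ∈ subs (length ys) xs × s ↭ ys
  subs-complete xs [] u h = [] , here refl , refl
  subs-complete [] (y ∷ ys) u h with () ← h (here refl)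
  subs-complete (x ∷ xs) ys'@(y ∷ ys) u h with x ∈? ys'
  ... | no n with subs-complete xs ys' u (λ {z} m → dr z m (h m))
    where dr : ∀ z → z ∈ ys' → z ∈ x ∷ xs → z ∈ xs
          dr z m (here refl) = ⊥-elim (n m)
          dr z m (there q) = q
  ...   | s , m , p = s , ∈-++⁺ʳ (map (x ∷_) (subs (length ys) xs)) m , p
  subs-complete (x ∷ xs) ys'@(y ∷ ys) u h | yes m with ∈-∃++ m
  ... | ps , qs , eq = fin (Unique-↭ per u)
    where
      per : ys' ↭ x ∷ ps ++ qs
      per = ↭-trans (↭-reflexive eq) (shift x ps qs)
      fin : Unique (x ∷ ps ++ qs) → _
      fin (a ∷ v) with subs-complete xs (ps ++ qs) v
             (λ r → dr r (h (∈-resp-↭ (↭-sym per) (there r))))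
        where dr : ∀ {z} → z ∈ ps ++ qs → z ∈ x ∷ xs → z ∈ xs
              dr r (here refl) = ⊥-elim (All≢⇒∉ a r)
              dr r (there q) = q
      ... | s , n , p = x ∷ s
            , ∈-++⁺ˡ (∈-map⁺ (x ∷_) (subst (λ l → s ∈ subs l xs) (symm (suc-injective (↭-length per))) n))
            , ↭-trans (prep x p) (↭-sym per)

  -- It depends on the underlying set only, so it makes sense for walks that repeat vertices; a list
  -- with fewer than k distinct entries is a clique.
  Clique : List V → Set
  Clique xs = ∀ ys → length ys ≡ suc k1 → Unique ys → ys ⊆l xs → E ys ≡ true

  Clique-⊆ : ∀ {xs ys} → xs ⊆l ys → Clique ys → Clique xs
  Clique-⊆ h C zs l u s = C zs l u (λ m → h (s m))

  -- E is only meaningful on lists without repetitions, so a vertex of s itself counts as bad for s.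
  bad : List V → V → Bool
  bad s x = mem _≟v_ x s ∨ not (E (x ∷ s))

  bad-mem : ∀ s x → bad s x ≡ false → x ∉ s
  bad-mem s x e with mem _≟v_ x s in eq
  ... | false = mem-false _≟v_ eq

  bad-edge : ∀ s x → bad s x ≡ false → E (x ∷ s) ≡ true
  bad-edge s x e with mem _≟v_ x s | E (x ∷ s)
  ... | false | true = refl

  bad-intro : ∀ s x → x ∉ s → E (x ∷ s) ≡ true → bad s x ≡ false
  bad-intro s x n e rewrite mem-∉ _≟v_ n | e = refl

  bad-perm : ∀ {s s'} x → s ↭ s' → bad s x ≡ false → bad s' x ≡ false
  bad-perm {s} {s'} x p e = bad-intro s' x (λ m → bad-mem s x e (∈-resp-↭ (↭-sym p) m))
    (symm (E-perm (prep x p)) ⟫ bad-edge s x e)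

  Ext : V → List V → Set
  Ext x S = ∀ ys → length ys ≡ k1 → Unique ys → ys ⊆l S → bad ys x ≡ false

  Ext-⊆ : ∀ {x S S'} → S ⊆l S' → Ext x S' → Ext x S
  Ext-⊆ h e ys l u s = e ys l u (λ m → h (s m))

  Clique-∷ : ∀ {x S} → Clique S → Ext x S → Clique (x ∷ S)
  Clique-∷ {x} {S} C e ys l u s with x ∈? ys
  ... | no n = C ys l u (λ m → dr m (s m))
    where dr : ∀ {z} → z ∈ ys → z ∈ x ∷ S → z ∈ S
          dr m (here refl) = ⊥-elim (n m)
          dr m (there q) = q
  ... | yes m with ∈-∃++ m
  ...   | ps , qs , refl with Unique-↭ (shift x ps qs) u
  ...     | a ∷ v = E-perm (shift x ps qs)
              ⟫ bad-edge (ps ++ qs) x (e (ps ++ qs) (suc-injective (symm (↭-length (shift x ps qs)) ⟫ l)) v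
                  (λ r → dr r (s (∈-resp-↭ (↭-sym (shift x ps qs)) (there r)))))
    where dr : ∀ {z} → z ∈ ps ++ qs → z ∈ x ∷ S → z ∈ S
          dr r (here refl) = ⊥-elim (All≢⇒∉ a r)
          dr r (there q) = q

  Clique-short : ∀ xs → length xs ≤ k1 → Clique xs
  Clique-short xs h ys l u s = ⊥-elim (<-irrefl refl (≤-trans (s≤s h) (≤-trans (≤-reflexive (symm l)) le)))
    where
      le : length ys ≤ length xs
      le = ≤-trans (≤-reflexive (symm (cnt-true ys)))
                (≤-trans (cnt-mono ys (λ m _ → mem-∈ _≟v_ (s m))) (cnt-mem _≟v_ ys xs u))

  okL : List (List V) → V → Bool
  okL ss x = allB (λ s → not (bad s x)) ss

  -- The (k-1)-sets that consist of v and k-2 vertices of c. For |c| = t-2 they, together with the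
  -- (k-1)-subsets of a (t-1)-clique containing c, make up the D tests.
  cmpTests : V → List V → List (List V)
  cmpTests v c = map (v ∷_) (subs k2 c)

  ok⇒Ext : ∀ {x S} → okL (subs k1 S) x ≡ true → Ext x S
  ok⇒Ext {x} {S} e ys l u s with subs-complete S ys u s
  ... | r , m , p = bad-perm x p (not-true (allB-∈ (λ s → not (bad s x)) e (subst (λ j → r ∈ subs j S) l m)))

  ok⇒Ext-cmp : ∀ {x v c} → Ext x c → okL (cmpTests v c) x ≡ true → Ext x (v ∷ c)
  ok⇒Ext-cmp {x} {v} {c} e o ys l u s with v ∈? ys
  ... | no n = e ys l u (λ m → dr m (s m))
    where dr : ∀ {z} → z ∈ ys → z ∈ v ∷ c → z ∈ c
          dr m (here refl) = ⊥-elim (n m)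
          dr m (there q) = q
  ... | yes m with ∈-∃++ m
  ...   | ps , qs , refl with Unique-↭ (shift v ps qs) u
  ...     | a ∷ w with subs-complete c (ps ++ qs) w
                  (λ r → dr r (s (∈-resp-↭ (↭-sym (shift v ps qs)) (there r))))
    where dr : ∀ {z} → z ∈ ps ++ qs → z ∈ v ∷ c → z ∈ c
          dr r (here refl) = ⊥-elim (All≢⇒∉ a r)
          dr r (there q) = q
  ...       | r , n , p = bad-perm x (↭-trans (prep v p) (↭-sym (shift v ps qs)))
      (not-true (allB-∈ (λ s → not (bad s x)) o
        (∈-map⁺ (v ∷_) (subst (λ j → r ∈ subs j c) (suc-injective (symm (↭-length (shift v ps qs)) ⟫ l)) n))))

  record Good (U W : List V) (b : ℕ) : Set where
    constructor mkGood
    field good : ∀ S → length S ≡ k1 → Unique S → S ⊆l U → cnt (bad S) W ≤ b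
  open Good public

  pickExt : ∀ {U W b} → Good U W b → ∀ (p : V → Bool) S → Unique S → S ⊆l U →
    cnt p W ≤ cnt (λ x → p x ∧ okL (subs k1 S) x) W + bin (length S) k1 * b
  pickExt {U} {W} {b} G p S u h = ≤-trans
    (cnt-tests bad p (subs k1 S) W b
       (λ m → good G _ (subs-length k1 S m) (subs-Unique k1 S u m) (λ q → h (subs-⊆ k1 S m q))))
    (≤-reflexive (cong (λ z → cnt (λ x → p x ∧ okL (subs k1 S) x) W + z * b) (length-subs k1 S)))

  pickCmp : ∀ {U W b} → Good U W b → ∀ (p : V → Bool) v c → Unique (v ∷ c) → (v ∷ c) ⊆l U →
    cnt p W ≤ cnt (λ x → p x ∧ okL (cmpTests v c) x) W + bin (length c) k2 * b
  pickCmp {U} {W} {b} G p v c (a ∷ u) h = ≤-trans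
    (cnt-tests bad p (cmpTests v c) W b val)
    (≤-reflexive (cong (λ z → cnt (λ x → p x ∧ okL (cmpTests v c) x) W + z * b)
      (length-map (v ∷_) (subs k2 c) ⟫ length-subs k2 c)))
    where
      val : ∀ {s} → s ∈ cmpTests v c → cnt (bad s) W ≤ b
      val m with ∈-map⁻ (v ∷_) m
      ... | s , n , refl = good G _ (cong suc (subs-length k2 c n))
              (∉⇒All≢ (λ q → All≢⇒∉ a (subs-⊆ k2 c n q)) ∷ subs-Unique k2 c u n)
              (λ { (here e) → h (here e) ; (there q) → h (there (subs-⊆ k2 c n q)) })

  Good-W : ∀ {U W W' b} → (∀ (p : V → Bool) → cnt p W' ≤ cnt p W) → Good U W b → Good U W' b
  Good-W h G = mkGood λ S l u s → ≤-trans (h (bad S)) (good G S l u s)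

  Good-U : ∀ {U U' W b} → U' ⊆l U → Good U W b → Good U' W b
  Good-U h G = mkGood λ S l u s → good G S l u (λ m → h (s m))

  Good-b : ∀ {U W b b'} → b ≤ b' → Good U W b → Good U W b'
  Good-b h G = mkGood λ S l u s → ≤-trans (good G S l u s) h

  cnt-sub : ∀ (q : V → Bool) {W} vs {W'} → W ↭ vs ++ W' → cnt q W ≡ cnt q vs + cnt q W'
  cnt-sub q vs {W'} p = sumL-↭ _ p ⟫ sumL-++ _ vs W'

  Good-sub : ∀ {U W b} vs {W'} → W ↭ vs ++ W' → Good U W b → Good U W' b
  Good-sub {U} {W} vs {W'} p = Good-W {U} {W} {W'} (λ q → ≤-trans (m≤n+m _ (cnt q vs))
     (≤-reflexive (symm (cnt-sub q vs p))))

  -- Power paths, with the most recently added vertex first.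
  PP : List V → Set
  PP []       = ⊤
  PP (x ∷ xs) = Clique (x ∷ take t1 xs) × PP xs

  PP-++ʳ : ∀ xs {ys} → PP (xs ++ ys) → PP ys
  PP-++ʳ [] p = p
  PP-++ʳ (x ∷ xs) (_ , p) = PP-++ʳ xs p

  PP-Clique : ∀ xs → Clique xs → PP xs
  PP-Clique [] C = tt
  PP-Clique (x ∷ xs) C = Clique-⊆ (λ { (here e) → here e ; (there m) → there (∈-take t1 xs m) }) C
                       , PP-Clique xs (Clique-⊆ there C)

  PP-window : ∀ xs {ys} → PP (xs ++ ys) → length xs ≤ T → Clique xs
  PP-window [] p h = Clique-short [] z≤n
  PP-window (x ∷ xs) {ys} (C , _) (s≤s h) = Clique-⊆ (λ { (here e) → here e ; (there m) → there (sub m) }) C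
    where
      sub : ∀ {z} → z ∈ xs → z ∈ take t1 (xs ++ ys)
      sub m = go t1 xs h m
        where go : ∀ n xs {z} → length xs ≤ n → z ∈ xs → z ∈ take n (xs ++ ys)
              go (suc n) (x ∷ xs) (s≤s h) (here e) = here e
              go (suc n) (x ∷ xs) (s≤s h) (there m) = there (go n xs h m)

  -- A window reaches back t1 places, so an overlap of t1 or more vertices hides B from the windows
  -- that start in A.
  PP-glue : ∀ A M {B} → t1 ≤ length M → PP (A ++ M) → PP (M ++ B) → PP (A ++ M ++ B)
  PP-glue [] M h p q = q
  PP-glue (x ∷ A) M {B} h (C , p) q =
    subst (λ z → Clique (x ∷ z)) eq C , PP-glue A M h p q
    where
      eq : take t1 (A ++ M) ≡ take t1 (A ++ M ++ B)
      eq = symm (cong (take t1) (symm (++-assoc A M B))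
           ⟫ take-++ t1 (A ++ M) B (≤-trans h (≤-trans (m≤n+m _ (length A)) (≤-reflexive (symm (length-++ A))))))

  PP-++ˡ : ∀ A {B} → PP (A ++ B) → PP A
  PP-++ˡ [] p = tt
  PP-++ˡ (x ∷ A) {B} (C , p) = Clique-⊆ (λ { (here e) → here e ; (there m) → there (go t1 A m) }) C , PP-++ˡ A p
    where go : ∀ n A {z} → z ∈ take n A → z ∈ take n (A ++ B)
          go (suc n) (x ∷ A) (here e) = here e
          go (suc n) (x ∷ A) (there m) = there (go n A m)

  PP-snoc : ∀ L M w → PP (L ++ M) → length M ≤ t1 → (length M ≡ t1 ⊎ L ≡ []) → Clique (w ∷ M) → PP (L ++ M ++ w ∷ [])
  PP-snoc (x ∷ L) M w (C , p) h (inj₁ e) K =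
    subst (λ z → Clique (x ∷ z)) eq C , PP-snoc L M w p h (inj₁ e) K
    where
      eq : take t1 (L ++ M) ≡ take t1 (L ++ M ++ w ∷ [])
      eq = symm (cong (take t1) (symm (++-assoc L M (w ∷ [])))
           ⟫ take-++ t1 (L ++ M) (w ∷ []) (≤-trans (≤-reflexive (symm e)) (≤-trans (m≤n+m _ (length L)) (≤-reflexive (symm (length-++ L))))))
  PP-snoc [] M w p h _ K = PP-Clique (M ++ w ∷ []) (Clique-⊆ sub K)
    where sub : (M ++ w ∷ []) ⊆l (w ∷ M)
          sub m with ∈-++⁻ M m
          ... | inj₁ q = there q
          ... | inj₂ (here e) = here e

  -- Walks

  -- A walk through the positions of a configuration may return to a position, but only after t1 other steps.
  Loc : ∀ {m} → List (Fin m) → Set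
  Loc []       = ⊤
  Loc (p ∷ ps) = p ∉ take t1 ps × Loc ps

  agree : ∀ {m} → List (Fin m) → Vec V m → Vec V m → Bool
  agree Q c c' = allB (λ q → does (lookup c q ≟v lookup c' q)) Q

  agree-map : ∀ {m} n (ps : List (Fin m)) c c' → agree (take n ps) c c' ≡ true →
    take n (map (lookup c) ps) ≡ take n (map (lookup c') ps)
  agree-map zero ps c c' e = refl
  agree-map (suc n) [] c c' e = refl
  agree-map (suc n) (p ∷ ps) c c' e with ∧-elim e
  ... | a , b = cong₂ _∷_ (does-true (lookup c p ≟v lookup c' p) a) (agree-map n ps c c' b)

  agree-update : ∀ {m} Q (c : Vec V m) p x y → p ∉ Q → agree Q (c [ p ]≔ x) (c [ p ]≔ y) ≡ true
  agree-update [] c p x y n = refl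
  agree-update (q ∷ Q) c p x y n = ∧-intro
    (does-intro (lookup (c [ p ]≔ x) q ≟v lookup (c [ p ]≔ y) q)
      (lookup∘update′ q≢p c x ⟫ symm (lookup∘update′ q≢p c y)))
    (agree-update Q c p x y (λ m → n (there m)))
    where q≢p : q ≢ p
          q≢p e = n (here (symm e))

  -- Configurations c with 𝒞 c admit few repetitions of the key on `take t1 ps`; discarding those whose key
  -- has at most d continuations costs d·|W|^m of them per step, and the rest can be followed greedily with
  -- fresh vertices although ps itself revisits positions.
  walk : ∀ {m W X d} {Rl : Fin (suc m) → V → Set} → Unique W →
    ∀ ps (𝒞 : Vec V (suc m) → Bool) →
    (∀ c → 𝒞 c ≡ true → ∀ i → lookup c i ∈ W) →
    (∀ c → 𝒞 c ≡ true → ∀ i → Rl i (lookup c i)) →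
    (∀ c → 𝒞 c ≡ true → PP (map (lookup c) ps ++ X)) →
    Loc ps → length ps ≤ d →
    length ps * (d * length W ^ m) < ΣV W (suc m) (λ c → b2n (𝒞 c)) →
    ∃ λ c → ∃ λ vs → 𝒞 c ≡ true × Pointwise Rl ps vs × Unique vs × vs ⊆l W × PP (vs ++ X)
      × take t1 vs ≡ take t1 (map (lookup c) ps)
  walk {m} {W} uW [] 𝒞 inW rl snd lc ld h
    with ΣV-pos (suc m) 𝒞 h
  ... | c , _ , eq = c , [] , eq , [] , [] , (λ ()) , snd c eq , refl
  walk {m} {W} {X} {d} {Rl} uW (p ∷ ps) 𝒞 inW rl snd (p∉ , lc) ld h = next (walk uW ps 𝒞′
      (λ c e → inW c (proj₁ (∧-elim e))) (λ c e → rl c (proj₁ (∧-elim e))) (λ c e → proj₂ (snd c (proj₁ (∧-elim e))))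
      lc (≤-trans (n≤1+n _) ld) cnt′)
    where
      Q = take t1 ps
      hasB : Vec V (suc m) → V → Vec V (suc m) → Bool
      hasB c x c' = 𝒞 c' ∧ (agree Q c c' ∧ does (lookup c' p ≟v x))
      hasN : Vec V (suc m) → V → ℕ
      hasN c x = ΣV W (suc m) (λ c' → b2n (hasB c x c'))
      has : Vec V (suc m) → V → Bool
      has c x = does (0 <? hasN c x)
      deg : Vec V (suc m) → ℕ
      deg c = cnt (has c) W
      big : Vec V (suc m) → Bool
      big c = does (d <? deg c)
      𝒞′ : Vec V (suc m) → Bool
      𝒞′ c = 𝒞 c ∧ big c
      low : Vec V (suc m) → Bool
      low c = 𝒞 c ∧ not (big c)
      splt : ∀ a b → b2n a ≤ b2n (a ∧ b) + b2n (a ∧ not b)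
      splt false b = z≤n
      splt true true = ≤-refl
      splt true false = ≤-refl
      -- As p is not in Q, all points of a line in direction p have the same key. If one of them is
      -- low, each low value y on the line is one of its continuations, and it has at most d of
      -- them.
      lowcoord : ∀ c → sumL (λ y → b2n (low (c [ p ]≔ y))) W ≤ d
      lowcoord c with cnt (λ y → low (c [ p ]≔ y)) W in eqn
      ... | zero = z≤n
      ... | suc j with cnt-∃ (λ y → low (c [ p ]≔ y)) W (≤-trans (s≤s z≤n) (≤-reflexive (symm eqn)))
      ...   | z , z∈ , ez = ≤-trans (≤-reflexive (symm eqn)) (≤-trans (cnt-mono W sub)
                (≮⇒≥ (does-false (d <? deg cz) (not-true (proj₂ (∧-elim {𝒞 cz} ez))))))
        where
          cz = c [ p ]≔ z
          sub : ∀ {y} → y ∈ W → low (c [ p ]≔ y) ≡ true → has cz y ≡ true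
          sub {y} y∈ ey = does-intro (0 <? hasN cz y)
            (≤-trans (≤-reflexive (cong b2n (symm tr)))
               (ΣV-∈ (suc m) (λ c' → b2n (hasB cz y c')) (c [ p ]≔ y) (inW _ ey′)))
            where ey′ = proj₁ (∧-elim {𝒞 (c [ p ]≔ y)} ey)
                  tr : hasB cz y (c [ p ]≔ y) ≡ true
                  tr = ∧-intro ey′ (∧-intro (agree-update Q c p z y p∉)
                         (does-intro (lookup (c [ p ]≔ y) p ≟v y) (lookup∘update p c y)))
      cnt′ : length ps * (d * length W ^ m) < ΣV W (suc m) (λ c → b2n (𝒞′ c))
      cnt′ = +-cancelˡ-< (d * length W ^ m) _ _ (<-≤-trans h (begin
        ΣV W (suc m) (λ c → b2n (𝒞 c))
          ≤⟨ ΣV-mono (suc m) (λ c → splt (𝒞 c) (big c)) ⟩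
        ΣV W (suc m) (λ c → b2n (𝒞′ c) + b2n (low c))
          ≡⟨ ΣV-+ (suc m) (λ c → b2n (𝒞′ c)) (λ c → b2n (low c)) ⟩
        ΣV W (suc m) (λ c → b2n (𝒞′ c)) + ΣV W (suc m) (λ c → b2n (low c))
          ≤⟨ +-monoʳ-≤ _ (ΣV-coord m p (λ c → b2n (low c)) d lowcoord) ⟩
        ΣV W (suc m) (λ c → b2n (𝒞′ c)) + d * length W ^ m
          ≡⟨ +-comm _ (d * length W ^ m) ⟩
        d * length W ^ m + ΣV W (suc m) (λ c → b2n (𝒞′ c)) ∎))
        where open ≤-Reasoning
      -- More than d continuations exist and fewer than d vertices are in use, so a fresh x can be
      -- chosen. The configuration is replaced by the witness for x, which agrees with it on the key
      -- and hence on the windows already built.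
      next : _ → _
      next (c , vs , ec , pw , uv , sv , pv , tk)
        with ∃-fresh _≟v_ (has c) W vs uW (≤-<-trans
               (≤-trans (≤-reflexive (symm (PW.Pointwise-length pw))) (≤-trans (n≤1+n _) ld))
               (does-true (d <? deg c) (proj₂ (∧-elim {𝒞 c} ec))))
      ... | x , x∈ , hx , x∉ with ΣV-pos (suc m) (hasB c x) (does-true (0 <? hasN c x) hx)
      ...   | c' , _ , eqh with ∧-elim {𝒞 c'} eqh
      ...       | e1 , e2 with ∧-elim {agree Q c c'} e2
      ...         | ag , lk with does-true (lookup c' p ≟v x) lk
      ...           | refl = c' , x ∷ vs , e1 , rl c' e1 p ∷ pw , ∉⇒All≢ x∉ ∷ uv
            , (λ { (here refl) → x∈ ; (there q) → sv q })
            , (subst (λ z → Clique (x ∷ z)) (symm tk2) (proj₁ (snd c' e1)) , pv)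
            , cong (x ∷_) (take-pred t2 vs (map (lookup c') ps) tk1)
        where
          tk1 : take t1 vs ≡ take t1 (map (lookup c') ps)
          tk1 = tk ⟫ agree-map t1 ps c c' ag
          tk2 : take t1 (vs ++ X) ≡ take t1 (map (lookup c') ps ++ X)
          tk2 = take-cong-++ t1 vs (map (lookup c') ps) X
                  (symm (PW.Pointwise-length pw) ⟫ symm (length-map (lookup c') ps)) tk1

  -- A family so large that the configurations lost in `walk`, a constant times |W|^(m-1), cannot
  -- exhaust it.
  record Rob (W : List V) (e m : ℕ) (P : Vec V m → Set) : Set where
    field
      conf  : Vec V m → Bool
      sound : ∀ c → conf c ≡ true → P c
      many  : e ^ m ≤ ΣV W m (λ c → b2n (conf c))

  Rob-map : ∀ {W e m} {P P' : Vec V m → Set} → (∀ c → P c → P' c) → Rob W e m P → Rob W e m P'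
  Rob-map f R = record { conf = conf ; sound = λ c e → f c (sound c e) ; many = many }
    where open Rob R

  Rob-pick : ∀ {W e m} {P : Vec V m → Set} → Rob W e m P → (ok : Vec V m → V → Bool) →
    (∀ c → P c → e ≤ cnt (ok c) W) →
    Rob W e (suc m) (λ { (x ∷ c) → P c × ok c x ≡ true })
  Rob-pick {W} {e} {m} R ok h = record
    { conf = λ { (x ∷ c) → conf c ∧ ok c x }
    ; sound = λ { (x ∷ c) q → sound c (proj₁ (∧-elim q)) , proj₂ (∧-elim {conf c} q) }
    ; many = ≤-trans (*-monoʳ-≤ e many) (≤-trans (≤-reflexive (symm (ΣV-* m e _))) (ΣV-mono m ge)) }
    where
      open Rob R
      ge : ∀ c → e * b2n (conf c) ≤ sumL (λ x → b2n (conf c ∧ ok c x)) W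
      ge c with conf c in eq
      ... | false = ≤-trans (≤-reflexive (*-zeroʳ e)) z≤n
      ... | true = ≤-trans (≤-reflexive (*-identityʳ e)) (h c (sound c eq))

  PP-take : ∀ L → PP L → Clique (take t1 L)
  PP-take L p = PP-window (take t1 L) {drop t1 L} (subst PP (symm (take++drop≡id t1 L)) p)
    (≤-trans (≤-reflexive (length-take t1 L)) (≤-trans (m⊓n≤m t1 _) (n≤1+n t1)))

  PP-swap : ∀ A {B B'} → take t1 B ≡ take t1 B' → PP (A ++ B) → PP B' → PP (A ++ B')
  PP-swap [] e p q = q
  PP-swap (x ∷ A) e (C , p) q = subst (λ z → Clique (x ∷ z)) (take-++-cong t1 A e) C , PP-swap A e p q

  -- Every window that starts in C stays inside K, in whatever order and with whatever repetitions;
  -- this lets a walk circle around a clique.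
  PP-within : ∀ {K} C P R → Clique K → C ⊆l K → P ⊆l K → t1 ≤ length P → PP (P ++ R) → PP (C ++ P ++ R)
  PP-within [] P R cl sC sP h p = p
  PP-within {K} (c ∷ C) P R cl sC sP h p = Clique-⊆ sub cl , PP-within C P R cl (λ m → sC (there m)) sP h p
    where
      sub : (c ∷ take t1 (C ++ P ++ R)) ⊆l K
      sub (here refl) = sC (here refl)
      sub (there m) with ∈-++⁻ C (∈-take t1 (C ++ P) (subst (_ ∈_) (cong (take t1) (symm (++-assoc C P R))
          ⟫ take-++ t1 (C ++ P) R (≤-trans h (≤-trans (m≤n+m _ (length C)) (≤-reflexive (symm (length-++ C)))))) m))
      ... | inj₁ a = sC (there a)
      ... | inj₂ a = sP a

  Loc-lift : ∀ {m} (ps : List (Fin m)) → Loc ps → Loc (map suc ps)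
  Loc-lift [] l = tt
  Loc-lift (p ∷ ps) (n , l) = (λ q → n (inv (subst (suc p ∈_) (take-map t1 ps) q))) , Loc-lift ps l
    where
      inv : suc p ∈ map suc (take t1 ps) → p ∈ take t1 ps
      inv q with ∈-map⁻ suc q
      ... | r , r∈ , refl = r∈

  Loc-zero : ∀ {m} (ps : List (Fin m)) → Loc ps → Loc (zero ∷ map suc ps)
  Loc-zero ps l = n , Loc-lift ps l
    where
      n : zero ∉ take t1 (map suc ps)
      n q with ∈-map⁻ suc (subst (zero ∈_) (take-map t1 ps) q)
      ... | _ , _ , ()

  Loc-visit : ∀ {m} (p : Fin m) L R → length L ≡ t1 → p ∉ L → Loc (L ++ R) → Loc (p ∷ L ++ R)
  Loc-visit p L R e n l = (λ q → n (subst (p ∈_) (take-exact L R t1 e) q)) , l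

  -- A position c of C2 is revisited only after the t1 other positions of C2, B and C1. The
  -- induction moves c from C2 to the end of C1.
  Loc-rot : ∀ {m} (C1 C2 B R : List (Fin m)) → length (C2 ++ B ++ C1) ≡ T → Unique (C2 ++ B ++ C1) →
    Loc (B ++ (C1 ++ C2) ++ R) → Loc (C2 ++ B ++ (C1 ++ C2) ++ R)
  Loc-rot C1 [] B R e u l = l
  Loc-rot C1 (c ∷ C2) B R e (a ∷ u) l = subst Loc' eq2 (Loc-visit c (C2 ++ B ++ C1) (c ∷ C2 ++ R) (suc-injective e) (All≢⇒∉ a) (subst Loc eq1 rec))
    where
      Loc' = Loc
      as : ∀ Z → (C1 ++ c ∷ []) ++ Z ≡ C1 ++ c ∷ Z
      as Z = ++-assoc C1 (c ∷ []) Z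
      mv : c ∷ (C2 ++ B ++ C1) ↭ C2 ++ B ++ (C1 ++ c ∷ [])
      mv = ↭-trans (++-comm (c ∷ []) (C2 ++ B ++ C1))
             (↭-reflexive (++-assoc C2 (B ++ C1) (c ∷ []) ⟫ cong (C2 ++_) (++-assoc B C1 (c ∷ []))))
      rec : Loc (C2 ++ B ++ (C1 ++ c ∷ C2) ++ R)
      rec = subst (λ z → Loc (C2 ++ B ++ z ++ R)) (as C2)
        (Loc-rot (C1 ++ c ∷ []) C2 B R (symm (↭-length mv) ⟫ e) (Unique-↭ mv (a ∷ u))
          (subst (λ z → Loc (B ++ z ++ R)) (symm (as C2)) l))
      eq1 : C2 ++ B ++ (C1 ++ c ∷ C2) ++ R ≡ (C2 ++ B ++ C1) ++ (c ∷ C2 ++ R)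
      eq1 = cong (λ z → C2 ++ B ++ z) (++-assoc C1 (c ∷ C2) R)
          ⟫ symm (++-assoc C2 (B ++ C1) (c ∷ C2 ++ R) ⟫ cong (C2 ++_) (++-assoc B C1 (c ∷ C2 ++ R)))
      eq2 : c ∷ (C2 ++ B ++ C1) ++ (c ∷ C2 ++ R) ≡ c ∷ C2 ++ B ++ (C1 ++ c ∷ C2) ++ R
      eq2 = cong (c ∷_) (symm eq1)

  bin≤D : bin t1 k1 ≤ D
  bin≤D = ≤-trans (m≤m+n (bin t1 k1) (bin t2 k2)) (≤-reflexive (symm D-def))

  okP : List V → List V → List V → V → List V → V → Bool
  okP W F S v cc x = ((mem _≟v_ x W ∧ not (mem _≟v_ x F)) ∧ okL (subs k1 S) x) ∧ okL (cmpTests v cc) x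

  okS : List V → List V → List V → V → Bool
  okS W F S x = (mem _≟v_ x W ∧ not (mem _≟v_ x F)) ∧ okL (subs k1 S) x

  okS-sound : ∀ W F S x → okS W F S x ≡ true → x ∈ W × x ∉ F × Ext x S
  okS-sound W F S x e with ∧-elim {mem _≟v_ x W ∧ not (mem _≟v_ x F)} e
  ... | a , b with ∧-elim {mem _≟v_ x W} a
  ...   | p , q = mem-true _≟v_ p , mem-false _≟v_ (not-true q) , ok⇒Ext b

  okP-sound : ∀ W F S v cc x → cc ⊆l S → okP W F S v cc x ≡ true → x ∈ W × x ∉ F × Ext x S × Ext x (v ∷ cc)
  okP-sound W F S v cc x h e with ∧-elim {okS W F S x} e
  ... | a , b with okS-sound W F S x a
  ...   | p , q , r = p , q , r , ok⇒Ext-cmp (Ext-⊆ {S' = S} h r) b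

  pickCountS : ∀ {U W b} → Good U W b → Unique W → ∀ F S → Unique S → S ⊆l U → length S ≤ t1 →
    length W ≤ cnt (okS W F S) W + bin t1 k1 * b + length F
  pickCountS {U} {W} {b} G uW F S uS sS lS = begin
    length W                                                ≡⟨ symm (cnt-true W) ⟩
    cnt (λ _ → true) W                                      ≤⟨ cnt-fresh _≟v_ (λ _ → true) W F uW ⟩
    cnt (λ x → true ∧ not (mem _≟v_ x F)) W + length F      ≤⟨ +-monoˡ-≤ (length F) (cnt-mono W (λ m e → ∧-intro (mem-∈ _≟v_ m) e)) ⟩
    cnt (λ x → mem _≟v_ x W ∧ not (mem _≟v_ x F)) W + length F ≤⟨ +-monoˡ-≤ (length F) (pickExt G _ S uS sS) ⟩
    cnt (okS W F S) W + bin (length S) k1 * b + length F    ≤⟨ +-monoˡ-≤ (length F) (+-monoʳ-≤ _ (*-monoˡ-≤ b (bin-mono k1 lS))) ⟩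
    cnt (okS W F S) W + bin t1 k1 * b + length F ∎
    where open ≤-Reasoning

  pickCount : ∀ {U W b} → Good U W b → Unique W → ∀ F S v cc → Unique S → S ⊆l U → length S ≤ t1 →
    Unique (v ∷ cc) → (v ∷ cc) ⊆l U → length cc ≤ t2 →
    length W ≤ cnt (okP W F S v cc) W + D * b + length F
  pickCount {U} {W} {b} G uW F S v cc uS sS lS uc sc lc = begin
    length W
      ≤⟨ pickCountS G uW F S uS sS lS ⟩
    cnt (okS W F S) W + bin t1 k1 * b + length F
      ≤⟨ +-monoˡ-≤ (length F) (+-monoˡ-≤ _ (≤-trans (pickCmp G (okS W F S) v cc uc sc) (+-monoʳ-≤ _ (*-monoˡ-≤ b (bin-mono k2 lc))))) ⟩
    cnt (okP W F S v cc) W + bin t2 k2 * b + bin t1 k1 * b + length F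
      ≡⟨ l (cnt (okP W F S v cc) W) (bin t2 k2) (bin t1 k1) b (length F) ⟫ cong (λ d → cnt (okP W F S v cc) W + d * b + length F) (symm D-def) ⟩
    cnt (okP W F S v cc) W + D * b + length F ∎
    where
      open ≤-Reasoning
      l : ∀ a p q b f → a + p * b + q * b + f ≡ a + (q + p) * b + f
      l = solve-∀

  val : ∀ {m} → Vec V m → List (Fin m) → List V
  val c = map (lookup c)

  val-lift : ∀ {m} x (c : Vec V m) ps → val (x ∷ c) (map suc ps) ≡ val c ps
  val-lift x c ps = symm (map-∘ ps)

  record Base {m} (W : List V) (c : Vec V m) : Set where
    field
      inW : ∀ i → lookup c i ∈ W
      inj : ∀ {i j} → lookup c i ≡ lookup c j → i ≡ j
  open Base public

  Base-∷ : ∀ {m W x} {c : Vec V m} → Base W c → x ∈ W → x ∉ toList c → Base W (x ∷ c)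
  Base-∷ {c = c} B m n = record
    { inW = λ { zero → m ; (suc i) → inW B i }
    ; inj = λ { {zero} {zero} e → refl
              ; {zero} {suc j} e → ⊥-elim (n (subst (_∈ toList c) (symm e) (lookup∈toList c j)))
              ; {suc i} {zero} e → ⊥-elim (n (subst (_∈ toList c) e (lookup∈toList c i)))
              ; {suc i} {suc j} e → cong suc (inj B e) } }

  val-Unique : ∀ {m W} {c : Vec V m} → Base W c → ∀ {ps} → Unique ps → Unique (val c ps)
  val-Unique B u = UniqueP.map⁺ (inj B) u

  val-∈ : ∀ {m W} {c : Vec V m} → Base W c → ∀ ps → val c ps ⊆l W
  val-∈ {c = c} B ps m with ∈-map⁻ (lookup c) m
  ... | i , _ , refl = inW B i

  ⊆l-map : ∀ {A B : Set} (f : A → B) {xs ys} → xs ⊆l ys → map f xs ⊆l map f ys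
  ⊆l-map f h m with ∈-map⁻ f m
  ... | a , a∈ , refl = ∈-map⁺ f (h a∈)

  -- Connecting

  -- W is the set of free vertices; U also contains the ends of paths, on which tests may be performed.
  record Amb (U W : List V) (b : ℕ) : Set where
    field
      uW : Unique W
      gd : Good U W b
      WU : W ⊆l U
  open Amb public

  record End (U W X : List V) : Set where
    field
      XU : X ⊆l U
      uX : Unique X
      lX : length X ≡ t1
      CX : Clique X
      dX : ∀ {x} → x ∈ X → x ∉ W
  open End public

  -- `ps` is the part of the walk grown upwards from X, `ws` the part grown from Y towards it, and
  -- `K` a set of positions that is to become the next clique.
  record Sem (W X Y : List V) {m} (ps ws K : List (Fin m)) (c : Vec V m) : Set where
    field
      base : Base W c
      ppX  : PP (val c ps ++ X)
      ppY  : PP (Y ++ val c ws)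
      clK  : Clique (val c K)
  open Sem public

  module Conn {U W X Y : List V} {b e M : ℕ} (am : Amb U W b) (eX : End U W X) (eY : End U W Y)
    (mar : D * b + e + M ≤ length W) where

    room : ∀ {a c m} → length W ≤ a + c + m → m ≤ M → c ≤ D * b → e ≤ a
    room {a} {c} {m} h hm hc = lin 0 (+-mono-≤ (+-mono-≤ mar h) (+-mono-≤ hm hc)) (end-identity₁ e a c m M (D * b) (length W))

    -- The new vertex extends the top S of the walk and also v ∷ cc, where cc lies in S: the double
    -- extension that costs D bad sets. It occupies position 0, so all earlier positions are
    -- shifted.
    stepPick : ∀ {m ps ws K} S R v cc → ps ≡ S ++ R → length S ≡ t1 → Unique S → Unique (v ∷ cc) → length cc ≤ t2 →
      cc ⊆l S → K ⊆l (v ∷ cc) → m ≤ M → Rob W e m (Sem W X Y ps ws K) →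
      Rob W e (suc m) (Sem W X Y (zero ∷ map suc ps) (map suc ws) (zero ∷ map suc K))
    stepPick {m} {ps} {ws} {K} S R v cc eq lS uS uc lc cS Kc hm R0 =
      Rob-map snd (Rob-pick R0 (λ c x → okP W (toList c) (val c S) (lookup c v) (val c cc) x) cn)
      where
        cn : ∀ c → Sem W X Y ps ws K c → e ≤ cnt (okP W (toList c) (val c S) (lookup c v) (val c cc)) W
        cn c s = room (subst (λ z → length W ≤ cnt (okP W (toList c) (val c S) (lookup c v) (val c cc)) W + D * b + z) (length-toList c)
          (pickCount (gd am) (uW am) (toList c) (val c S) (lookup c v) (val c cc)
            (val-Unique (base s) uS) (λ q → WU am (val-∈ (base s) S q)) (≤-reflexive (length-map _ S ⟫ lS))
            (val-Unique (base s) uc) (λ q → WU am (val-∈ (base s) (v ∷ cc) q)) (≤-trans (≤-reflexive (length-map _ cc)) lc)))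
          hm ≤-refl
        snd : ∀ c' → _ → Sem W X Y (zero ∷ map suc ps) (map suc ws) (zero ∷ map suc K) c'
        snd (x ∷ c) (s , o) with okP-sound W (toList c) (val c S) (lookup c v) (val c cc) x (⊆l-map (lookup c) cS) o
        ... | x∈ , x∉ , eS , eC = record
          { base = Base-∷ (base s) x∈ x∉
          ; ppX = subst (λ z → PP (x ∷ z ++ X)) (symm (val-lift x c ps))
              (subst (λ z → Clique (x ∷ z)) (symm tk) (Clique-∷ clS eS) , ppX s)
          ; ppY = subst (λ z → PP (Y ++ z)) (symm (val-lift x c ws)) (ppY s)
          ; clK = subst (λ z → Clique (x ∷ z)) (symm (val-lift x c K))
              (Clique-∷ (clK s) (Ext-⊆ {S' = lookup c v ∷ val c cc} (⊆l-map (lookup c) Kc) eC)) }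
          where
            ve : val c ps ++ X ≡ val c S ++ (val c R ++ X)
            ve = cong (λ z → val c z ++ X) eq ⟫ cong (_++ X) (map-++ (lookup c) S R) ⟫ ++-assoc (val c S) (val c R) X
            lv : length (val c S) ≡ t1
            lv = length-map _ S ⟫ lS
            tk : take t1 (val c ps ++ X) ≡ val c S
            tk = cong (take t1) ve ⟫ take-exact (val c S) (val c R ++ X) t1 lv
            clS : Clique (val c S)
            clS = subst Clique tk (PP-take (val c ps ++ X) (ppX s))

    -- Later steps revisit and replace positions of the configuration, and the vertices of X are not
    -- among these; hence the walk first climbs T fresh vertices away from X.
    zsPlan : ∀ j → j ≤ M → ∃ λ (zs : List (Fin j)) → length zs ≡ j × Unique zs × Loc zs ×
      Rob W e j (Sem W X Y zs [] [])
    zsPlan zero h = [] , refl , [] , tt , record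
      { conf = λ _ → true
      ; sound = λ { [] _ → record { base = record { inW = λ () ; inj = λ { {()} } } ; ppX = PP-Clique X (CX eX)
                 ; ppY = PP-Clique (Y ++ []) (subst Clique (symm (++-identityʳ Y)) (CX eY)) ; clK = Clique-short [] z≤n } }
      ; many = ≤-refl }
    zsPlan (suc j) h with zsPlan j (≤-trans (n≤1+n j) h)
    ... | zs , l , u , lo , R0 = zero ∷ map suc zs , cong suc (length-map suc zs ⟫ l)
        , ∉⇒All≢ z∉ ∷ UniqueP.map⁺ (λ { refl → refl }) u
        , Loc-zero zs lo
        , Rob-map snd (Rob-pick R0 (λ c x → okS W (toList c) (S c) x) cn)
      where
        z∉ : zero ∉ map suc zs
        z∉ m with ∈-map⁻ suc m
        ... | _ , _ , ()
        S : Vec V j → List V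
        S c = take t1 (val c zs ++ X)
        cn : ∀ c → Sem W X Y zs [] [] c → e ≤ cnt (okS W (toList c) (S c)) W
        cn c s = room (subst (λ z → length W ≤ cnt (okS W (toList c) (S c)) W + bin t1 k1 * b + z) (length-toList c)
          (pickCountS (gd am) (uW am) (toList c) (S c)
            (UniqueP.take⁺ t1 (Unique-++ (val-Unique (base s) u) (uX eX) (λ m n → dX eX n (val-∈ (base s) zs m))))
            sub (≤-trans (≤-reflexive (length-take t1 (val c zs ++ X))) (m⊓n≤m t1 _))))
          (≤-trans (n≤1+n j) h) (*-monoˡ-≤ b bin≤D)
          where
            sub : S c ⊆l U
            sub m with ∈-++⁻ (val c zs) (∈-take t1 (val c zs ++ X) m)
            ... | inj₁ a = WU am (val-∈ (base s) zs a)
            ... | inj₂ a = XU eX a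
        snd : ∀ c' → _ → Sem W X Y (zero ∷ map suc zs) [] [] c'
        snd (x ∷ c) (s , o) with okS-sound W (toList c) (S c) x o
        ... | x∈ , x∉ , eS = record
          { base = Base-∷ (base s) x∈ x∉
          ; ppX = subst (λ z → PP (x ∷ z ++ X)) (symm (val-lift x c zs))
              (Clique-∷ (PP-take _ (ppX s)) eS , ppX s)
          ; ppY = ppY s
          ; clK = Clique-short [] z≤n }

    wsPlan : ∀ j → j ≤ T → T + j ≤ M → ∃ λ m → ∃ λ (zs : List (Fin m)) → ∃ λ (ws : List (Fin m)) →
      m ≡ T + j × length zs ≡ T × length ws ≡ j × Unique (zs ++ ws) × Loc zs × Rob W e m (Sem W X Y zs ws [])
    wsPlan zero hj h with zsPlan T (≤-trans (≤-reflexive (symm (+-identityʳ T))) h)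
    ... | zs , l , u , lo , R0 = T , zs , [] , symm (+-identityʳ T) , l , refl , subst Unique (symm (++-identityʳ zs)) u , lo , R0
    wsPlan (suc j) hj h with wsPlan j (≤-trans (n≤1+n j) hj) (≤-trans (+-monoʳ-≤ T (n≤1+n j)) h)
    ... | m , zs , ws , me , lz , lw , u , lo , R0 = suc m , map suc zs , map suc ws ++ zero ∷ []
        , (cong suc me ⟫ symm (+-suc T j)) , (length-map suc zs ⟫ lz)
        , (length-++ (map suc ws) ⟫ +-comm _ 1 ⟫ cong suc (length-map suc ws ⟫ lw))
        , uu , Loc-lift zs lo
        , Rob-map snd (Rob-pick R0 (λ c x → okS W (toList c) (S c) x) cn)
      where
        uu : Unique (map suc zs ++ map suc ws ++ zero ∷ [])
        uu = subst Unique (cong (_++ zero ∷ []) (map-++ suc zs ws) ⟫ ++-assoc (map suc zs) (map suc ws) (zero ∷ []))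
          (Unique-++ (UniqueP.map⁺ (λ { refl → refl }) u) ([] ∷ []) z∉)
          where
            z∉ : ∀ {x} → x ∈ map suc (zs ++ ws) → x ∉ zero ∷ []
            z∉ q (here refl) with ∈-map⁻ suc q
            ... | _ , _ , ()
        S : Vec V m → List V
        S c = drop j Y ++ val c ws
        yse : ∀ c → take j Y ++ S c ≡ Y ++ val c ws
        yse c = symm (++-assoc (take j Y) (drop j Y) (val c ws)) ⟫ cong (_++ val c ws) (take++drop≡id j Y)
        lS : ∀ c → length (S c) ≡ t1
        lS c = length-++ (drop j Y) ⟫ cong₂ _+_ (length-drop j Y ⟫ cong (_∸ j) (lX eY)) (length-map _ ws ⟫ lw) ⟫ m∸n+n≡m (≤-pred hj)
        uS : ∀ {c} → Sem W X Y zs ws [] c → Unique (S c)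
        uS s = Unique-++ (UniqueP.drop⁺ j (uX eY)) (val-Unique (base s) (Unique-++ʳ zs u))
          (λ a b → dX eY (∈-drop a) (val-∈ (base s) ws b))
          where ∈-drop : ∀ {z} → z ∈ drop j Y → z ∈ Y
                ∈-drop {z} q = subst (z ∈_) (take++drop≡id j Y) (∈-++⁺ʳ (take j Y) q)
        cn : ∀ c → Sem W X Y zs ws [] c → e ≤ cnt (okS W (toList c) (S c)) W
        cn c s = room (subst (λ z → length W ≤ cnt (okS W (toList c) (S c)) W + bin t1 k1 * b + z) (length-toList c)
          (pickCountS (gd am) (uW am) (toList c) (S c) (uS s) sub (≤-reflexive (lS c))))
          (≤-trans (≤-reflexive me) (≤-trans (+-monoʳ-≤ T (n≤1+n j)) h)) (*-monoˡ-≤ b bin≤D)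
          where
            sub : S c ⊆l U
            sub q with ∈-++⁻ (drop j Y) q
            ... | inj₁ a = XU eY (subst (_ ∈_) (take++drop≡id j Y) (∈-++⁺ʳ (take j Y) a))
            ... | inj₂ a = WU am (val-∈ (base s) ws a)
        snd : ∀ c' → _ → Sem W X Y (map suc zs) (map suc ws ++ zero ∷ []) [] c'
        snd (x ∷ c) (s , o) with okS-sound W (toList c) (S c) x o
        ... | x∈ , x∉ , eS = record
          { base = Base-∷ (base s) x∈ x∉
          ; ppX = subst (λ z → PP (z ++ X)) (symm (val-lift x c zs)) (ppX s)
          ; ppY = subst PP eqY (PP-snoc (take j Y) (S c) x pS (≤-reflexive (lS c)) (inj₁ (lS c)) (Clique-∷ clS eS))
          ; clK = Clique-short [] z≤n }
          where
            pS : PP (take j Y ++ S c)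
            pS = subst PP (symm (yse c)) (ppY s)
            clS : Clique (S c)
            clS = PP-window (S c) (subst PP (symm (++-identityʳ (S c))) (PP-++ʳ (take j Y) pS)) (≤-trans (≤-reflexive (lS c)) (n≤1+n t1))
            eqY : take j Y ++ S c ++ x ∷ [] ≡ Y ++ val (x ∷ c) (map suc ws ++ zero ∷ [])
            eqY = symm (++-assoc (take j Y) (S c) (x ∷ [])) ⟫ cong (_++ x ∷ []) (yse c)
                ⟫ ++-assoc Y (val c ws) (x ∷ [])
                ⟫ cong (Y ++_) (symm (map-++ (lookup (x ∷ c)) (map suc ws) (zero ∷ []) ⟫ cong (_++ x ∷ []) (val-lift x c ws)))

  -- One turn around the clique on us, u and dn, in which w takes the place of u on return. The top
  -- window is the clique on us, w and dn; all other new windows lie in the old clique.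
  PP-rot : ∀ us u dn w R → length (us ++ u ∷ dn) ≡ T → PP ((us ++ u ∷ dn) ++ R) → Clique (us ++ w ∷ dn) →
    PP (w ∷ (dn ++ us) ++ u ∷ dn ++ R)
  PP-rot us u dn w R l p C = Clique-⊆ sub C , subst PP eq
      (PP-within dn (us ++ u ∷ dn) R (PP-window (us ++ u ∷ dn) p (≤-reflexive l)) (λ m → ∈-++⁺ʳ us (there m)) (λ m → m)
        (≤-trans (n≤1+n t1) (≤-reflexive (symm l))) p)
    where
      eq : dn ++ (us ++ u ∷ dn) ++ R ≡ (dn ++ us) ++ u ∷ dn ++ R
      eq = cong (dn ++_) (++-assoc us (u ∷ dn) R) ⟫ symm (++-assoc dn us (u ∷ dn ++ R))
      ld : length (dn ++ us) ≡ t1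
      ld = length-++ dn ⟫ +-comm (length dn) (length us)
         ⟫ suc-injective (symm (length-++ us ⟫ +-suc (length us) (length dn)) ⟫ l)
      sub : (w ∷ take t1 ((dn ++ us) ++ u ∷ dn ++ R)) ⊆l (us ++ w ∷ dn)
      sub (here refl) = ∈-++⁺ʳ us (here refl)
      sub (there m) with ∈-++⁻ dn (subst (_ ∈_) (take-exact (dn ++ us) (u ∷ dn ++ R) t1 ld) m)
      ... | inj₁ a = ∈-++⁺ʳ us (there a)
      ... | inj₂ a = ∈-++⁺ˡ a

  Loc-rotate : ∀ {m} (us : List (Fin m)) u dn w rest → length (dn ++ us) ≡ t1 →
    Unique (dn ++ us ++ u ∷ []) → w ∉ dn ++ us →
    Loc ((us ++ u ∷ dn) ++ rest) → Loc (w ∷ (dn ++ us) ++ u ∷ dn ++ rest)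
  Loc-rotate us u dn w rest ld uq w∉ lo = Loc-visit w (dn ++ us) (u ∷ dn ++ rest) ld w∉ (subst Loc eq2 rec)
    where
      idr : dn ++ (us ++ u ∷ []) ++ [] ≡ dn ++ us ++ u ∷ []
      idr = cong (dn ++_) (++-identityʳ (us ++ u ∷ []))
      eq1 : (us ++ u ∷ dn) ++ rest ≡ (us ++ u ∷ []) ++ dn ++ rest
      eq1 = ++-assoc us (u ∷ dn) rest ⟫ symm (++-assoc us (u ∷ []) (dn ++ rest))
      eq2 : dn ++ (us ++ u ∷ []) ++ dn ++ rest ≡ (dn ++ us) ++ u ∷ dn ++ rest
      eq2 = cong (dn ++_) (++-assoc us (u ∷ []) (dn ++ rest)) ⟫ symm (++-assoc dn us (u ∷ dn ++ rest))
      rec : Loc (dn ++ (us ++ u ∷ []) ++ dn ++ rest)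
      rec = Loc-rot [] dn (us ++ u ∷ []) rest
        (cong length (idr ⟫ symm (++-assoc dn us (u ∷ []))) ⟫ length-++ (dn ++ us) ⟫ +-comm _ 1 ⟫ cong suc ld)
        (subst Unique (symm idr) uq) (subst Loc eq1 lo)

  module Conn2 {U W X Y : List V} {b e M : ℕ} (am : Amb U W b) (eX : End U W X) (eY : End U W Y)
    (mar : D * b + e + M ≤ length W) (NB : ℕ) where
    open Conn am eX eY mar

    record Plan : Set where
      constructor mkPlan
      field
        {pm} : ℕ
        path : List (Fin pm)
        pm≤  : pm ≤ M
        pN≤  : length path ≤ NB
        loc  : Loc path
        rob  : Rob W e pm (λ c → Base W c × PP (Y ++ val c path ++ X))

    Rob-eq : ∀ {m} {ps ps' ws ws' K K' : List (Fin m)} → ps ≡ ps' → ws ≡ ws' → K ≡ K' →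
      Rob W e m (Sem W X Y ps ws K) → Rob W e m (Sem W X Y ps' ws' K')
    Rob-eq refl refl refl R = R

    ws-lift : ∀ {m} (tds : List (Fin m)) w dn →
      map Fin.suc (reverse tds ++ w ∷ dn) ≡ reverse (map suc tds) ++ suc w ∷ map suc dn
    ws-lift tds w dn = map-++ suc (reverse tds) (w ∷ dn) ⟫ cong (_++ suc w ∷ map suc dn) (reverse-map suc tds)

    eqU : ∀ {m} (P us : List (Fin m)) o R → (P ++ us ++ o ∷ []) ++ R ≡ (P ++ us) ++ o ∷ R
    eqU P us o R = cong (_++ R) (symm (++-assoc P us (o ∷ []))) ⟫ ++-assoc (P ++ us) (o ∷ []) R

    eqL : ∀ {m} (P us : List (Fin m)) o R →
      map Fin.suc ((P ++ us ++ o ∷ []) ++ R) ≡ (map suc P ++ map suc us) ++ suc o ∷ map suc R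
    eqL P us o R = cong (map suc) (eqU P us o R) ⟫ map-++ suc (P ++ us) (o ∷ R)
      ⟫ cong (_++ suc o ∷ map suc R) (map-++ suc P us)

    mutual
      -- `dn` are the targets already reached, `w` is the target that now replaces `u`, `tds` are
      -- the targets still to come, and `us` are clique vertices that are not targets. Once `us` is
      -- empty, the clique is the target itself in its prescribed order and the walk meets the path
      -- from Y.
      stage : ∀ n {m} (tds us : List (Fin m)) u dn w rest →
        length tds ≡ n → length us ≡ n → length us + suc (length dn) ≡ T →
        Unique (us ++ u ∷ reverse tds ++ w ∷ dn) → Loc ((us ++ u ∷ dn) ++ rest) →
        m + n * T ≤ M → T + length rest + suc n * (T + T) ≤ NB →
        Rob W e m (Sem W X Y ((us ++ u ∷ dn) ++ rest) (reverse tds ++ w ∷ dn) (us ++ w ∷ dn)) → Plan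
      stage n {m} tds us u dn w rest lt lu lA uq lo bm bN R0 = go n tds (snocView us) lt lu lA uq lo1 bm bN R1
        where
          bs : Vec (List (Fin m)) 5
          bs = us ∷ (u ∷ []) ∷ reverse tds ∷ (w ∷ []) ∷ dn ∷ []
          all5 = # 0 ∷ # 1 ∷ # 2 ∷ # 3 ∷ # 4 ∷ []
          lA' : length (us ++ u ∷ dn) ≡ T
          lA' = length-++ us ⟫ lA
          ld : length (dn ++ us) ≡ t1
          ld = length-++ dn ⟫ +-comm (length dn) (length us) ⟫ suc-injective (symm (+-suc (length us) (length dn)) ⟫ lA)
          w∉ : w ∉ dn ++ us
          w∉ with cat-Unique bs all5 (# 3 ∷ # 4 ∷ # 0 ∷ []) uq refl refl
          ... | a ∷ _ = All≢⇒∉ a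
          lo1 : Loc (w ∷ (dn ++ us) ++ u ∷ dn ++ rest)
          lo1 = Loc-rotate us u dn w rest ld (cat-Unique bs all5 (# 4 ∷ # 0 ∷ # 1 ∷ []) uq refl refl) w∉ lo
          ps1 = w ∷ (dn ++ us) ++ u ∷ dn ++ rest
          R1 : Rob W e m (Sem W X Y ps1 (reverse tds ++ w ∷ dn) [])
          R1 = Rob-map f R0
            where
              f : ∀ c → Sem W X Y ((us ++ u ∷ dn) ++ rest) (reverse tds ++ w ∷ dn) (us ++ w ∷ dn) c → Sem W X Y ps1 (reverse tds ++ w ∷ dn) [] c
              f c s = record { base = base s ; ppY = ppY s ; clK = Clique-short [] z≤n
                ; ppX = subst PP (symm e2) (PP-rot (v us) (lookup c u) (v dn) (lookup c w) (v rest ++ X)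
                    (symm (cong length (map-++ (lookup c) us (u ∷ dn))) ⟫ length-map (lookup c) (us ++ u ∷ dn) ⟫ lA')
                    (subst PP e1 (ppX s))
                    (subst Clique (map-++ (lookup c) us (w ∷ dn)) (clK s))) }
                where
                  v = val c
                  e1 : v ((us ++ u ∷ dn) ++ rest) ++ X ≡ (v us ++ lookup c u ∷ v dn) ++ v rest ++ X
                  e1 = cong (_++ X) (map-++ (lookup c) (us ++ u ∷ dn) rest ⟫ cong (_++ v rest) (map-++ (lookup c) us (u ∷ dn)))
                     ⟫ ++-assoc (v us ++ lookup c u ∷ v dn) (v rest) X
                  e2 : v ps1 ++ X ≡ lookup c w ∷ (v dn ++ v us) ++ lookup c u ∷ v dn ++ v rest ++ X
                  e2 = cong (λ z → lookup c w ∷ z) (cong (_++ X) (map-++ (lookup c) (dn ++ us) (u ∷ dn ++ rest)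
                        ⟫ cong₂ (λ p q → p ++ lookup c u ∷ q) (map-++ (lookup c) dn us) (map-++ (lookup c) dn rest))
                     ⟫ ++-assoc (v dn ++ v us) (lookup c u ∷ v dn ++ v rest) X
                     ⟫ cong (λ z → (v dn ++ v us) ++ lookup c u ∷ z) (++-assoc (v dn) (v rest) X))
          go : ∀ n tds {us} → Snoc us → length tds ≡ n → length us ≡ n → length us + suc (length dn) ≡ T →
            Unique (us ++ u ∷ reverse tds ++ w ∷ dn) → Loc (w ∷ (dn ++ us) ++ u ∷ dn ++ rest) →
            m + n * T ≤ M → T + length rest + suc n * (T + T) ≤ NB →
            Rob W e m (Sem W X Y (w ∷ (dn ++ us) ++ u ∷ dn ++ rest) (reverse tds ++ w ∷ dn) []) → Plan
          go zero [] nil lt lu lA uq lo bm bN R = mkPlan (w ∷ (dn ++ []) ++ u ∷ dn ++ rest)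
              (≤-trans (m≤m+n m 0) bm) lenb lo (Rob-map f R)
            where
              lenb : suc (length ((dn ++ []) ++ u ∷ dn ++ rest)) ≤ NB
              lenb = ≤-trans (≤-reflexive (cong suc (length-++ (dn ++ []) ⟫ cong₂ _+_ (cong length (++-identityʳ dn)) (cong suc (length-++ dn)))))
                (≤-trans (lin T (+-mono-≤ (≤-reflexive lA) (≤-reflexive lA)) (connect-identity₁ (length dn) (length rest) T)) bN)
              f : ∀ c → Sem W X Y (w ∷ (dn ++ []) ++ u ∷ dn ++ rest) (w ∷ dn) [] c →
                  Base W c × PP (Y ++ val c (w ∷ (dn ++ []) ++ u ∷ dn ++ rest) ++ X)
              f c s = base s , subst (λ z → PP (Y ++ z)) (symm e3)
                  (PP-glue Y (val c (w ∷ dn)) (≤-trans (n≤1+n t1) (≤-reflexive (symm (length-map _ (w ∷ dn) ⟫ lA)))) (ppY s)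
                     (subst PP e3 (ppX s)))
                where
                  e3 : val c (w ∷ (dn ++ []) ++ u ∷ dn ++ rest) ++ X ≡ val c (w ∷ dn) ++ (val c (u ∷ dn ++ rest) ++ X)
                  e3 = cong (λ z → val c (w ∷ z ++ u ∷ dn ++ rest) ++ X) (++-identityʳ dn)
                     ⟫ cong (_++ X) (map-++ (lookup c) (w ∷ dn) (u ∷ dn ++ rest)) ⟫ ++-assoc (val c (w ∷ dn)) _ X
          go (suc n) (w' ∷ tds') (snoc us0 o) lt lu lA uq lo bm bN R =
            -- A fresh vertex replaces the oldest vertex `o` and takes the role of `u` for the next
            -- target w'; the vertices of `us0` are renewed afterwards.
            inner n (length us0) (map suc tds') [] (map suc us0) zero (suc w ∷ map suc dn) (suc w') (suc o ∷ map suc (u ∷ dn ++ rest))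
              (length-map suc tds' ⟫ suc-injective lt) (length-map suc us0) lu0
              lA1 uq1 (subst Loc eqP (Loc-zero _ lo)) bm1 bN1
              (Rob-eq eqP eqW refl (Rob-map clw (stepPick ((w ∷ dn) ++ us0) (o ∷ u ∷ dn ++ rest) w' [] (eqU (w ∷ dn) us0 o (u ∷ dn ++ rest))
                 lS (cat-Unique bs7 all7 (# 5 ∷ # 6 ∷ # 0 ∷ []) uq7 refl refl) ([] ∷ []) z≤n (λ ()) (λ ())
                 (≤-trans (m≤m+n m _) bm) R)))
            where
              lu0 : length us0 ≡ n
              lu0 = suc-injective (symm (length-++ us0 ⟫ +-comm (length us0) 1) ⟫ lu)
              lA0 : suc (length us0) + suc (length dn) ≡ T
              lA0 = symm (cong (_+ suc (length dn)) (length-++ us0 ⟫ +-comm (length us0) 1)) ⟫ lA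
              lA1 : suc (suc (length (map Fin.suc dn)) + length us0) ≡ T
              lA1 = cong (λ z → suc (suc z + length us0)) (length-map suc dn) ⟫ connect-identity₂ (length dn) (length us0) ⟫ lA0
              lS : suc (length (dn ++ us0)) ≡ t1
              lS = cong suc (length-++ dn) ⟫ suc-injective (connect-identity₃ (length dn) (length us0) ⟫ lA0)
              bs7 : Vec (List (Fin m)) 7
              bs7 = us0 ∷ (o ∷ []) ∷ (u ∷ []) ∷ reverse tds' ∷ (w' ∷ []) ∷ (w ∷ []) ∷ dn ∷ []
              all7 = # 0 ∷ # 1 ∷ # 2 ∷ # 3 ∷ # 4 ∷ # 5 ∷ # 6 ∷ []
              eqW0 : reverse (w' ∷ tds') ++ w ∷ dn ≡ reverse tds' ++ w' ∷ w ∷ dn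
              eqW0 = cong (_++ w ∷ dn) (unfold-reverse w' tds') ⟫ ++-assoc (reverse tds') (w' ∷ []) (w ∷ dn)
              uq7 : Unique (cat bs7 all7)
              uq7 = subst Unique (++-assoc us0 (o ∷ []) _ ⟫ cong (λ z → us0 ++ o ∷ u ∷ z) eqW0) uq
              uq1 : Unique (zero ∷ map suc us0 ++ reverse (map suc tds') ++ suc w' ∷ suc w ∷ map suc dn)
              uq1 = subst (λ z → Unique (zero ∷ z)) (map-++ suc us0 (reverse tds' ++ w' ∷ w ∷ dn) ⟫ cong (map suc us0 ++_) (ws-lift tds' w' (w ∷ dn)))
                (Unique-zero (cat-Unique bs7 all7 (# 0 ∷ # 3 ∷ # 4 ∷ # 5 ∷ # 6 ∷ []) uq7 refl refl))
              eqP : zero ∷ map Fin.suc (w ∷ (dn ++ us0 ++ o ∷ []) ++ u ∷ dn ++ rest)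
                  ≡ (zero ∷ (suc w ∷ map suc dn) ++ map suc us0) ++ suc o ∷ map suc (u ∷ dn ++ rest)
              eqP = cong (zero ∷_) (eqL (w ∷ dn) us0 o (u ∷ dn ++ rest))
              eqW : map Fin.suc (reverse (w' ∷ tds') ++ w ∷ dn) ≡ reverse (map suc tds') ++ suc w' ∷ suc w ∷ map suc dn
              eqW = cong (map suc) eqW0 ⟫ ws-lift tds' w' (w ∷ dn)
              lW : length (reverse (w' ∷ tds') ++ w ∷ dn) ≡ T
              lW = length-++ (reverse (w' ∷ tds')) ⟫ cong (_+ suc (length dn)) (length-reverse (w' ∷ tds') ⟫ lt ⟫ cong suc (symm lu0)) ⟫ lA0
              clw : ∀ c → Sem W X Y (zero ∷ map suc (w ∷ (dn ++ us0 ++ o ∷ []) ++ u ∷ dn ++ rest)) (map suc (reverse (w' ∷ tds') ++ w ∷ dn)) (zero ∷ []) c →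
                    Sem W X Y (zero ∷ map suc (w ∷ (dn ++ us0 ++ o ∷ []) ++ u ∷ dn ++ rest)) (map suc (reverse (w' ∷ tds') ++ w ∷ dn)) (suc w' ∷ suc w ∷ map suc dn) c
              clw c s = record { base = base s ; ppX = ppX s ; ppY = ppY s
                ; clK = Clique-⊆ (⊆l-map (lookup c) sub) (PP-window _ (subst PP (symm (++-identityʳ _)) (PP-++ʳ Y (ppY s)))
                    (≤-reflexive (length-map (lookup c) (map Fin.suc (reverse (w' ∷ tds') ++ w ∷ dn)) ⟫ length-map Fin.suc (reverse (w' ∷ tds') ++ w ∷ dn) ⟫ lW))) }
                where sub : (suc w' ∷ suc w ∷ map suc dn) ⊆l map suc (reverse (w' ∷ tds') ++ w ∷ dn)
                      sub q = subst (_ ∈_) (symm eqW) (∈-++⁺ʳ (reverse (map suc tds')) q)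
              bm1 : suc m + length us0 + n * T ≤ M
              bm1 = ≤-trans (lin (suc (length dn)) (≤-reflexive lA0) (connect-identity₄ m (length us0) n T (length dn))) bm
              bN1 : T + suc (length (map Fin.suc (u ∷ dn ++ rest))) + length us0 + suc n * (T + T) ≤ NB
              bN1 = ≤-trans (≤-reflexive (cong (λ z → T + suc z + length us0 + suc n * (T + T)) (length-map suc (u ∷ dn ++ rest) ⟫ cong suc (length-++ dn))))
                (≤-trans (lin T (≤-reflexive lA0) (connect-identity₅ T (length dn) (length rest) (length us0) n)) bN)
          go zero (_ ∷ _) _ () _ _ _ _ _ _ _
          go (suc n) [] _ () _ _ _ _ _ _ _
          go zero _ (snoc us0 o) lt lu _ _ _ _ _ _ with () ← symm (length-++ us0 ⟫ +-comm (length us0) 1) ⟫ lu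

      -- The old vertices `us0` need not form a clique with w. They are exchanged one at a time for
      -- vertices `xs` that extend the walk and also form a clique with w and dn; the two (t-1)-sets
      -- tested, u with cc and w with cc, differ in one vertex.
      inner : ∀ n j {m} (tds xs us0 : List (Fin m)) u dn w rest →
        length tds ≡ n → length us0 ≡ j → length xs + j ≡ n → length xs + suc (length dn + j) ≡ T →
        Unique (xs ++ u ∷ us0 ++ reverse tds ++ w ∷ dn) → Loc ((xs ++ u ∷ dn ++ us0) ++ rest) →
        m + j + n * T ≤ M → T + length rest + j + suc n * (T + T) ≤ NB →
        Rob W e m (Sem W X Y ((xs ++ u ∷ dn ++ us0) ++ rest) (reverse tds ++ w ∷ dn) (xs ++ w ∷ dn)) → Plan
      inner n zero tds xs (_ ∷ _) u dn w rest lt () lx lA uq lo bm bN R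
      inner n zero {m} tds xs [] u dn w rest lt l0 lx lA uq lo bm bN R =
        stage n tds xs u dn w rest lt (symm (+-identityʳ _) ⟫ lx) (cong (λ z → length xs + suc z) (symm (+-identityʳ _)) ⟫ lA) uq
          (subst Loc eq lo) (≤-trans (≤-reflexive (cong (_+ n * T) (symm (+-identityʳ m)))) bm)
          (≤-trans (≤-reflexive (cong (_+ suc n * (T + T)) (symm (+-identityʳ (T + length rest))))) bN)
          (Rob-eq eq refl refl R)
        where eq : (xs ++ u ∷ dn ++ []) ++ rest ≡ (xs ++ u ∷ dn) ++ rest
              eq = cong (λ z → (xs ++ u ∷ z) ++ rest) (++-identityʳ dn)
      inner n (suc j) {m} tds xs us0 u dn w rest lt l0 lx lA uq lo bm bN R with snocView us0
      inner n (suc j) {m} tds xs .[] u dn w rest lt () lx lA uq lo bm bN R | nil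
      inner n (suc j) {m} tds xs .(us1 ++ o ∷ []) u dn w rest lt l0 lx lA uq lo bm bN R | snoc us1 o =
        inner n j (map suc tds) (zero ∷ map suc xs) (map suc us1) (suc u) (map suc dn) (suc w) (suc o ∷ map suc rest)
          (length-map suc tds ⟫ lt) (length-map suc us1 ⟫ l1)
          (cong (λ z → suc z + j) (length-map suc xs) ⟫ symm (+-suc (length xs) j) ⟫ lx)
          (cong₂ (λ y z → suc y + suc (z + j)) (length-map suc xs) (length-map suc dn) ⟫ connect-identity₆ (length xs) (length dn) j ⟫ lA)
          uq1 (subst Loc eqP (Loc-zero _ lo))
          (≤-trans (≤-reflexive (cong (_+ n * T) (symm (+-suc m j)))) bm)
          (≤-trans (≤-reflexive (cong (λ z → T + suc z + j + suc n * (T + T)) (length-map suc rest) ⟫ connect-identity₇ T (length rest) j (suc n * (T + T)))) bN)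
          (Rob-eq eqP (ws-lift tds w dn) (cong (zero ∷_) (map-++ suc xs (w ∷ dn)))
            (stepPick S (o ∷ rest) w cc eqS lS (cat-Unique bs all6 (# 0 ∷ # 1 ∷ # 6 ∷ # 2 ∷ []) uq7 refl refl)
               (cat-Unique bs all6 (# 5 ∷ # 0 ∷ # 6 ∷ # 2 ∷ []) uq7 refl refl) (≤-reflexive lc)
               (cat-⊆ bs (# 0 ∷ # 6 ∷ # 2 ∷ []) (# 0 ∷ # 1 ∷ # 6 ∷ # 2 ∷ []) refl)
               (cat-⊆ bs (# 0 ∷ # 5 ∷ # 6 ∷ []) (# 5 ∷ # 0 ∷ # 6 ∷ # 2 ∷ []) refl)
               (≤-trans (m≤m+n m _) (≤-trans (m≤m+n (m + suc j) _) bm)) R))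
        where
          l1 : length us1 ≡ j
          l1 = suc-injective (symm (length-++ us1 ⟫ +-comm (length us1) 1) ⟫ l0)
          bs : Vec (List (Fin m)) 7
          bs = xs ∷ (u ∷ []) ∷ us1 ∷ (o ∷ []) ∷ reverse tds ∷ (w ∷ []) ∷ dn ∷ []
          all6 = # 0 ∷ # 1 ∷ # 2 ∷ # 3 ∷ # 4 ∷ # 5 ∷ # 6 ∷ []
          uq7 : Unique (cat bs all6)
          uq7 = subst (λ z → Unique (xs ++ u ∷ z)) (++-assoc us1 (o ∷ []) _) uq
          S = xs ++ u ∷ dn ++ us1
          cc = xs ++ dn ++ us1
          eqS : (xs ++ u ∷ dn ++ us1 ++ o ∷ []) ++ rest ≡ S ++ o ∷ rest
          eqS = cong (_++ rest) (symm (++-assoc xs (u ∷ dn) (us1 ++ o ∷ []))) ⟫ eqU (xs ++ u ∷ dn) us1 o rest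
              ⟫ cong (_++ o ∷ rest) (++-assoc xs (u ∷ dn) us1)
          eqP : zero ∷ map Fin.suc ((xs ++ u ∷ dn ++ us1 ++ o ∷ []) ++ rest)
              ≡ (zero ∷ map suc xs ++ suc u ∷ map suc dn ++ map suc us1) ++ suc o ∷ map suc rest
          eqP = cong (zero ∷_) (cong (map suc) eqS ⟫ map-++ suc S (o ∷ rest) ⟫ cong (_++ suc o ∷ map suc rest)
                  (map-++ suc xs (u ∷ dn ++ us1) ⟫ cong (λ z → map suc xs ++ suc u ∷ z) (map-++ suc dn us1)))
          lcc : length S ≡ suc (length cc)
          lcc = length-++ xs ⟫ +-suc (length xs) _ ⟫ cong suc (symm (length-++ xs))
          lS : length S ≡ t1
          lS = suc-injective (cong suc (length-++ xs ⟫ cong (λ z → length xs + suc z) (length-++ dn ⟫ cong (length dn +_) l1)) ⟫ connect-identity₆ (length xs) (length dn) j ⟫ lA)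
          lc : length cc ≡ t2
          lc = suc-injective (symm lcc ⟫ lS)
          uq1 : Unique (zero ∷ map suc xs ++ suc u ∷ map suc us1 ++ reverse (map suc tds) ++ suc w ∷ map suc dn)
          uq1 = subst (λ z → Unique (zero ∷ z)) (map-++ suc xs (u ∷ us1 ++ reverse tds ++ w ∷ dn)
                  ⟫ cong (λ z → map suc xs ++ suc u ∷ z) (map-++ suc us1 (reverse tds ++ w ∷ dn) ⟫ cong (map suc us1 ++_) (ws-lift tds w dn)))
                (Unique-zero (cat-Unique bs all6 (# 0 ∷ # 1 ∷ # 2 ∷ # 4 ∷ # 5 ∷ # 6 ∷ []) uq7 refl refl))

  connPlan : ∀ {U W X Y b e} (am : Amb U W b) (eX : End U W X) (eY : End U W Y)
    (mar : D * b + e + MC ≤ length W) → Conn2.Plan am eX eY mar NC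
  connPlan {U} {W} {X} {Y} {b} {e} am eX eY mar =
    let m , zs , ws , me , lz , lw , u , lo , R = Conn.wsPlan am eX eY mar T ≤-refl
                                                    (≤-trans (≤-trans (m≤m+n (T + T) t1) (m≤m+n (T + T + t1) (t1 * T))) (≤-reflexive (symm MC-def)))
    in go me zs (snocView ws) lz lw u lo R
    where
      open Conn2 am eX eY mar NC
      go : ∀ {m} → m ≡ T + T → (zs : List (Fin m)) → ∀ {ws} → Snoc ws → length zs ≡ T → length ws ≡ T → Unique (zs ++ ws) → Loc zs →
        Rob W e m (Sem W X Y zs ws []) → Plan
      go me (z ∷ us) (snoc ws' w) lz lw u lo R = inner t1 t1 (reverse ws') [] us z [] w []
        (length-reverse ws' ⟫ suc-injective (symm (length-++ ws' ⟫ +-comm (length ws') 1) ⟫ lw))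
        (suc-injective lz) refl refl
        (subst (λ r → Unique (z ∷ us ++ r ++ w ∷ [])) (symm (reverse-involutive ws')) u)
        (subst Loc (symm (++-identityʳ (z ∷ us))) lo)
        (≤-reflexive (cong (λ y → y + t1 + t1 * T) me ⟫ symm MC-def))
        (≤-reflexive (symm NC-def))
        (Rob-eq (symm (++-identityʳ (z ∷ us))) (cong (_++ w ∷ []) (symm (reverse-involutive ws'))) refl
          (Rob-map (λ c s → record { base = base s ; ppX = ppX s ; ppY = ppY s ; clK = Clique-short _ (s≤s z≤n) }) R))

  Link : List V → List V → List V → Set
  Link W X Y = ∃ λ ps → Unique ps × ps ⊆l W × length ps ≤ NC × PP (Y ++ ps ++ X)

  Connects : ℕ → ℕ → Set
  Connects q w₀ = ∀ {U W X Y b e} → Amb U W b → End U W X → End U W Y →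
    D * b + e ≤ length W → length W ≤ q * e → w₀ ≤ length W → Link W X Y

  -- MC is taken off e to pay for avoiding the positions chosen before. The at least (e - MC)^m
  -- configurations of the plan outnumber the NC^2·w^(m-1) that `walk` may lose, so the walk is
  -- realised by distinct vertices.
  connect′ : ∀ q → Connects q (connW q)
  connect′ q {U} {W} {X} {Y} {b} {e} am eX eY h1 h2 h3′ = fin (connPlan am eX eY mar)
        where
          Q = q + q
          h3 : suc (NC * NC * suc Q ^ MC + q * (MC + MC)) ≤ length W
          h3 = ≤-trans (≤-reflexive (symm (connW-def q))) h3′
          w = length W
          2M<e : MC + MC < e
          2M<e = *-canc-< q (<-≤-trans (≤-trans (s≤s (m≤n+m _ _)) h3) h2)
          e' = e ∸ MC
          ee : e' + MC ≡ e
          ee = m∸n+n≡m (≤-trans (m≤m+n MC MC) (<⇒≤ 2M<e))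
          mar : D * b + e' + MC ≤ length W
          mar = ≤-trans (≤-reflexive (+-assoc (D * b) e' MC ⟫ cong (D * b +_) ee)) h1
          M≤e' : MC ≤ e'
          M≤e' = +-cancelʳ-≤ MC MC e' (≤-trans (<⇒≤ 2M<e) (≤-reflexive (symm ee)))
          hQ : w ≤ suc Q * e'
          hQ = ≤-trans h2 (≤-trans (≤-reflexive (cong (q *_) (symm ee))) (≤-trans (*-monoʳ-≤ q (+-monoʳ-≤ e' M≤e'))
                 (≤-trans (≤-reflexive (l q e')) (m≤n+m _ e'))))
            where l : ∀ q e → q * (e + e) ≡ (q + q) * e
                  l = solve-∀
          fin : Conn2.Plan am eX eY mar NC → Link W X Y
          fin (Conn2.mkPlan {zero} [] _ _ _ r) with ΣV-pos {W = W} zero (Rob.conf r) (Rob.many r)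
          ... | [] , _ , ec = [] , [] , (λ ()) , z≤n , proj₂ (Rob.sound r [] ec)
          fin (Conn2.mkPlan {suc m} ps pm pN lo r)
            with walk {X = X} {NC} {λ _ _ → ⊤} (uW am) ps (Rob.conf r)
              (λ c ec → inW (proj₁ (Rob.sound r c ec))) (λ _ _ _ → tt)
              (λ c ec → PP-++ʳ Y (proj₂ (Rob.sound r c ec))) lo pN
              (<-≤-trans (≤-<-trans (≤-trans (*-monoˡ-≤ (NC * w ^ m) pN) (≤-reflexive (symm (*-assoc NC NC (w ^ m)))))
                 (power-room (suc Q) e' w m (NC * NC) hQ
                   (≤-trans (s≤s (≤-trans (*-monoʳ-≤ (NC * NC) (^-monoʳ-≤ (suc Q) pm)) (m≤m+n _ _))) h3)))
                 (Rob.many r))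
          ... | c , vs , ec , pw , uv , sv , pv , tk = vs , uv , sv
              , ≤-trans (≤-reflexive (symm (PW.Pointwise-length pw))) pN
              , PP-swap Y (take-cong-++ t1 (val c ps) vs X (length-map (lookup c) ps ⟫ PW.Pointwise-length pw) (symm tk))
                  (proj₂ (Rob.sound r c ec)) pv

  abstract
    connect : ∀ q → Connects q (connW q)
    connect = connect′

  -- Heavy tiles

  Unique⇒Loc : ∀ {m} (ps : List (Fin m)) → Unique ps → Loc ps
  Unique⇒Loc [] u = tt
  Unique⇒Loc (p ∷ ps) (a ∷ u) = (λ q → All≢⇒∉ a (∈-take t1 ps q)) , Unique⇒Loc ps u

  Loc-repeat : ∀ {m} h (A : List (Fin m)) → length A ≡ T → Unique A → Loc (repeat h A)
  Loc-repeat zero A l u = Unique⇒Loc A u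
  Loc-repeat (suc h) A l u with repeat-++ h A | Loc-repeat h A l u
  ... | R , eq | lo = subst (λ z → Loc (A ++ z)) (symm eq)
    (Loc-rot [] A [] R (cong length (++-identityʳ A) ⟫ l) (subst Unique (symm (++-identityʳ A)) u) (subst Loc eq lo))

  PP-repeat : ∀ h A → length A ≡ T → Clique A → PP (repeat h A)
  PP-repeat zero A l C = PP-Clique A C
  PP-repeat (suc h) A l C with repeat-++ h A | PP-repeat h A l C
  ... | R , eq | p = subst (λ z → PP (A ++ z)) (symm eq)
    (PP-within A A R C (λ m → m) (λ m → m) (≤-trans (n≤1+n t1) (≤-reflexive (symm l))) (subst PP eq p))

  module Heavy {U R vs R' : List V} {b : ℕ} (am : Amb U R b) (pR : R ↭ vs ++ R')
    (ω : V → ℕ) (Ω : ℕ) (ω≤ : ∀ {v} → v ∈ R → ω v ≤ Ω) (f e : ℕ)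
    (hf : length vs + T + e ≤ f) (hD : D * b + f ≤ length R) where

    r = length R

    cn : ℕ → ℕ
    cn θ = cnt (λ v → leq θ (ω v)) R

    open Thresholds cn

    -- The rank of the weight demanded of clique vertex i: beyond its C(i,k-1) bad sets, the term f
    -- covers the used vertices, the clique so far, and the e choices that must remain.
    ρ : ℕ → ℕ
    ρ i = bin i k1 * b + f

    θ : ℕ → ℕ
    θ i = mx (ρ i) Ω

    thV : ∀ i → Vec ℕ i
    thV zero    = []
    thV (suc i) = θ i ∷ thV i

    sumT : ℕ → ℕ
    sumT i = sumL (λ x → x) (toList (thV i))

    -- The number of the first i ranks that are at most y; summed over θ with y = cn θ it bounds the
    -- sum of the thresholds from below.
    cI : ℕ → ℕ → ℕ
    cI zero    y = 0
    cI (suc i) y = b2n (leq (ρ i) y) + cI i y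

    sum-cI : ∀ i → sumTo Ω (λ θ → cI i (cn θ)) ≤ sumT i
    sum-cI zero = ≤-reflexive (sumTo-const Ω 0 ⟫ *-zeroʳ Ω)
    sum-cI (suc i) = ≤-trans (≤-reflexive (sumTo-+ Ω (λ θ → b2n (leq (ρ i) (cn θ))) (λ θ → cI i (cn θ))))
      (+-mono-≤ (mx-sum (ρ i) Ω) (sum-cI i))

    -- By `bin-rank` and D·b ≤ r, rank i fits into z + f as soon as i·r ≤ T·z. So at least min(T,
    -- T·z/r) of the T ranks fit.
    cI-claim : ∀ z i → i ≤ T → T * z ≤ r * cI i (z + f) ⊎ i * r ≤ r * cI i (z + f)
    cI-claim z zero h = inj₂ z≤n
    cI-claim z (suc i) h with cI-claim z i (≤-trans (n≤1+n i) h)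
    ... | inj₁ p = inj₁ (≤-trans p (*-monoʳ-≤ r (m≤n+m _ _)))
    ... | inj₂ p with T * z ≤? i * r
    ...   | yes q = inj₁ (≤-trans q (≤-trans p (*-monoʳ-≤ r (m≤n+m _ _))))
    ...   | no ¬q = inj₂ (subst (λ t → suc i * r ≤ r * (t + cI i (z + f))) (cong b2n (symm (le-intro cond)))
                      (≤-trans (+-monoʳ-≤ r p) (≤-reflexive (symm (*-suc r _)))))
      where
        cond : ρ i ≤ z + f
        cond = +-monoˡ-≤ f (*-cancelˡ-≤ T (begin
          T * (bin i k1 * b)    ≡⟨ heavy-identity₁ T (bin i k1) b ⟩
          bin i k1 * T * b      ≤⟨ *-monoˡ-≤ b (≤-trans (bin-rank t2 k2 i (≤-pred h)) (≤-reflexive (cong (i *_) (symm D-def)))) ⟩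
          i * D * b             ≡⟨ *-assoc i D b ⟩
          i * (D * b)           ≤⟨ *-monoʳ-≤ i (≤-trans (m≤m+n (D * b) f) hD) ⟩
          i * r                 ≤⟨ <⇒≤ (≰⇒> ¬q) ⟩
          T * z ∎))
          where
            open ≤-Reasoning

    cI-bound : ∀ y → y ≤ r → T * y ≤ r * cI T y + T * f
    cI-bound y h with ≤-total f y
    ... | inj₂ y≤f = ≤-trans (*-monoʳ-≤ T y≤f) (m≤n+m (T * f) (r * cI T y))
    ... | inj₁ f≤y = subst (λ y → T * y ≤ r * cI T y + T * f) zf
        (≤-trans (≤-reflexive (*-distribˡ-+ T z f)) (+-monoˡ-≤ (T * f) (big (cI-claim z T ≤-refl))))
      where
        z = y ∸ f
        zf : z + f ≡ y
        zf = m∸n+n≡m f≤y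
        big : T * z ≤ r * cI T (z + f) ⊎ T * r ≤ r * cI T (z + f) → T * z ≤ r * cI T (z + f)
        big (inj₁ p) = p
        big (inj₂ p) = ≤-trans (*-monoʳ-≤ T (≤-trans (m∸n≤m y f) h)) p

    -- Summing the previous bound over all thresholds θ: the weight guaranteed for the clique is at
    -- least T times the average weight, up to the error caused by f.
    sumT-bound : T * sumL ω R ≤ r * sumT T + T * (Ω * f)
    sumT-bound = begin
      T * sumL ω R
        ≤⟨ *-monoʳ-≤ T (sumL-mono R (λ {v} m → layers Ω (ω v) (ω≤ m))) ⟩
      T * sumL (λ v → sumTo Ω (λ θ → b2n (leq θ (ω v)))) R
        ≡⟨ cong (T *_) (symm (sumTo-sumL Ω (λ θ v → b2n (leq θ (ω v))) R)) ⟩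
      T * sumTo Ω cn
        ≡⟨ symm (sumTo-* Ω T cn) ⟩
      sumTo Ω (λ θ → T * cn θ)
        ≤⟨ sumTo-mono Ω (λ θ → cI-bound (cn θ) (cnt≤length _ R)) ⟩
      sumTo Ω (λ θ → r * cI T (cn θ) + T * f)
        ≡⟨ sumTo-+ Ω (λ θ → r * cI T (cn θ)) (λ _ → T * f) ⟫ cong₂ _+_ (sumTo-* Ω r (λ θ → cI T (cn θ))) (sumTo-const Ω (T * f)) ⟩
      r * sumTo Ω (λ θ → cI T (cn θ)) + Ω * (T * f)
        ≤⟨ +-mono-≤ (*-monoʳ-≤ r (sum-cI T)) (≤-reflexive (heavy-identity₄ Ω T f)) ⟩
      r * sumT T + T * (Ω * f) ∎
      where
        open ≤-Reasoning

    uR' : Unique R'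
    uR' = Unique-++ʳ vs (Unique-↭ pR (uW am))

    record Inv {i} (c : Vec V i) : Set where
      field
        ibase : Base R' c
        icl   : Clique (toList c)
        iw    : ∀ p → lookup (thV i) p ≤ ω (lookup c p)
    open Inv

    toList-Unique : ∀ {i} {c : Vec V i} → Base R' c → Unique (toList c) × toList c ⊆l U
    toList-Unique {c = []} B = [] , λ ()
    toList-Unique {c = x ∷ c} B with toList-Unique {c = c} (record { inW = λ i → inW B (suc i) ; inj = λ e → suc-inj (inj B e) })
      where suc-inj : ∀ {n} {i j : Fin n} → Fin.suc i ≡ suc j → i ≡ j
            suc-inj refl = refl
    ... | u , s = ∉⇒All≢ x∉ ∷ u
        , λ { (here refl) → WU am (∈-resp-↭ (↭-sym pR) (∈-++⁺ʳ vs (inW B zero))) ; (there q) → s q }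
      where
        ex : ∀ {n} (c : Vec V n) {z} → z ∈ toList c → ∃ λ i → lookup c i ≡ z
        ex (y ∷ c) (here refl) = zero , refl
        ex (y ∷ c) (there q) with ex c q
        ... | i , e = suc i , e
        x∉ : x ∉ toList c
        x∉ q with ex c q
        ... | i , e with inj B {zero} {suc i} (symm e)
        ...   | ()

    ok : ∀ {i} → Vec V i → V → Bool
    ok {i} c x = (mem _≟v_ x R' ∧ (leq (θ i) (ω x) ∧ okL (subs k1 (toList c)) x)) ∧ not (mem _≟v_ x (toList c))

    confs : ∀ i → i ≤ T → Rob R' e i Inv
    confs zero h = record { conf = λ _ → true
      ; sound = λ { [] _ → record { ibase = record { inW = λ () ; inj = λ { {()} } } ; icl = Clique-short [] z≤n ; iw = λ () } }
      ; many = ≤-refl }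
    confs (suc i) h = Rob-map snd (Rob-pick (confs i (≤-trans (n≤1+n i) h)) ok cnts)
      where
        cnts : ∀ c → Inv c → e ≤ cnt (ok c) R'
        cnts c I = +-cancelʳ-≤ (bin i k1 * b + f) e (cnt (ok c) R') (begin
          e + (bin i k1 * b + f)
            ≤⟨ +-monoʳ-≤ e (mx-ok (ρ i) Ω (≤-trans (+-monoˡ-≤ f (*-monoˡ-≤ b (≤-trans (bin-mono k1 (≤-pred h)) bin≤D)))
                 (≤-trans hD (≤-reflexive (symm (cnt-true R)))))) ⟩
          e + cn (θ i)
            ≡⟨ cong (e +_) (cnt-sub (λ v → leq (θ i) (ω v)) vs pR) ⟩
          e + (cnt (λ v → leq (θ i) (ω v)) vs + cnt (λ v → leq (θ i) (ω v)) R')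
            ≤⟨ +-monoʳ-≤ e (+-mono-≤ (cnt≤length _ vs) (≤-trans (pickExt (Good-sub vs pR (gd am)) _ (toList c) uc sc)
                 (+-monoˡ-≤ _ (≤-trans (cnt-mono R' (λ m q → ∧-intro (mem-∈ _≟v_ m) q)) (cnt-fresh _≟v_ _ R' (toList c) uR'))))) ⟩
          e + (length vs + (cnt (ok c) R' + length (toList c) + bin (length (toList c)) k1 * b))
            ≡⟨ cong (λ z → e + (length vs + (cnt (ok c) R' + z + bin z k1 * b))) (length-toList c) ⟩
          e + (length vs + (cnt (ok c) R' + i + bin i k1 * b))
            ≤⟨ lin 0 (+-mono-≤ hf (≤-trans (n≤1+n i) h)) (heavy-identity₂ e (length vs) (cnt (ok c) R') i (bin i k1 * b) T f) ⟩
          cnt (ok c) R' + (bin i k1 * b + f) ∎)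
          where
            open ≤-Reasoning
            uc = proj₁ (toList-Unique (ibase I))
            sc : toList c ⊆l U
            sc = proj₂ (toList-Unique (ibase I))
        snd : ∀ c' → _ → Inv c'
        snd (x ∷ c) (I , o) with ∧-elim {mem _≟v_ x R' ∧ (leq (θ i) (ω x) ∧ okL (subs k1 (toList c)) x)} o
        ... | o1 , o2 with ∧-elim {mem _≟v_ x R'} o1
        ...   | m , o3 with ∧-elim {leq (θ i) (ω x)} o3
        ...     | w , s = record
          { ibase = Base-∷ (ibase I) (mem-true _≟v_ m) (mem-false _≟v_ (not-true o2))
          ; icl = Clique-∷ (icl I) (ok⇒Ext s)
          ; iw = λ { zero → le-true w ; (suc p) → iw I p } }

    -- The clique is circled h + 1 times and the walk realised by distinct vertices; the relation
    -- passed to `walk` carries the threshold of each position over to its clones.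
    tile′ : ∀ h → let ℓ = suc h * T in ℓ * (ℓ * length R' ^ t1) < e ^ T →
      ∃ λ tl → length tl ≡ ℓ × Unique tl × tl ⊆l R' × PP tl ×
        ℓ * sumL ω R ≤ r * sumL ω tl + ℓ * (Ω * f)
    tile′ h hl = out (walk {X = []} {ℓ} {λ p v → lookup (thV T) p ≤ ω v} uR' (repeat h A) (Rob.conf rb)
        (λ c ec → inW (ibase (Rob.sound rb c ec))) (λ c ec → iw (Rob.sound rb c ec)) pps
        (Loc-repeat h A (length-fins T) (Unique-fins T)) (≤-reflexive lr)
        (<-≤-trans (≤-<-trans (≤-reflexive (cong (_* (ℓ * length R' ^ t1)) lr)) hl) (Rob.many rb)))
      where
        A = fins T
        ℓ = suc h * T
        rb = confs T ≤-refl
        lr : length (repeat h A) ≡ ℓ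
        lr = length-repeat h A ⟫ cong (suc h *_) (length-fins T)
        val-repeat : ∀ c h → val c (repeat h A) ≡ repeat h (val c A)
        val-repeat c zero = refl
        val-repeat c (suc h) = map-++ (lookup c) A (repeat h A) ⟫ cong (val c A ++_) (val-repeat c h)
        pps : ∀ c → Rob.conf rb c ≡ true → PP (map (lookup c) (repeat h A) ++ [])
        pps c ec = subst PP (symm (++-identityʳ _ ⟫ val-repeat c h)) (PP-repeat h (val c A) (length-map _ A ⟫ length-fins T)
          (Clique-⊆ sub (icl (Rob.sound rb c ec))))
          where sub : val c A ⊆l toList c
                sub m with ∈-map⁻ (lookup c) m
                ... | i , _ , refl = lookup∈toList c i
        out : _ → ∃ λ tl → length tl ≡ ℓ × Unique tl × tl ⊆l R' × PP tl × ℓ * sumL ω R ≤ r * sumL ω tl + ℓ * (Ω * f)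
        out (c , tl , ec , pw , u , s , p , _) = tl , (symm (PW.Pointwise-length pw) ⟫ lr) , u , s , subst PP (++-identityʳ tl) p , (begin
          ℓ * sumL ω R                              ≡⟨ *-assoc (suc h) T (sumL ω R) ⟩
          suc h * (T * sumL ω R)                    ≤⟨ *-monoʳ-≤ (suc h) sumT-bound ⟩
          suc h * (r * sumT T + T * (Ω * f))        ≡⟨ heavy-identity₃ (suc h) r (sumT T) T (Ω * f) ⟩
          r * (suc h * sumT T) + ℓ * (Ω * f)        ≤⟨ +-monoˡ-≤ (ℓ * (Ω * f)) (*-monoʳ-≤ r
             (≤-trans (≤-reflexive (symm (sumL-repeat (lookup (thV T)) h A ⟫ cong (suc h *_) (sumL-fins (thV T))))) (Pointwise-sum pw))) ⟩
          r * sumL ω tl + ℓ * (Ω * f) ∎)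
          where
            open ≤-Reasoning

    abstract
      tile : ∀ h → suc h * T * (suc h * T * length R' ^ t1) < e ^ T →
        ∃ λ tl → length tl ≡ suc h * T × Unique tl × tl ⊆l R' × PP tl ×
          suc h * T * sumL ω R ≤ r * sumL ω tl + suc h * T * (Ω * f)
      tile = tile′

  -- Absorbing

  -- Each new vertex extends the last t-1 vertices, and also v with the last t-2 of them. So v forms
  -- a clique with any t-1 consecutive vertices and can later be inserted.
  confA : List V → V → ∀ {i} → Vec V i → Bool
  confA W v []      = true
  confA W v (x ∷ c) = confA W v c ∧ okP W (v ∷ toList c) (take t1 (toList c)) v (take t2 (toList c)) x

  With : V → List V → Set
  With v []       = ⊤
  With v (x ∷ xs) = Clique (v ∷ x ∷ take t2 xs) × With v xs

  record AInv (W : List V) (v : V) (a : List V) : Set where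
    field
      au : Unique a
      aW : a ⊆l W
      av : v ∉ a
      aP : PP a
      ac : With v a
  open AInv

  With-take : ∀ v xs → With v xs → Clique (v ∷ take t2 xs)
  With-take v [] w = Clique-short (v ∷ take t2 []) (s≤s (≤-trans (≤-reflexive (length-take t2 [])) (≤-trans (≤-reflexive (⊓-zeroʳ t2)) z≤n)))
  With-take v (x ∷ xs) (C , _) = Clique-⊆ sub C
    where
      sub : (v ∷ take t2 (x ∷ xs)) ⊆l (v ∷ x ∷ take t2 xs)
      sub (here e) = here e
      sub (there m) = there (go t2 m)
        where
          go : ∀ n {z} → z ∈ take n (x ∷ xs) → z ∈ x ∷ take n xs
          go (suc n) (here e) = here e
          go (suc n) (there m) = there (tk n xs m)
            where tk : ∀ n xs {z} → z ∈ take n xs → z ∈ take (suc n) xs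
                  tk (suc n) (x ∷ xs) (here e) = here e
                  tk (suc n) (x ∷ xs) (there m) = there (tk n xs m)

  take-⊆-suc : ∀ n (xs : List V) → take n xs ⊆l take (suc n) xs
  take-⊆-suc (suc n) (x ∷ xs) (here e)  = here e
  take-⊆-suc (suc n) (x ∷ xs) (there m) = there (take-⊆-suc n xs m)

  confA-sound : ∀ W v {i} (c : Vec V i) → confA W v c ≡ true → AInv W v (toList c)
  confA-sound W v [] e = record { au = [] ; aW = λ () ; av = λ () ; aP = tt ; ac = tt }
  confA-sound W v (x ∷ c) e with ∧-elim {confA W v c} e
  ... | e1 , e2 with confA-sound W v c e1 | okP-sound W (v ∷ toList c) (take t1 (toList c)) v (take t2 (toList c)) x (take-⊆-suc t2 (toList c)) e2
  ... | I | x∈ , x∉ , eS , eC = record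
    { au = ∉⇒All≢ (λ m → x∉ (there m)) ∷ au I
    ; aW = λ { (here refl) → x∈ ; (there m) → aW I m }
    ; av = λ { (here refl) → x∉ (here refl) ; (there m) → av I m }
    ; aP = Clique-∷ (PP-take _ (aP I)) eS , aP I
    ; ac = Clique-⊆ (λ { (here p) → there (here p) ; (there (here p)) → here p ; (there (there m)) → there (there m) })
             (Clique-∷ (With-take v (toList c) (ac I)) eC) , ac I }

  confA-many : ∀ {U W b e v} m → Amb U W b → v ∈ U → D * b + e + suc m ≤ length W →
    ∀ i → i ≤ m → e ^ i ≤ ΣV W i (λ c → b2n (confA W v c))
  confA-many m am v∈ mar zero h = ≤-refl
  confA-many {U} {W} {b} {e} {v} m am v∈ mar (suc i) h =
    ≤-trans (*-monoʳ-≤ e (confA-many m am v∈ mar i (≤-trans (n≤1+n i) h)))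
      (≤-trans (≤-reflexive (symm (ΣV-* i e _))) (ΣV-mono i ge))
    where
      ok : Vec V i → V → Bool
      ok c = okP W (v ∷ toList c) (take t1 (toList c)) v (take t2 (toList c))
      cn : ∀ c → AInv W v (toList c) → e ≤ cnt (ok c) W
      cn c I = lin 0 (+-mono-≤ (+-mono-≤ mar
          (pickCount (gd am) (uW am) (v ∷ toList c) (take t1 (toList c)) v (take t2 (toList c))
            (UniqueP.take⁺ t1 (au I)) (λ q → WU am (aW I (∈-take t1 _ q))) (≤-trans (≤-reflexive (length-take t1 (toList c))) (m⊓n≤m t1 _))
            (∉⇒All≢ (λ q → av I (∈-take t2 _ q)) ∷ UniqueP.take⁺ t2 (au I))
            (λ { (here refl) → v∈ ; (there q) → WU am (aW I (∈-take t2 _ q)) })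
            (≤-trans (≤-reflexive (length-take t2 (toList c))) (m⊓n≤m t2 _))))
          (≤-trans (s≤s (≤-trans (≤-reflexive (length-toList c)) (≤-trans (n≤1+n i) h))) ≤-refl))
        (block-identity₁ e (cnt (ok c) W) (D * b) (suc (length (toList c))) (suc m) (length W))
      ge : ∀ c → e * b2n (confA W v c) ≤ sumL (λ x → b2n (confA W v c ∧ ok c x)) W
      ge c with confA W v c in eq
      ... | false = ≤-trans (≤-reflexive (*-zeroʳ e)) z≤n
      ... | true = ≤-trans (≤-reflexive (*-identityʳ e)) (cn c (confA-sound W v c eq))

  -- A window containing v lies in v together with t-1 consecutive old vertices, which `With` makes
  -- a clique.
  PP-insert : ∀ v oR oL → length oL ≡ t1 → length oR ≤ t1 → PP (oR ++ oL) → With v (oR ++ oL) → PP (oR ++ v ∷ oL)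
  PP-insert v [] (x ∷ oL) l h p (C , _) = Clique-⊆ sub C , p
    where sub : (v ∷ x ∷ take t2 oL) ⊆l (v ∷ x ∷ take t2 oL)
          sub m = m
  PP-insert v (x ∷ oR) oL l (s≤s h) (_ , p) (C , w) =
    Clique-⊆ sub C , PP-insert v oR oL l (≤-trans h (n≤1+n t2)) p w
    where
      sub : (x ∷ take t1 (oR ++ v ∷ oL)) ⊆l (v ∷ x ∷ take t2 (oR ++ oL))
      sub (here e) = there (here e)
      sub (there m) with ∈-take-insert t2 oR h m
      ... | here e = here e
      ... | there q = there (there q)

  -- The absorber is oR ++ oL; mid holds the vertex absorbed by it (if any) and cn the connection to the next block.
  record Block : Set where
    field
      oR mid oL cn : List V
      ab   : V → Bool
      lR   : length oR ≡ t1
      lL   : length oL ≡ t1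
      absb : ∀ v → ab v ≡ true → PP (oR ++ v ∷ oL)
  open Block public

  module Chain (X : List V) (lX : length X ≡ t1) where

    end : List Block → List V
    end []      = X
    end (B ∷ S) = oR B

    body : List Block → List V
    body []      = []
    body (B ∷ S) = oR B ++ mid B ++ oL B ++ cn B ++ body S

    Valid : List Block → Set
    Valid []      = Clique X
    Valid (B ∷ S) = PP (oR B ++ mid B ++ oL B) × PP (oL B ++ cn B ++ end S) × Valid S

    length-end : ∀ S → length (end S) ≡ t1
    length-end []      = lX
    length-end (B ∷ S) = lR B

    tl : List Block → List V
    tl []      = []
    tl (B ∷ S) = mid B ++ oL B ++ cn B ++ body S ++ X

    end-tl : ∀ S → body S ++ X ≡ end S ++ tl S
    end-tl []      = symm (++-identityʳ X)
    end-tl (B ∷ S) = ++-assoc (oR B) _ X ⟫ cong (oR B ++_) (++-assoc (mid B) _ X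
      ⟫ cong (mid B ++_) (++-assoc (oL B) _ X ⟫ cong (oL B ++_) (++-assoc (cn B) _ X)))

    chain-PP : ∀ S → Valid S → PP (body S ++ X)
    chain-PP [] C = PP-Clique X C
    chain-PP (B ∷ S) (p , q , v) = subst PP (symm (end-tl (B ∷ S)))
      (subst PP (++-assoc (oR B) (mid B) _)
        (PP-glue (oR B ++ mid B) (oL B) (≤-reflexive (symm (lL B)))
          (subst PP (symm (++-assoc (oR B) (mid B) (oL B))) p) low))
      where
        low : PP (oL B ++ cn B ++ body S ++ X)
        low = subst PP (++-assoc (oL B) (cn B) (end S ++ tl S) ⟫ cong (λ z → oL B ++ cn B ++ z) (symm (end-tl S)))
          (PP-glue (oL B ++ cn B) (end S) (≤-reflexive (symm (length-end S)))
            (subst PP (symm (++-assoc (oL B) (cn B) (end S))) q)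
            (subst PP (end-tl S) (chain-PP S v)))

    used : Block → Bool
    used B with mid B
    ... | []    = false
    ... | _ ∷ _ = true

    ins : V → Block → Block
    ins v B = record B { mid = v ∷ [] }

    unused-mid : ∀ B → used B ≡ false → mid B ≡ []
    unused-mid B e with mid B
    ... | [] = refl

    record Ins (v : V) (S : List Block) : Set where
      field
        S'   : List Block
        val' : Valid S'
        perm : body S' ↭ v ∷ body S
        same : end S' ≡ end S
        keep : ∀ u → cnt (λ B → ab B u) S' ≡ cnt (λ B → ab B u) S
        one  : cnt used S' ≡ suc (cnt used S)

    insert1 : ∀ v S → Valid S → cnt used S < cnt (λ B → ab B v) S → Ins v S
    insert1 v (B ∷ S) (p , q , vl) h = go (ab B v) (used B) refl refl
      where
        rec : cnt used S < cnt (λ B → ab B v) S → Ins v (B ∷ S)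
        rec h' = record
          { S' = B ∷ Ins.S' I ; val' = p , subst (λ z → PP (oL B ++ cn B ++ z)) (symm (Ins.same I)) q , Ins.val' I
          ; perm = ↭-trans (++⁺ˡ (oR B) (++⁺ˡ (mid B) (++⁺ˡ (oL B) (++⁺ˡ (cn B) (Ins.perm I))))) mv
          ; same = refl ; keep = λ u → cong (b2n (ab B u) +_) (Ins.keep I u)
          ; one = cong (b2n (used B) +_) (Ins.one I) ⟫ +-suc (b2n (used B)) _ }
          where
            I = insert1 v S vl h'
            pre = oR B ++ mid B ++ oL B ++ cn B
            as : ∀ Z → oR B ++ mid B ++ oL B ++ cn B ++ Z ≡ pre ++ Z
            as Z = symm (++-assoc (oR B) _ Z ⟫ cong (oR B ++_) (++-assoc (mid B) _ Z ⟫ cong (mid B ++_) (++-assoc (oL B) (cn B) Z)))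
            mv : oR B ++ mid B ++ oL B ++ cn B ++ v ∷ body S ↭ v ∷ oR B ++ mid B ++ oL B ++ cn B ++ body S
            mv = ↭-trans (↭-reflexive (as (v ∷ body S))) (↭-trans (shift v pre (body S)) (prep v (↭-reflexive (symm (as (body S))))))
        go : ∀ a u → ab B v ≡ a → used B ≡ u → Ins v (B ∷ S)
        go true false ea eu = record
          { S' = ins v B ∷ S ; val' = absb B v ea , q , vl
          ; perm = ↭-trans (shift v (oR B) _) (prep v (↭-reflexive (cong (λ z → oR B ++ z ++ oL B ++ cn B ++ body S) (symm (unused-mid B eu)))))
          ; same = refl ; keep = λ u → refl
          ; one = cong (λ z → suc z) (cong (λ z → b2n z + cnt used S) (symm eu)) }
        go true true ea eu = rec (≤-pred (subst₂ (λ x y → b2n x + cnt used S < b2n y + cnt (λ B → ab B v) S) eu ea h))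
        go false true ea eu = rec (≤-trans (n≤1+n _) (subst₂ (λ x y → b2n x + cnt used S < b2n y + cnt (λ B → ab B v) S) eu ea h))
        go false false ea eu = rec (subst₂ (λ x y → b2n x + cnt used S < b2n y + cnt (λ B → ab B v) S) eu ea h)

    absorb : ∀ Λ S → Valid S → (∀ {v} → v ∈ Λ → cnt used S + length Λ ≤ cnt (λ B → ab B v) S) →
      ∃ λ S' → Valid S' × body S' ↭ Λ ++ body S × end S' ≡ end S
    absorb [] S vl h = S , vl , refl , refl
    absorb (v ∷ Λ) S vl h = S' , v' , ↭-trans pr (↭-trans (++⁺ˡ Λ (Ins.perm I)) (shift v Λ (body S))) , (ee ⟫ Ins.same I)
      where
        I = insert1 v S vl (≤-trans (≤-trans (s≤s (m≤m+n _ (length Λ))) (≤-reflexive (symm (+-suc (cnt used S) (length Λ))))) (h (here refl)))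
        rec = absorb Λ (Ins.S' I) (Ins.val' I) (λ {u} m → subst₂ _≤_
          (+-suc (cnt used S) (length Λ) ⟫ cong (_+ length Λ) (symm (Ins.one I))) (symm (Ins.keep I u)) (h (there m)))
        S' = proj₁ rec
        v' = proj₁ (proj₂ rec)
        pr = proj₁ (proj₂ (proj₂ rec))
        ee = proj₂ (proj₂ (proj₂ rec))

  ∈-part : ∀ {W : List V} vs {R} → W ↭ vs ++ R → R ⊆l W
  ∈-part vs p m = ∈-resp-↭ (↭-sym p) (∈-++⁺ʳ vs m)

  length-part : ∀ {W : List V} vs {R} → W ↭ vs ++ R → length W ≡ length vs + length R
  length-part vs p = ↭-length p ⟫ length-++ vs

  Amb-sub : ∀ {U W b} vs {R} → W ↭ vs ++ R → Amb U W b → Amb U R b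
  Amb-sub vs p am = record { uW = Unique-++ʳ vs (Unique-↭ p (uW am)) ; gd = Good-sub vs p (gd am) ; WU = λ m → WU am (∈-part vs p m) }

  End-sub : ∀ {U W X} vs {R} → W ↭ vs ++ R → End U W X → End U R X
  End-sub vs p eX = record { XU = XU eX ; uX = uX eX ; lX = lX eX ; CX = CX eX ; dX = λ m n → dX eX m (∈-part vs p n) }

  Absorber : List V → List V → (X : List V) → length X ≡ t1 → ℕ → ℕ → Set
  Absorber U W X lX N ℓ = ∃ λ S → ∃ λ R → Chain.Valid X lX S × W ↭ Chain.body X lX S ++ R ×
    length (Chain.body X lX S) ≤ N * (mA + NC) × End U R (Chain.end X lX S) ×
    cnt (Chain.used X lX) S ≡ 0 × (∀ {v} → v ∈ W → N ≤ ℓ * cnt (λ B → ab B v) S)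

  module Absorbing {U W X : List V} {b : ℕ} (am : Amb U W b) (eX : End U W X) {q w₀ : ℕ} (conn : Connects q w₀)
    (e₁ e₂ eₐ qa N : ℕ) (mar : D * b + e₁ + e₂ ≤ length W) (hq : length W ≤ q * e₂) (hw : w₀ ≤ e₂)
    (ha : eₐ + suc mA ≤ e₂) (hqa : length W ≤ qa * eₐ) (hN : N * (mA + NC) ≤ e₁) (ne : 0 < length W)
    (big : length W * mwA (qa ^ mA + qa ^ mA) 1 ^ N < suc (mwA (qa ^ mA + qa ^ mA) 1) ^ N) where

    open Chain X (lX eX)

    qm ℓ' ℓ : ℕ
    qm = qa ^ mA
    ℓ' = qm + qm
    ℓ = suc ℓ'

    record AState (i : ℕ) (Xf : V → ℕ) : Set where
      field
        S    : List Block
        R    : List V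
        vS   : Valid S
        part : W ↭ body S ++ R
        len  : length (body S) ≤ i * (mA + NC)
        eS   : End U R (end S)
        cX   : ∀ v → Xf v ≡ ℓ * cnt (λ B → ab B v) S
        un   : cnt used S ≡ 0

    enough : ∀ {R vs} → W ↭ vs ++ R → length vs ≤ e₁ → D * b + e₂ ≤ length R
    enough {R} {vs} p h = lin 0 (+-mono-≤ (+-mono-≤ mar h) (≤-reflexive (length-part vs p)))
      (absorb-identity₄ (D * b) e₁ e₂ (length W) (length vs) (length R))

    module Step (i : ℕ) (i< : i < N) (Xf : V → ℕ) (st : AState i Xf) (φ : V → ℕ) (φ>0 : ∀ v → 0 < φ v) where
      open AState st

      bud : ∀ {x} → x ≤ i * (mA + NC) + mA → x ≤ e₁
      bud h = ≤-trans h (≤-trans (+-monoʳ-≤ (i * (mA + NC)) (m≤m+n mA NC)) (≤-trans (≤-reflexive (+-comm _ (mA + NC))) (≤-trans (*-monoˡ-≤ (mA + NC) i<) hN)))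

      amR : Amb U R b
      amR = Amb-sub (body S) part am

      marR : D * b + e₂ ≤ length R
      marR = enough {R} {body S} part (bud (≤-trans len (m≤m+n _ mA)))

      marA : D * b + eₐ + suc mA ≤ length R
      marA = ≤-trans (≤-reflexive (+-assoc (D * b) eₐ (suc mA))) (≤-trans (+-monoʳ-≤ (D * b) ha) marR)

      R≤W : length R ≤ length W
      R≤W = ≤-trans (m≤n+m _ (length (body S))) (≤-reflexive (symm (length-part (body S) part)))

      Φ = sumL φ W
      gain : Vec V mA → ℕ
      gain c = sumL (λ v → φ v * b2n (confA R v c)) W

      Φ>0 : 0 < Φ
      Φ>0 = go W ne
        where go : ∀ Z → 0 < length Z → 0 < sumL φ Z
              go (z ∷ Z) _ = ≤-trans (φ>0 z) (m≤m+n _ _)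

      -- Each v is absorbed by at least eₐ^mA of the |R|^mA configurations, a fraction of at least
      -- 1/qm. Comparing with Φ - 1 yields the strict inequality that the averaging principle asks
      -- for.
      avg : ΣV R mA (λ _ → pred Φ) < ΣV R mA (λ c → qm * gain c)
      avg = begin-strict
        ΣV R mA (λ _ → pred Φ)           ≡⟨ ΣV-const mA (pred Φ) ⟩
        pred Φ * length R ^ mA           ≤⟨ *-monoʳ-≤ (pred Φ) (^-monoˡ-≤ mA (≤-trans R≤W hqa)) ⟩
        pred Φ * (qa * eₐ) ^ mA          <⟨ *-mono-<ˡ ((qa * eₐ) ^ mA) (^-pos (qa * eₐ) mA (≤-trans ne hqa)) (≤-reflexive (suc-pred Φ {{>-nonZero Φ>0}})) ⟩
        Φ * (qa * eₐ) ^ mA               ≡⟨ cong (Φ *_) (^-mul qa eₐ mA) ⟫ absorb-identity₅ Φ qm (eₐ ^ mA) ⟩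
        qm * (eₐ ^ mA * Φ)               ≡⟨ cong (qm *_) (symm (sumL-* (eₐ ^ mA) φ W)) ⟩
        qm * sumL (λ v → eₐ ^ mA * φ v) W ≤⟨ *-monoʳ-≤ qm (sumL-mono W (λ {v} m → ≤-trans (≤-reflexive (*-comm (eₐ ^ mA) (φ v))) (*-monoʳ-≤ (φ v) (confA-many mA amR (WU am m) marA mA ≤-refl)))) ⟩
        qm * sumL (λ v → φ v * ΣV R mA (λ c → b2n (confA R v c))) W ≡⟨ cong (qm *_) (sumL-cong W (λ {v} _ → symm (ΣV-* mA (φ v) _))) ⟩
        qm * sumL (λ v → ΣV R mA (λ c → φ v * b2n (confA R v c))) W ≡⟨ cong (qm *_) (symm (ΣV-sumL mA (λ v c → φ v * b2n (confA R v c)) W)) ⟩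
        qm * ΣV R mA gain                ≡⟨ symm (ΣV-* mA qm gain) ⟩
        ΣV R mA (λ c → qm * gain c) ∎
        where
          open ≤-Reasoning

      next : (c : Vec V mA) → pred Φ < qm * gain c →
        ∃ λ (x : V → ℕ) → (∀ j → x j ≤ ℓ) × 2 * sumL φ W ≤ sumL (λ j → φ j * x j) W × AState (suc i) (λ j → Xf j + x j)
      next c lt = xs , (λ j → ≤-trans (*-monoʳ-≤ ℓ (b2n≤1 (confA R j c))) (≤-reflexive (*-identityʳ ℓ))) , gn , st'
        where
          xs : V → ℕ
          -- A hit counts ℓ > 2·qm, which raises the weighted average to at least μ = 2; the weights
          -- then guarantee μ - 1 = 1 per round.
          xs v = ℓ * b2n (confA R v c)
          Φ≤ : Φ ≤ qm * gain c
          Φ≤ = ≤-trans (≤-reflexive (symm (suc-pred Φ {{>-nonZero Φ>0}}))) lt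
          gn : 2 * sumL φ W ≤ sumL (λ j → φ j * xs j) W
          gn = begin
            2 * Φ                                       ≤⟨ *-monoʳ-≤ 2 Φ≤ ⟩
            2 * (qm * gain c)                           ≡⟨ absorb-identity₂ qm (gain c) ⟩
            ℓ' * gain c                                 ≤⟨ *-monoˡ-≤ (gain c) (n≤1+n ℓ') ⟩
            ℓ * gain c                                  ≡⟨ symm (sumL-* ℓ (λ v → φ v * b2n (confA R v c)) W) ⟩
            sumL (λ v → ℓ * (φ v * b2n (confA R v c))) W ≡⟨ sumL-cong W (λ {v} _ → absorb-identity₃ ℓ (φ v) (b2n (confA R v c))) ⟩
            sumL (λ j → φ j * xs j) W ∎
            where
              open ≤-Reasoning
          -- The configuration must absorb some vertex, for only `confA-sound` shows it to be a
          -- power path of distinct vertices.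
          someone : ∃ λ v → confA R v c ≡ true
          someone = pick (sumL-∃ {f = λ _ → 0} {λ v → φ v * b2n (confA R v c)} W
              (≤-<-trans (≤-reflexive (sumL-const 0 W ⟫ *-zeroʳ (length W))) (posr qm (gain c) (<-≤-trans Φ>0 Φ≤))))
            where
              posr : ∀ a b → 0 < a * b → 0 < b
              posr a zero h = ≤-trans h (≤-reflexive (*-zeroʳ a))
              posr a (suc b) h = s≤s z≤n
              pick : (∃ λ v → v ∈ W × 0 < φ v * b2n (confA R v c)) → ∃ λ v → confA R v c ≡ true
              pick (v , _ , h) = v , tr (φ v) (confA R v c) h
                where tr : ∀ a b → 0 < a * b2n b → b ≡ true
                      tr a true h = refl
                      tr a false h with () ← ≤-trans h (≤-reflexive (*-zeroʳ a))
          a = toList c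
          I : AInv R (proj₁ someone) a
          I = confA-sound R (proj₁ someone) c (proj₂ someone)
          oR' = take t1 a
          oL' = drop t1 a
          la : length a ≡ mA
          la = length-toList c
          RL : oR' ++ oL' ≡ a
          RL = take++drop≡id t1 a
          lens = split-len t1 a (≤-trans (m≤m+n t1 t1) (≤-reflexive (symm (la ⟫ mA≡))))
          lL' : length oL' ≡ t1
          lL' = proj₂ lens ⟫ cong (_∸ t1) (la ⟫ mA≡) ⟫ m+n∸n≡m t1 t1
          rm = remove _≟v_ a R (uW amR) (AInv.au I) (AInv.aW I)
          R2 = proj₁ rm
          p2 : R ↭ a ++ R2
          p2 = proj₂ rm
          a∉R2 : ∀ {x} → x ∈ a → x ∉ R2
          a∉R2 = Unique-++-disj a (Unique-↭ p2 (uW amR))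
          inL : ∀ {x} → x ∈ oL' → x ∈ a
          inL m = subst (_ ∈_) RL (∈-++⁺ʳ oR' m)
          inR : ∀ {x} → x ∈ oR' → x ∈ a
          inR m = subst (_ ∈_) RL (∈-++⁺ˡ m)
          uRL : Unique (oR' ++ oL')
          uRL = subst Unique (symm RL) (AInv.au I)
          pRL : PP (oR' ++ oL')
          pRL = subst PP (symm RL) (AInv.aP I)
          eL : End U R2 oL'
          eL = record { XU = λ m → WU amR (AInv.aW I (inL m)) ; uX = Unique-++ʳ oR' uRL ; lX = lL'
            ; CX = PP-window oL' (subst PP (symm (++-identityʳ oL')) (PP-++ʳ oR' pRL)) (≤-trans (≤-reflexive lL') (n≤1+n t1))
            ; dX = λ m → a∉R2 (inL m) }
          pW2 : W ↭ (body S ++ a) ++ R2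
          pW2 = ↭-trans part (↭-trans (++⁺ˡ (body S) p2) (↭-reflexive (symm (++-assoc (body S) a R2))))
          mar2 : D * b + e₂ ≤ length R2
          mar2 = enough {R2} {body S ++ a} pW2 (bud (≤-trans (≤-reflexive (length-++ (body S))) (+-mono-≤ len (≤-reflexive la))))
          lk : Link R2 (end S) oL'
          lk = conn (Amb-sub a p2 amR) (End-sub a p2 eS) eL mar2
                 (≤-trans (≤-trans (≤-trans (m≤n+m _ (length a)) (≤-reflexive (symm (length-part a p2)))) R≤W) hq)
                 (≤-trans hw (≤-trans (m≤n+m e₂ (D * b)) mar2))
          ps = proj₁ lk
          ups : Unique ps
          ups = proj₁ (proj₂ lk)
          sps : ps ⊆l R2
          sps = proj₁ (proj₂ (proj₂ lk))
          lps : length ps ≤ NC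
          lps = proj₁ (proj₂ (proj₂ (proj₂ lk)))
          pps : PP (oL' ++ ps ++ end S)
          pps = proj₂ (proj₂ (proj₂ (proj₂ lk)))
          rm3 = remove _≟v_ ps R2 (uW (Amb-sub a p2 amR)) ups sps
          R3 = proj₁ rm3
          p3 : R2 ↭ ps ++ R3
          p3 = proj₂ rm3
          B : Block
          B = record { oR = oR' ; mid = [] ; oL = oL' ; cn = ps ; ab = λ v → confA R v c ; lR = proj₁ lens ; lL = lL'
            ; absb = λ v e → PP-insert v oR' oL' lL' (≤-reflexive (proj₁ lens)) pRL
                (subst (With v) (symm RL) (AInv.ac (confA-sound R v c e))) }
          eqB : a ++ ps ++ body S ++ R3 ≡ body (B ∷ S) ++ R3
          eqB = cong (_++ ps ++ body S ++ R3) (symm RL) ⟫ ++-assoc oR' oL' _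
              ⟫ symm (++-assoc oR' _ R3 ⟫ cong (oR' ++_) (++-assoc oL' _ R3 ⟫ cong (oL' ++_) (++-assoc ps (body S) R3)))
          pW3 : W ↭ body (B ∷ S) ++ R3
          pW3 = ↭-trans part (↭-trans (++⁺ˡ (body S) (↭-trans p2 (++⁺ˡ a p3)))
                  (↭-trans (shifts (body S) a) (↭-trans (++⁺ˡ a (shifts (body S) ps)) (↭-reflexive eqB))))
          st' : AState (suc i) (λ j → Xf j + xs j)
          st' = record { S = B ∷ S ; R = R3 ; vS = pRL , pps , vS ; part = pW3
            ; len = ≤-trans (≤-reflexive (length-++ oR' ⟫ cong (length oR' +_) (length-++ oL' ⟫ cong (length oL' +_) (length-++ ps))))
                (≤-trans (≤-reflexive (absorb-identity₁ (length oR') (length oL') (length ps) (length (body S)) ⟫ cong₂ (λ x y → (x + y + length ps) + length (body S)) (proj₁ lens) lL' ⟫ cong (λ z → z + length ps + length (body S)) (symm mA≡)))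
                  (+-mono-≤ (+-monoʳ-≤ mA lps) len))
            ; eS = record { XU = λ m → WU amR (AInv.aW I (inR m)) ; uX = Unique-++ˡ oR' uRL ; lX = proj₁ lens
                ; CX = PP-window oR' pRL (≤-trans (≤-reflexive (proj₁ lens)) (n≤1+n t1))
                ; dX = λ m n → a∉R2 (inR m) (∈-part ps p3 n) }
            ; cX = λ v → cong (_+ xs v) (cX v) ⟫ +-comm (ℓ * cnt (λ B → ab B v) S) (xs v) ⟫ symm (*-distribˡ-+ ℓ (b2n (confA R v c)) _)
            ; un = un }

    step : ∀ i Xf → i < N → AState i Xf → (φ : V → ℕ) → (∀ j → 0 < φ j) →
      ∃ λ (x : V → ℕ) → (∀ j → x j ≤ ℓ) × 2 * sumL φ W ≤ sumL (λ j → φ j * x j) W × AState (suc i) (λ j → Xf j + x j)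
    step i Xf i< st φ φ>0 = let c , _ , lt = ΣV-∃ mA {λ _ → pred (sumL φ W)} {λ c → qm * Step.gain i i< Xf st φ φ>0 c} (Step.avg i i< Xf st φ φ>0) in Step.next i i< Xf st φ φ>0 c lt

    start : AState 0 (λ _ → 0)
    start = record { S = [] ; R = W ; vS = CX eX ; part = refl ; len = z≤n ; eS = eX ; cX = λ v → symm (*-zeroʳ ℓ) ; un = refl }

    absorber′ : Absorber U W X (lX eX) N ℓ
    absorber′ = fin (MW.result W ℓ' 1 N AState step start big)
      where
        fin : _ → Absorber U W X (lX eX) N ℓ
        fin (Xf , st , h) = S , R , vS , part , len , eS , un , λ {v} m → ≤-trans (≤-reflexive (symm (+-identityʳ N))) (≤-trans (h m) (≤-reflexive (cX v)))
          where open AState st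

  abstract
    absorber : ∀ {U W X b} → Amb U W b → (eX : End U W X) → ∀ {q w₀} → Connects q w₀ → ∀ e₁ e₂ eₐ qa N →
      D * b + e₁ + e₂ ≤ length W → length W ≤ q * e₂ → w₀ ≤ e₂ → eₐ + suc mA ≤ e₂ → length W ≤ qa * eₐ →
      N * (mA + NC) ≤ e₁ → 0 < length W →
      length W * mwA (qa ^ mA + qa ^ mA) 1 ^ N < suc (mwA (qa ^ mA + qa ^ mA) 1) ^ N →
      Absorber U W X (lX eX) N (suc (qa ^ mA + qa ^ mA))
    absorber am eX {q} {w₀} conn = Absorbing.absorber′ am eX {q} {w₀} conn

  -- Covering

  open import Data.List.Relation.Unary.Unique.DecPropositional _≟v_ using (unique?)

  tests : List V → List (List V)
  tests U = filter unique? (lists k1 U)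

  length-tests : ∀ U → length (tests U) ≤ length U ^ k1
  length-tests U = ≤-trans (length-filter unique? (lists k1 U)) (≤-reflexive (length-lists k1 U))

  tests-∈ : ∀ {U S} → length S ≡ k1 → Unique S → S ⊆l U → S ∈ tests U
  tests-∈ {U} {S} l u h = ∈-filter⁺ unique? (subst (λ n → S ∈ lists n U) l (∈-lists S U h)) u

  lists-good : ∀ n {U : List V} {S : List V} → S ∈ lists n U → length S ≡ n × S ⊆l U
  lists-good zero (here refl) = refl , λ ()
  lists-good (suc n) {U} {S} m with ∈-concat⁻′ (map (λ x → map (x ∷_) (lists n U)) U) m
  ... | ys , a , b with ∈-map⁻ (λ x → map (x ∷_) (lists n U)) b
  ...   | x , x∈ , refl with ∈-map⁻ (x ∷_) a
  ...     | S' , s∈ , refl with lists-good n s∈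
  ...       | l , h = cong suc l , λ { (here refl) → x∈ ; (there q) → h q }

  tests-Good : ∀ {U W b S} → Good U W b → S ∈ tests U → cnt (bad S) W ≤ b
  tests-Good {U} {W} {b} {S} G m with ∈-filter⁻ unique? {xs = lists k1 U} m
  ... | s∈ , u with lists-good k1 s∈
  ...   | l , h = good G S l u h

  record PathTo (U R p : List V) : Set where
    field
      en rs : List V
      peq   : p ≡ en ++ rs
      pend  : End U R en
      ppp   : PP p
  open PathTo public

  record Extended (U R p tl : List V) : Set where
    field
      xps xR : List V
      xpart : R ↭ (tl ++ xps) ++ xR
      xlen  : length xps ≤ NC
      xpath : PathTo U xR ((tl ++ xps) ++ p)
  open Extended public

  -- The last t1 vertices Y of the tile are connected to the old end of the path, and its first t1
  -- vertices become the new end.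
  extend : ∀ {U R p b q w₀ e} → Amb U R b → Connects q w₀ → PathTo U R p →
    ∀ tl → Unique tl → tl ⊆l R → PP tl → t1 ≤ length tl →
    D * b + e + length tl ≤ length R → length R ≤ q * e → w₀ ≤ e → Extended U R p tl
  extend {U} {R} {p} {b} {q} {w₀} {e} am conn pt tl utl stl ptl ltl mar hq hw = record
    { xps = ps ; xR = R3 ; xpart = ↭-trans p2 (↭-trans (++⁺ˡ tl p3) (↭-reflexive (symm (++-assoc tl ps R3)))) ; xlen = lps
    ; xpath = record { en = take t1 tl ; rs = (drop t1 tl ++ ps) ++ p
        ; peq = cong (λ z → (z ++ ps) ++ p) (symm (take++drop≡id t1 tl)) ⟫ cong (_++ p) (++-assoc (take t1 tl) (drop t1 tl) ps) ⟫ ++-assoc (take t1 tl) (drop t1 tl ++ ps) p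
        ; pend = record { XU = λ m → WU am (stl (∈-take t1 tl m)) ; uX = UniqueP.take⁺ t1 utl
            ; lX = length-take t1 tl ⟫ m≤n⇒m⊓n≡m ltl ; CX = PP-take tl ptl
            ; dX = λ m n → tl∉R2 (∈-take t1 tl m) (∈-part ps p3 n) }
        ; ppp = final } }
    where
      d = length tl ∸ t1
      hd = take d tl
      Y = drop d tl
      hdY : hd ++ Y ≡ tl
      hdY = take++drop≡id d tl
      lY : length Y ≡ t1
      lY = length-drop d tl ⟫ m∸[m∸n]≡n ltl
      inY : ∀ {x} → x ∈ Y → x ∈ tl
      inY m = subst (_ ∈_) hdY (∈-++⁺ʳ hd m)
      rm = remove _≟v_ tl R (uW am) utl stl
      R2 = proj₁ rm
      p2 : R ↭ tl ++ R2
      p2 = proj₂ rm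
      tl∉R2 : ∀ {x} → x ∈ tl → x ∉ R2
      tl∉R2 = Unique-++-disj tl (Unique-↭ p2 (uW am))
      lnR : length R ≡ length tl + length R2
      lnR = length-part tl p2
      mar2 : D * b + e ≤ length R2
      mar2 = +-cancelʳ-≤ (length tl) _ _ (≤-trans mar (≤-reflexive (lnR ⟫ +-comm (length tl) (length R2))))
      eY : End U R2 Y
      eY = record { XU = λ m → WU am (stl (inY m)) ; uX = UniqueP.drop⁺ d utl ; lX = lY
        ; CX = PP-window Y (subst PP (symm (++-identityʳ Y)) (PP-++ʳ hd (subst PP (symm hdY) ptl))) (≤-trans (≤-reflexive lY) (n≤1+n t1))
        ; dX = λ m → tl∉R2 (inY m) }
      lk : Link R2 (en pt) Y
      lk = conn (Amb-sub tl p2 am) (End-sub tl p2 (pend pt)) eY mar2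
             (≤-trans (≤-trans (m≤n+m _ (length tl)) (≤-reflexive (symm lnR))) hq) (≤-trans hw (≤-trans (m≤n+m e (D * b)) mar2))
      ps = proj₁ lk
      lps : length ps ≤ NC
      lps = proj₁ (proj₂ (proj₂ (proj₂ lk)))
      pps : PP (Y ++ ps ++ en pt)
      pps = proj₂ (proj₂ (proj₂ (proj₂ lk)))
      rm3 = remove _≟v_ ps R2 (uW (Amb-sub tl p2 am)) (proj₁ (proj₂ lk)) (proj₁ (proj₂ (proj₂ lk)))
      R3 = proj₁ rm3
      p3 : R2 ↭ ps ++ R3
      p3 = proj₂ rm3
      low : PP (Y ++ ps ++ p)
      low = subst PP (++-assoc Y ps (en pt ++ rs pt) ⟫ cong (λ z → Y ++ ps ++ z) (symm (peq pt)))
        (PP-glue (Y ++ ps) (en pt) (≤-reflexive (symm (lX (pend pt)))) (subst PP (symm (++-assoc Y ps (en pt))) pps)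
          (subst PP (peq pt) (ppp pt)))
      final : PP ((tl ++ ps) ++ p)
      final = subst PP (symm (++-assoc tl ps p ⟫ cong (_++ ps ++ p) (symm hdY) ⟫ ++-assoc hd Y (ps ++ p)))
        (PP-glue hd Y (≤-reflexive (symm lY)) (subst PP (symm hdY) ptl) low)

  PhaseResult : List V → List V → List V → ℕ → ℕ → ℕ → ℕ → Set
  PhaseResult U R p b h μ' N = ∃ λ vs → ∃ λ R' → R ↭ vs ++ R' × PathTo U R' (vs ++ p) ×
    N * ell h ≤ length vs × length vs ≤ N * (ell h + NC) × Good U R' (b ∸ μ' * N)

  module Phase {U R p : List V} {b : ℕ} (am : Amb U R b) (pt : PathTo U R p) {q w₀ : ℕ} (conn : Connects q w₀)
    (h μ' N f eₜ e₁ e₂ : ℕ) (hb : b ≤ length R)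
    (mar : D * b + e₁ + e₂ ≤ length R) (hq : length R ≤ q * e₂) (hw : w₀ ≤ e₂)
    (hN : N * (ell h + NC) ≤ e₁) (hf : N * (ell h + NC) + T + eₜ ≤ f) (hD : D * b + f ≤ length R)
    (hμ : suc μ' * length R + ell h * f ≤ ell h * b) (hwalk : ell h * (ell h * length R ^ t1) < eₜ ^ T)
    (r>0 : 0 < length R)
    (big : length (tests U) * mwA (pred (ell h)) μ' ^ N < suc (mwA (pred (ell h)) μ') ^ N) where

    ℓ r : ℕ
    ℓ = ell h
    r = length R
    js = tests U

    pad : List V → V → Bool
    pad S with cnt (bad S) R ≤? b
    -- A default for lists that are not tests; for tests `tests-Good` rules this case out.
    ... | no _ = bad S
    ... | yes le' = proj₁ (pad-ex _≟v_ (b ∸ cnt (bad S) R) (bad S) R (uW am) (≤-trans (≤-reflexive (m+[n∸m]≡n le')) hb))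

    pad-cnt : ∀ S → cnt (bad S) R ≤ b → cnt (pad S) R ≡ b
    pad-cnt S hS with cnt (bad S) R ≤? b
    ... | no n = ⊥-elim (n hS)
    ... | yes le' = proj₂ (proj₂ (pad-ex _≟v_ (b ∸ cnt (bad S) R) (bad S) R (uW am) (≤-trans (≤-reflexive (m+[n∸m]≡n le')) hb))) ⟫ m+[n∸m]≡n le'

    pad-bad : ∀ S x → bad S x ≡ true → pad S x ≡ true
    pad-bad S x e with cnt (bad S) R ≤? b
    ... | no n = e
    ... | yes le' = proj₁ (proj₂ (pad-ex _≟v_ (b ∸ cnt (bad S) R) (bad S) R (uW am) (≤-trans (≤-reflexive (m+[n∸m]≡n le')) hb))) x e

    record PState (i : ℕ) (X : List V → ℕ) : Set where
      field
        vs R' : List V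
        part  : R ↭ vs ++ R'
        path  : PathTo U R' (vs ++ p)
        lo    : i * ℓ ≤ length vs
        hi    : length vs ≤ i * (ℓ + NC)
        cX    : ∀ S → X S ≤ cnt (pad S) vs

    module Step (i : ℕ) (i< : i < N) (X : List V → ℕ) (st : PState i X) (φ : List V → ℕ) where
      open PState st
      Φ = sumL φ js
      -- The weight of v is the total weight of the padded bad sets it lies in. All of these have
      -- size b, so the weights over R add up to exactly b·Φ.
      ω : V → ℕ
      ω v = sumL (λ S → φ S * b2n (pad S v)) js
      ω≤ : ∀ {v} → v ∈ R → ω v ≤ Φ
      ω≤ {v} _ = sumL-mono js (λ {S} _ → ≤-trans (*-monoʳ-≤ (φ S) (b2n≤1 (pad S v))) (≤-reflexive (*-identityʳ (φ S))))
      ωsum : ∀ xs → sumL ω xs ≡ sumL (λ S → φ S * cnt (pad S) xs) js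
      ωsum xs = sumL-swap (λ v S → φ S * b2n (pad S v)) xs js ⟫ sumL-cong js (λ {S} _ → sumL-* (φ S) (λ v → b2n (pad S v)) xs)
      ωR : sumL ω R ≡ b * Φ
      ωR = ωsum R ⟫ sumL-cong js (λ {S} m → cong (φ S *_) (pad-cnt S (tests-Good (gd am) m)) ⟫ *-comm (φ S) b) ⟫ sumL-* b φ js
      used≤ : length vs + ℓ ≤ N * (ℓ + NC)
      used≤ = ≤-trans (+-mono-≤ hi (m≤m+n ℓ NC)) (≤-trans (≤-reflexive (+-comm _ (ℓ + NC))) (*-monoˡ-≤ (ℓ + NC) i<))
      module Hv = Heavy {U} {R} {vs} {R'} am part ω Φ ω≤ f eₜ
        (≤-trans (+-monoˡ-≤ eₜ (+-monoˡ-≤ T (≤-trans (m≤m+n _ ℓ) used≤))) hf) hD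
      lenR : length R ≡ length vs + length R'
      lenR = length-part vs part
      R'≤ : length R' ≤ r
      R'≤ = ≤-trans (m≤n+m _ (length vs)) (≤-reflexive (symm lenR))
      tile = Hv.tile h (≤-<-trans (*-monoʳ-≤ ℓ (*-monoʳ-≤ ℓ (^-monoˡ-≤ t1 R'≤))) hwalk)
      tl = proj₁ tile
      ltl : length tl ≡ ℓ
      ltl = proj₁ (proj₂ tile)
      amR' : Amb U R' b
      amR' = Amb-sub vs part am
      marT : D * b + e₂ + length tl ≤ length R'
      marT = lin 0 (+-mono-≤ (+-mono-≤ mar (≤-trans used≤ hN)) (+-mono-≤ (≤-reflexive lenR) (≤-reflexive ltl)))
        (tile-identity₁ (D * b) e₂ (length tl) e₁ (length vs) ℓ r (length R'))
      ext : Extended U R' (vs ++ p) tl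
      ext = extend {q = q} {w₀} {e₂} amR' conn path tl (proj₁ (proj₂ (proj₂ tile))) (proj₁ (proj₂ (proj₂ (proj₂ tile))))
        (proj₁ (proj₂ (proj₂ (proj₂ (proj₂ tile))))) (≤-trans (≤-trans (n≤1+n t1) (m≤m+n T (h * T))) (≤-reflexive (symm ltl)))
        marT (≤-trans R'≤ hq) hw
      x : List V → ℕ
      x S = cnt (pad S) tl
      gain : suc μ' * Φ ≤ sumL (λ S → φ S * x S) js
      gain = *-canc-≤ r r>0 (+-cancelʳ-≤ (ℓ * (Φ * f)) _ _ (begin
        r * (suc μ' * Φ) + ℓ * (Φ * f)        ≡⟨ tile-identity₂ r (suc μ') Φ ℓ f ⟩
        (suc μ' * r + ℓ * f) * Φ              ≤⟨ *-monoˡ-≤ Φ hμ ⟩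
        ℓ * b * Φ                             ≡⟨ *-assoc ℓ b Φ ⟫ cong (ℓ *_) (symm ωR) ⟩
        ℓ * sumL ω R                          ≤⟨ proj₂ (proj₂ (proj₂ (proj₂ (proj₂ tile)))) ⟩
        r * sumL ω tl + ℓ * (Φ * f)           ≡⟨ cong (λ z → r * z + ℓ * (Φ * f)) (ωsum tl) ⟩
        r * sumL (λ S → φ S * x S) js + ℓ * (Φ * f) ∎))
        where
          open ≤-Reasoning
      st' : PState (suc i) (λ S → X S + x S)
      st' = record
        { vs = (tl ++ xps ext) ++ vs ; R' = xR ext
        ; part = ↭-trans part (↭-trans (++⁺ˡ vs (xpart ext)) (↭-trans (shifts vs (tl ++ xps ext)) (↭-reflexive (symm (++-assoc (tl ++ xps ext) vs (xR ext))))))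
        ; path = subst (PathTo U (xR ext)) (symm (++-assoc (tl ++ xps ext) vs p)) (xpath ext)
        ; lo = ≤-trans (+-mono-≤ (≤-trans (≤-reflexive (symm ltl)) (m≤m+n _ (length (xps ext)))) lo) (≤-reflexive (symm ln))
        ; hi = ≤-trans (≤-reflexive ln) (+-mono-≤ (+-mono-≤ (≤-reflexive ltl) (xlen ext)) hi)
        ; cX = λ S → ≤-trans (≤-trans (≤-reflexive (+-comm (X S) (x S))) (+-mono-≤ (m≤m+n (x S) (cnt (pad S) (xps ext))) (cX S)))
            (≤-reflexive (symm (sumL-++ _ (tl ++ xps ext) vs ⟫ cong (_+ cnt (pad S) vs) (sumL-++ _ tl (xps ext))))) }
        where ln : length ((tl ++ xps ext) ++ vs) ≡ length tl + length (xps ext) + length vs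
              ln = length-++ (tl ++ xps ext) ⟫ cong (_+ length vs) (length-++ tl)

    step : ∀ i X → i < N → PState i X → (φ : List V → ℕ) → (∀ j → 0 < φ j) →
      ∃ λ (x : List V → ℕ) → (∀ j → x j ≤ suc (pred ℓ)) × suc μ' * sumL φ js ≤ sumL (λ j → φ j * x j) js × PState (suc i) (λ j → X j + x j)
    step i X i< st φ _ = Step.x i i< X st φ
      , (λ S → ≤-trans (cnt≤length (pad S) (Step.tl i i< X st φ)) (≤-reflexive (Step.ltl i i< X st φ)))
      , Step.gain i i< X st φ , Step.st' i i< X st φ

    start : PState 0 (λ _ → 0)
    start = record { vs = [] ; R' = R ; part = refl ; path = pt ; lo = z≤n ; hi = z≤n ; cX = λ _ → z≤n }

    phase′ : PhaseResult U R p b h μ' N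
    phase′ = fin (MW.result js (pred ℓ) μ' N PState step start big)
      where
        fin : _ → PhaseResult U R p b h μ' N
        fin (X , st , hX) = vs , R' , part , path , lo , hi , mkGood gdd
          where
            open PState st
            gdd : ∀ S → length S ≡ k1 → Unique S → S ⊆l U → cnt (bad S) R' ≤ b ∸ μ' * N
            gdd S l u s = m+n≤o⇒n≤o∸m
              where
                S∈ = tests-∈ l u s
                eqc : cnt (pad S) vs + cnt (pad S) R' ≡ b
                eqc = symm (cnt-sub (pad S) vs part) ⟫ pad-cnt S (tests-Good (gd am) S∈)
                m+n≤o⇒n≤o∸m : cnt (bad S) R' ≤ b ∸ μ' * N
                m+n≤o⇒n≤o∸m = ≤-trans (cnt-mono R' (λ {y} _ → pad-bad S y))
                  (≤-trans (≤-reflexive (symm (m+n∸m≡n (cnt (pad S) vs) _) ⟫ cong (_∸ cnt (pad S) vs) eqc))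
                    (∸-monoʳ-≤ b (≤-trans (hX S∈) (cX S))))

  abstract
    phase : ∀ {U R p b} → Amb U R b → PathTo U R p → ∀ {q w₀} → Connects q w₀ →
      ∀ h μ' N f eₜ e₁ e₂ → b ≤ length R → D * b + e₁ + e₂ ≤ length R → length R ≤ q * e₂ → w₀ ≤ e₂ →
      N * (ell h + NC) ≤ e₁ → N * (ell h + NC) + T + eₜ ≤ f → D * b + f ≤ length R →
      suc μ' * length R + ell h * f ≤ ell h * b → ell h * (ell h * length R ^ t1) < eₜ ^ T → 0 < length R →
      length (tests U) * mwA (pred (ell h)) μ' ^ N < suc (mwA (pred (ell h)) μ') ^ N →
      PhaseResult U R p b h μ' N
    phase am pt {q} {w₀} conn = Phase.phase′ am pt {q} {w₀} conn

  -- The remainder lies between w/(2z) and w/z: small enough to be absorbed, yet large enough for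
  -- one more connection with relative slack 1/(4q).
  record Covered (q z w : ℕ) (U R p : List V) : Set where
    field
      cvs cR : List V
      cb     : ℕ
      cpart  : R ↭ cvs ++ cR
      cpath  : PathTo U cR (cvs ++ p)
      cgood  : Good U cR cb
      small  : length cR * z ≤ w
      large  : w ≤ 2 * z * length cR
      slack  : 4 * q * (D * cb) + length cR ≤ 4 * q * length cR

  module Cover (q z : ℕ) (D>0 : 0 < D) (q>0 : 0 < q) (z>0 : 0 < z) where
    open PhaseNum D q z D>0 q>0 z>0 using (Θ; Q; s₁; Q-s₁; s₁-def; s₁>0; Θ>0; Q>0; phaseNumbers)

    open CoverSize t2 k2 q z D>0 q>0 z>0

    conn : Connects (16 * q) w₀
    conn = connect (16 * q)

    h≤ℓ : 4 * Q * NC + 8 * D * Q + NC ≤ ℓ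
    h≤ℓ = ≤-trans (≤-reflexive (symm h-def)) (≤-trans (n≤1+n h) (≤-trans (≤-reflexive (symm (*-identityʳ (suc h)))) (*-monoʳ-≤ (suc h) (s≤s z≤n))))

    T≤ℓ : T ≤ ℓ
    T≤ℓ = m≤m+n T (h * T)

    c>0 : 0 < c
    c>0 = *-mono-≤ Θ>0 (≤-trans (s≤s z≤n) T≤ℓ)

    instance
      nzc : NonZero c
      nzc = >-nonZero c>0

    module Run {U : List V} (w : ℕ) (hU : length U ≤ 3 * w) (hw₁ : w₁ ≤ w) where
      N : ℕ
      N = w / c

      Nc≤w : N * c ≤ w
      Nc≤w = m/n*n≤m w c

      N₀<N : N₀ < N
      N₀<N = ≤-pred (*-cancelʳ-< c (suc N₀) (suc N) (≤-<-trans (≤-trans (≤-reflexive (*-comm (suc N₀) c)) (≤-trans (m≤m+n _ (z * X₀)) hw₁)) (div-lower w c)))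

      w≤2cN : w ≤ 2 * c * N
      w≤2cN = ≤-trans (<⇒≤ (div-lower w c)) (≤-trans (*-monoˡ-≤ c (+-monoˡ-≤ N (≤-trans (s≤s z≤n) N₀<N))) (≤-reflexive (cover-identity₂ N c)))

      beats : length (tests U) * Amax ^ N < suc Amax ^ N
      beats = ≤-<-trans (*-monoˡ-≤ (Amax ^ N) (≤-trans (length-tests U) (^-monoˡ-≤ k1 (≤-trans hU (≤-trans (*-monoʳ-≤ 3 w≤2cN) (≤-reflexive (cover-identity₃ c N)))))))
                (proj₂ (exp-beats Amax k1 (6 * c) (mwA-pos (pred ℓ) ℓ)) N (<⇒≤ N₀<N))

      -- n counts the units of slack above s₁ that may still be spent. Every phase uses at least N·ℓ
      -- vertices, so at n = 0 nothing is left to cover.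
      cover : ∀ n {R b p} → Amb U R b → PathTo U R p → D * Q * b + (s₁ + n) * length R ≤ Q * length R →
        n ≤ s₁ → length R ≤ n * (N * ℓ) → length R ≤ w → w ≤ 2 * z * length R → Covered q z w U R p
      cover n {R} {b} {p} am pt hb hn hR hRw hlow with length R * z ≤? w
      ... | yes sm = record { cvs = [] ; cR = R ; cb = b ; cpart = refl ; cpath = pt ; cgood = gd am ; small = sm ; large = hlow
          ; slack = *-canc-≤ s₁ s₁>0 (begin
              s₁ * (4 * q * (D * b) + r)        ≡⟨ cover-identity₆ s₁ q D b r ⟩
              D * (4 * q * s₁) * b + s₁ * r     ≡⟨ cong (λ y → D * y * b + s₁ * r) (symm Q-s₁) ⟩
              D * Q * b + s₁ * r                ≤⟨ +-monoʳ-≤ (D * Q * b) (*-monoˡ-≤ r (m≤m+n s₁ n)) ⟩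
              D * Q * b + (s₁ + n) * r          ≤⟨ hb ⟩
              Q * r                              ≡⟨ cong (_* r) Q-s₁ ⟩
              4 * q * s₁ * r                     ≡⟨ cover-identity₇ q s₁ r ⟩
              s₁ * (4 * q * r) ∎) }
        where
          open ≤-Reasoning
          r = length R
      cover zero {R} am pt hb hn hR hRw hlow | no ¬sm = ⊥-elim (¬sm (≤-trans (*-monoˡ-≤ z hR) z≤n))
      cover (suc n) {R} {b} {p} am pt hb hn hR hRw hlow | no ¬sm = combine onePhase
        where
          r = length R
          w<rz : w < r * z
          w<rz = ≰⇒> ¬sm
          big-r : ∀ x → x ≤ X₀ → x < r
          big-r x hx = *-cancelʳ-< z x r (≤-<-trans (≤-trans (*-monoˡ-≤ z hx) (≤-trans (≤-reflexive (*-comm X₀ z)) (≤-trans (m≤n+m _ (c * suc N₀)) hw₁))) w<rz)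
          s' = s₁ + n
          hb' : D * Q * b + suc s' * r ≤ Q * r
          hb' = subst (λ y → D * Q * b + y * r ≤ Q * r) (+-suc s₁ n) hb
          h₁ : 4 * Q * NC ≤ ℓ
          h₁ = ≤-trans (≤-trans (m≤m+n (4 * Q * NC) (8 * D * Q)) (m≤m+n (4 * Q * NC + 8 * D * Q) NC)) h≤ℓ
          h₂ : 8 * D * Q ≤ ℓ
          h₂ = ≤-trans (≤-trans (m≤n+m (8 * D * Q) (4 * Q * NC)) (m≤m+n (4 * Q * NC + 8 * D * Q) NC)) h≤ℓ
          nums : PhaseNumbers D Q q ℓ NC T N r s' b
          nums = phaseNumbers ℓ NC T N r w s' b (≤-trans (m≤m+n s₁ n) (n≤1+n s'))
            (≤-trans (≤-reflexive (symm (+-suc s₁ n))) (+-monoʳ-≤ s₁ hn)) Nc≤w w<rz h₁ h₂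
            (≤-trans (m≤n+m NC (4 * Q * NC + 8 * D * Q)) h≤ℓ) T≤ℓ (≤-trans (s≤s z≤n) N₀<N)
            (<⇒≤ (big-r (8 * D * q) (≤-trans (m≤m+n (8 * D * q) (8 * q * w₀)) (m≤m+n _ (ℓ * ℓ * (2 * Θ) ^ T))))) hb'
          open PhaseNumbers nums
          am₊ : Amb U R b₊
          am₊ = record { uW = uW am ; gd = Good-b b≤b₊ (gd am) ; WU = WU am }
          wk : ℓ * (ℓ * r ^ t1) < (N * ℓ) ^ T
          wk = ≤-<-trans (≤-reflexive (symm (*-assoc ℓ ℓ (r ^ t1)))) (power-room (2 * Θ) (N * ℓ) r t1 (ℓ * ℓ)
              (≤-trans hRw (≤-trans w≤2cN (≤-reflexive (cover-identity₈ Θ ℓ N))))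
              (big-r (ℓ * ℓ * (2 * Θ) ^ T) (m≤n+m _ (8 * D * q + 8 * q * w₀))))
          onePhase : PhaseResult U R p b₊ h μ' N
          onePhase = phase am₊ pt {16 * q} {w₀} conn h μ' N f (N * ℓ) e₁ e₂ b₊≤r mar hq
            (e₂-big w₀ (<⇒≤ (big-r (8 * q * w₀) (≤-trans (m≤n+m (8 * q * w₀) (8 * D * q)) (m≤m+n _ (ℓ * ℓ * (2 * Θ) ^ T))))))
            hN hf hD hμ wk r>0
            (exp-mono (length (tests U)) N (mwA-pos (pred ℓ) μ') (mwA-mono (pred ℓ) μ'≤ℓ) beats)
          combine : PhaseResult U R p b₊ h μ' N → Covered q z w U R p
          combine (vs , R₁ , part , path , lo , hi , gd₁) = record
            { cvs = cvs rec ++ vs ; cR = cR rec ; cb = cb rec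
            ; cpart = ↭-trans part (↭-trans (++⁺ˡ vs (cpart rec)) (↭-trans (shifts vs (cvs rec)) (↭-reflexive (symm (++-assoc (cvs rec) vs (cR rec))))))
            ; cpath = subst (PathTo U (cR rec)) (symm (++-assoc (cvs rec) vs p)) (cpath rec)
            ; cgood = cgood rec ; small = small rec ; large = large rec ; slack = slack rec }
            where
              open Covered
              er : r ≡ length vs + length R₁
              er = length-part vs part
              2v≤r : length vs + length vs ≤ r
              2v≤r = ≤-trans (+-mono-≤ hi hi) half
              -- A phase takes at most half of R, so the remainder after the last phase does not
              -- fall below w/(2z).
              v≤r₁ : length vs ≤ length R₁
              v≤r₁ = +-cancelˡ-≤ (length vs) _ _ (≤-trans 2v≤r (≤-reflexive er))
              rec : Covered q z w U R₁ (vs ++ p)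
              rec = cover n
                (record { uW = Unique-++ʳ vs (Unique-↭ part (uW am)) ; gd = gd₁ ; WU = λ m → WU am (∈-part vs part m) })
                path (next (length vs) (length R₁) er hi) (≤-trans (n≤1+n n) hn)
                (+-cancelˡ-≤ (N * ℓ) _ _ (≤-trans (+-monoˡ-≤ (length R₁) lo) (≤-trans (≤-reflexive (symm er)) hR)))
                (≤-trans (m≤n+m _ (length vs)) (≤-trans (≤-reflexive (symm er)) hRw))
                (≤-trans (<⇒≤ w<rz) (≤-trans (*-monoˡ-≤ z (≤-trans (≤-reflexive er) (+-monoˡ-≤ (length R₁) v≤r₁))) (≤-reflexive (cover-identity₁ (length R₁) z))))

      start : ∀ {R b p} → Amb U R b → PathTo U R p → 2 * q * (D * b) + length R ≤ 2 * q * length R →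
        length R ≤ w → w ≤ 2 * z * length R → Covered q z w U R p
      start {R} {b} am pt hb hRw hlow = cover s₁ am pt hb' ≤-refl
          (≤-trans hRw (≤-trans w≤2cN (≤-reflexive (cover-identity₈ Θ ℓ N ⟫ cong (_* (N * ℓ)) (symm s₁-def))))) hRw hlow
        where
          r = length R
          hb' : D * Q * b + (s₁ + s₁) * r ≤ Q * r
          hb' = begin
            D * Q * b + (s₁ + s₁) * r                    ≡⟨ cong (λ y → D * y * b + (s₁ + s₁) * r) Q-s₁ ⟩
            D * (4 * q * s₁) * b + (s₁ + s₁) * r         ≡⟨ cover-identity₄ D q s₁ b r ⟩
            2 * s₁ * (2 * q * (D * b) + r)               ≤⟨ *-monoʳ-≤ (2 * s₁) hb ⟩
            2 * s₁ * (2 * q * r)                         ≡⟨ cover-identity₅ s₁ q r ⟫ cong (_* r) (symm Q-s₁) ⟩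
            Q * r ∎
            where
              open ≤-Reasoning

  abstract
    covering : ∀ q z (D>0 : 0 < D) (q>0 : 0 < q) (z>0 : 0 < z) → ∀ {U R b p} w → length U ≤ 3 * w → coverW t2 k2 q z D>0 q>0 z>0 ≤ w →
      Amb U R b → PathTo U R p → 2 * q * (D * b) + length R ≤ 2 * q * length R →
      length R ≤ w → w ≤ 2 * z * length R → Covered q z w U R p
    covering q z D>0 q>0 z>0 w hU hw = Cover.Run.start q z D>0 q>0 z>0 w hU (≤-trans (≤-reflexive (symm (coverW-def t2 k2 q z D>0 q>0 z>0))) hw)

  -- Existence of a spanning power path

  Traverse : List V → List V → List V → Set
  Traverse W X Y = ∃ λ ws → ws ↭ W × PP (Y ++ ws ++ X)

  module Existence (q : ℕ) (D>0 : 0 < D) (q>0 : 0 < q) where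
    open ExistSize t2 k2 q D>0 q>0

    instance
      nzB : NonZero B
      nzB = >-nonZero B>0
      nz4q : NonZero (4 * q)
      nz4q = >-nonZero (*-mono-≤ {1} {4} (s≤s z≤n) q>0)
      nzq : NonZero q
      nzq = >-nonZero q>0

    conn : Connects qc w₀
    conn = connect qc

    module At {U W X Y : List V} {b : ℕ} (am : Amb U W b) (eX : End U W X) (eY : End U W Y) (hU : length U ≤ 3 * length W)
      (hb : q * (D * b) + length W ≤ q * length W) (hw : w₊ ≤ length W) where

      w e : ℕ
      w = length W
      e = w / (4 * q)

      X₁ X₂ X₃ X₄ : ℕ
      X₁ = 4 * q * (B * suc N₀)
      X₂ = 4 * q * (2 * suc mA)
      X₃ = 4 * q * w₀
      X₄ = 2 * z * (w₀ + 4 * q)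

      hX : X₁ + X₂ + X₃ + X₄ ≤ w
      hX = ≤-trans (m≤n+m _ w₁) hw

      hX₁ : X₁ ≤ w
      hX₁ = ≤-trans (≤-trans (m≤m+n X₁ X₂) (≤-trans (m≤m+n _ X₃) (m≤m+n _ X₄))) hX
      hX₂ : X₂ ≤ w
      hX₂ = ≤-trans (≤-trans (m≤n+m X₂ X₁) (≤-trans (m≤m+n _ X₃) (m≤m+n _ X₄))) hX
      hX₃ : X₃ ≤ w
      hX₃ = ≤-trans (≤-trans (m≤n+m X₃ (X₁ + X₂)) (m≤m+n _ X₄)) hX
      hX₄ : X₄ ≤ w
      hX₄ = ≤-trans (m≤n+m X₄ (X₁ + X₂ + X₃)) hX

      4qe≤w : e * (4 * q) ≤ w
      4qe≤w = m/n*n≤m w (4 * q)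

      w≤8qe : w ≤ 8 * q * e
      w≤8qe = ≤-trans (div-half w (4 * q) (≤-trans (≤-trans (≤-reflexive (symm (*-identityʳ (4 * q)))) (*-monoʳ-≤ (4 * q) {1} {2 * suc mA} (s≤s z≤n))) hX₂)) (≤-reflexive (exist-identity₂ q e))

      mar : D * b + e + e ≤ w
      mar = *-cancelˡ-≤ q (+-cancelʳ-≤ w _ _ (begin
        q * (D * b + e + e) + w             ≤⟨ lin (q * (e + e)) {L = 0} z≤n (exist-identity₁₂ q (D * b) e w) ⟩
        q * (D * b) + w + e * (4 * q)       ≤⟨ +-mono-≤ hb 4qe≤w ⟩
        q * w + w ∎))
        where
          open ≤-Reasoning

      eₐ N : ℕ
      eₐ = e ∸ suc mA
      N = e / B

      2m≤e : 2 * suc mA ≤ e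
      2m≤e = div-big w (4 * q) (2 * suc mA) hX₂

      ea≡ : eₐ + suc mA ≡ e
      ea≡ = m∸n+n≡m (≤-trans (m≤m+n (suc mA) (suc mA + 0)) 2m≤e)

      e≤2a : e ≤ 2 * eₐ
      e≤2a = lin 0 {L = 2 * suc mA + (e + e)} {R = e + (eₐ + suc mA + (eₐ + suc mA))} (+-mono-≤ 2m≤e (+-mono-≤ (≤-reflexive (symm ea≡)) (≤-reflexive (symm ea≡)))) (exist-identity₃ e eₐ (suc mA))

      w≤qae : w ≤ qa * eₐ
      w≤qae = ≤-trans w≤8qe (≤-trans (*-monoʳ-≤ (8 * q) e≤2a) (≤-reflexive (exist-identity₄ q eₐ)))

      N₀<N : N₀ < N
      N₀<N = div-big e B (suc N₀) (div-big w (4 * q) (B * suc N₀) hX₁)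

      w≤cN : w ≤ cA * N
      w≤cN = ≤-trans w≤8qe (≤-trans (*-monoʳ-≤ (8 * q) (div-half e B (≤-trans (≤-trans (≤-reflexive (symm (*-identityʳ B))) (*-monoʳ-≤ B {1} {suc N₀} (s≤s z≤n))) (div-big w (4 * q) (B * suc N₀) hX₁)))) (≤-reflexive (exist-identity₅ q B N)))

      w>0 : 0 < w
      w>0 = ≤-trans (*-mono-≤ (*-mono-≤ {1} {4} (s≤s z≤n) q>0) (s≤s {n = mA + (suc mA + 0)} z≤n)) hX₂

      big : length W * Aa ^ N < suc Aa ^ N
      big = ≤-<-trans (*-monoˡ-≤ (Aa ^ N) (≤-trans w≤cN (≤-reflexive (symm (*-identityʳ (cA * N))))))
              (proj₂ (exp-beats Aa 1 cA (mwA-pos (qa ^ mA + qa ^ mA) 1)) N (<⇒≤ N₀<N))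

      ares : Absorber U W X (lX eX) N ℓa
      ares = absorber am eX {qc} {w₀} conn e e eₐ qa N mar w≤8qe (div-big w (4 * q) w₀ hX₃)
        (≤-reflexive ea≡) w≤qae (m/n*n≤m e B) w>0 big
      open Chain X (lX eX)

      traverse : Absorber U W X (lX eX) N ℓa → Traverse W X Y
      traverse (S , R , vS , part , len , eS , un , many) = fin
        where
          r v : ℕ
          r = length R
          v = length (body S)
          wr : w ≡ v + r
          wr = length-part (body S) part
          v≤e : v ≤ e
          v≤e = ≤-trans len (m/n*n≤m e B)
          4qv : 4 * q * v ≤ w
          4qv = ≤-trans (*-monoʳ-≤ (4 * q) v≤e) (≤-trans (≤-reflexive (*-comm (4 * q) e)) 4qe≤w)
          2v≤w : v + v ≤ w
          2v≤w = ≤-trans (pos2 q v q>0) 4qv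
            where pos2 : ∀ q v → 0 < q → v + v ≤ 4 * q * v
                  pos2 (suc q') v _ = lin (2 * v + 4 * q' * v) {L = 0} z≤n (exist-identity₁ q' v)
          v≤r : v ≤ r
          v≤r = +-cancelˡ-≤ v v r (≤-trans 2v≤w (≤-reflexive wr))
          slack0 : 2 * q * (D * b) + r ≤ 2 * q * r
          slack0 = +-cancelʳ-≤ (2 * w) _ _ (begin
            2 * q * (D * b) + r + 2 * w        ≡⟨ exist-identity₆ q (D * b) r w ⟩
            2 * (q * (D * b) + w) + r          ≤⟨ +-monoˡ-≤ r (*-monoʳ-≤ 2 hb) ⟩
            2 * (q * w) + r                    ≡⟨ cong (λ y → 2 * (q * y) + r) wr ⟩
            2 * (q * (v + r)) + r              ≡⟨ exist-identity₇ q v r ⟩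
            2 * q * r + (2 * q * v + r)        ≤⟨ +-monoʳ-≤ (2 * q * r) (+-mono-≤ (≤-trans (lin (2 * q * v) {L = 0} z≤n (exist-identity₈ q v)) 4qv) r≤w) ⟩
            2 * q * r + (w + w)                ≡⟨ cong (2 * q * r +_) (exist-identity₉ w) ⟩
            2 * q * r + 2 * w ∎)
            where
              open ≤-Reasoning
              r≤w : r ≤ w
              r≤w = ≤-trans (m≤n+m r v) (≤-reflexive (symm wr))
          p₀ = body S ++ X
          pt₀ : PathTo U R p₀
          pt₀ = record { en = end S ; rs = tl S ; peq = end-tl S ; pend = eS ; ppp = chain-PP S vS }
          r≤w : r ≤ w
          r≤w = ≤-trans (m≤n+m r v) (≤-reflexive (symm wr))
          cov : Covered q z w U R p₀
          cov = covering q z D>0 q>0 z>0 w hU (≤-trans (m≤m+n w₁ _) hw) (Amb-sub (body S) part am) pt₀ slack0 r≤w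
            (≤-trans (≤-reflexive wr) (≤-trans (+-monoˡ-≤ r v≤r) (≤-trans (≤-reflexive (exist-identity₁₀ r)) (*-monoˡ-≤ r (*-monoʳ-≤ 2 z>0)))))
          open Covered cov
          r' : ℕ
          r' = length cR
          amC : Amb U cR cb
          amC = record { uW = Unique-++ʳ cvs (Unique-↭ cpart (uW (Amb-sub (body S) part am))) ; gd = cgood
                       ; WU = λ m → WU am (∈-part (body S) part (∈-part cvs cpart m)) }
          big-r : w₀ + 4 * q ≤ r'
          big-r = *-canc-≤ (2 * z) (*-mono-≤ {1} {2} (s≤s z≤n) z>0) (≤-trans hX₄ large)
          e' : ℕ
          e' = r' / (4 * q)
          marC : D * cb + e' ≤ r'
          marC = *-cancelˡ-≤ (4 * q) (≤-trans (≤-reflexive (*-distribˡ-+ (4 * q) (D * cb) e')) (≤-trans (+-monoʳ-≤ (4 * q * (D * cb)) (≤-trans (≤-reflexive (*-comm (4 * q) e')) (m/n*n≤m r' (4 * q)))) slack))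
          lk : Link cR (en cpath) Y
          lk = conn amC (pend cpath) (End-sub cvs cpart (End-sub (body S) part eY)) marC
            (≤-trans (div-half r' (4 * q) (≤-trans (m≤n+m (4 * q) w₀) big-r)) (≤-reflexive (exist-identity₂ q e')))
            (≤-trans (m≤m+n w₀ (4 * q)) big-r)
          ps = proj₁ lk
          pps : PP (Y ++ ps ++ en cpath)
          pps = proj₂ (proj₂ (proj₂ (proj₂ lk)))
          rm = remove _≟v_ ps cR (uW amC) (proj₁ (proj₂ lk)) (proj₁ (proj₂ (proj₂ lk)))
          Λ = proj₁ rm
          pΛ : cR ↭ ps ++ Λ
          pΛ = proj₂ rm
          Λ≤ : length Λ ≤ r'
          Λ≤ = ≤-trans (m≤n+m _ (length ps)) (≤-reflexive (symm (length-part ps pΛ)))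
          capacity : ∀ {x} → x ∈ Λ → cnt used S + length Λ ≤ cnt (λ B → ab B x) S
          capacity {x} m = subst (λ u → u + length Λ ≤ cnt (λ B → ab B x) S) (symm un)
            (*-cancelˡ-≤ ℓa (≤-trans (*-cancelˡ-≤ cA {{>-nonZero cA>0}} (begin
              cA * (ℓa * length Λ)    ≡⟨ exist-identity₁₁ cA ℓa (length Λ) ⟩
              length Λ * z            ≤⟨ *-monoˡ-≤ (z) Λ≤ ⟩
              r' * z             ≤⟨ small ⟩
              w                       ≤⟨ w≤cN ⟩
              cA * N ∎)) (many (∈-part (body S) part (∈-part cvs cpart (∈-part ps pΛ m))))))
            where
              open ≤-Reasoning
          ab' = absorb Λ S vS capacity
          S' = proj₁ ab'
          vS' = proj₁ (proj₂ ab')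
          perm' : body S' ↭ Λ ++ body S
          perm' = proj₁ (proj₂ (proj₂ ab'))
          end' : end S' ≡ end S
          end' = proj₂ (proj₂ (proj₂ ab'))
          upper : PP (Y ++ ps ++ cvs ++ p₀)
          upper = subst PP (++-assoc Y ps (en cpath ++ rs cpath) ⟫ cong (λ y → Y ++ ps ++ y) (symm (peq cpath)))
            (PP-glue (Y ++ ps) (en cpath) (≤-reflexive (symm (lX (pend cpath)))) (subst PP (symm (++-assoc Y ps (en cpath))) pps)
              (subst PP (peq cpath) (ppp cpath)))
          Z = Y ++ ps ++ cvs
          asZ : ∀ A → Y ++ ps ++ cvs ++ A ≡ Z ++ A
          asZ A = symm (++-assoc Y (ps ++ cvs) A ⟫ cong (Y ++_) (++-assoc ps cvs A))
          -- Absorbing does not alter the end of the chain, so the enlarged chain can be exchanged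
          -- for the old one beneath the covering path.
          final : PP (Y ++ (ps ++ cvs ++ body S') ++ X)
          final = subst PP (symm (cong (Y ++_) (++-assoc ps (cvs ++ body S') X ⟫ cong (ps ++_) (++-assoc cvs (body S') X)) ⟫ asZ (body S' ++ X) ⟫ cong (Z ++_) (end-tl S' ⟫ cong (_++ tl S') end')))
            (PP-glue Z (end S) (≤-reflexive (symm (length-end S)))
              (PP-++ˡ (Z ++ end S) {tl S} (subst PP (asZ p₀ ⟫ cong (Z ++_) (end-tl S) ⟫ symm (++-assoc Z (end S) (tl S))) upper))
              (subst PP (end-tl S' ⟫ cong (_++ tl S') end') (chain-PP S' vS')))
          permW : ps ++ cvs ++ body S' ↭ W
          permW = ↭-sym (↭-trans part (↭-trans (++-comm (body S) R) (↭-trans (++⁺ʳ (body S) (↭-trans cpart (++-comm cvs cR)))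
            (↭-trans (++⁺ʳ (body S) (++⁺ʳ cvs pΛ)) (↭-trans (↭-reflexive asm) (++⁺ˡ ps (↭-trans (shifts Λ cvs) (++⁺ˡ cvs (↭-sym perm')))))))))
            where asm : ((ps ++ Λ) ++ cvs) ++ body S ≡ ps ++ Λ ++ cvs ++ body S
                  asm = ++-assoc (ps ++ Λ) cvs (body S) ⟫ ++-assoc ps Λ (cvs ++ body S)
          fin : Traverse W X Y
          fin = ps ++ cvs ++ body S' , permW , final

  Exists : ℕ → ℕ → Set
  Exists q w₊ = ∀ {U W X Y b} → Amb U W b → End U W X → End U W Y → length U ≤ 3 * length W →
    q * (D * b) + length W ≤ q * length W → w₊ ≤ length W → Traverse W X Y

  abstract
    exists : ∀ (D>0 : 0 < D) q (q>0 : 0 < q) → Exists q (existW t2 k2 q D>0 q>0)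
    exists D>0 q q>0 {U} {W} {X} {Y} {b} am eX eY hU hb hw′ = Existence.At.traverse q D>0 q>0 am eX eY hU hb hw (Existence.At.ares q D>0 q>0 am eX eY hU hb hw)
      where
        hw : ExistSize.w₊ t2 k2 q D>0 q>0 ≤ length W
        hw = ≤-trans (≤-reflexive (symm (existW-def t2 k2 q D>0 q>0))) hw′

  -- Counting spanning power paths

  -- The surplus 2·w^T is used up and restored at each halving: 2 compensates the splits lost, w^t1
  -- the vertices of the linking clique, and the one remaining factor w the 16^T by which α^T·β^T
  -- may fall short of w^(2T).
  record Counted (W X Y : List V) (K : ℕ) : Set where
    field
      L  : List (List V)
      uL : Unique L
      vL : ∀ {ws} → ws ∈ L → ws ↭ W × PP (Y ++ ws ++ X)
      nL : 2 * (length W ! * length W ^ T) ≤ length L * K ^ length W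
  open Counted

  findClique : ∀ {U W b} → Amb U W b → D * b + T ≤ length W → ∀ j → j ≤ t1 →
    ∃ λ M → length M ≡ j × Unique M × M ⊆l W × Clique M
  findClique am h zero le' = [] , refl , [] , (λ ()) , Clique-short [] z≤n
  findClique {U} {W} {b} am h (suc j) le' = go (findClique am h j (≤-trans (n≤1+n j) le'))
    where
      go : (∃ λ M → length M ≡ j × Unique M × M ⊆l W × Clique M) → ∃ λ M → length M ≡ suc j × Unique M × M ⊆l W × Clique M
      go (M , l , u , s , C) with cnt-∃ (okS W M M) W pos
        where
          pos : 0 < cnt (okS W M M) W
          pos = +-cancelʳ-< (D * b + length M) 0 _ (<-≤-trans (≤-trans (≤-reflexive (symm (+-suc (D * b) (length M)) ⟫ cong (λ z → D * b + suc z) l)) (≤-trans (+-monoʳ-≤ (D * b) (≤-trans le' (n≤1+n t1))) h))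
            (≤-trans (pickCountS (gd am) (uW am) M M u (λ m → WU am (s m)) (≤-trans (≤-reflexive l) (≤-trans (n≤1+n j) le')))
              (≤-trans (+-monoˡ-≤ (length M) (+-monoʳ-≤ (cnt (okS W M M) W) (*-monoˡ-≤ b bin≤D))) (≤-reflexive (+-assoc (cnt (okS W M M) W) (D * b) (length M))))))
      ... | x , x∈ , ok with okS-sound W M M x ok
      ...   | _ , x∉ , ex = x ∷ M , cong suc l , ∉⇒All≢ x∉ ∷ u , (λ { (here refl) → x∈ ; (there m) → s m }) , Clique-∷ C ex

  Fits : List V → Split V → List V → Set
  Fits M s z = ∃ λ wb → ∃ λ wa → z ≡ wb ++ M ++ wa × wb ↭ proj₂ s × wa ↭ proj₁ s

  record Piece (M X Y : List V) (s : Split V) (c KK : ℕ) : Set where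
    field
      pL : List (List V)
      pu : Unique pL
      pv : ∀ {z} → z ∈ pL → Fits M s z × PP (Y ++ z ++ X)
      pn : c ≤ length pL * KK
  open Piece

  -- M serves as an end for both halves, so any path through B and any path through A can be glued
  -- along it.
  piece : ∀ {M X Y A B K} → length M ≡ t1 → Counted A X M K → Counted B M Y K →
    Piece M X Y (A , B) (2 * (length B ! * length B ^ T) * (2 * (length A ! * length A ^ T))) (K ^ length B * K ^ length A)
  piece {M} {X} {Y} {A} {B} {K} lM cA cB = record
    { pL = concatMap f (L cB)
    ; pu = Unique-concatMap f (L cB) (uL cB) (λ {wb} _ → UniqueP.map⁺ (λ {x} {y} e → ++-cancelˡ M x y (++-cancelˡ wb _ _ e)) (uL cA)) dis
    ; pv = valid
    ; pn = ≤-trans (*-mono-≤ (nL cB) (nL cA)) (≤-reflexive (count-identity₁₃ (length (L cB)) (K ^ length B) (length (L cA)) (K ^ length A)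
             ⟫ cong (_* (K ^ length B * K ^ length A)) (symm (length-concatMap f (length (L cA)) (L cB) (λ wb → length-map _ (L cA)))))) }
    where
      f : List V → List (List V)
      f wb = map (λ wa → wb ++ M ++ wa) (L cA)
      dis : ∀ {x y z} → x ∈ L cB → y ∈ L cB → z ∈ f x → z ∈ f y → x ≡ y
      dis {x} {y} x∈ y∈ m n with ∈-map⁻ (λ wa → x ++ M ++ wa) m | ∈-map⁻ (λ wa → y ++ M ++ wa) n
      ... | a , _ , e | a' , _ , e' = proj₁ (app-inj x y (↭-length (proj₁ (vL cB x∈)) ⟫ symm (↭-length (proj₁ (vL cB y∈)))) (symm e ⟫ e'))
      valid : ∀ {z} → z ∈ concatMap f (L cB) → Fits M (A , B) z × PP (Y ++ z ++ X)
      valid m with ∈-concat⁻′ (map f (L cB)) m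
      ... | zs , z∈ , zs∈ with ∈-map⁻ f zs∈
      ...   | wb , wb∈ , refl with ∈-map⁻ (λ wa → wb ++ M ++ wa) z∈
      ...     | wa , wa∈ , refl = (wb , wa , refl , proj₁ (vL cB wb∈) , proj₁ (vL cA wa∈))
              , subst PP (++-assoc Y wb (M ++ wa ++ X) ⟫ cong (Y ++_) (symm (++-assoc wb (M ++ wa) X ⟫ cong (wb ++_) (++-assoc M wa X))))
                  (PP-glue (Y ++ wb) M (≤-reflexive (symm lM)) (subst PP (symm (++-assoc Y wb M)) (proj₂ (vL cB wb∈))) (proj₂ (vL cA wa∈)))

  record Built (M X Y : List V) (G : List (Split V)) (c KK : ℕ) : Set where
    field
      bL : List (List V)
      bu : Unique bL
      bv : ∀ {z} → z ∈ bL → ∃ λ s → s ∈ G × Fits M s z × PP (Y ++ z ++ X)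
      bn : length G * c ≤ length bL * KK
  open Built

  -- All second parts have the same length, so a path shows where M begins; this reveals the vertex
  -- sets of the two halves, hence the split.
  build : ∀ {M X Y W' α c KK} → Unique W' → ∀ G → Unique G → (∀ {s} → s ∈ G → s ∈ splits W' × length (proj₁ s) ≡ α) →
    (∀ {s} → s ∈ G → Piece M X Y s c KK) → Built M X Y G c KK
  build uW' [] u h p = record { bL = [] ; bu = [] ; bv = λ () ; bn = z≤n }
  build {M} {X} {Y} {W'} {α} {c} {KK} uW' (s ∷ G) (a ∷ u) h p = record
    { bL = pL P ++ bL R ; bu = Unique-++ (pu P) (bu R) dis
    ; bv = vv
    ; bn = ≤-trans (+-mono-≤ (pn P) (bn R)) (≤-reflexive (symm (cong (_* KK) (length-++ (pL P)) ⟫ *-distribʳ-+ KK (length (pL P)) (length (bL R))))) }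
    where
      P = p (here refl)
      R = build uW' G u (λ m → h (there m)) (λ m → p (there m))
      vv : ∀ {z} → z ∈ pL P ++ bL R → ∃ λ s' → s' ∈ s ∷ G × Fits M s' z × PP (Y ++ z ++ X)
      vv m with ∈-++⁻ (pL P) m
      ... | inj₁ q = s , here refl , pv P q
      ... | inj₂ q = let s' , s'∈ , r = bv R q in s' , there s'∈ , r
      dis : ∀ {z} → z ∈ pL P → z ∉ bL R
      dis m n = clash (proj₁ (pv P m)) (proj₁ (proj₂ (bv R n))) (proj₁ (proj₂ (proj₂ (bv R n))))
        where
          clash : ∀ {z s'} → Fits M s z → s' ∈ G → Fits M s' z → ⊥
          clash {z} {s'} (wb , wa , e , pb , pa) s'∈ (wb' , wa' , e' , pb' , pa') = All≢⇒∉ a (subst (_∈ G) (symm same) s'∈)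
            where
              s₀ = h (here refl)
              s₁ = h (there s'∈)
              lenB : ∀ {s} → s ∈ splits W' → length (proj₁ s) ≡ α → length (proj₂ s) ≡ length W' ∸ α
              lenB {s} m l = symm (m+n∸m≡n α _) ⟫ cong (_∸ α) (cong (_+ length (proj₂ s)) (symm l) ⟫ symm (length-++ (proj₁ s)) ⟫ ↭-length (splits-↭ W' m))
              lwb : length wb ≡ length wb'
              lwb = ↭-length pb ⟫ lenB (proj₁ s₀) (proj₂ s₀) ⟫ symm (↭-length pb' ⟫ lenB (proj₁ s₁) (proj₂ s₁))
              wa≡ : wa ≡ wa'
              wa≡ = ++-cancelˡ M wa wa' (proj₂ (app-inj wb wb' lwb (symm e ⟫ e')))
              p≡ : proj₁ s ↭ proj₁ s'
              p≡ = ↭-trans (↭-sym pa) (↭-trans (↭-reflexive wa≡) pa')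
              same : s ≡ s'
              same = splits-inj W' uW' (proj₁ s₀) (proj₁ s₁) (∈-resp-↭ p≡) (∈-resp-↭ (↭-sym p≡))

  module Counting (q : ℕ) (D>0 : 0 < D) (q>1 : 2 ≤ q) where
    open CountSize t2 k2 q D>0 q>1

    ex : Exists q (existW t2 k2 q D>0 q>0)
    ex = exists D>0 q q>0

    -- Level i combines the slack (2 - 1/(i+1))/q with the size bound |W| ≤ M₀·(4/3)^i; at level 0
    -- the size is bounded and the slack is still 1/q, as existence requires.
    Hyp : ℕ → List V → List V → List V → List V → ℕ → Set
    Hyp i U W X Y b = Amb U W b × End U W X × End U W Y × length U ≤ 3 * length W ×
      suc i * (q * (D * b)) + (2 * i + 1) * length W ≤ suc i * (q * length W) × m ≤ length W × 3 ^ i * length W ≤ 4 ^ i * M₀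

    base-num : ∀ w → 0 < w → w ≤ M₀ → 2 * (w ! * w ^ T) ≤ K ^ w
    base-num w w>0 h = begin
      2 * (w ! * w ^ T)               ≤⟨ *-monoʳ-≤ 2 (*-mono-≤ (fact≤pow w M₀ h) (^-monoˡ-≤ T h)) ⟩
      2 * (M₀ ^ w * M₀ ^ T)           ≤⟨ *-mono-≤ (pow1 2 w w>0) (*-monoʳ-≤ (M₀ ^ w) (pow1 (M₀ ^ T) w w>0)) ⟩
      2 ^ w * (M₀ ^ w * (M₀ ^ T) ^ w) ≡⟨ cong (2 ^ w *_) (symm (^-mul M₀ (M₀ ^ T) w)) ⟫ symm (^-mul 2 (M₀ * M₀ ^ T) w) ⟫ cong (_^ w) (symm K-def) ⟩
      K ^ w ∎
      where
        open ≤-Reasoning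
        pow1 : ∀ x w → 0 < w → x ≤ x ^ w
        pow1 zero w h = z≤n
        pow1 (suc x) (suc w) h = ≤-trans (≤-reflexive (symm (*-identityʳ (suc x)))) (*-monoʳ-≤ (suc x) (^-pos (suc x) w (s≤s z≤n)))

    claim-zero : ∀ {U W X Y b} → Hyp 0 U W X Y b → Counted W X Y K
    claim-zero {U} {W} {X} {Y} {b} (am , eX , eY , hU , hb , hm , hM) = fin (ex am eX eY hU hb' (≤-trans (n≤1+n _) (≤-trans (≤-reflexive (symm m-def)) hm)))
      where
        w = length W
        hb' : q * (D * b) + w ≤ q * w
        hb' = subst₂ _≤_ (cong₂ _+_ (*-identityˡ (q * (D * b))) (*-identityˡ w)) (*-identityˡ (q * w)) hb
        fin : Traverse W X Y → Counted W X Y K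
        fin (ws , p , pp) = record { L = ws ∷ [] ; uL = [] ∷ [] ; vL = λ { (here refl) → p , pp }
          ; nL = ≤-trans (base-num w (≤-trans (≤-trans (s≤s z≤n) (≤-reflexive (symm m-def))) hm) (subst₂ _≤_ (*-identityˡ w) (*-identityˡ M₀) hM)) (≤-reflexive (symm (*-identityˡ (K ^ w)))) }

    module Halve (i : ℕ) (rec : ∀ {U W X Y b} → Hyp i U W X Y b → Counted W X Y K)
      {U W X Y : List V} {b : ℕ} (hyp : Hyp (suc i) U W X Y b) (big : LevelNums q D k1 t1 m T i (length W)) where
      open LevelNums big
      w = length W
      am = proj₁ hyp
      eX = proj₁ (proj₂ hyp)
      eY = proj₁ (proj₂ (proj₂ hyp))
      hU = proj₁ (proj₂ (proj₂ (proj₂ hyp)))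
      hb = proj₁ (proj₂ (proj₂ (proj₂ (proj₂ hyp))))
      hM = proj₂ (proj₂ (proj₂ (proj₂ (proj₂ (proj₂ hyp)))))

      hb₀ : q * (D * b) + w ≤ q * w
      hb₀ = *-cancelˡ-≤ (suc (suc i)) (≤-trans (≤-trans (≤-reflexive (*-distribˡ-+ (suc (suc i)) (q * (D * b)) w)) (+-monoʳ-≤ (suc (suc i) * (q * (D * b))) (*-monoˡ-≤ w (lin (suc i) {suc (suc i)} {2 * suc i + 1} {0} {0} z≤n (count-identity₆ i))))) hb)

      room : D * b + T ≤ w
      room = *-canc-≤ q q>0 (≤-trans (≤-reflexive (*-distribˡ-+ q (D * b) T)) (≤-trans (+-monoʳ-≤ _ qT≤w) hb₀))

      abstract
        cl : ∃ λ M → length M ≡ t1 × Unique M × M ⊆l W × Clique M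
        cl = findClique am room t1 ≤-refl
      M = proj₁ cl
      lM : length M ≡ t1
      lM = proj₁ (proj₂ cl)
      uM : Unique M
      uM = proj₁ (proj₂ (proj₂ cl))
      sM : M ⊆l W
      sM = proj₁ (proj₂ (proj₂ (proj₂ cl)))
      CM : Clique M
      CM = proj₂ (proj₂ (proj₂ (proj₂ cl)))
      abstract
        rm : ∃ λ W' → W ↭ M ++ W'
        rm = remove _≟v_ M W (uW am) uM sM
      W' = proj₁ rm
      pW : W ↭ M ++ W'
      pW = proj₂ rm
      uW' : Unique W'
      uW' = Unique-++ʳ M (Unique-↭ pW (uW am))
      M∉ : ∀ {x} → x ∈ M → x ∉ W'
      M∉ = Unique-++-disj M (Unique-↭ pW (uW am))
      wlen : w ≡ t1 + length W'
      wlen = length-part M pW ⟫ cong (_+ length W') lM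
      amW' : Amb U W' b
      amW' = Amb-sub M pW am

      Qs : List (V → Bool)
      -- The constant test balances the sizes of the two halves themselves.
      Qs = (λ _ → true) ∷ map bad (tests U)

      nQ : length Qs ≤ (4 * w) ^ k1
      nQ = ≤-trans (s≤s (≤-trans (≤-reflexive (length-map bad (tests U))) (≤-trans (length-tests U) (^-monoˡ-≤ k1 hU))))
        (≤-trans (+-monoˡ-≤ ((3 * w) ^ k1) (^-pos w k1 w>0)) (≤-trans (sum-pow w k2) ≤-refl))
        where
          w>0 : 0 < w
          w>0 = ≤-trans (≤-trans (s≤s z≤n) (≤-reflexive (symm m-def))) (proj₁ (proj₂ (proj₂ (proj₂ (proj₂ (proj₂ hyp))))))
          sum-pow : ∀ w k → w ^ suc k + (3 * w) ^ suc k ≤ (4 * w) ^ suc k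
          sum-pow w k = ≤-trans (+-mono-≤ (*-monoʳ-≤ w (^-monoˡ-≤ k (m≤m+n w (3 * w)))) (*-monoʳ-≤ (3 * w) (^-monoˡ-≤ k (m≤n+m (3 * w) w)))) (≤-reflexive (symm (*-distribʳ-+ ((4 * w) ^ k) w (3 * w))))

      W'≤w : length W' ≤ w
      W'≤w = ≤-trans (m≤n+m _ t1) (≤-reflexive (symm wlen))

      abstract
        pop : ∃ λ α → bin (length W') α < 2 * cnt (λ sp → balanced d Qs sp ∧ does (length (proj₁ sp) ≟ α)) (splits W')
        pop = popular-size W' (balanced d Qs) (many-balanced Qs s d W' (≤-trans W'≤w w≤ad) (s≤s z≤n) (beat (length Qs) nQ (s≤s z≤n)))

      α β : ℕ
      α = proj₁ pop
      β = length W' ∸ α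

      pG : Split V → Bool
      pG sp = balanced d Qs sp ∧ does (length (proj₁ sp) ≟ α)

      G : List (Split V)
      G = sel pG (splits W')

      record GS (sp : Split V) : Set where
        field
          gin  : sp ∈ splits W'
          gbal : balanced d Qs sp ≡ true
          gα   : length (proj₁ sp) ≡ α
          gβ   : length (proj₂ sp) ≡ β
          gsum : length (proj₁ sp) + length (proj₂ sp) ≡ length W'

      G-ok : ∀ {sp} → sp ∈ G → GS sp
      G-ok {sp} m with ∈-filter⁻ (λ x → pG x BoolP.≟ true) {xs = splits W'} m
      ... | m₁ , e with ∧-elim {balanced d Qs sp} e
      ...   | e₁ , e₂ = record { gin = m₁ ; gbal = e₁ ; gα = la ; gβ = symm (m+n∸m≡n α _) ⟫ cong (_∸ α) (cong (_+ length (proj₂ sp)) (symm la) ⟫ sm) ; gsum = sm }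
        where
          la = does-true (length (proj₁ sp) ≟ α) e₂
          sm : length (proj₁ sp) + length (proj₂ sp) ≡ length W'
          sm = symm (length-++ (proj₁ sp)) ⟫ ↭-length (splits-↭ W' m₁)

      record Side (A : List V) : Set where
        field
          s-slack : suc i * (q * (D * ((b + d) / 2))) + (2 * i + 1) * length A ≤ suc i * (q * length A)
          s-m     : m ≤ length A
          s-lev   : 3 ^ i * length A ≤ 4 ^ i * M₀
          s-U     : t1 + (t1 + length A) ≤ 3 * length A
          s-w     : w ≤ 4 * length A

      side : ∀ (A B : List V) → length A + length B ≡ length W' → length B < length A + d → length A < length B + d → Side A
      side A B sm h₁ h₂ = record
        { s-slack = slack-step i q D b ((b + d) / 2) w d x q>1 hb (≤-trans (≤-reflexive (*-comm 2 ((b + d) / 2))) (m/n*n≤m (b + d) 2)) w≤2 dsm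
        ; s-m = *-cancelˡ-≤ 4 (≤-trans 4m≤w w≤4)
        ; s-lev = *-cancelˡ-≤ 4 (≤-trans (≤-reflexive (count-identity₈ (3 ^ i) x)) (≤-trans (*-monoʳ-≤ (3 ^ i) 4x≤) (≤-trans (≤-reflexive (count-identity₉ (3 ^ i) w)) (≤-trans hM (≤-reflexive (*-assoc 4 (4 ^ i) M₀))))))
        ; s-U = ≤-trans (+-mono-≤ t≤x (+-monoˡ-≤ x t≤x)) (≤-reflexive (count-identity₁₀ x))
        ; s-w = w≤4 }
        where
          x = length A
          y = length B
          wxy : w ≡ t1 + (x + y)
          wxy = wlen ⟫ cong (t1 +_) (symm sm)
          w≤2 : w ≤ 2 * x + 2 * d
          w≤2 = ≤-trans (≤-reflexive wxy) (≤-trans (+-mono-≤ t1≤d (+-monoʳ-≤ x (<⇒≤ h₁))) (≤-reflexive (count-identity₁ x d)))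
          w≤4 : w ≤ 4 * x
          w≤4 = lin 0 (+-mono-≤ (+-mono-≤ w≤2 w≤2) 4d≤w) (count-identity₂ w x d)
          4x≤ : 4 * x ≤ 3 * w
          4x≤ = lin (2 * d + 2 * t1) (+-mono-≤ (+-mono-≤ (<⇒≤ h₂) (<⇒≤ h₂)) (+-mono-≤ 4d≤w (+-mono-≤ (≤-reflexive (symm wxy)) (≤-reflexive (symm wxy))))) (count-identity₃ x y d t1 w)
          t≤x : t1 ≤ x
          t≤x = *-cancelˡ-≤ 4 (≤-trans 4t≤w w≤4)

      balQ : ∀ {sp} → GS sp → ∀ {Q} → Q ∈ Qs → cnt Q (proj₁ sp) < cnt Q (proj₂ sp) + d × cnt Q (proj₂ sp) < cnt Q (proj₁ sp) + d
      balQ {sp} g = balanced-bound d Qs sp (GS.gbal g)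

      balLen : ∀ {sp} → GS sp → length (proj₁ sp) < length (proj₂ sp) + d × length (proj₂ sp) < length (proj₁ sp) + d
      balLen {sp} g = subst₂ (λ x y → x < y + d × y < x + d) (cnt-true (proj₁ sp)) (cnt-true (proj₂ sp)) (balQ g {λ _ → true} (here refl))

      half-bound : ∀ x y → x < y + d → x + y ≤ b → x ≤ (b + d) / 2
      half-bound x y h hb' = div-big (b + d) 2 x (lin 0 (+-mono-≤ (<⇒≤ h) hb') (count-identity₇ x y d b))

      sub-count : ∀ {sp} → GS sp → ∀ S → cnt (bad S) (proj₁ sp) + cnt (bad S) (proj₂ sp) ≡ cnt (bad S) W'
      sub-count {sp} g S = symm (sumL-++ _ (proj₁ sp) (proj₂ sp)) ⟫ sumL-↭ _ (splits-↭ W' (GS.gin g))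

      in-Qs : ∀ {S} → S ∈ tests U → bad S ∈ Qs
      in-Qs m = there (∈-map⁺ bad m)

      goodA : ∀ {sp} → GS sp → Good U (proj₁ sp) ((b + d) / 2)
      goodA {sp} g = mkGood λ S l u h → half-bound _ _ (proj₁ (balQ g (in-Qs (tests-∈ l u h))))
        (≤-trans (≤-reflexive (sub-count g S)) (good (gd amW') S l u h))

      goodB : ∀ {sp} → GS sp → Good U (proj₂ sp) ((b + d) / 2)
      goodB {sp} g = mkGood λ S l u h → half-bound _ _ (proj₂ (balQ g (in-Qs (tests-∈ l u h))))
        (≤-trans (≤-reflexive (+-comm (cnt (bad S) (proj₂ sp)) _ ⟫ sub-count g S)) (good (gd amW') S l u h))

      -- The recursive instance on A: its universe consists of A and of the two ends.
      instanceOf : ∀ A P R → Unique A → A ⊆l W' → Good U A ((b + d) / 2) → Side A →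
        (P ⊆l U × Unique P × length P ≡ t1 × Clique P × (∀ {x} → x ∈ P → x ∉ W')) →
        (R ⊆l U × Unique R × length R ≡ t1 × Clique R × (∀ {x} → x ∈ R → x ∉ W')) → Counted A P R K
      instanceOf A P R uA sA gA sd (P₁ , P₂ , P₃ , P₄ , P₅) (R₁ , R₂ , R₃ , R₄ , R₅) = rec {UA} {A} {P} {R} {(b + d) / 2}
          ( record { uW = uA ; gd = Good-U UA⊆ gA ; WU = λ m → ∈-++⁺ʳ P (∈-++⁺ʳ R m) }
          , record { XU = ∈-++⁺ˡ ; uX = P₂ ; lX = P₃ ; CX = P₄ ; dX = λ m n → P₅ m (sA n) }
          , record { XU = λ m → ∈-++⁺ʳ P (∈-++⁺ˡ m) ; uX = R₂ ; lX = R₃ ; CX = R₄ ; dX = λ m n → R₅ m (sA n) }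
          , ≤-trans (≤-reflexive (length-++ P ⟫ cong₂ _+_ P₃ (length-++ R ⟫ cong (_+ length A) R₃))) (Side.s-U sd)
          , Side.s-slack sd , Side.s-m sd , Side.s-lev sd )
        where
          UA = P ++ R ++ A
          UA⊆ : UA ⊆l U
          UA⊆ m with ∈-++⁻ P m
          ... | inj₁ p = P₁ p
          ... | inj₂ n with ∈-++⁻ R n
          ...   | inj₁ r = R₁ r
          ...   | inj₂ a = WU amW' (sA a)

      endX : X ⊆l U × Unique X × length X ≡ t1 × Clique X × (∀ {x} → x ∈ X → x ∉ W')
      endX = XU eX , uX eX , lX eX , CX eX , λ m n → dX eX m (∈-part M pW n)
      endY : Y ⊆l U × Unique Y × length Y ≡ t1 × Clique Y × (∀ {x} → x ∈ Y → x ∉ W')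
      endY = XU eY , uX eY , lX eY , CX eY , λ m n → dX eY m (∈-part M pW n)
      endM : M ⊆l U × Unique M × length M ≡ t1 × Clique M × (∀ {x} → x ∈ M → x ∉ W')
      endM = (λ m → WU am (sM m)) , uM , lM , CM , M∉

      sideA : ∀ {sp} → GS sp → Side (proj₁ sp)
      sideA {sp} g = side (proj₁ sp) (proj₂ sp) (GS.gsum g) (proj₂ (balLen g)) (proj₁ (balLen g))
      sideB : ∀ {sp} → GS sp → Side (proj₂ sp)
      sideB {sp} g = side (proj₂ sp) (proj₁ sp) (+-comm (length (proj₂ sp)) _ ⟫ GS.gsum g) (proj₁ (balLen g)) (proj₂ (balLen g))

      c KK : ℕ
      c = 2 * (β ! * β ^ T) * (2 * (α ! * α ^ T))
      KK = K ^ β * K ^ α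

      pieceOf : ∀ {sp} → sp ∈ G → Piece M X Y sp c KK
      pieceOf {sp} m = subst₂ (λ x y → Piece M X Y sp (2 * (y ! * y ^ T) * (2 * (x ! * x ^ T))) (K ^ y * K ^ x)) (GS.gα g) (GS.gβ g)
          (piece {M} {X} {Y} {proj₁ sp} {proj₂ sp} {K} lM cA cB)
        where
          g = G-ok m
          uAB : Unique (proj₁ sp ++ proj₂ sp)
          uAB = Unique-↭ (↭-sym (splits-↭ W' (GS.gin g))) uW'
          cA : Counted (proj₁ sp) X M K
          cA = instanceOf (proj₁ sp) X M (Unique-++ˡ (proj₁ sp) uAB) (splits-⊆ W' (GS.gin g)) (goodA g) (sideA g) endX endM
          cB : Counted (proj₂ sp) M Y K
          cB = instanceOf (proj₂ sp) M Y (Unique-++ʳ (proj₁ sp) uAB) (splits-⊆ʳ W' (GS.gin g)) (goodB g) (sideB g) endM endY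

      built : Built M X Y G c KK
      built = build uW' G (UniqueP.filter⁺ (λ x → pG x BoolP.≟ true) (splits-Unique W' uW')) (λ m → GS.gin (G-ok m) , GS.gα (G-ok m)) pieceOf

      nG : bin (length W') α < 2 * length G
      nG = <-≤-trans (proj₂ pop) (≤-reflexive (cong (2 *_) (symm (length-sel pG (splits W')))))

      someG : ∃ λ sp → sp ∈ G
      someG = ne G (pos2 (length G) (≤-<-trans z≤n nG))
        where
          pos2 : ∀ x → 0 < 2 * x → 0 < x
          pos2 (suc x) _ = s≤s z≤n
          ne : ∀ (G : List (Split V)) → 0 < length G → ∃ λ sp → sp ∈ G
          ne (sp ∷ G) _ = sp , here refl

      g₀ : GS (proj₁ someG)
      g₀ = G-ok (proj₂ someG)
      w4α : w ≤ 4 * α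
      w4α = subst (λ z → w ≤ 4 * z) (GS.gα g₀) (Side.s-w (sideA g₀))
      w4β : w ≤ 4 * β
      w4β = subst (λ z → w ≤ 4 * z) (GS.gβ g₀) (Side.s-w (sideB g₀))
      αβ : α + β ≡ length W'
      αβ = symm (cong₂ _+_ (GS.gα g₀) (GS.gβ g₀)) ⟫ GS.gsum g₀

      w'f : length W' ! ≤ 2 * length G * (α ! * β !)
      w'f = ≤-trans (≤-reflexive (cong _! (symm αβ) ⟫ symm (bin-fact α β) ⟫ cong (λ z → bin z α * (α ! * β !)) αβ)) (*-monoˡ-≤ (α ! * β !) (<⇒≤ nG))

      powers : w ^ t1 * w ^ T ≤ β ^ T * α ^ T
      powers = *-canc-≤ (16 ^ T) (^-pos 16 T (s≤s z≤n)) (begin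
        16 ^ T * (w ^ t1 * w ^ T)      ≤⟨ *-monoˡ-≤ (w ^ t1 * w ^ T) 16≤w ⟩
        w * (w ^ t1 * w ^ T)           ≡⟨ symm (*-assoc w (w ^ t1) (w ^ T)) ⟩
        w ^ T * w ^ T                  ≤⟨ *-mono-≤ (^-monoˡ-≤ T w4β) (^-monoˡ-≤ T w4α) ⟩
        (4 * β) ^ T * (4 * α) ^ T      ≡⟨ cong₂ _*_ (^-mul 4 β T) (^-mul 4 α T) ⟫ count-identity₁₁ (4 ^ T) (β ^ T) (α ^ T) ⟫ cong (_* (β ^ T * α ^ T)) (symm (^-mul 4 4 T)) ⟩
        16 ^ T * (β ^ T * α ^ T) ∎)
        where
          open ≤-Reasoning

      wfact : w ! ≤ length W' ! * w ^ t1
      wfact with fact-split t1 (length W') w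
      ... | inj₁ h = ≤-trans (≤-reflexive (cong _! wlen)) h
      ... | inj₂ h = ⊥-elim (<-irrefl wlen h)

      total : 2 * (w ! * w ^ T) ≤ length (bL built) * K ^ w
      total = begin
        2 * (w ! * w ^ T)                                       ≤⟨ *-monoʳ-≤ 2 (*-monoˡ-≤ (w ^ T) wfact) ⟩
        2 * (length W' ! * w ^ t1 * w ^ T)                      ≡⟨ cong (2 *_) (*-assoc (length W' !) (w ^ t1) (w ^ T)) ⟩
        2 * (length W' ! * (w ^ t1 * w ^ T))                    ≤⟨ *-monoʳ-≤ 2 (*-mono-≤ w'f powers) ⟩
        2 * (2 * length G * (α ! * β !) * (β ^ T * α ^ T))      ≡⟨ count-identity₁₂ (length G) (α !) (β !) (β ^ T) (α ^ T) ⟩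
        length G * c                                            ≤⟨ bn built ⟩
        length (bL built) * KK                                  ≤⟨ *-monoʳ-≤ (length (bL built)) KK≤ ⟩
        length (bL built) * K ^ w ∎
        where
          open ≤-Reasoning
          KK≤ : KK ≤ K ^ w
          KK≤ = ≤-trans (≤-reflexive (symm (^-distribˡ-+-* K β α) ⟫ cong (K ^_) (+-comm β α ⟫ αβ))) (^-monoʳ-≤ K {{>-nonZero K>0}} W'≤w)

      counted : Counted W X Y K
      counted = record { L = bL built ; uL = bu built ; nL = total
        ; vL = λ m → let s' , s'∈ , (wb , wa , e , pb , pa) , pp = bv built m in
            ↭-trans (↭-reflexive e) (↭-trans (++⁺ pb (++⁺ˡ M pa)) (↭-trans (shifts (proj₂ s') M) (↭-trans (++⁺ˡ M (↭-trans (++-comm (proj₂ s') (proj₁ s')) (splits-↭ W' (GS.gin (G-ok s'∈))))) (↭-sym pW)))) , pp }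

    -- A set that already meets the size bound of level i descends unsplit. Otherwise it is large
    -- enough to be halved, and each half, having at most 3/4 of its vertices, meets that bound.
    claim : ∀ i {U W X Y b} → Hyp i U W X Y b → Counted W X Y K
    claim zero h = claim-zero h
    claim (suc i) {U} {W} {X} {Y} {b} h@(am , eX , eY , hU , hb , hm , hM) = go (3 ^ i * length W ≤? 4 ^ i * M₀)
      where
        go : Dec (3 ^ i * length W ≤ 4 ^ i * M₀) → Counted W X Y K
        go (yes le') = claim i (am , eX , eY , hU , slack-down i (q * (D * b)) (length W) (q * length W) hb , hm , le')
        go (no n) = Halve.counted i (claim i) h (level i (length W) n)

  abstract
    counting : ∀ (D>0 : 0 < D) q (q>1 : 2 ≤ q) {U W X Y b} → Amb U W b → End U W X → End U W Y →
      length U ≤ 3 * length W → q * (D * b) + 2 * length W ≤ q * length W → CountSize.m t2 k2 q D>0 q>1 ≤ length W →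
      Counted W X Y (CountSize.K t2 k2 q D>0 q>1)
    counting D>0 q q>1 {U} {W} {X} {Y} {b} am eX eY hU hb hm =
        -- Starting at level 3w is enough, because (4/3)^(3w) ≥ w.
        Counting.claim q D>0 q>1 (3 * length W) (am , eX , eY , hU , slack-up (3 * length W) (q * (D * b)) (length W) (q * length W) hb , hm
          , ≤-trans (lev (length W)) (≤-trans (≤-reflexive (symm (*-identityʳ (4 ^ (3 * length W))))) (*-monoʳ-≤ (4 ^ (3 * length W)) (CountSize.M₀>0 t2 k2 q D>0 q>1))))
      where
        slack-up : ∀ i x w y → x + 2 * w ≤ y → suc i * x + (2 * i + 1) * w ≤ suc i * y
        slack-up i x w y h = ≤-trans (lin w {L = 0} z≤n (count-identity₄ i x w)) (*-monoʳ-≤ (suc i) h)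
        lev : ∀ w → 3 ^ (3 * w) * w ≤ 4 ^ (3 * w)
        lev w = *-cancelˡ-≤ 3 (≤-trans (lin (3 * 3 ^ (3 * w)) {L = 0} z≤n (count-identity₅ (3 ^ (3 * w)) w)) (lin-exp 3 (3 * w)))

-- Cyclic orders

∈-fins : ∀ {n} (v : Fin n) → v ∈ fins n
∈-fins zero    = here refl
∈-fins (suc v) = there (∈-map⁺ suc (∈-fins v))

fromL : ∀ {n} → List (Fin n) → Subset n
fromL []      = ⊥s
fromL (x ∷ S) = ⁅ x ⁆ ∪ fromL S

fromL-perm : ∀ {n} {S S' : List (Fin n)} → S ↭ S' → fromL S ≡ fromL S'
fromL-perm refl = refl
fromL-perm (prep x p) = cong (⁅ x ⁆ ∪_) (fromL-perm p)
fromL-perm (swap {ys = S'} x y p) = cong (λ z → ⁅ x ⁆ ∪ (⁅ y ⁆ ∪ z)) (fromL-perm p)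
  ⟫ symm (∪-assoc ⁅ x ⁆ ⁅ y ⁆ (fromL S')) ⟫ cong (_∪ fromL S') (∪-comm ⁅ x ⁆ ⁅ y ⁆) ⟫ ∪-assoc ⁅ y ⁆ ⁅ x ⁆ (fromL S')
fromL-perm (trans p q) = fromL-perm p ⟫ fromL-perm q

fromL-∈ : ∀ {n} (S : List (Fin n)) {v} → v ∈ S → lookup (fromL S) v ≡ true
fromL-∈ (x ∷ S) (here refl) = lookup-zipWith _∨_ x ⁅ x ⁆ (fromL S) ⟫ cong (_∨ lookup (fromL S) x) ([]=⇒lookup (x∈⁅x⁆ x))
fromL-∈ (x ∷ S) {v} (there m) = lookup-zipWith _∨_ v ⁅ x ⁆ (fromL S) ⟫ cong (lookup ⁅ x ⁆ v ∨_) (fromL-∈ S m) ⟫ BoolP.∨-zeroʳ _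

fromL-∈⁻ : ∀ {n} (S : List (Fin n)) {v} → lookup (fromL S) v ≡ true → v ∈ S
fromL-∈⁻ [] {v} e with () ← symm (VecP.lookup-replicate v false) ⟫ e
fromL-∈⁻ (x ∷ S) {v} e = go (lookup ⁅ x ⁆ v) refl (symm (lookup-zipWith _∨_ v ⁅ x ⁆ (fromL S)) ⟫ e)
  where
    go : ∀ b → lookup ⁅ x ⁆ v ≡ b → lookup ⁅ x ⁆ v ∨ lookup (fromL S) v ≡ true → v ∈ x ∷ S
    go true eb _ = here (x∈⁅y⁆⇒x≡y x (lookup⇒[]= v ⁅ x ⁆ eb))
    go false eb e' = there (fromL-∈⁻ S (symm (cong (_∨ lookup (fromL S) v) eb) ⟫ e'))

size : ∀ {n} (p : Subset n) → ∣ p ∣ ≡ cnt (lookup p) (fins n)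
size Vec.[] = refl
size (true Vec.∷ p) = cong suc (size p ⟫ symm (sumL-map (λ x → b2n (lookup (true Vec.∷ p) x)) suc (fins _)))
size (false Vec.∷ p) = size p ⟫ symm (sumL-map (λ x → b2n (lookup (false Vec.∷ p) x)) suc (fins _))

toL : ∀ {n} → Subset n → List (Fin n)
toL {n} e = sel (lookup e) (fins n)

toL-∈ : ∀ {n} (e : Subset n) {v} → v ∈ toL e → lookup e v ≡ true
toL-∈ {n} e m = proj₂ (∈-filter⁻ (λ x → lookup e x BoolP.≟ true) {xs = fins n} m)

fromL-toL : ∀ {n} (e : Subset n) → fromL (toL e) ≡ e
fromL-toL {n} e = symm (VecP.tabulate∘lookup (fromL (toL e))) ⟫ VecP.tabulate-cong eq ⟫ VecP.tabulate∘lookup e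
  where
    eq : ∀ v → lookup (fromL (toL e)) v ≡ lookup e v
    eq v = go (lookup e v) refl (lookup (fromL (toL e)) v) refl
      where
        go : ∀ a → lookup e v ≡ a → ∀ b → lookup (fromL (toL e)) v ≡ b → lookup (fromL (toL e)) v ≡ lookup e v
        go true ea b eb = fromL-∈ (toL e) (∈-filter⁺ (λ x → lookup e x BoolP.≟ true) (∈-fins v) ea) ⟫ symm ea
        go false ea false eb = eb ⟫ symm ea
        go false ea true eb with () ← symm ea ⟫ toL-∈ e (fromL-∈⁻ (toL e) eb)

split-at : ∀ {A : Set} (xs : List A) (i : Fin (length xs)) → xs ≡ take (toℕ i) xs ++ List.lookup xs i ∷ drop (suc (toℕ i)) xs
split-at (x ∷ xs) zero = refl
split-at (x ∷ xs) (suc i) = cong (x ∷_) (split-at xs i)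

lookup-inj : ∀ {A : Set} (xs : List A) → Unique xs → ∀ i j → List.lookup xs i ≡ List.lookup xs j → i ≡ j
lookup-inj (x ∷ xs) u zero zero e = refl
lookup-inj (x ∷ xs) (a ∷ u) zero (suc j) e = ⊥-elim (All≢⇒∉ a (subst (_∈ xs) (symm e) (∈-lookup j)))
lookup-inj (x ∷ xs) (a ∷ u) (suc i) zero e = ⊥-elim (All≢⇒∉ a (subst (_∈ xs) e (∈-lookup i)))
lookup-inj (x ∷ xs) (a ∷ u) (suc i) (suc j) e = cong suc (lookup-inj xs u i j e)

index-unique : ∀ {A : Set} (ls : List A) {v rs xs} → xs ≡ ls ++ v ∷ rs → Unique xs → (m : v ∈ xs) → toℕ (index m) ≡ length ls
index-unique [] refl u (here e) = refl
index-unique [] refl (a ∷ u) (there m) = ⊥-elim (All≢⇒∉ a m)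
index-unique (l ∷ ls) refl (a ∷ u) (here refl) = ⊥-elim (All≢⇒∉ a (∈-++⁺ʳ ls (here refl)))
index-unique (l ∷ ls) refl (a ∷ u) (there m) = cong suc (index-unique ls refl u m)

∈-window : ∀ {A : Set} T i j (ls : List A) {v rs} → length ls ≡ i + j → j < T → v ∈ take T (drop i (ls ++ v ∷ rs))
∈-window T zero j ls {v} {rs} l h = go T ls (≤-trans (≤-reflexive (cong suc l)) h)
  where go : ∀ T ls → length ls < T → v ∈ take T (ls ++ v ∷ rs)
        go (suc T) [] h = here refl
        go (suc T) (x ∷ ls) (s≤s h) = there (go T ls h)
∈-window T (suc i) j (x ∷ ls) l h = ∈-window T i j ls (suc-injective l) h

%-shift : ∀ a b n' → (a % suc n' + b) % suc n' ≡ (a + b) % suc n'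
%-shift a b n' = %-distribˡ-+ (a % n) b n ⟫ cong (λ z → (z + b % n) % n) (m%n%n≡m%n a n) ⟫ symm (%-distribˡ-+ a b n)
  where n = suc n'

%-back : ∀ i j x n' → j ≤ suc n' → ((i + j) % suc n' + ((suc n' ∸ j) + x)) % suc n' ≡ (i + x) % suc n'
%-back i j x n' h = %-shift (i + j) ((suc n' ∸ j) + x) n' ⟫ cong (_% suc n') (l i j (suc n' ∸ j) x ⟫ cong (i + x +_) (m∸n+n≡m h)) ⟫ [m+n]%n≡m%n (i + x) (suc n')
  where l : ∀ i j d x → i + j + (d + x) ≡ i + x + (d + j)
        l = solve-∀

%-inj : ∀ i j j' n' → i ≤ suc n' → j < suc n' → j' < suc n' → (i + j) % suc n' ≡ (i + j') % suc n' → j ≡ j'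
%-inj i j j' n' hi hj hj' e = symm (m<n⇒m%n≡m hj) ⟫ rot j ⟫ cong (λ z → (z + (suc n' ∸ i)) % suc n') e ⟫ symm (rot j') ⟫ m<n⇒m%n≡m hj'
  where
    l : ∀ i j d → i + j + d ≡ j + (d + i)
    l = solve-∀
    rot : ∀ j → j % suc n' ≡ ((i + j) % suc n' + (suc n' ∸ i)) % suc n'
    rot j = symm (%-shift (i + j) (suc n' ∸ i) n' ⟫ cong (_% suc n') (l i j (suc n' ∸ i) ⟫ cong (j +_) (m∸n+n≡m hi)) ⟫ [m+n]%n≡m%n j (suc n'))

linked : ∀ {A : Set} {R : A → A → Set} pre xs → (∀ ls x y rs → pre ++ xs ≡ ls ++ x ∷ y ∷ rs → R x y) → Linked R xs
linked pre [] h = []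
linked pre (x ∷ []) h = [-]
linked pre (x ∷ y ∷ xs) h = h pre x y xs refl
  ∷ (linked (pre ++ x ∷ []) (y ∷ xs) (λ l u v r e → h l u v r (symm (++-assoc pre (x ∷ []) (y ∷ xs)) ⟫ e)))

module _ {A : Set} (nb : A → List A) where
  chains : ℕ → A → List (List A)
  chains zero    x = [] ∷ []
  chains (suc m) x = concatMap (λ y → map (y ∷_) (chains m y)) (nb x)

  length-chains : ∀ c → (∀ x → length (nb x) ≡ c) → ∀ m x → length (chains m x) ≡ c ^ m
  length-chains c h zero x = refl
  length-chains c h (suc m) x = length-concatMap _ (c ^ m) (nb x) (λ y → length-map (y ∷_) (chains m y) ⟫ length-chains c h m y) ⟫ cong (_* c ^ m) (h x)

  ∈-chains : ∀ x xs → Linked (λ x y → y ∈ nb x) (x ∷ xs) → xs ∈ chains (length xs) x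
  ∈-chains x [] _ = here refl
  ∈-chains x (y ∷ xs) (r ∷ l) = ∈-concat⁺′ (∈-map⁺ (y ∷_) (∈-chains y xs l)) (∈-map⁺ (λ y → map (y ∷_) (chains (length xs) y)) r)

AllPairs-lookup : ∀ {A : Set} {P : A → A → Set} → (∀ {x y} → P x y → P y x) → ∀ {xs} → AllPairs P xs →
  ∀ i j → i ≢ j → P (List.lookup xs i) (List.lookup xs j)
AllPairs-lookup sy (a ∷ ap) zero zero ne = ⊥-elim (ne refl)
AllPairs-lookup sy (a ∷ ap) zero (suc j) ne = All.lookup a (∈-lookup j)
AllPairs-lookup sy (a ∷ ap) (suc i) zero ne = sy (All.lookup a (∈-lookup i))
AllPairs-lookup sy (a ∷ ap) (suc i) (suc j) ne = AllPairs-lookup sy ap i j (λ e → ne (cong suc e))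

-- Greedily keep an element and discard the (at most C) later elements whose key it excludes.
module Select {A K : Set} (_≟k_ : DecidableEquality K) (key : A → K) (ex : A → List K) (C : ℕ) (exC : ∀ a → length (ex a) ≤ C) where

  free : A → A → Bool
  free a b = not (mem _≟k_ (key b) (ex a))

  sel-keys : ∀ p xs → Unique (map key xs) → Unique (map key (sel p xs))
  sel-keys p [] u = []
  sel-keys p (x ∷ xs) (a ∷ u) with p x
  ... | false = sel-keys p xs u
  ... | true = ∉⇒All≢ (λ m → All≢⇒∉ a (inc m)) ∷ sel-keys p xs u
    where inc : ∀ {k} → k ∈ map key (sel p xs) → k ∈ map key xs
          inc m with ∈-map⁻ key m
          ... | y , y∈ , refl = ∈-map⁺ key (proj₁ (∈-filter⁻ (λ x → p x BoolP.≟ true) {xs = xs} y∈))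

  select : ∀ fuel xs → length xs ≤ fuel → Unique (map key xs) →
    ∃ λ ys → AllPairs (λ a b → key b ∉ ex a) ys × ys ⊆l xs × length xs ≤ length ys * suc C
  select fuel [] h u = [] , [] , (λ ()) , z≤n
  select (suc fuel) (x ∷ xs) (s≤s h) (a ∷ u) = go (select fuel xs' (≤-trans (≤-trans (≤-reflexive (length-sel (free x) xs)) (cnt≤length (free x) xs)) h) (sel-keys (free x) xs u))
    where
      xs' = sel (free x) xs
      inx : ∀ {y} → y ∈ xs' → y ∈ xs × key y ∉ ex x
      inx m = let p , q = ∈-filter⁻ (λ y → free x y BoolP.≟ true) {xs = xs} m in p , mem-false _≟k_ (not-true q)
      enough : length xs ≤ length xs' + C
      enough = begin
        length xs                                          ≡⟨ symm (cnt-true xs) ⟩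
        cnt (λ _ → true) xs                                ≤⟨ cnt-split (λ _ → true) (λ y → mem _≟k_ (key y) (ex x)) xs ⟩
        cnt (free x) xs + cnt (λ y → mem _≟k_ (key y) (ex x)) xs ≡⟨ cong₂ _+_ (symm (length-sel (free x) xs)) (symm (sumL-map (λ k → b2n (mem _≟k_ k (ex x))) key xs)) ⟩
        length xs' + cnt (λ k → mem _≟k_ k (ex x)) (map key xs) ≤⟨ +-monoʳ-≤ (length xs') (≤-trans (cnt-mem _≟k_ (map key xs) (ex x) u) (exC x)) ⟩
        length xs' + C ∎
        where open ≤-Reasoning
      go : (∃ λ ys → AllPairs (λ a b → key b ∉ ex a) ys × ys ⊆l xs' × length xs' ≤ length ys * suc C) → _
      go (ys , ap , sub , le') = x ∷ ys , All.tabulate (λ m → proj₂ (inx (sub m))) ∷ ap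
        , (λ { (here e) → here e ; (there m) → there (proj₁ (inx (sub m))) })
        , ≤-trans (s≤s (≤-trans enough (+-monoˡ-≤ C le'))) (≤-reflexive (cong suc (+-comm (length ys * suc C) C)))

module Final (k2 t2 n' : ℕ) (H : KGraph (suc (suc k2)) (suc n')) where
  n : ℕ
  n = suc n'

  V : Set
  V = Fin n

  E : List V → Bool
  E xs = edge H (fromL xs)

  E-perm : ∀ {xs ys : List V} → xs ↭ ys → E xs ≡ E ys
  E-perm p = cong (edge H) (fromL-perm p)

  open Params t2 k2
  open Graph {V} _≟F_ E (λ {xs} {ys} → E-perm {xs} {ys}) t2 k2 public
    using (bad; Clique; PP; PP-window; PP-glue; PP-++ʳ; Good; mkGood; Amb; End; Amb-sub; length-part; findClique; Counted; module Counted; cnt-sub; counting)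

  U : List V
  U = fins n

  size-fromL : ∀ S → Unique S → ∣ fromL S ∣ ≡ length S
  size-fromL S u = size (fromL S) ⟫ sumL-cong U (λ {v} _ → cong b2n (lk v)) ⟫ ≤-antisym (cnt-mem _≟F_ U S (Unique-fins n)) ge
    where
      lk : ∀ v → lookup (fromL S) v ≡ mem _≟F_ v S
      lk v = go (mem _≟F_ v S) refl (lookup (fromL S) v) refl
        where
          go : ∀ a → mem _≟F_ v S ≡ a → ∀ b → lookup (fromL S) v ≡ b → lookup (fromL S) v ≡ mem _≟F_ v S
          go true ea b eb = fromL-∈ S (mem-true _≟F_ ea) ⟫ symm ea
          go false ea false eb = eb ⟫ symm ea
          go false ea true eb = ⊥-elim (mem-false _≟F_ ea (fromL-∈⁻ S eb))
      rm = remove _≟F_ S U (Unique-fins n) u (λ {v} _ → ∈-fins v)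
      ge : length S ≤ cnt (λ v → mem _≟F_ v S) U
      ge = ≤-trans (≤-trans (≤-reflexive (symm (cnt-true S))) (cnt-mono S (λ m _ → mem-∈ _≟F_ m)))
        (≤-trans (m≤m+n _ _) (≤-reflexive (symm (cnt-sub (λ v → mem _≟F_ v S) S (proj₂ rm)))))

  -- The sum is exactly n because `bad` also counts the vertices of S, which the codegree leaves
  -- out.
  codeg-bad : ∀ S → codeg H (fromL S) + cnt (bad S) U ≡ n
  codeg-bad S = cong (_+ cnt (bad S) U) (size (Vec.tabulate f) ⟫ sumL-cong U (λ {v} _ → cong b2n (VecP.lookup∘tabulate f v)))
    ⟫ symm (sumL-+ (λ v → b2n (f v)) (λ v → b2n (bad S v)) U) ⟫ sumL-cong U (λ {v} _ → one v) ⟫ cnt-true U ⟫ length-fins n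
    where
      f : V → Bool
      f v = not (lookup (fromL S) v) ∧ edge H (⁅ v ⁆ ∪ fromL S)
      one : ∀ v → b2n (f v) + b2n (bad S v) ≡ 1
      one v = go (mem _≟F_ v S) refl (edge H (⁅ v ⁆ ∪ fromL S)) refl
        where
          go : ∀ a → mem _≟F_ v S ≡ a → ∀ b → edge H (⁅ v ⁆ ∪ fromL S) ≡ b → b2n (f v) + b2n (bad S v) ≡ 1
          go true ea b eb = cong₂ (λ x y → b2n (not x ∧ edge H (⁅ v ⁆ ∪ fromL S)) + b2n (y ∨ not (edge H (⁅ v ⁆ ∪ fromL S)))) (fromL-∈ S (mem-true _≟F_ ea)) ea
          go false ea b eb = cong₂ (λ x y → b2n (not x ∧ edge H (⁅ v ⁆ ∪ fromL S)) + b2n (y ∨ not (edge H (⁅ v ⁆ ∪ fromL S)))) lf ea ⟫ xor b eb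
            where
              lf : lookup (fromL S) v ≡ false
              lf = gl (lookup (fromL S) v) refl
                where gl : ∀ c → lookup (fromL S) v ≡ c → lookup (fromL S) v ≡ false
                      gl false ec = ec
                      gl true ec = ⊥-elim (mem-false _≟F_ ea (fromL-∈⁻ S ec))
              xor : ∀ b → edge H (⁅ v ⁆ ∪ fromL S) ≡ b → b2n (edge H (⁅ v ⁆ ∪ fromL S)) + b2n (not (edge H (⁅ v ⁆ ∪ fromL S))) ≡ 1
              xor true e = cong (λ z → b2n z + b2n (not z)) e
              xor false e = cong (λ z → b2n z + b2n (not z)) e

  -- Writing the cyclic list twice turns the windows that wrap around into ordinary ones.
  record Cyc : Set where
    field
      cl   : List V
      perm : cl ↭ U
      ppc  : PP (cl ++ cl)
  open Cyc

  clen : ∀ c → length (cl c) ≡ n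
  clen c = ↭-length (perm c) ⟫ length-fins n

  cuniq : ∀ c → Unique (cl c)
  cuniq c = Unique-↭ (↭-sym (perm c)) (Unique-fins n)

  full : ∀ c v → v ∈ cl c
  full c v = ∈-resp-↭ (↭-sym (perm c)) (∈-fins v)

  at : Cyc → V → V
  at c i = List.lookup (cl c) (cast (symm (clen c)) i)

  pos : Cyc → V → V
  pos c v = cast (clen c) (index (full c v))

  at-pos : ∀ c v → at c (pos c v) ≡ v
  at-pos c v = cong (List.lookup (cl c)) (toℕ-injective (toℕ-cast (symm (clen c)) (pos c v) ⟫ toℕ-cast (clen c) (index (full c v)))) ⟫ symm (lookup-index (full c v))

  pos-at : ∀ c i → pos c (at c i) ≡ i
  pos-at c i = toℕ-injective (toℕ-cast (clen c) (index (full c (at c i)))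
    ⟫ cong toℕ (lookup-inj (cl c) (cuniq c) _ _ (symm (lookup-index (full c (at c i))))) ⟫ toℕ-cast (symm (clen c)) i)

  perm-of : Cyc → Permutation′ n
  perm-of c = permutation (at c) (pos c) (at-pos c) (pos-at c)

  pos-split : ∀ c ls {v rs} → cl c ≡ ls ++ v ∷ rs → toℕ (pos c v) ≡ length ls
  pos-split c ls {v} e = toℕ-cast (clen c) (index (full c v)) ⟫ index-unique ls e (cuniq c) (full c v)

  split-pos : ∀ c v → ∃ λ ls → ∃ λ rs → cl c ≡ ls ++ v ∷ rs × length ls ≡ toℕ (pos c v)
  split-pos c v = ls' , rs' , eq , symm (pos-split c ls' eq)
    where
      i = index (full c v)
      ls' = take (toℕ i) (cl c)
      rs' = drop (suc (toℕ i)) (cl c)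
      eq : cl c ≡ ls' ++ v ∷ rs'
      eq = split-at (cl c) i ⟫ cong (λ z → ls' ++ z ∷ rs') (symm (lookup-index (full c v)))

  module _ (T≤n : T ≤ n) where

    in-window : ∀ c (i v : V) → InWindow T (perm-of c) i v → v ∈ take T (drop (toℕ i) (cl c ++ cl c))
    in-window c i v (j , j< , e) with split-pos c v
    ... | ls' , rs' , eq , l with toℕ i + j <? n
    ...   | yes lt = subst (λ z → v ∈ take T (drop (toℕ i) z)) (symm (cong (_++ cl c) eq ⟫ ++-assoc ls' (v ∷ rs') (cl c)))
              (∈-window T (toℕ i) j ls' (l ⟫ e ⟫ m<n⇒m%n≡m lt) j<)
    -- The offset passes n, so v is found in the second copy of the list.
    ...   | no ge = subst (λ z → v ∈ take T (drop (toℕ i) z)) (symm (cong (cl c ++_) eq ⟫ symm (++-assoc (cl c) ls' (v ∷ rs'))))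
              (∈-window T (toℕ i) j (cl c ++ ls') (length-++ (cl c) ⟫ cong₂ _+_ (clen c) (l ⟫ e ⟫ red) ⟫ m+[n∸m]≡n n≤) j<)
      where
        m = toℕ i + j
        n≤ : n ≤ m
        n≤ = ≮⇒≥ ge
        m∸n<n : m ∸ n < n
        m∸n<n = +-cancelˡ-< n (m ∸ n) n (<-≤-trans (≤-<-trans (≤-reflexive (m+[n∸m]≡n n≤)) (+-mono-<-≤ (toℕ<n i) (≤-trans (<⇒≤ j<) T≤n))) ≤-refl)
        red : m % n ≡ m ∸ n
        red = cong (_% n) (symm (m∸n+n≡m n≤)) ⟫ [m+n]%n≡m%n (m ∸ n) n ⟫ m<n⇒m%n≡m m∸n<n

    power-in : ∀ c → PowerIn T H (perm-of c)
    power-in c e (se , i , w) = symm (cong (edge H) (fromL-toL e)) ⟫ win (toL e)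
        (length-sel (lookup e) U ⟫ symm (size e) ⟫ se) (UniqueP.filter⁺ (λ x → lookup e x BoolP.≟ true) (Unique-fins n))
        (λ {v} m → in-window c i v (w v (lookup⇒[]= v e (toL-∈ e m))))
      where
        Z = drop (toℕ i) (cl c ++ cl c)
        win : Clique (take T Z)
        win = PP-window (take T Z) {drop T Z} (subst PP (symm (take++drop≡id T Z)) (PP-++ʳ (take (toℕ i) (cl c ++ cl c)) (subst PP (symm (take++drop≡id (toℕ i) (cl c ++ cl c))) (ppc c))))
          (≤-trans (≤-reflexive (length-take T Z)) (m⊓n≤m T _))

    atℕ : Cyc → ℕ → V
    atℕ c m = at c (fromℕ< (m%n<n m n))

    pos-atℕ : ∀ c m → toℕ (pos c (atℕ c m)) ≡ m % n
    pos-atℕ c m = cong toℕ (pos-at c (fromℕ< (m%n<n m n))) ⟫ toℕ-fromℕ< (m%n<n m n)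

    atℕ-pos : ∀ c v m → toℕ (pos c v) ≡ m % n → v ≡ atℕ c m
    atℕ-pos c v m e = symm (at-pos c v) ⟫ cong (at c) (toℕ-injective (e ⟫ symm (toℕ-fromℕ< (m%n<n m n))))

    -- If x and y have offsets j and j' in one window, then y lies j' - j places after x; n - j
    -- stands for -j modulo n.
    step : Cyc → V → ℕ → ℕ → V
    step c x j j' = atℕ c (toℕ (pos c x) + ((n ∸ j) + j'))

    row : Cyc → V → ℕ → List V
    row c x j = map (step c x j) (upTo T)

    nb : Cyc → V → List V
    nb c x = concatMap (row c x) (upTo T)

    length-nb : ∀ c x → length (nb c x) ≡ T * T
    length-nb c x = length-concatMap (row c x) T (upTo T) (λ j → length-map (step c x j) (upTo T) ⟫ length-upTo T) ⟫ cong (_* T) (length-upTo T)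

    nb-∈ : ∀ c i x y → InWindow T (perm-of c) i x → InWindow T (perm-of c) i y → y ∈ nb c x
    nb-∈ c i x y (j , j< , ex) (j' , j'< , ey) = ∈-concat⁺′ {vs = row c x j} {xss = map (row c x) (upTo T)}
        (subst (_∈ row c x j) (symm eq) (∈-map⁺ (step c x j) (∈-upTo⁺ j'<))) (∈-map⁺ (row c x) (∈-upTo⁺ j<))
      where
        eq : y ≡ step c x j j'
        eq = atℕ-pos c y (toℕ (pos c x) + ((n ∸ j) + j')) (ey ⟫ symm (cong (λ z → (z + ((n ∸ j) + j')) % n) ex ⟫ %-back (toℕ i) j j' n' (≤-trans (<⇒≤ j<) T≤n)))

    from : Cyc → V → List (List V)
    from c x = map (x ∷_) (chains (nb c) n' x)

    -- A list of candidates for every cyclic order with the same power as c: a first vertex, then n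
    -- - 1 choices among the T^2 offset pairs of the preceding one.
    enum : Cyc → List (List V)
    enum c = concatMap (from c) U

    length-enum : ∀ c → length (enum c) ≡ n * (T * T) ^ n'
    length-enum c = length-concatMap (from c) ((T * T) ^ n') U (λ x → length-map (x ∷_) (chains (nb c) n' x) ⟫ length-chains (nb c) (T * T) (length-nb c) n' x) ⟫ cong (_* (T * T) ^ n') (length-fins n)

    module _ (k≤t : suc k1 ≤ T) where

      -- Two consecutive vertices of c' lie in a common edge of its power, hence in a common window of c.
      same-enum : ∀ c c' → SamePower (suc k1) T (perm-of c) (perm-of c') → cl c' ∈ enum c
      same-enum c c' same = wrap (cl c') (clen c') (linked [] (cl c') near)
        where
          near : ∀ ls x y rs → cl c' ≡ ls ++ x ∷ y ∷ rs → y ∈ nb c x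
          near ls' x y rs e = let _ , i , w = proj₂ (same ee) pe in nb-∈ c i x y (w x (in-e x∈)) (w y (in-e y∈))
            where
              i₀ = length ls'
              i₀<n : i₀ < n
              i₀<n = <-≤-trans (m<m+n i₀ (s≤s z≤n)) (≤-reflexive (symm (length-++ ls') ⟫ cong length (symm e) ⟫ clen c'))
              f : ℕ → V
              f j = atℕ c' (i₀ + j)
              eL = map f (upTo (suc k1))
              k≤n : suc k1 ≤ n
              k≤n = ≤-trans k≤t T≤n
              uE : Unique eL
              uE = inj-map (upTo (suc k1)) (UniqueP.upTo⁺ (suc k1)) (λ m → <-≤-trans (∈-upTo⁻ m) k≤n)
                where
                  f-inj : ∀ {j j'} → j < n → j' < n → f j ≡ f j' → j ≡ j'
                  f-inj {j} {j'} h h' q = %-inj i₀ j j' n' (<⇒≤ i₀<n) h h' (symm (pos-atℕ c' (i₀ + j)) ⟫ cong (λ z → toℕ (pos c' z)) q ⟫ pos-atℕ c' (i₀ + j'))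
                  inj-map : ∀ js → Unique js → (∀ {j} → j ∈ js → j < n) → Unique (map f js)
                  inj-map [] u h = []
                  inj-map (j ∷ js) (a ∷ u) h = ∉⇒All≢ nin ∷ inj-map js u (λ m → h (there m))
                    where
                      nin : f j ∉ map f js
                      nin m with ∈-map⁻ f m
                      ... | j' , j'∈ , q = All≢⇒∉ a (subst (_∈ js) (symm (f-inj (h (here refl)) (h (there j'∈)) q)) j'∈)
              ee = fromL eL
              in-e : ∀ {v} → v ∈ eL → v ∈s ee
              in-e {v} m = lookup⇒[]= v ee (fromL-∈ eL m)
              x≡ : x ≡ f 0
              x≡ = atℕ-pos c' x (i₀ + 0) (pos-split c' ls' e ⟫ symm (cong (_% n) (+-identityʳ i₀) ⟫ m<n⇒m%n≡m i₀<n))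
              e2 : cl c' ≡ (ls' ++ x ∷ []) ++ y ∷ rs
              e2 = e ⟫ symm (++-assoc ls' (x ∷ []) (y ∷ rs))
              ly : length (ls' ++ x ∷ []) ≡ i₀ + 1
              ly = length-++ ls'
              y≡ : y ≡ f 1
              y≡ = atℕ-pos c' y (i₀ + 1) (pos-split c' (ls' ++ x ∷ []) e2 ⟫ ly ⟫ symm (m<n⇒m%n≡m (<-≤-trans (m<m+n (i₀ + 1) (s≤s z≤n)) (≤-reflexive (cong (_+ suc (length rs)) (symm ly) ⟫ symm (length-++ (ls' ++ x ∷ [])) ⟫ cong length (symm e2) ⟫ clen c')))))
              x∈ : x ∈ eL
              x∈ = subst (_∈ eL) (symm x≡) (∈-map⁺ f (∈-upTo⁺ {suc k1} (s≤s z≤n)))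
              y∈ : y ∈ eL
              y∈ = subst (_∈ eL) (symm y≡) (∈-map⁺ f (∈-upTo⁺ {suc k1} (s≤s (s≤s z≤n))))
              pe : PowEdge (suc k1) T (perm-of c') ee
              pe = (size-fromL eL uE ⟫ length-map f (upTo (suc k1)) ⟫ length-upTo (suc k1)) , fromℕ< i₀<n , λ v m → win v (fromL-∈⁻ eL ([]=⇒lookup m))
                where
                  win : ∀ v → v ∈ eL → InWindow T (perm-of c') (fromℕ< i₀<n) v
                  win v m with ∈-map⁻ f m
                  ... | j , j∈ , refl = j , <-≤-trans (∈-upTo⁻ j∈) k≤t , (pos-atℕ c' (i₀ + j) ⟫ cong (λ z → (z + j) % n) (symm (toℕ-fromℕ< i₀<n)))
          wrap : ∀ xs → length xs ≡ n → Linked (λ x y → y ∈ nb c x) xs → xs ∈ enum c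
          wrap (x ∷ xs) l lk = ∈-concat⁺′ (∈-map⁺ (x ∷_) (subst (λ m → xs ∈ chains (nb c) m x) (suc-injective l) (∈-chains (nb c) x xs lk))) (∈-map⁺ (from c) (∈-fins x))

-- Assembling the theorem.

bin-pos : ∀ {n k} → k ≤ n → 0 < bin n k
bin-pos z≤n = s≤s z≤n
bin-pos (s≤s h) = ≤-trans (bin-pos h) (m≤m+n _ _)

-- All losses are at most exponential: n^s ≤ (2^s)^n for the end clique, 4^n·R^n for cyclic orders
-- with the same power, K^n from the count of paths, and 4^n from comparing n^n with n!.
copies-count : ∀ n' w s R K l N → suc n' ! ≤ w ! * suc n' ^ s → w ! ≤ l * K ^ w → w ≤ suc n' → 0 < K → 0 < R →
  l ≤ N * suc (suc n' * R ^ n') → suc n' ^ suc n' ≤ N * (4 * (4 * R * K) * 2 ^ s) ^ suc n'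
copies-count n' w s R K l N h₁ h₂ h₃ K>0 R>0 h₄ = begin
  n ^ n                                                    ≤⟨ self-power n ⟩
  4 ^ n * n !                                              ≤⟨ *-monoʳ-≤ (4 ^ n) h₁ ⟩
  4 ^ n * (w ! * n ^ s)                                    ≤⟨ *-monoʳ-≤ (4 ^ n) (*-mono-≤ (≤-trans h₂ (*-mono-≤ (≤-trans h₄ (*-monoʳ-≤ N sC)) (^-monoʳ-≤ K {{>-nonZero K>0}} h₃))) ns) ⟩
  4 ^ n * (N * (4 ^ n * R ^ n) * K ^ n * (2 ^ s) ^ n)      ≡⟨ l1 (4 ^ n) N (R ^ n) (K ^ n) ((2 ^ s) ^ n) ⟩
  N * (4 ^ n * (4 ^ n * R ^ n * K ^ n) * (2 ^ s) ^ n)      ≡⟨ cong (N *_) (symm pw) ⟩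
  N * (4 * (4 * R * K) * 2 ^ s) ^ n ∎
  where
    open ≤-Reasoning
    n = suc n'
    l1 : ∀ f N r k t → f * (N * (f * r) * k * t) ≡ N * (f * (f * r * k) * t)
    l1 = solve-∀
    pw : (4 * (4 * R * K) * 2 ^ s) ^ n ≡ 4 ^ n * (4 ^ n * R ^ n * K ^ n) * (2 ^ s) ^ n
    pw = ^-mul (4 * (4 * R * K)) (2 ^ s) n ⟫ cong (_* (2 ^ s) ^ n) (^-mul 4 (4 * R * K) n ⟫ cong (4 ^ n *_) (^-mul (4 * R) K n ⟫ cong (_* K ^ n) (^-mul 4 R n)))
    ns : n ^ s ≤ (2 ^ s) ^ n
    ns = ≤-trans (^-monoˡ-≤ s (n≤2^n n)) (≤-reflexive (^-*-assoc 2 n s ⟫ cong (2 ^_) (*-comm n s) ⟫ symm (^-*-assoc 2 s n)))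
    RR : R ^ n' ≤ R ^ n
    RR = ^-monoʳ-≤ R {{>-nonZero R>0}} (n≤1+n n')
    sC : suc (n * R ^ n') ≤ 4 ^ n * R ^ n
    sC = begin
      suc (n * R ^ n')                ≤⟨ +-mono-≤ (*-mono-≤ (^-pos 2 n (s≤s z≤n)) (^-pos R n R>0)) (*-mono-≤ (n≤2^n n) RR) ⟩
      2 ^ n * R ^ n + 2 ^ n * R ^ n   ≡⟨ l2 (2 ^ n) (R ^ n) ⟩
      2 * 2 ^ n * R ^ n               ≤⟨ *-monoˡ-≤ (R ^ n) (*-monoˡ-≤ (2 ^ n) (*-monoʳ-≤ 2 (^-pos 2 n' (s≤s z≤n)))) ⟩
      2 ^ n * 2 ^ n * R ^ n           ≡⟨ cong (_* R ^ n) (symm (^-mul 2 2 n)) ⟩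
      4 ^ n * R ^ n ∎
      where l2 : ∀ a b → a * b + a * b ≡ 2 * a * b
            l2 = solve-∀

-- The relative slack 1/d on n = t + w vertices survives as 2/(4d) on the w vertices outside the end
-- clique; the halved slack outweighs the change of size. This is the reason for `q = 4 * suc d`.
quadruple-slack : ∀ d x t w → d * x + (t + w) ≤ d * (t + w) → 2 * (d * suc t) ≤ t + w → 4 * d * x + 2 * w ≤ 4 * d * w
quadruple-slack d x t w h g = lin (2 * t + 4 * d) (+-mono-≤ (+-mono-≤ h (+-mono-≤ h (+-mono-≤ h h))) (+-mono-≤ g g)) (l d x t w)
  where
    l : ∀ d x t w → 4 * d * x + 2 * w + (d * (t + w) + (d * (t + w) + (d * (t + w) + d * (t + w))) + (t + w + (t + w))) + (2 * t + 4 * d)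
      ≡ 4 * d * w + ((d * x + (t + w)) + ((d * x + (t + w)) + ((d * x + (t + w)) + (d * x + (t + w)))) + (2 * (d * suc t) + 2 * (d * suc t)))
    l = solve-∀

module Threshold (t2 k2 d : ℕ) (k≤t : k2 ≤ t2) where
  open Params t2 k2

  D>0 : 0 < D
  D>0 = ≤-trans (≤-trans (bin-pos k≤t) (m≤n+m _ (bin t1 k1))) (≤-reflexive (symm D-def))

  q : ℕ
  q = 4 * suc d

  q>1 : 2 ≤ q
  q>1 = ≤-trans (s≤s (s≤s z≤n)) (*-monoʳ-≤ 4 {1} {suc d} (s≤s z≤n))

  m K₀ n₀ K : ℕ
  m = CountSize.m t2 k2 q D>0 q>1
  K₀ = CountSize.K t2 k2 q D>0 q>1
  n₀ = 2 * (suc d * T) + (T + m)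
  K = 4 * (4 * (T * T) * K₀) * 2 ^ t1

  module _ (n' : ℕ) (n₀≤n : n₀ ≤ suc n') (H : KGraph (suc k1) (suc n'))
    (few : ∀ S → length S ≡ k1 → Unique S → suc d * (D * cnt (Final.bad k2 t2 n' H S) (fins (suc n'))) + suc n' ≤ suc d * suc n') where
    open Final k2 t2 n' H
    open Cyc

    instance
      nzD : NonZero (suc d * D)
      nzD = >-nonZero (*-mono-≤ {1} {suc d} (s≤s z≤n) D>0)

    b : ℕ
    b = d * n / (suc d * D)

    slack : suc d * (D * b) + n ≤ suc d * n
    slack = ≤-trans (≤-reflexive (+-comm _ n)) (+-monoʳ-≤ n (≤-trans (≤-reflexive (symm (*-assoc (suc d) D b) ⟫ *-comm (suc d * D) b)) (m/n*n≤m (d * n) (suc d * D))))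

    amU : Amb U U b
    amU = record { uW = Unique-fins n ; WU = λ m → m
      ; gd = mkGood λ S l u _ → div-big (d * n) (suc d * D) _ (≤-trans (≤-reflexive (*-assoc (suc d) D _))
          (+-cancelˡ-≤ n _ _ (≤-trans (≤-reflexive (+-comm n _)) (few S l u)))) }

    2dT≤n : 2 * (suc d * T) ≤ n
    2dT≤n = ≤-trans (m≤m+n _ (T + m)) n₀≤n

    Tm≤n : T + m ≤ n
    Tm≤n = ≤-trans (m≤n+m (T + m) (2 * (suc d * T))) n₀≤n

    T≤n : T ≤ n
    T≤n = ≤-trans (m≤m+n T m) Tm≤n

    room : D * b + T ≤ length U
    room = ≤-trans (*-cancelˡ-≤ (suc d) (≤-trans (≤-reflexive (*-distribˡ-+ (suc d) (D * b) T)) (≤-trans (+-monoʳ-≤ _ (≤-trans (m≤m+n _ _) 2dT≤n)) slack))) (≤-reflexive (symm (length-fins n)))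

    Copies : Set
    Copies = ∃ λ N → n ^ n ≤ N * K ^ n × Σ (Fin N → Permutation′ n) λ σs →
        (∀ i → PowerIn T H (σs i)) × (∀ i j → i ≢ j → ¬ SamePower (suc k1) T (σs i) (σs j))

    start : ∃ λ X → length X ≡ t1 × Unique X × X ⊆l U × Clique X
    start = findClique amU room t1 ≤-refl

    copies : (∃ λ X → length X ≡ t1 × Unique X × X ⊆l U × Clique X) → Copies
    -- Both ends are the same clique X, so that each spanning path closes up to a cycle through X.
    copies (X , lX′ , uX′ , sX , CX′) = fromCounted (counting D>0 q q>1 amW eX eX hU hb hm)
      where
        rm : ∃ λ W → U ↭ X ++ W
        rm = remove _≟F_ X U (Unique-fins n) uX′ sX
        W = proj₁ rm
        pW : U ↭ X ++ W
        pW = proj₂ rm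
        w = length W
        nw : n ≡ t1 + w
        nw = symm (length-fins n) ⟫ length-part X pW ⟫ cong (_+ w) lX′
        w≤n : w ≤ n
        w≤n = ≤-trans (m≤n+m w t1) (≤-reflexive (symm nw))
        amW : Amb U W b
        amW = Amb-sub X pW amU
        eX : End U W X
        eX = record { XU = sX ; uX = uX′ ; lX = lX′ ; CX = CX′ ; dX = Unique-++-disj X (Unique-↭ pW (Unique-fins n)) }
        t1≤T : t1 ≤ T
        t1≤T = n≤1+n t1
        t≤w : t1 ≤ w
        t≤w = +-cancelˡ-≤ t1 t1 w (≤-trans (≤-trans (+-mono-≤ t1≤dT (≤-trans t1≤dT (m≤m+n (suc d * T) 0))) 2dT≤n) (≤-reflexive nw))
          where t1≤dT : t1 ≤ suc d * T
                t1≤dT = ≤-trans t1≤T (m≤m+n T (d * T))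
        hU : length U ≤ 3 * w
        hU = ≤-trans (≤-reflexive (length-fins n ⟫ nw)) (≤-trans (+-monoˡ-≤ w t≤w) (lin w {L = 0} z≤n (l w)))
          where l : ∀ w → w + w + 0 + w ≡ 3 * w + 0
                l = solve-∀
        hm : m ≤ w
        hm = +-cancelˡ-≤ t1 m w (≤-trans (+-monoˡ-≤ m t1≤T) (≤-trans Tm≤n (≤-reflexive nw)))
        hb : q * (D * b) + 2 * w ≤ q * w
        hb = quadruple-slack (suc d) (D * b) t1 w (subst (λ z → suc d * (D * b) + z ≤ suc d * z) nw slack) (≤-trans 2dT≤n (≤-reflexive nw))
        toCyc : ∀ {ws} → ws ↭ W → PP (X ++ ws ++ X) → Cyc
        toCyc {ws} p pp = record { cl = ws ++ X ; perm = ↭-trans (++-comm ws X) (↭-trans (++⁺ˡ X p) (↭-sym pW))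
          ; ppc = subst PP (symm (++-assoc ws X (ws ++ X))) (PP-glue ws X (≤-reflexive (symm lX′)) (PP-++ʳ X pp) pp) }
        cycles : ∀ L → (∀ {ws} → ws ∈ L → ws ↭ W × PP (X ++ ws ++ X)) → ∃ λ cs → map cl cs ≡ map (_++ X) L
        cycles [] v = [] , refl
        cycles (ws ∷ L) v = let cs , e = cycles L (λ m → v (there m)) ; p , pp = v (here refl) in
          toCyc p pp ∷ cs , cong ((ws ++ X) ∷_) e
        wfact : n ! ≤ w ! * n ^ t1
        wfact with fact-split t1 w n
        ... | inj₁ h = ≤-trans (≤-reflexive (cong _! nw)) h
        ... | inj₂ h = ⊥-elim (<-irrefl nw h)
        fromCounted : Counted W X X K₀ → Copies
        fromCounted ct = pick (cycles (Counted.L ct) (Counted.vL ct))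
          where
            C = n * (T * T) ^ n'
            w>0 : 0 < w
            w>0 = ≤-trans (s≤s z≤n) t≤w
            many : w ! ≤ length (Counted.L ct) * K₀ ^ w
            many = ≤-trans (≤-trans (≤-trans (≤-reflexive (symm (*-identityʳ (w !)))) (*-monoʳ-≤ (w !) (^-pos w T w>0))) (m≤m+n _ _)) (Counted.nL ct)
            pick : (∃ λ cs → map cl cs ≡ map (_++ X) (Counted.L ct)) → Copies
            pick (cs , e) = fin (Select.select (≡-dec _≟F_) cl (enum T≤n) C (λ c → ≤-reflexive (length-enum T≤n c)) (length cs) cs ≤-refl
                (subst Unique (symm e) (UniqueP.map⁺ (λ {x} {y} q → ++-cancelʳ X x y q) (Counted.uL ct))))
              where
                lcs : length (Counted.L ct) ≡ length cs
                lcs = symm (length-map (_++ X) (Counted.L ct)) ⟫ cong length (symm e) ⟫ length-map cl cs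
                fin : (∃ λ ys → AllPairs (λ a b → cl b ∉ enum T≤n a) ys × ys ⊆l cs × length cs ≤ length ys * suc C) → Copies
                fin (ys , ap , _ , le′) = length ys
                  , copies-count n' w t1 (T * T) K₀ (length (Counted.L ct)) (length ys) wfact many w≤n (CountSize.K>0 t2 k2 q D>0 q>1) (s≤s z≤n) (≤-trans (≤-reflexive lcs) le′)
                  , (λ i → perm-of (List.lookup ys i))
                  , (λ i → power-in T≤n (List.lookup ys i))
                  , AllPairs-lookup {P = λ a b → ¬ SamePower (suc k1) T (perm-of a) (perm-of b)} (λ h same → h (λ e → Product.swap (same e)))
                      (AllPairs.map (λ {a} {b} nin same → nin (same-enum T≤n (s≤s (s≤s k≤t)) a b same)) ap)

    result : Copies
    result = copies start

few-bad : ∀ t2 k2 p d γ → ℚ.toℚᵘ γ ≡ ℚᵘ.mkℚᵘ (ℤ.+ suc p) d → ∀ n' (H : KGraph (suc (suc k2)) (suc n')) → 0 < Params.D t2 k2 →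
  MinCodegreeAtLeast H (threshold (suc (suc t2)) (suc (suc k2)) γ ℚ.* ℕtoℚ (suc n')) →
  ∀ S → length S ≡ suc k2 → Unique S → suc d * (Params.D t2 k2 * cnt (Final.bad k2 t2 n' H S) (fins (suc n'))) + suc n' ≤ suc d * suc n'
few-bad t2 k2 p d γ eγ n' H D>0 hyp S l u = subst (λ z → suc d * (z * cnt (bad S) U) + n ≤ suc d * n) (symm sδ)
    (codegree-bad δ p d n (codeg H (fromL S)) (cnt (bad S) U) (codeg-bad S)
      (clear-denominators δ p d γ n (codeg H (fromL S)) eγ
        (subst (λ z → ((ℚ.1ℚ ℚ.- invℕ z) ℚ.+ γ) ℚ.* ℕtoℚ n ℚ.≤ ℕtoℚ (codeg H (fromL S)))
          (cong₂ _+_ (bin≡C (suc t2) (suc k2)) (bin≡C t2 k2) ⟫ symm (Params.D-def t2 k2) ⟫ sδ)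
          (hyp (fromL S) (size-fromL S u ⟫ l)))))
  where
    open Final k2 t2 n' H using (n; U; bad; codeg-bad; size-fromL)
    δ = pred (Params.D t2 k2)
    sδ : Params.D t2 k2 ≡ suc δ
    sδ = symm (suc-pred (Params.D t2 k2) {{>-nonZero D>0}})

theorem1p3 : ∀ (t k : ℕ) → 2 ≤ k → k ≤ t → (γ : ℚ) → 0ℚ <ℚ γ →
    ∃ λ (n₀ : ℕ) → ∃ λ (K : ℕ) → ∀ (n : ℕ) → n₀ ≤ n → (H : KGraph k n) →
      MinCodegreeAtLeast H (threshold t k γ *ℚ ℕtoℚ n) →
      ∃ λ (N : ℕ) → n ^ n ≤ N * K ^ n ×
        Σ (Fin N → Permutation′ n) λ σs →
          (∀ i → PowerIn t H (σs i)) ×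
          (∀ i j → i ≢ j → ¬ SamePower k t (σs i) (σs j))
theorem1p3 (suc (suc t2)) (suc (suc k2)) (s≤s (s≤s _)) (s≤s (s≤s k≤t)) (ℚ.mkℚ (ℤ.+ suc p) d cop) γ>0 = n₀ , K , large
  where
    open Threshold t2 k2 d k≤t using (n₀; K; result; D>0)
    γ = ℚ.mkℚ (ℤ.+ suc p) d cop
    large : ∀ n → n₀ ≤ n → (H : KGraph (suc (suc k2)) n) → MinCodegreeAtLeast H (threshold (suc (suc t2)) (suc (suc k2)) γ ℚ.* ℕtoℚ n) →
      ∃ λ (N : ℕ) → n ^ n ≤ N * K ^ n ×
        Σ (Fin N → Permutation′ n) λ σs →
          (∀ i → PowerIn (suc (suc t2)) H (σs i)) ×
          (∀ i j → i ≢ j → ¬ SamePower (suc (suc k2)) (suc (suc t2)) (σs i) (σs j))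
    -- The threshold `n₀` is positive, so the empty vertex set does not arise.
    large zero h with () ← m+n≤o⇒n≤o (2 * (suc d * suc (suc t2))) h
    large (suc n') h H hyp = result n' h H (few-bad t2 k2 p d γ refl n' H D>0 hyp)
theorem1p3 (suc (suc t2)) (suc (suc k2)) (s≤s (s≤s _)) (s≤s (s≤s _)) (ℚ.mkℚ (ℤ.+ zero) d cop) γ>0 with () ← ℚ.positive γ>0
theorem1p3 (suc (suc t2)) (suc (suc k2)) (s≤s (s≤s _)) (s≤s (s≤s _)) (ℚ.mkℚ ℤ.-[1+ p ] d cop) γ>0 with () ← ℚ.positive γ>0
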